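{- Let $(G,\mathcal{B},\mathcal{L},\mathcal{F})$ be a quasi-biased graph such that neither $\mathcal{L}$ nor $\mathcal{F}$ is degenerate, and suppose $M=M(G,\mathcal{B},\mathcal{L},\mathcal{F})$ is connected. Then $M$ is obtained via $2$-sums of graphic matroids and a single $3$-connected matroid of the form $M(H,\mathcal{B}',\mathcal{L}',\mathcal{F}')$ for some quasi-biased graph $(H,\mathcal{B}',\mathcal{L}',\mathcal{F}')$ in which $\mathcal{L}'$ and $\mathcal{F}'$ are both non-degenerate.
   Context: Graphs are finite with loops and parallel edges allowed; cycles include loops and 2-cycles. A quasi-biased graph $(G,\mathcal{B},\mathcal{L},\mathcal{F})$ is a graph with a partition $(\mathcal{B},\mathcal{L},\mathcal{F})$ of its cycles such that no theta subgraph contains exactly two cycles of $\mathcal{B}$ and every cycle in $\mathcal{L}$ shares a vertex with every cycle in $\mathcal{F}$. $M(G,\mathcal{B},\mathcal{L},\mathcal{F})$ is the matroid on $E(G)$ with circuits: cycles in $\mathcal{B}$; theta subgraphs with no cycle in $\mathcal{B}$; tight handcuffs (two edge-disjoint cycles sharing exactly one vertex) with neither cycle in $\mathcal{B}$; unions of two vertex-disjoint cycles of $\mathcal{L}$; loose handcuffs (two vertex-disjoint cycles plus a minimal path joining them) with both cycles in $\mathcal{F}$. $\mathcal{L}$ (resp. $\mathcal{F}$) is degenerate if no two of its cycles are vertex-disjoint, and non-degenerate otherwise. -}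

module Defs where

open import Level using (0ℓ)
open import Data.Nat using (ℕ; zero; suc; _+_; _≤_; _<_)
open import Data.Bool using (Bool; true; false; _∧_; _∨_)
open import Data.Fin using (Fin)
import Data.Fin
open import Data.Fin.Subset
  using (Subset; _∈_; _∉_; _⊆_; ∁; _∪_; _∩_; ⁅_⁆; ∣_∣; inside; outside)
  renaming (⊥ to ∅; ⊤ to full)
open import Data.Vec using (Vec; _∷_; []; _++_; tabulate; lookup)
open import Data.List using (List; []; _∷_; foldr)
open import Data.List.Membership.Propositional using () renaming (_∈_ to _∈ₗ_)
open import Data.List.Relation.Unary.Unique.Propositional using (Unique)
open import Data.Product using (Σ; ∃; ∃-syntax; _×_; _,_)
open import Data.Sum using (_⊎_)
open import Data.Empty using (⊥)
open import Data.Unit using () renaming (⊤ to Unit)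
open import Relation.Nullary using (¬_)
open import Relation.Binary.PropositionalEquality using (_≡_; _≢_)
open import Function.Bundles using (_↔_; _⇔_; Inverse)

-- Graphs: finitely many vertices Fin n and edges Fin m; every edge has
-- an (unordered) pair of ends.  Loops (equal ends) and parallel edges
-- are allowed.

record Graph (m : ℕ) : Set where
  field
    nV   : ℕ
    ends : Fin m → Fin nV × Fin nV

open Graph public

module _ {m : ℕ} (G : Graph m) where

  Joins : Fin m → Fin (nV G) → Fin (nV G) → Set
  Joins e u w = ends G e ≡ (u , w) ⊎ ends G e ≡ (w , u)

  Incident : Fin m → Fin (nV G) → Set
  Incident e v = ∃[ w ] Joins e v w

  data Walk : Fin (nV G) → Fin (nV G) → Set where
    nil  : ∀ v → Walk v v
    cons : ∀ {u w v} (e : Fin m) → Joins e u w → Walk w v → Walk u v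

  verts : ∀ {u v} → Walk u v → List (Fin (nV G))
  verts (nil v) = v ∷ []
  verts (cons {u} e _ W) = u ∷ verts W

  edges : ∀ {u v} → Walk u v → List (Fin m)
  edges (nil v) = []
  edges (cons e _ W) = e ∷ edges W

  edgeSet : ∀ {u v} → Walk u v → Subset m
  edgeSet W = foldr (λ e S → ⁅ e ⁆ ∪ S) ∅ (edges W)

  IsPath : ∀ {u v} → Walk u v → Set
  IsPath W = Unique (verts W)

  -- X is (the edge set of) a cycle: a closed walk of length ≥ 1 with
  -- no repeated edge and no repeated vertex (apart from the return to
  -- the start).  Loops and 2-cycles are included.
  IsCycle : Subset m → Set
  IsCycle X =
    Σ (Fin (nV G)) λ u → Σ (Fin (nV G)) λ w → Σ (Fin m) λ e →
    Σ (Joins e u w) λ j → Σ (Walk w u) λ W →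
      Unique (verts W) × Unique (e ∷ edges W) × edgeSet (cons e j W) ≡ X

  VertexOf : Subset m → Fin (nV G) → Set
  VertexOf X v = ∃[ e ] (e ∈ X × Incident e v)

  ShareVertex : Subset m → Subset m → Set
  ShareVertex X Y = ∃[ v ] (VertexOf X v × VertexOf Y v)

  VertexDisjoint : Subset m → Subset m → Set
  VertexDisjoint X Y = ¬ ShareVertex X Y

  record Theta : Set where
    field
      u v        : Fin (nV G)
      u≢v        : u ≢ v
      P₁ P₂ P₃   : Walk u v
      path₁      : IsPath P₁
      path₂      : IsPath P₂
      path₃      : IsPath P₃
      int₁₂      : ∀ x → x ∈ₗ verts P₁ → x ∈ₗ verts P₂ → x ≡ u ⊎ x ≡ v
      int₁₃      : ∀ x → x ∈ₗ verts P₁ → x ∈ₗ verts P₃ → x ≡ u ⊎ x ≡ v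
      int₂₃      : ∀ x → x ∈ₗ verts P₂ → x ∈ₗ verts P₃ → x ≡ u ⊎ x ≡ v
      edisj₁₂    : edgeSet P₁ ∩ edgeSet P₂ ≡ ∅
      edisj₁₃    : edgeSet P₁ ∩ edgeSet P₃ ≡ ∅
      edisj₂₃    : edgeSet P₂ ∩ edgeSet P₃ ≡ ∅

    cyc₁₂ cyc₁₃ cyc₂₃ thetaEdges : Subset m
    cyc₁₂ = edgeSet P₁ ∪ edgeSet P₂
    cyc₁₃ = edgeSet P₁ ∪ edgeSet P₃
    cyc₂₃ = edgeSet P₂ ∪ edgeSet P₃
    thetaEdges = edgeSet P₁ ∪ edgeSet P₂ ∪ edgeSet P₃

-- Quasi-biased graphs.  The partition (B, L, F) of the cycles is given
-- by a labelling of edge sets; only its values on cycles matter.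

data Class : Set where
  B L F : Class

ExactlyTwoB : Class → Class → Class → Set
ExactlyTwoB B B B = ⊥
ExactlyTwoB B B _ = Unit
ExactlyTwoB B _ B = Unit
ExactlyTwoB _ B B = Unit
ExactlyTwoB _ _ _ = ⊥

record QuasiBiased {m : ℕ} (G : Graph m) : Set where
  field
    cls : Subset m → Class
    theta-cond : (T : Theta G) →
      ¬ ExactlyTwoB (cls (Theta.cyc₁₂ T)) (cls (Theta.cyc₁₃ T)) (cls (Theta.cyc₂₃ T))
    LF-cond : ∀ C D → IsCycle G C → IsCycle G D → cls C ≡ L → cls D ≡ F →
      ShareVertex G C D

open QuasiBiased public

module _ {m : ℕ} {G : Graph m} (Q : QuasiBiased G) where

  Degenerate : Class → Set
  Degenerate c = ∀ C D → IsCycle G C → IsCycle G D → cls Q C ≡ c → cls Q D ≡ c →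
    ShareVertex G C D

  NonDegenerate : Class → Set
  NonDegenerate c = ∃[ C ] ∃[ D ] (IsCycle G C × IsCycle G D × cls Q C ≡ c ×
    cls Q D ≡ c × VertexDisjoint G C D)

-- Matroids are given by their families of circuits on ground set Fin m.

CircFam : ℕ → Set₁
CircFam m = Subset m → Set

module _ {m : ℕ} {G : Graph m} (Q : QuasiBiased G) where

  NotB : Subset m → Set
  NotB C = cls Q C ≢ B

  qbCircuit : CircFam m
  qbCircuit X =
    (IsCycle G X × cls Q X ≡ B)
    ⊎ (Σ (Theta G) λ T → Theta.thetaEdges T ≡ X × NotB (Theta.cyc₁₂ T) ×
          NotB (Theta.cyc₁₃ T) × NotB (Theta.cyc₂₃ T))
    ⊎ (∃[ C ] ∃[ D ] (IsCycle G C × IsCycle G D × C ∩ D ≡ ∅ ×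
          (∃[ v ] (VertexOf G C v × VertexOf G D v ×
                   (∀ w → VertexOf G C w → VertexOf G D w → w ≡ v))) ×
          NotB C × NotB D × C ∪ D ≡ X))
    ⊎ (∃[ C ] ∃[ D ] (IsCycle G C × IsCycle G D × VertexDisjoint G C D ×
          cls Q C ≡ L × cls Q D ≡ L × C ∪ D ≡ X))
    ⊎ (∃[ C ] ∃[ D ] (IsCycle G C × IsCycle G D × VertexDisjoint G C D ×
          cls Q C ≡ F × cls Q D ≡ F ×
          (Σ (Fin (nV G)) λ u → Σ (Fin (nV G)) λ v → Σ (Walk G u v) λ P →
             IsPath G P × VertexOf G C u × VertexOf G D v ×
             (∀ x → x ∈ₗ verts G P → VertexOf G C x → x ≡ u) ×
             (∀ x → x ∈ₗ verts G P → VertexOf G D x → x ≡ v) ×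
             C ∪ D ∪ edgeSet G P ≡ X)))

module _ {m : ℕ} (M : CircFam m) where

  Indep : Subset m → Set
  Indep I = ∀ C → C ⊆ I → ¬ M C

  Rank : Subset m → ℕ → Set
  Rank X r = (∃[ I ] (I ⊆ X × Indep I × ∣ I ∣ ≡ r)) ×
             (∀ J → J ⊆ X → Indep J → ∣ J ∣ ≤ r)

  Separation : ℕ → Subset m → Set
  Separation k X = ∃[ rx ] ∃[ ry ] ∃[ re ]
    (Rank X rx × Rank (∁ X) ry × Rank full re ×
     k ≤ ∣ X ∣ × k ≤ ∣ ∁ X ∣ × rx + ry < k + re)

  Connected : Set
  Connected = ∀ X → ¬ Separation 1 X

  ThreeConnected : Set
  ThreeConnected = ∀ X → ¬ Separation 1 X × ¬ Separation 2 X

  Loop : Fin m → Set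
  Loop e = M ⁅ e ⁆

  Coloop : Fin m → Set
  Coloop e = ∀ C → M C → e ∉ C

Iso : ∀ {m m'} → CircFam m → CircFam m' → Set
Iso {m} {m'} M M' = Σ (Fin m ↔ Fin m') λ σ →
  ∀ (Y : Subset m') → M' Y ⇔ M (tabulate λ i → lookup Y (Inverse.to σ i))

Graphic : ∀ {m} → CircFam m → Set
Graphic {m} M = Σ (Graph m) λ G → ∀ X → M X ⇔ IsCycle G X

-- 2-sum of M₁ on Fin (suc a) and M₂ on Fin (suc b), with basepoint the
-- element zero of each; the ground set is Fin (a + b) (first the
-- non-basepoint elements of M₁, then those of M₂).
twoSum : ∀ {a b} → CircFam (suc a) → CircFam (suc b) → CircFam (a + b)
twoSum {a} {b} M₁ M₂ Z = ∃[ X ] ∃[ Y ] (Z ≡ X ++ Y ×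
  ((M₁ (outside ∷ X) × Y ≡ ∅) ⊎
   (X ≡ ∅ × M₂ (outside ∷ Y)) ⊎
   (M₁ (inside ∷ X) × M₂ (inside ∷ Y))))

-- side conditions for a 2-sum (Oxley): each matroid has at least three
-- elements and the basepoint is neither a loop nor a coloop
TwoSumOK : ∀ {a b} → CircFam (suc a) → CircFam (suc b) → Set
TwoSumOK {a} {b} M₁ M₂ =
  2 ≤ a × 2 ≤ b ×
  ¬ Loop M₁ Data.Fin.zero × ¬ Coloop M₁ Data.Fin.zero ×
  ¬ Loop M₂ Data.Fin.zero × ¬ Coloop M₂ Data.Fin.zero

-- Built N M u : M is obtained by (iterated) 2-sums from graphic
-- matroids and N, where N is used exactly once if u = true and never
-- if u = false.  All matroids are taken up to isomorphism.
data Built {k : ℕ} (N : CircFam k) : ∀ {m} → CircFam m → Bool → Set₁ where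
  useN    : ∀ {m} (M : CircFam m) → Iso N M → Built N M true
  graphic : ∀ {m} (M : CircFam m) → Graphic M → Built N M false
  sum     : ∀ {a b m} (M₁ : CircFam (suc a)) (M₂ : CircFam (suc b))
              (M : CircFam m) {u v : Bool} →
            Built N M₁ u → Built N M₂ v → TwoSumOK M₁ M₂ →
            u ∧ v ≡ false → Iso (twoSum M₁ M₂) M → Built N M (u ∨ v)

{-# OPTIONS --safe #-}
-- Call a set of edges even if it meets every vertex cut in an even number of
-- edges; the cycles are the minimal nonempty even sets.  The circuits of the
-- matroid are the minimal sets X that contain a cycle of B, two distinct cycles
-- of L, or two distinct cycles joined inside X, so an identity of matroids may
-- be checked on dependent sets.
--
-- Let L₁, L₂ ∈ L and F₁, F₂ ∈ F be disjoint pairs.  Every cycle outside B meets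
-- both L₁ and L₂, or both F₁ and F₂, so no cut vertex separates two such cycles,
-- and a connected matroid forces the graph to be 2-connected.
--
-- Two reductions split off a graphic matroid by a 2-sum and keep all hypotheses.
-- If a part R with at least two edges and all cycles in B is attached at two
-- vertices v, w only, replace R by an edge vw.  If all cycles avoiding the edges
-- f and g are in B, then f and g are in series, and g is contracted (a 2-sum with
-- a triangle).
--
-- When neither reduction applies the matroid is 3-connected.  For an edge
-- bipartition (X, Y) let S be the set of shared vertices, let s(K) ≥ 2 be the
-- number of attachments of a component K of X or Y, and let u ∈ {0, 1, 2} count
-- the sides that contain a cycle outside B.  Rank estimates turn a separation of
-- order k ≤ 2 into Σ_K (s(K) − 2) + 2u ≤ 2k − 2.  A component with two attachments
-- and all cycles in B is a single edge, and two such components never meet; in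
-- each remaining case this contradicts the disjointness of L₁, L₂ or of F₁, F₂.

module Submission where

open import Defs
open import Data.Nat using (ℕ; zero; suc; _+_; _≤_; _<_; z≤n; s≤s; _∸_)
open import Data.Nat.Properties as ℕₚ using (≤-refl; ≤-trans; ≤-reflexive; +-comm; +-assoc; +-suc; +-identityʳ; m≤m+n; m≤n+m; +-mono-≤; _≤?_)
open import Data.Nat.Solver using (module +-*-Solver)
open import Data.Bool using (Bool; true; false; _∧_; _∨_; _xor_; not; if_then_else_)
import Data.Bool as Bool
open import Data.Bool.Properties using (xor-same; xor-comm; xor-assoc; xor-identityʳ; ∧-distribʳ-xor; ∧-zeroʳ; ∧-identityʳ; ∧-comm; ∨-zeroʳ; ∨-identityʳ; ∨-assoc; ∨-comm; not-involutive)
open import Data.Fin using (Fin; zero; suc; splitAt; join; _↑ˡ_; _↑ʳ_)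
open import Data.Fin.Properties as Finₚ using (_≟_; any?; all?; splitAt-join; join-splitAt; splitAt-↑ˡ; splitAt-↑ʳ)
open import Data.Fin.Subset using (Subset; _∈_; _⊆_; ∁; _∪_; _∩_; ⁅_⁆; ∣_∣) renaming (⊥ to ∅; ⊤ to full)
open import Data.Fin.Subset.Properties using (anySubset?; x∈⁅x⁆; x∈⁅y⁆⇒x≡y; ∣p∣≤n; ∈⊤)
open import Data.Vec as Vec using ([]; _∷_; tabulate; lookup)
open import Data.Vec.Properties using ([]=⇒lookup; lookup⇒[]=; lookup∘tabulate; tabulate∘lookup; tabulate-cong; lookup-zipWith; lookup-map; lookup-replicate; lookup-splitAt; lookup-++ˡ; lookup-++ʳ)
open import Data.List using (List; []; _∷_; allFin; foldr; length)
open import Data.List.Membership.Propositional using () renaming (_∈_ to _∈ₗ_)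
open import Data.List.Membership.Propositional.Properties using (∈-allFin)
import Data.List.Membership.DecPropositional
open import Data.List.Relation.Unary.Any using (here; there)
open import Data.List.Relation.Unary.All as All using (All; []; _∷_)
open import Data.List.Relation.Unary.AllPairs using ([]; _∷_)
open import Data.List.Relation.Unary.Unique.Propositional using (Unique)
open import Data.Product using (Σ; ∃; ∃-syntax; _×_; _,_; proj₁; proj₂)
open import Data.Sum as Sum using (_⊎_; inj₁; inj₂; [_,_]′)
open import Data.Empty using (⊥; ⊥-elim)
open import Function using (_∘_; id; case_of_)
open import Function.Bundles using (_↔_; mk↔ₛ′; Inverse; mk⇔; _⇔_; Equivalence)
open import Relation.Nullary using (¬_; Dec; yes; no; does)
open import Relation.Nullary.Decidable using (_×-dec_; _⊎-dec_; ¬?; map′; _→-dec_; dec-true; dec-false)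
open import Relation.Binary.PropositionalEquality using (_≡_; _≢_; refl; sym; trans; cong; cong₂; subst; _≗_)

-- Sets as Boolean functions

-- Cycles are handled as even sets because symmetric difference, splitting at one or two vertices
-- and contraction then become parity identities; walks serve to produce paths and to meet the
-- definitions. Ranks are never computed: a separation is refuted from an independent set of size
-- `u + |T|` in each side (`T` a spanning forest) and the bound `|V|` for the whole matroid, so no
-- augmentation or submodularity is needed. The factor 2 in the excess inequality comes from
-- counting the shared vertices twice, through the components of `X` and through those of `Y`. The
-- obstacle in replacing a part by an edge is that a cycle through the new edge has no class of its
-- own. It inherits the class obtained by inserting one fixed v-w path. The theta property makes
-- membership in `B` independent of that path, but another path may interchange `L` and `F`. This is
-- harmless: two cycles through the new edge meet, and a cycle disjoint from one of them avoids the
-- edge, keeps its class and thereby fixes the class of the other.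

ESet : ℕ → Set
ESet m = Fin m → Bool

infix 4 _⊑_
infixl 6 _⊔_ _⊖_ _△_
infixl 7 _⊓_

_⊑_ : ∀ {m} → ESet m → ESet m → Set
X ⊑ Y = ∀ e → X e ≡ true → Y e ≡ true

_⊔_ _⊓_ _⊖_ _△_ : ∀ {m} → ESet m → ESet m → ESet m
(X ⊔ Y) e = X e ∨ Y e
(X ⊓ Y) e = X e ∧ Y e
(X ⊖ Y) e = X e ∧ not (Y e)
(X △ Y) e = X e xor Y e

none all : ∀ {m} → ESet m
none _ = false
all _ = true

sing : ∀ {m} → Fin m → ESet m
sing e f = does (f ≟ e)

NE : ∀ {m} → ESet m → Set
NE X = ∃[ e ] X e ≡ true

t≢f : ∀ {b} → b ≡ true → b ≡ false → ⊥
t≢f refl ()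

bool-cases : ∀ b → b ≡ true ⊎ b ≡ false
bool-cases true = inj₁ refl
bool-cases false = inj₂ refl

≢true : ∀ {b} → ¬ b ≡ true → b ≡ false
≢true {true} n = ⊥-elim (n refl)
≢true {false} n = refl

≢false : ∀ {b} → ¬ b ≡ false → b ≡ true
≢false {true} n = refl
≢false {false} n = ⊥-elim (n refl)

∨-elim : ∀ {a b} → a ∨ b ≡ true → a ≡ true ⊎ b ≡ true
∨-elim {true} p = inj₁ refl
∨-elim {false} p = inj₂ p

∨-inl : ∀ {a b} → a ≡ true → a ∨ b ≡ true
∨-inl refl = refl

∨-inr : ∀ {a b} → b ≡ true → a ∨ b ≡ true
∨-inr {a} refl = ∨-zeroʳ a

∨-nil : ∀ {a b} → a ≡ false → b ≡ false → a ∨ b ≡ false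
∨-nil refl refl = refl

∧-in : ∀ {a b} → a ≡ true → b ≡ true → a ∧ b ≡ true
∧-in refl refl = refl

∧-fst : ∀ {a b} → a ∧ b ≡ true → a ≡ true
∧-fst {true} p = refl

∧-snd : ∀ {a b} → a ∧ b ≡ true → b ≡ true
∧-snd {true} p = p

∧-f₁ : ∀ {a b} → a ≡ false → a ∧ b ≡ false
∧-f₁ refl = refl

∧-f₂ : ∀ {a b} → b ≡ false → a ∧ b ≡ false
∧-f₂ {a} refl = ∧-zeroʳ a

not-t : ∀ {b} → not b ≡ true → b ≡ false
not-t {false} p = refl

not-f : ∀ {b} → b ≡ false → not b ≡ true
not-f refl = refl

⊖-in : ∀ {m} {X Y : ESet m} {e} → X e ≡ true → Y e ≡ false → (X ⊖ Y) e ≡ true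
⊖-in p q = ∧-in p (not-f q)

⊖-snd : ∀ {m} {X Y : ESet m} {e} → (X ⊖ Y) e ≡ true → Y e ≡ false
⊖-snd {X = X} {e = e} p = not-t (∧-snd {X e} p)

xor-elim : ∀ {a b} → a xor b ≡ true → (a ≡ true × b ≡ false) ⊎ (a ≡ false × b ≡ true)
xor-elim {true} {false} p = inj₁ (refl , refl)
xor-elim {false} {true} p = inj₂ (refl , refl)

xor-tf : ∀ {a b} → a ≡ true → b ≡ false → a xor b ≡ true
xor-tf refl refl = refl

xor-ft : ∀ {a b} → a ≡ false → b ≡ true → a xor b ≡ true
xor-ft refl refl = refl

xor-eq : ∀ {a b} → a xor b ≡ false → a ≡ b
xor-eq {true} {true} p = refl
xor-eq {false} {false} p = refl

eq-xor : ∀ {a b} → a ≡ b → a xor b ≡ false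
eq-xor {a} refl = xor-same a

true-iff : ∀ {a b} → (a ≡ true → b ≡ true) → (b ≡ true → a ≡ true) → a ≡ b
true-iff {true} {true} f g = refl
true-iff {true} {false} f g = sym (f refl)
true-iff {false} {true} f g = g refl
true-iff {false} {false} f g = refl

⊑-antisym : ∀ {m} {X Y : ESet m} → X ⊑ Y → Y ⊑ X → X ≗ Y
⊑-antisym p q e = true-iff (p e) (q e)

≗→⊑ : ∀ {m} {X Y : ESet m} → X ≗ Y → X ⊑ Y
≗→⊑ p e q = trans (sym (p e)) q

⊑-refl : ∀ {m} {X : ESet m} → X ⊑ X
⊑-refl e p = p

⊑-trans : ∀ {m} {X Y Z : ESet m} → X ⊑ Y → Y ⊑ Z → X ⊑ Z
⊑-trans p q e r = q e (p e r)

sing-self : ∀ {m} (e : Fin m) → sing e e ≡ true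
sing-self e = dec-true (e ≟ e) refl

sing-elim : ∀ {m} {e f : Fin m} → sing e f ≡ true → f ≡ e
sing-elim {e = e} {f} p with f ≟ e
... | yes q = q
sing-elim () | no _

sing-ne : ∀ {m} {e f : Fin m} → f ≢ e → sing e f ≡ false
sing-ne {e = e} {f} n = dec-false (f ≟ e) n

NE-not : ∀ {m} {X : ESet m} → ¬ NE X → X ≗ none
NE-not n e = ≢true (λ p → n (e , p))

-- Finite search

-- Functions are only compared pointwise, so the search runs over vectors, and `P` has to respect
-- `≗` to be carried back.
any-ESet? : ∀ {m} (P : ESet m → Set) → (∀ {X Y} → X ≗ Y → P X → P Y) →
            (∀ X → Dec (P X)) → Dec (∃ P)
any-ESet? P resp P? = map′ (λ (S , p) → lookup S , p)
  (λ (X , p) → tabulate X , resp (λ e → sym (lookup∘tabulate X e)) p)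
  (anySubset? (λ S → P? (lookup S)))

all-ESet? : ∀ {m} (P : ESet m → Set) → (∀ {X Y} → X ≗ Y → P X → P Y) →
            (∀ X → Dec (P X)) → Dec (∀ X → P X)
all-ESet? P resp P? with any-ESet? (λ X → ¬ P X) (λ e n p → n (resp (λ x → sym (e x)) p)) (λ X → ¬? (P? X))
... | yes (X , n) = no (λ a → n (a X))
... | no n = yes λ X → case P? X of λ where
  (yes p) → p
  (no q) → ⊥-elim (n (X , q))

⊑? : ∀ {m} (X Y : ESet m) → Dec (X ⊑ Y)
⊑? X Y = all? (λ e → (X e Bool.≟ true) →-dec (Y e Bool.≟ true))

≗? : ∀ {m} (X Y : ESet m) → Dec (X ≗ Y)
≗? X Y = all? (λ e → X e Bool.≟ Y e)

NE? : ∀ {m} (X : ESet m) → Dec (NE X)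
NE? X = any? (λ e → X e Bool.≟ true)

⋢ : ∀ {m} {X Y : ESet m} → ¬ X ⊑ Y → ∃[ e ] (X e ≡ true × Y e ≡ false)
⋢ {X = X} {Y} n with any? (λ e → (X e Bool.≟ true) ×-dec (Y e Bool.≟ false))
... | yes p = p
... | no q = ⊥-elim (n (λ e x → ≢false (λ y → q (e , x , y))))

-- Parity sums

xsum : ∀ {m} → ESet m → Bool
xsum {zero} f = false
xsum {suc m} f = f zero xor xsum (f ∘ suc)

xsum-cong : ∀ {m} {f g : ESet m} → f ≗ g → xsum f ≡ xsum g
xsum-cong {zero} p = refl
xsum-cong {suc m} p = cong₂ _xor_ (p zero) (xsum-cong (p ∘ suc))

xsum-none : ∀ {m} → xsum {m} none ≡ false
xsum-none {zero} = refl
xsum-none {suc m} = xsum-none {m}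

xsum-zero : ∀ {m} {f : ESet m} → (∀ e → f e ≡ false) → xsum f ≡ false
xsum-zero {m} p = trans (xsum-cong p) (xsum-none {m})

xor-swap : ∀ a b c d → (a xor b) xor (c xor d) ≡ (a xor c) xor (b xor d)
xor-swap true true true true = refl
xor-swap true true true false = refl
xor-swap true true false true = refl
xor-swap true true false false = refl
xor-swap true false true true = refl
xor-swap true false true false = refl
xor-swap true false false true = refl
xor-swap true false false false = refl
xor-swap false true true true = refl
xor-swap false true true false = refl
xor-swap false true false true = refl
xor-swap false true false false = refl
xor-swap false false true true = refl
xor-swap false false true false = refl
xor-swap false false false true = refl
xor-swap false false false false = refl

xsum-△ : ∀ {m} (f g : ESet m) → xsum (f △ g) ≡ xsum f xor xsum g
xsum-△ {zero} f g = refl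
xsum-△ {suc m} f g = trans (cong ((f zero xor g zero) xor_) (xsum-△ (f ∘ suc) (g ∘ suc)))
  (xor-swap (f zero) (g zero) (xsum (f ∘ suc)) (xsum (g ∘ suc)))

xsum-one : ∀ {m} {f : ESet m} e → f e ≡ true → (∀ e' → e' ≢ e → f e' ≡ false) → xsum f ≡ true
xsum-one {suc m} zero p q = cong₂ _xor_ p (xsum-zero (λ e → q (suc e) (λ ())))
xsum-one {suc m} (suc e) p q = cong₂ _xor_ (q zero (λ ()))
  (xsum-one e p (λ e' n → q (suc e') (n ∘ Finₚ.suc-injective)))

-- Counting

b2n : Bool → ℕ
b2n true = 1
b2n false = 0

nsum : ∀ {n} → (Fin n → ℕ) → ℕ
nsum {zero} f = 0
nsum {suc n} f = f zero + nsum (f ∘ suc)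

count : ∀ {n} → ESet n → ℕ
count f = nsum (b2n ∘ f)

nsum-cong : ∀ {n} {f g : Fin n → ℕ} → f ≗ g → nsum f ≡ nsum g
nsum-cong {zero} p = refl
nsum-cong {suc n} p = cong₂ _+_ (p zero) (nsum-cong (p ∘ suc))

nsum-mono : ∀ {n} {f g : Fin n → ℕ} → (∀ i → f i ≤ g i) → nsum f ≤ nsum g
nsum-mono {zero} p = z≤n
nsum-mono {suc n} p = +-mono-≤ (p zero) (nsum-mono (p ∘ suc))

nsum-zero : ∀ {n} {f : Fin n → ℕ} → (∀ i → f i ≡ 0) → nsum f ≡ 0
nsum-zero {zero} p = refl
nsum-zero {suc n} p = cong₂ _+_ (p zero) (nsum-zero (p ∘ suc))

+-swap : ∀ a b c d → (a + b) + (c + d) ≡ (a + c) + (b + d)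
+-swap a b c d = trans (+-assoc a b (c + d))
  (trans (cong (a +_) (trans (sym (+-assoc b c d)) (trans (cong (_+ d) (+-comm b c)) (+-assoc c b d))))
    (sym (+-assoc a c (b + d))))

nsum-+ : ∀ {n} (f g : Fin n → ℕ) → nsum (λ i → f i + g i) ≡ nsum f + nsum g
nsum-+ {zero} f g = refl
nsum-+ {suc n} f g = trans (cong (f zero + g zero +_) (nsum-+ (f ∘ suc) (g ∘ suc)))
  (+-swap (f zero) (g zero) (nsum (f ∘ suc)) (nsum (g ∘ suc)))

nsum-swap : ∀ {n k} (f : Fin n → Fin k → ℕ) →
            nsum (λ i → nsum (f i)) ≡ nsum (λ j → nsum (λ i → f i j))
nsum-swap {zero} {k} f = sym (nsum-zero {k} (λ _ → refl))
nsum-swap {suc n} f = trans (cong (nsum (f zero) +_) (nsum-swap (f ∘ suc)))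
  (sym (nsum-+ (f zero) (λ j → nsum (λ i → f (suc i) j))))

nsum-≥ : ∀ {n} (f : Fin n → ℕ) i → f i ≤ nsum f
nsum-≥ f zero = m≤m+n _ _
nsum-≥ f (suc i) = ≤-trans (nsum-≥ (f ∘ suc) i) (m≤n+m _ (f zero))

nsum-≥₂ : ∀ {n} (f : Fin n → ℕ) i j → i ≢ j → f i + f j ≤ nsum f
nsum-≥₂ f zero zero n = ⊥-elim (n refl)
nsum-≥₂ f zero (suc j) n = +-mono-≤ (≤-refl {f zero}) (nsum-≥ (f ∘ suc) j)
nsum-≥₂ f (suc i) zero n = ≤-trans (≤-reflexive (+-comm (f (suc i)) (f zero)))
  (+-mono-≤ (≤-refl {f zero}) (nsum-≥ (f ∘ suc) i))
nsum-≥₂ f (suc i) (suc j) n = ≤-trans (nsum-≥₂ (f ∘ suc) i j (λ e → n (cong suc e))) (m≤n+m _ (f zero))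

count-cong : ∀ {n} {f g : ESet n} → f ≗ g → count f ≡ count g
count-cong p = nsum-cong (λ i → cong b2n (p i))

count-mono : ∀ {n} {f g : ESet n} → f ⊑ g → count f ≤ count g
count-mono {f = f} {g} p = nsum-mono aux
  where
  aux : ∀ i → b2n (f i) ≤ b2n (g i)
  aux i with f i | p i
  ... | false | q = z≤n
  ... | true | q rewrite q refl = ≤-refl

count-split : ∀ {n} (f g : ESet n) → count (f ⊓ g) + count (f ⊖ g) ≡ count f
count-split f g = trans (sym (nsum-+ (b2n ∘ (f ⊓ g)) (b2n ∘ (f ⊖ g)))) (nsum-cong (λ i → aux (f i) (g i)))
  where
  aux : ∀ a b → b2n (a ∧ b) + b2n (a ∧ not b) ≡ b2n a
  aux true true = refl
  aux true false = refl
  aux false b = refl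

count-⊔ : ∀ {n} (f g : ESet n) → (∀ i → f i ≡ true → g i ≡ false) → count (f ⊔ g) ≡ count f + count g
count-⊔ f g d = trans (nsum-cong aux) (nsum-+ (b2n ∘ f) (b2n ∘ g))
  where
  aux : ∀ i → b2n (f i ∨ g i) ≡ b2n (f i) + b2n (g i)
  aux i with f i | d i
  ... | false | q = refl
  ... | true | q rewrite q refl = refl

count-none : ∀ {n} → count {n} none ≡ 0
count-none {n} = nsum-zero {n} (λ _ → refl)

count-all : ∀ {n} → count {n} all ≡ n
count-all {zero} = refl
count-all {suc n} = cong suc (count-all {n})

count-sing : ∀ {n} (i : Fin n) → count (sing i) ≡ 1
count-sing {suc n} zero = cong suc (nsum-zero {n} (λ i → refl))
count-sing (suc i) = count-sing i

count-insert : ∀ {n} (f : ESet n) i → f i ≡ false → count (f ⊔ sing i) ≡ suc (count f)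
count-insert f i p = trans (count-⊔ f (sing i) d) (trans (cong (count f +_) (count-sing i)) (+-comm (count f) 1))
  where
  d : ∀ j → f j ≡ true → sing i j ≡ false
  d j q = sing-ne {e = i} {j} λ { refl → t≢f q p }

count-< : ∀ {n} {f g : ESet n} i → f ⊑ g → f i ≡ false → g i ≡ true → count f < count g
count-< {f = f} {g} i s p q = ≤-trans (≤-reflexive (sym (count-insert f i p)))
  (count-mono {f = f ⊔ sing i} {g} λ j r → case ∨-elim {f j} r of λ where
    (inj₁ a) → s j a
    (inj₂ b) → subst (λ x → g x ≡ true) (sym (sing-elim {e = i} {j} b)) q)

count-comp : ∀ {n} (f : ESet n) → count f + count (not ∘ f) ≡ n
count-comp {n} f = trans (sym (count-⊔ f (not ∘ f) (λ i p → cong not p)))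
  (trans (count-cong (λ i → aux (f i))) (count-all {n}))
  where
  aux : ∀ b → b ∨ not b ≡ true
  aux true = refl
  aux false = refl

∣∣≡count : ∀ {n} (X : Subset n) → ∣ X ∣ ≡ count (lookup X)
∣∣≡count [] = refl
∣∣≡count (true ∷ X) = cong suc (∣∣≡count X)
∣∣≡count (false ∷ X) = ∣∣≡count X

-- Double counting: after exchanging the sums, each element of `S` lies in exactly one fibre. This
-- is how attachments are distributed over components.
fiber : ∀ {n k} (S : ESet n) (ρ : Fin n → Fin k) →
        nsum (λ r → count (λ z → S z ∧ does (ρ z ≟ r))) ≡ count S
fiber {k = k} S ρ = trans (nsum-swap (λ r z → b2n (S z ∧ does (ρ z ≟ r)))) (nsum-cong aux)
  where
  aux : ∀ z → count (λ r → S z ∧ does (ρ z ≟ r)) ≡ b2n (S z)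
  aux z with S z
  ... | false = nsum-zero {k} (λ r → refl)
  ... | true = trans (nsum-cong (λ r → cong b2n (flip-dec r))) (count-sing (ρ z))
    where
    flip-dec : ∀ r → does (ρ z ≟ r) ≡ does (r ≟ ρ z)
    flip-dec r with r ≟ ρ z
    ... | yes refl = dec-true (r ≟ r) refl
    ... | no n = dec-false (ρ z ≟ r) (n ∘ sym)

count-≤1 : ∀ {n} (f : ESet n) → (∀ i j → f i ≡ true → f j ≡ true → i ≡ j) → count f ≤ 1
count-≤1 {zero} f u = z≤n
count-≤1 {suc n} f u with f zero in eq
... | false = count-≤1 (f ∘ suc) (λ i j p q → Finₚ.suc-injective (u (suc i) (suc j) p q))
... | true = s≤s (≤-reflexive (nsum-zero λ i → cong b2n (≢true λ p → case u zero (suc i) eq p of λ ())))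

count-inj : ∀ {n k} (f : ESet n) (g : ESet k) (ρ : Fin n → Fin k) →
  (∀ i → f i ≡ true → g (ρ i) ≡ true) →
  (∀ i j → f i ≡ true → f j ≡ true → ρ i ≡ ρ j → i ≡ j) → count f ≤ count g
count-inj f g ρ into inj = ≤-trans (≤-reflexive (sym (fiber f ρ))) (nsum-mono aux)
  where
  aux : ∀ r → count (λ z → f z ∧ does (ρ z ≟ r)) ≤ b2n (g r)
  aux r with g r in eq
  ... | true = count-≤1 _ λ i j p q → inj i j (∧-fst p) (∧-fst q)
    (trans (sing-elim {e = r} (∧-snd {f i} p)) (sym (sing-elim {e = r} (∧-snd {f j} q))))
  ... | false = ≤-reflexive (nsum-zero λ i → cong b2n (≢true λ p →
    t≢f (subst (λ x → g x ≡ true) (sing-elim {e = r} (∧-snd {f i} p)) (into i (∧-fst p))) eq))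

count-≥ : ∀ {n} (f : ESet n) (xs : List (Fin n)) → Unique xs → All (λ x → f x ≡ true) xs →
          length xs ≤ count f
count-≥ f [] u a = z≤n
count-≥ {n} f (x ∷ xs) (px ∷ u) (fx ∷ a) =
  ≤-trans (s≤s (count-≥ (f ⊖ sing x) xs u (go xs px a)))
    (count-< {f = f ⊖ sing x} {f} x (λ _ → ∧-fst) (∧-f₂ {f x} (cong not (sing-self x))) fx)
  where
  go : ∀ ys → All (x ≢_) ys → All (λ y → f y ≡ true) ys → All (λ y → (f ⊖ sing x) y ≡ true) ys
  go [] _ _ = []
  go (y ∷ ys) (n ∷ ns) (q ∷ qs) = ⊖-in {X = f} {sing x} {y} q (sing-ne (n ∘ sym)) ∷ go ys ns qs

-- Cuts, even sets and cycles

module _ {m : ℕ} (G : Graph m) where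

  src tgt : Fin m → Fin (nV G)
  src e = proj₁ (ends G e)
  tgt e = proj₂ (ends G e)

  -- The edge cut of a vertex set; a loop belongs to no cut.
  δ : ESet (nV G) → ESet m
  δ U e = U (src e) xor U (tgt e)

  bd : ESet m → ESet (nV G) → Bool
  bd Z U = xsum (λ e → Z e ∧ δ U e)

  -- Every cut is a sum of vertex stars, so testing all vertex sets is no stronger than testing
  -- degrees, and a test set may be a whole component or one side of a separation.
  Even : ESet m → Set
  Even Z = ∀ U → bd Z U ≡ false

  record Cyc (Z : ESet m) : Set where
    field
      even : Even Z
      ne   : NE Z
      min  : ∀ Y → Y ⊑ Z → Even Y → NE Y → Z ⊑ Y

  InV : ESet m → Fin (nV G) → Set
  InV Z x = ∃[ e ] (Z e ≡ true × Incident G e x)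

  inc-src : ∀ e → Incident G e (src e)
  inc-src e = tgt e , inj₁ refl

  inc-tgt : ∀ e → Incident G e (tgt e)
  inc-tgt e = src e , inj₂ refl

  inc-cases : ∀ {e x} → Incident G e x → x ≡ src e ⊎ x ≡ tgt e
  inc-cases (w , inj₁ p) = inj₁ (sym (cong proj₁ p))
  inc-cases (w , inj₂ p) = inj₂ (sym (cong proj₂ p))

  inc? : ∀ e x → Dec (Incident G e x)
  inc? e x with x ≟ src e | x ≟ tgt e
  ... | yes refl | _ = yes (inc-src e)
  ... | no p | yes refl = yes (inc-tgt e)
  ... | no p | no q = no λ i → [ p , q ]′ (inc-cases i)

  InV? : ∀ Z x → Dec (InV Z x)
  InV? Z x = any? (λ e → (Z e Bool.≟ true) ×-dec inc? e x)

  InV-mono : ∀ {X Y} → X ⊑ Y → ∀ {x} → InV X x → InV Y x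
  InV-mono s (e , p , i) = e , s e p , i

  vset : ESet m → ESet (nV G)
  vset Z x = does (InV? Z x)

  vset-in : ∀ {Z x} → InV Z x → vset Z x ≡ true
  vset-in {Z} {x} p = dec-true (InV? Z x) p

  vset-out : ∀ {Z x} → vset Z x ≡ true → InV Z x
  vset-out {Z} {x} p with InV? Z x
  ... | yes q = q
  vset-out () | no _

  joins-sym : ∀ {e u w} → Joins G e u w → Joins G e w u
  joins-sym (inj₁ p) = inj₂ p
  joins-sym (inj₂ p) = inj₁ p

  joins-inc : ∀ {e u w} → Joins G e u w → Incident G e u
  joins-inc {w = w} j = w , j

  joins-inc₂ : ∀ {e u w} → Joins G e u w → Incident G e w
  joins-inc₂ {u = u} j = u , joins-sym j

  joins-self : ∀ e → Joins G e (src e) (tgt e)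
  joins-self e = inj₁ refl

  joins-ends : ∀ {e u w x} → Joins G e u w → Incident G e x → x ≡ u ⊎ x ≡ w
  joins-ends (inj₁ p) i with inc-cases i
  ... | inj₁ q = inj₁ (trans q (cong proj₁ p))
  ... | inj₂ q = inj₂ (trans q (cong proj₂ p))
  joins-ends (inj₂ p) i with inc-cases i
  ... | inj₁ q = inj₂ (trans q (cong proj₁ p))
  ... | inj₂ q = inj₁ (trans q (cong proj₂ p))

  δ-joins : ∀ U {e u w} → Joins G e u w → δ U e ≡ U u xor U w
  δ-joins U (inj₁ p) = cong (λ (a , b) → U a xor U b) p
  δ-joins U {u = u} {w} (inj₂ p) = trans (cong (λ (a , b) → U a xor U b) p) (xor-comm (U w) (U u))

  bd-cong : ∀ {Z Y} → Z ≗ Y → ∀ U → bd Z U ≡ bd Y U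
  bd-cong p U = xsum-cong (λ e → cong (_∧ δ U e) (p e))

  bd-△ : ∀ Z Y U → bd (Z △ Y) U ≡ bd Z U xor bd Y U
  bd-△ Z Y U = trans (xsum-cong (λ e → ∧-distribʳ-xor (δ U e) (Z e) (Y e)))
    (xsum-△ (λ e → Z e ∧ δ U e) (λ e → Y e ∧ δ U e))

  bd-U : ∀ Z {U U'} → (∀ x → InV Z x → U x ≡ U' x) → bd Z U ≡ bd Z U'
  bd-U Z {U} {U'} a = xsum-cong aux
    where
    aux : ∀ e → Z e ∧ δ U e ≡ Z e ∧ δ U' e
    aux e with Z e in eq
    ... | false = refl
    ... | true = cong₂ _xor_ (a _ (e , eq , inc-src e)) (a _ (e , eq , inc-tgt e))

  bd-const : ∀ Z U b → (∀ x → InV Z x → U x ≡ b) → bd Z U ≡ false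
  bd-const Z U b a = trans (bd-U Z {U} {λ _ → b} a) (xsum-zero (λ e → ∧-f₂ {Z e} (xor-same b)))

  even-resp : ∀ {Z Y} → Z ≗ Y → Even Z → Even Y
  even-resp p ev U = trans (sym (bd-cong p U)) (ev U)

  even-△ : ∀ {Z Y} → Even Z → Even Y → Even (Z △ Y)
  even-△ {Z} {Y} p q U = trans (bd-△ Z Y U) (cong₂ _xor_ (p U) (q U))

  Even? : ∀ Z → Dec (Even Z)
  Even? Z = all-ESet? (λ U → bd Z U ≡ false)
    (λ {X} {Y} p q → trans (sym (bd-U Z {X} {Y} (λ x _ → p x))) q) (λ U → bd Z U Bool.≟ false)

  cyc-resp : ∀ {Z Y} → Z ≗ Y → Cyc Z → Cyc Y
  cyc-resp p c = record
    { even = even-resp p (Cyc.even c)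
    ; ne = let (e , q) = Cyc.ne c in e , trans (sym (p e)) q
    ; min = λ X s ev n e q → Cyc.min c X (λ f r → trans (p f) (s f r)) ev n e (trans (p e) q) }

  Cyc? : ∀ Z → Dec (Cyc Z)
  Cyc? Z = map′ (λ (a , b , c) → record { even = a ; ne = b ; min = λ Y → c Y })
    (λ c → Cyc.even c , Cyc.ne c , Cyc.min c)
    (Even? Z ×-dec NE? Z ×-dec
      all-ESet? (λ Y → Y ⊑ Z → Even Y → NE Y → Z ⊑ Y)
        (λ {X} {Y} p a s ev (e , n) f q → trans (sym (p f))
          (a (λ g r → s g (trans (sym (p g)) r)) (even-resp (λ g → sym (p g)) ev) (e , trans (p e) n) f q))
        (λ Y → ⊑? Y Z →-dec Even? Y →-dec NE? Y →-dec ⊑? Z Y))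

  cyc-eq : ∀ {C D} → Cyc C → Cyc D → C ⊑ D → C ≗ D
  cyc-eq {C} c d s = ⊑-antisym s (Cyc.min d C s (Cyc.even c) (Cyc.ne c))

  cyc-diff : ∀ {C D} → Cyc C → Cyc D → ¬ C ≗ D → ∃[ e ] (D e ≡ true × C e ≡ false)
  cyc-diff c d n = ⋢ (λ s → n (λ e → sym (cyc-eq d c s e)))

  -- Walks and paths

  memb : List (Fin m) → ESet m
  memb [] e = false
  memb (x ∷ xs) e = sing x e ∨ memb xs e

  memb-in : ∀ {xs e} → e ∈ₗ xs → memb xs e ≡ true
  memb-in {x ∷ xs} (here refl) = ∨-inl (sing-self x)
  memb-in {x ∷ xs} {e} (there p) = ∨-inr {sing x e} (memb-in p)

  memb-out : ∀ {xs e} → memb xs e ≡ true → e ∈ₗ xs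
  memb-out {x ∷ xs} {e} p with ∨-elim {sing x e} p
  ... | inj₁ q = here (sing-elim {e = x} q)
  ... | inj₂ q = there (memb-out q)

  lookup-∪ : ∀ (X Y : Subset m) e → lookup (X ∪ Y) e ≡ lookup X e ∨ lookup Y e
  lookup-∪ X Y e = lookup-zipWith _∨_ e X Y

  lookup-∩ : ∀ (X Y : Subset m) e → lookup (X ∩ Y) e ≡ lookup X e ∧ lookup Y e
  lookup-∩ X Y e = lookup-zipWith _∧_ e X Y

  lookup-∅ : ∀ (e : Fin m) → lookup (∅ {m}) e ≡ false
  lookup-∅ e = lookup-replicate e false

  lookup-⁅⁆ : ∀ (x e : Fin m) → lookup ⁅ x ⁆ e ≡ sing x e
  lookup-⁅⁆ x e = true-iff
    (λ p → subst (λ y → sing x y ≡ true) (sym (x∈⁅y⁆⇒x≡y x (lookup⇒[]= e ⁅ x ⁆ p))) (sing-self x))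
    (λ p → subst (λ y → lookup ⁅ x ⁆ y ≡ true) (sym (sing-elim {e = x} {e} p)) ([]=⇒lookup (x∈⁅x⁆ x)))

  edgeSet-memb : ∀ {u v} (W : Walk G u v) → lookup (edgeSet G W) ≗ memb (edges G W)
  edgeSet-memb W = go (edges G W)
    where
    go : ∀ es e → lookup (foldr (λ e S → ⁅ e ⁆ ∪ S) ∅ es) e ≡ memb es e
    go [] e = lookup-∅ e
    go (x ∷ es) e = trans (lookup-∪ ⁅ x ⁆ _ e) (cong₂ _∨_ (lookup-⁅⁆ x e) (go es e))

  wset : ∀ {u v} → Walk G u v → ESet m
  wset W = memb (edges G W)

  start-in : ∀ {u v} (W : Walk G u v) → u ∈ₗ verts G W
  start-in (nil v) = here refl
  start-in (cons e j W) = here refl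

  end-in : ∀ {u v} (W : Walk G u v) → v ∈ₗ verts G W
  end-in (nil v) = here refl
  end-in (cons e j W) = there (end-in W)

  edge-verts : ∀ {u v} (W : Walk G u v) {e x} → e ∈ₗ edges G W → Incident G e x → x ∈ₗ verts G W
  edge-verts (cons e j W) (here refl) i with joins-ends j i
  ... | inj₁ refl = here refl
  ... | inj₂ refl = there (start-in W)
  edge-verts (cons e j W) (there p) i = there (edge-verts W p i)

  wset-verts : ∀ {u v} (W : Walk G u v) {x} → InV (wset W) x → x ∈ₗ verts G W
  wset-verts W (e , p , i) = edge-verts W (memb-out p) i

  -- The parities telescope along the walk. Distinct edges are needed so that the edge set is the
  -- symmetric difference of the single edges.
  bd-walk : ∀ {u v} (W : Walk G u v) → Unique (edges G W) → ∀ U → bd (wset W) U ≡ U u xor U v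
  bd-walk (nil v) _ U = trans (xsum-none {m}) (sym (xor-same (U v)))
  bd-walk {u} {v} (cons {w = w} e j W) (n ∷ uq) U =
    trans (bd-cong {wset (cons e j W)} {sing e △ wset W} dis U) (trans (bd-△ (sing e) (wset W) U)
      (trans (cong₂ _xor_ single (bd-walk W uq U)) (tel (U u) (U w) (U v))))
    where
    dis : wset (cons e j W) ≗ sing e △ wset W
    dis f with f ≟ e
    ... | yes refl = sym (cong not (≢true (λ p → All.lookup n (memb-out p) refl)))
    ... | no _ = refl
    single : bd (sing e) U ≡ U u xor U w
    single with δ U e in eq
    ... | true = trans (xsum-one e (∧-in (sing-self e) eq) (λ f q → ∧-f₁ (sing-ne q)))
                   (trans (sym eq) (δ-joins U j))
    ... | false = trans (xsum-zero aux) (trans (sym eq) (δ-joins U j))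
      where
      aux : ∀ f → sing e f ∧ δ U f ≡ false
      aux f with f ≟ e
      ... | yes refl = eq
      ... | no _ = refl
    tel : ∀ a b c → (a xor b) xor (b xor c) ≡ a xor c
    tel true true true = refl
    tel true true false = refl
    tel true false true = refl
    tel true false false = refl
    tel false true true = refl
    tel false true false = refl
    tel false false c = refl

  path-edges : ∀ {u v} (W : Walk G u v) → IsPath G W → Unique (edges G W)
  path-edges (nil v) _ = []
  path-edges (cons e j W) (n ∷ uq) =
    All.tabulate (λ { p refl → All.lookup n (edge-verts W p (joins-inc j)) refl }) ∷ path-edges W uq

  path-noloop : ∀ {u v} (W : Walk G u v) → IsPath G W → ∀ {e} → e ∈ₗ edges G W → src e ≢ tgt e
  path-noloop (cons e j W) (n ∷ uq) (there p) = path-noloop W uq p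
  path-noloop (cons e j W) (n ∷ uq) (here refl) q = All.lookup n (start-in W) (u≡w j)
    where
    u≡w : ∀ {u w} → Joins G e u w → u ≡ w
    u≡w (inj₁ p) = trans (sym (cong proj₁ p)) (trans q (cong proj₂ p))
    u≡w (inj₂ p) = trans (sym (cong proj₂ p)) (trans (sym q) (cong proj₁ p))

  -- The internal vertices of a path that meet nothing else are peeled off one by one.
  peel : ∀ {u v} (W : Walk G u v) → IsPath G W → ∀ Z Y → Even Z → Z ⊑ wset W ⊔ Y →
         (∀ x → x ∈ₗ verts G W → InV Y x → x ≡ v) → Z ⊑ Y
  peel (nil v) _ Z Y ev s a = s
  peel {u} {v} (cons {w = w} e j W) (n ∷ uq) Z Y ev s a =
    peel W uq Z Y ev s' (λ x p → a x (there p))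
    where
    u∉ : ∀ {x} → x ∈ₗ verts G W → x ≢ u
    u∉ p refl = All.lookup n p refl
    Z' : ∀ f → Z f ≡ true → f ≢ e → f ∈ₗ edges G W ⊎ Y f ≡ true
    Z' f p q with ∨-elim {wset (cons e j W) f} (s f p)
    ... | inj₂ y = inj₂ y
    ... | inj₁ r with memb-out {e ∷ edges G W} r
    ... | here eq = ⊥-elim (q eq)
    ... | there t = inj₁ t
    ninc : ∀ f → Z f ≡ true → f ≢ e → ¬ Incident G f u
    ninc f p q i with Z' f p q
    ... | inj₁ t = u∉ (edge-verts W t i) refl
    ... | inj₂ y = u∉ (end-in W) (sym (a u (here refl) (f , y , i)))
    others : ∀ f → f ≢ e → Z f ∧ δ (sing u) f ≡ false
    others f q with Z f in eq
    ... | false = refl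
    ... | true = cong₂ _xor_ (sing-ne (λ r → ninc f eq q (subst (Incident G f) r (inc-src f))))
                              (sing-ne (λ r → ninc f eq q (subst (Incident G f) r (inc-tgt f))))
    Ze : Z e ≡ false
    -- Within `Z` only `e` can meet `u`, so the star of `u` would cut an even set in one edge.
    Ze = ≢true λ p → t≢f
      (xsum-one e (∧-in p (trans (δ-joins (sing u) j) (cong₂ _xor_ (sing-self u) (sing-ne (u∉ (start-in W)))))) others)
      (ev (sing u))
    s' : Z ⊑ wset W ⊔ Y
    s' f p with Z' f p (λ { refl → t≢f p Ze })
    ... | inj₁ t = ∨-inl (memb-in t)
    ... | inj₂ y = ∨-inr {wset W f} y

  no-even-in-path : ∀ {u v} (W : Walk G u v) → IsPath G W → ∀ Z → Even Z → Z ⊑ wset W → ¬ NE Z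
  no-even-in-path W p Z ev s (e , q) with peel W p Z none ev (λ f r → ∨-inl (s f r)) (λ { _ _ (_ , () , _) }) e q
  ... | ()

  -- A competitor `Y` containing `e` is replaced by `Z △ Y`, which is even and avoids `e`; hence
  -- only sets avoiding one edge need to be excluded.
  cyc-by-edge : ∀ Z e → Even Z → Z e ≡ true →
    (∀ Y → Even Y → Y ⊑ Z → Y e ≡ false → ¬ NE Y) → Cyc Z
  cyc-by-edge Z e ev ze h = record
    { even = ev ; ne = e , ze ; min = λ Y s evY n f zf → ≢false λ yf →
        case bool-cases (Y e) of λ where
          (inj₂ ye) → h Y evY s ye n
          (inj₁ ye) → h (Z △ Y) (even-△ {Z} {Y} ev evY)
            (λ g r → case xor-elim {Z g} r of λ { (inj₁ (a , _)) → a ; (inj₂ (_ , b)) → s g b })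
            (cong₂ _xor_ ze ye) (f , xor-tf zf yf) }

  -- Without its first edge the closed walk is a path, and a path contains no nonempty even set.
  IsCycle→Cyc : ∀ {X} → IsCycle G X → Cyc (lookup X)
  IsCycle→Cyc (u , w , e , j , W , uv , ue , refl) =
    cyc-resp (λ f → sym (edgeSet-memb (cons e j W) f))
      (cyc-by-edge (wset (cons e j W)) e
        (λ U → trans (bd-walk (cons e j W) ue U) (xor-same (U u)))
        (memb-in {e ∷ edges G W} (here refl))
        (λ Y ev s ye → no-even-in-path W uv Y ev (λ f yf → case memb-out {e ∷ edges G W} (s f yf) of λ where
          (here refl) → ⊥-elim (t≢f yf ye)
          (there p) → memb-in p)))

  -- Connection inside an edge set

  data Conn (X : ESet m) : Fin (nV G) → Fin (nV G) → Set where
    stop : ∀ {u} → Conn X u u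
    step : ∀ {u w v} e → X e ≡ true → Joins G e u w → Conn X w v → Conn X u v

  conn-trans : ∀ {X u v w} → Conn X u v → Conn X v w → Conn X u w
  conn-trans stop q = q
  conn-trans (step e p j c) q = step e p j (conn-trans c q)

  conn-sym : ∀ {X u v} → Conn X u v → Conn X v u
  conn-sym stop = stop
  conn-sym (step e p j c) = conn-trans (conn-sym c) (step e p (joins-sym j) stop)

  conn-mono : ∀ {X Y u v} → X ⊑ Y → Conn X u v → Conn Y u v
  conn-mono s stop = stop
  conn-mono s (step e p j c) = step e (s e p) j (conn-mono s c)

  conn-edge : ∀ {X} e → X e ≡ true → Conn X (src e) (tgt e)
  conn-edge e p = step e p (joins-self e) stop

  conn-inc : ∀ {X e x y} → X e ≡ true → Incident G e x → Incident G e y → Conn X x y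
  conn-inc {e = e} p (w , j) i with joins-ends j i
  ... | inj₁ refl = stop
  ... | inj₂ refl = step e p j stop

  conn-const : ∀ {A : Set} {X} (φ : Fin (nV G) → A) → (∀ e → X e ≡ true → φ (src e) ≡ φ (tgt e)) →
               ∀ {u v} → Conn X u v → φ u ≡ φ v
  conn-const φ h stop = refl
  conn-const φ h (step e p j c) = trans (aux j (h e p)) (conn-const φ h c)
    where
    aux : ∀ {u w} → Joins G e u w → φ (src e) ≡ φ (tgt e) → φ u ≡ φ w
    aux (inj₁ q) r = trans (cong φ (sym (cong proj₁ q))) (trans r (cong φ (cong proj₂ q)))
    aux (inj₂ q) r = trans (cong φ (sym (cong proj₂ q))) (trans (sym r) (cong φ (cong proj₁ q)))

  conn-InV : ∀ {X u v} → Conn X u v → InV X u → InV X v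
  conn-InV stop p = p
  conn-InV (step e p j c) _ = conn-InV c (e , p , joins-inc₂ j)

  conn-isolated : ∀ {X u v} → Conn X u v → ¬ InV X u → u ≡ v
  conn-isolated stop n = refl
  conn-isolated (step e p j c) n = ⊥-elim (n (e , p , joins-inc j))

  conn-walk : ∀ {u v} (W : Walk G u v) → Conn (wset W) u v
  conn-walk (nil v) = stop
  conn-walk (cons e j W) = step e (memb-in {e ∷ edges G W} (here refl)) j
    (conn-mono (λ f p → ∨-inr {sing e f} p) (conn-walk W))

  suffix : ∀ {u v x} (W : Walk G u v) → IsPath G W → x ∈ₗ verts G W →
           Σ (Walk G x v) λ W' → IsPath G W' × (∀ {e} → e ∈ₗ edges G W' → e ∈ₗ edges G W)
  suffix (nil v) uq (here refl) = nil v , uq , id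
  suffix (cons e j W) uq (here refl) = cons e j W , uq , id
  suffix (cons e j W) (_ ∷ uq) (there p) = let (W' , a , b) = suffix W uq p in W' , a , there ∘ b

  abstract
    -- Loop erasure: if `u` already occurs on the path built from its successor, only the part from
    -- that occurrence on is kept.
    conn-path : ∀ {X u v} → Conn X u v → Σ (Walk G u v) λ W → IsPath G W × wset W ⊑ X
    conn-path {u = u} stop = nil u , ([] ∷ []) , λ _ ()
    conn-path {X} {u} (step e p j c) with conn-path c
    ... | W , uq , s with Data.List.Membership.DecPropositional._∈?_ _≟_ u (verts G W)
    ... | yes i = let (W' , a , b) = suffix W uq i in W' , a , λ f r → s f (memb-in (b (memb-out r)))
    ... | no n = cons e j W , All.tabulate (λ { q refl → n q }) ∷ uq ,
                 λ f r → case ∨-elim {sing e f} r of λ where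
                   (inj₁ a) → subst (λ x → X x ≡ true) (sym (sing-elim {e = e} a)) p
                   (inj₂ b) → s f b

  abstract
    -- For a forest `X` this is the fundamental cycle of `d`.
    close : ∀ {X} d → X d ≡ false → ∀ {u w} → Joins G d u w → Conn X w u →
            ∃[ C ] (IsCycle G C × lookup C ⊑ X ⊔ sing d × lookup C d ≡ true)
    close {X} d n {u} {w} j c with conn-path c
    ... | W , uq , s = edgeSet G (cons d j W) ,
          (u , w , d , j , W , uq ,
            All.tabulate (λ { p refl → t≢f (s d (memb-in p)) n }) ∷ path-edges W uq , refl) ,
          (λ f p → case ∨-elim {sing d f} (trans (sym (edgeSet-memb (cons d j W) f)) p) of λ where
            (inj₁ a) → ∨-inr {X f} a
            (inj₂ b) → ∨-inl (s f b)) ,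
          trans (edgeSet-memb (cons d j W) d) (∨-inl (sing-self d))

lookup-ext : ∀ {m} {X Y : Subset m} → lookup X ≗ lookup Y → X ≡ Y
lookup-ext {X = X} {Y} p = trans (sym (tabulate∘lookup X)) (trans (tabulate-cong p) (tabulate∘lookup Y))

module _ {m : ℕ} (G : Graph m) where

  -- Spanning forests with component representatives

  -- The components are named by the fixed points of `rep`. Keeping the relation between edges,
  -- components and vertices as the invariant `size` makes the later rank estimates pure counting.
  record Forest (T : ESet m) (rep : Fin (nV G) → Fin (nV G)) : Set where
    field
      acyc  : ∀ Z → Even G Z → Z ⊑ T → ¬ NE Z
      toRep : ∀ v → Conn G T v (rep v)
      same  : ∀ e → T e ≡ true → rep (src G e) ≡ rep (tgt G e)
      size  : count T + count (λ v → does (rep v ≟ v)) ≡ nV G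

    idem : ∀ v → rep (rep v) ≡ rep v
    idem v = sym (conn-const G rep same (toRep v))

  emptyForest : Forest none id
  emptyForest = record
    { acyc = λ { Z ev s (e , p) → case s e p of λ () }
    ; toRep = λ v → stop
    ; same = λ _ ()
    ; size = trans (cong₂ _+_ (count-none {m}) (count-cong {nV G} {λ v → does (v ≟ v)} {all} (λ v → dec-true (v ≟ v) refl))) (count-all {nV G}) }

  module _ {T : ESet m} {rep : Fin (nV G) → Fin (nV G)} (Fo : Forest T rep) (e : Fin m)
           (ne : rep (src G e) ≢ rep (tgt G e)) where
    open Forest Fo

    merged : Fin (nV G) → Fin (nV G)
    merged v = if does (rep v ≟ rep (tgt G e)) then rep (src G e) else rep v

    private
      p q : Fin (nV G)
      p = rep (src G e)
      q = rep (tgt G e)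

      Te : T e ≡ false
      Te = ≢true (λ t → ne (same e t))

      merged-yes : ∀ {v} → rep v ≡ q → merged v ≡ p
      merged-yes {v} r rewrite dec-true (rep v ≟ q) r = refl

      merged-no : ∀ {v} → rep v ≢ q → merged v ≡ rep v
      merged-no {v} r rewrite dec-false (rep v ≟ q) r = refl

    merged-resp : ∀ {x y} → rep x ≡ rep y → merged x ≡ merged y
    merged-resp {x} {y} r rewrite r = refl

    merged-edge : merged (src G e) ≡ merged (tgt G e)
    merged-edge = trans (merged-no ne) (sym (merged-yes refl))

    -- One representative, that of the target of `e`, is lost while one edge is gained, so `size` is
    -- preserved.
    insert-edge : Forest (T ⊔ sing e) merged
    insert-edge = record { acyc = acyc' ; toRep = toRep' ; same = same' ; size = size' }
      where
      U : ESet (nV G)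
      U v = does (rep v ≟ q)
      split : ∀ f → (T ⊔ sing e) f ≡ true → T f ≡ true ⊎ f ≡ e
      split f r with ∨-elim {T f} r
      ... | inj₁ a = inj₁ a
      ... | inj₂ b = inj₂ (sing-elim {e = e} b)
      acyc' : ∀ Z → Even G Z → Z ⊑ T ⊔ sing e → ¬ NE Z
      acyc' Z ev s nz with bool-cases (Z e)
      ... | inj₂ ze = acyc Z ev (λ f r → case split f (s f r) of λ where
                (inj₁ a) → a
                (inj₂ refl) → ⊥-elim (t≢f r ze)) nz
      -- `U` is the old component of the target: the edges of `T` do not leave it, so an even set
      -- containing `e` would meet its cut in `e` alone.
      ... | inj₁ ze = t≢f (xsum-one e
            (∧-in ze (cong₂ _xor_ (dec-false (rep (src G e) ≟ q) ne) (dec-true (q ≟ q) refl))) others) (ev U)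
        where
        others : ∀ f → f ≢ e → Z f ∧ δ G U f ≡ false
        others f n with Z f in eq
        ... | false = refl
        ... | true with split f (s f eq)
        ... | inj₁ a = eq-xor (cong (λ x → does (x ≟ q)) (same f a))
        ... | inj₂ b = ⊥-elim (n b)
      old : ∀ {u v} → Conn G T u v → Conn G (T ⊔ sing e) u v
      old = conn-mono G (λ f r → ∨-inl r)
      toRep' : ∀ v → Conn G (T ⊔ sing e) v (merged v)
      toRep' v with rep v ≟ q
      ... | no _ = old (toRep v)
      ... | yes r = conn-trans G (old (subst (Conn G T v) r (toRep v)))
                     (conn-trans G (conn-sym G (old (toRep (tgt G e))))
                       (conn-trans G (conn-sym G (conn-edge G e (∨-inr {T e} (sing-self e)))) (old (toRep (src G e)))))
      same' : ∀ f → (T ⊔ sing e) f ≡ true → merged (src G f) ≡ merged (tgt G f)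
      same' f r with split f r
      ... | inj₁ a = merged-resp (same f a)
      ... | inj₂ refl = merged-edge
      fx fx' : ESet (nV G)
      fx v = does (rep v ≟ v)
      fx' v = does (merged v ≟ v)
      fx'q : fx' q ≡ false
      fx'q = dec-false (merged q ≟ q) (λ r → ne (trans (sym (merged-yes (idem (tgt G e)))) r))
      fx-eq : fx ≗ fx' ⊔ sing q
      fx-eq v = true-iff to from
        where
        to : fx v ≡ true → fx' v ∨ sing q v ≡ true
        to r with v ≟ q
        ... | yes refl = ∨-zeroʳ (fx' v)
        ... | no n = ∨-inl (dec-true (merged v ≟ v) (trans (merged-no (λ s → n (trans (sym (sing-elim {e = v} r)) s))) (sing-elim {e = v} r)))
        from : fx' v ∨ sing q v ≡ true → fx v ≡ true
        from r with ∨-elim {fx' v} r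
        ... | inj₂ b = dec-true (rep v ≟ v) (subst (λ x → rep x ≡ x) (sym (sing-elim {e = q} b)) (idem (tgt G e)))
        ... | inj₁ a with rep v ≟ q
        ... | no n = a
        ... | yes s = ⊥-elim (ne (trans (sym (idem (src G e))) (trans (cong rep (sing-elim {e = v} a)) s)))
      size' : count (T ⊔ sing e) + count fx' ≡ nV G
      size' = trans (cong (_+ count fx') (count-insert T e Te))
        (trans (sym (+-suc (count T) (count fx')))
          (trans (cong (count T +_) (sym (trans (count-cong fx-eq) (count-insert fx' q fx'q)))) size))

  -- `coarse` is what lets an edge examined early keep both ends in one component through all later
  -- mergers.
  record Grown (X : ESet m) (T : ESet m) (rep : Fin (nV G) → Fin (nV G)) (es : List (Fin m)) : Set where
    field
      T'     : ESet m
      rep'   : Fin (nV G) → Fin (nV G)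
      forest : Forest T' rep'
      above  : T ⊑ T'
      below  : T' ⊑ T ⊔ X
      spans  : ∀ {e} → e ∈ₗ es → X e ≡ true → rep' (src G e) ≡ rep' (tgt G e)
      coarse : ∀ {x y} → rep x ≡ rep y → rep' x ≡ rep' y

  grow : ∀ X {T rep} → Forest T rep → ∀ es → Grown X T rep es
  grow X Fo [] = record { forest = Fo ; above = λ e p → p ; below = λ e p → ∨-inl p ; spans = λ () ; coarse = id }
  grow X {T} {rep} Fo (e ∷ es) with X e in eq | rep (src G e) ≟ rep (tgt G e)
  ... | true | no n = let module R = Grown (grow X (insert-edge Fo e n) es) in record
        { forest = R.forest
        ; above = λ f p → R.above f (∨-inl p)
        ; below = λ f p → case ∨-elim {T f ∨ sing e f} (R.below f p) of λ where
            (inj₂ b) → ∨-inr {T f} b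
            (inj₁ a) → case ∨-elim {T f} a of λ where
              (inj₁ c) → ∨-inl c
              (inj₂ d) → ∨-inr {T f} (subst (λ x → X x ≡ true) (sym (sing-elim {e = e} d)) eq)
        ; spans = λ { (here refl) _ → R.coarse (merged-edge Fo e n) ; (there p) → R.spans p }
        ; coarse = λ r → R.coarse (merged-resp Fo e n r) }
  ... | true | yes r = let module R = Grown (grow X Fo es) in record
        { forest = R.forest ; above = R.above ; below = R.below
        ; spans = λ { (here refl) _ → R.coarse r ; (there p) → R.spans p } ; coarse = R.coarse }
  ... | false | _ = let module R = Grown (grow X Fo es) in record
        { forest = R.forest ; above = R.above ; below = R.below
        ; spans = λ { (here refl) q → ⊥-elim (t≢f q eq) ; (there p) → R.spans p } ; coarse = R.coarse }

  record Span (X : ESet m) : Set where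
    field
      T      : ESet m
      rep    : Fin (nV G) → Fin (nV G)
      forest : Forest T rep
      T⊑X    : T ⊑ X
      spans  : ∀ e → X e ≡ true → rep (src G e) ≡ rep (tgt G e)
    open Forest forest public

    rep-conn : ∀ {u v} → rep u ≡ rep v → Conn G T u v
    rep-conn {u} {v} p = conn-trans G (subst (Conn G T u) p (toRep u)) (conn-sym G (toRep v))

    conn-rep : ∀ {u v} → Conn G X u v → rep u ≡ rep v
    conn-rep = conn-const G rep spans

    inc-rep : ∀ {e x y} → X e ≡ true → Incident G e x → Incident G e y → rep x ≡ rep y
    inc-rep p i j = conn-rep (conn-inc G p i j)

  abstract
    span : ∀ X → Span X
    span X = let module R = Grown (grow X emptyForest (allFin m)) in record
      { forest = R.forest ; T⊑X = λ e p → R.below e p ; spans = λ e → R.spans (∈-allFin e) }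

  abstract
    Conn? : ∀ X u v → Dec (Conn G X u v)
    Conn? X u v = map′ (λ p → conn-mono G T⊑X (rep-conn p)) conn-rep (rep u ≟ rep v)
      where open Span (span X)

  abstract
    -- The growth starts from a spanning forest of `T₀`. Since `T₀` is acyclic this forest is all of
    -- `T₀`: a missing edge would close a cycle inside `T₀`.
    span-over : ∀ X T₀ → T₀ ⊑ X → (∀ Z → Even G Z → Z ⊑ T₀ → ¬ NE Z) → Σ (Span X) λ S → T₀ ⊑ Span.T S
    span-over X T₀ s ac = record
        { forest = R.forest
        ; T⊑X = λ e p → case ∨-elim {S₀.T e} (R.below e p) of λ where
            (inj₁ a) → s e (S₀.T⊑X e a)
            (inj₂ b) → b
        ; spans = λ e → R.spans (∈-allFin e) } , λ e p → R.above e (all₀ e p)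
      where
      module S₀ = Span (span T₀)
      module R = Grown (grow X S₀.forest (allFin m))
      all₀ : T₀ ⊑ S₀.T
      all₀ e p = ≢false λ n → case close G {S₀.T} e n (joins-self G e) (S₀.rep-conn (sym (S₀.spans e p))) of
        λ (C , c , sub , _) → let cy = IsCycle→Cyc G c in
          ac (lookup C) (Cyc.even cy) (λ f q → case ∨-elim {S₀.T f} (sub f q) of λ where
            (inj₁ a) → S₀.T⊑X f a
            (inj₂ b) → subst (λ x → T₀ x ≡ true) (sym (sing-elim {e = e} b)) p) (Cyc.ne cy)

  -- Otherwise the component of w would be a cut meeting Z in d only.
  abstract
    even-conn : ∀ {Z} → Even G Z → ∀ {d u w} → Z d ≡ true → Joins G d u w → Conn G (Z ⊖ sing d) w u
    even-conn {Z} ev {d} {u} {w} zd j with Conn? (Z ⊖ sing d) w u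
    ... | yes c = c
    ... | no n = ⊥-elim (t≢f (xsum-one d
        (∧-in zd (trans (δ-joins G U j) (cong₂ _xor_ (dec-false (rep u ≟ rep w) (λ r → n (conn-mono G T⊑X (rep-conn (sym r))))) (dec-true (rep w ≟ rep w) refl))))
        others) (ev U))
      where
      open Span (span (Z ⊖ sing d))
      U : ESet (nV G)
      U v = does (rep v ≟ rep w)
      others : ∀ f → f ≢ d → Z f ∧ δ G U f ≡ false
      others f q with Z f in eq
      ... | false = refl
      ... | true = eq-xor (cong (λ x → does (x ≟ rep w)) (spans f (⊖-in {X = Z} {sing d} eq (sing-ne q))))

  abstract
    cycle-through : ∀ {Z} → Even G Z → ∀ {d} → Z d ≡ true →
      ∃[ C ] (IsCycle G C × lookup C ⊑ Z × lookup C d ≡ true)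
    cycle-through {Z} ev {d} zd with close G {Z ⊖ sing d} d (∧-f₂ {Z d} (cong not (sing-self d))) (joins-self G d)
                                       (even-conn ev zd (joins-self G d))
    ... | C , c , s , p = C , c , (λ f q → case ∨-elim {(Z ⊖ sing d) f} (s f q) of λ where
            (inj₁ a) → ∧-fst a
            (inj₂ b) → subst (λ x → Z x ≡ true) (sym (sing-elim {e = d} b)) zd) , p

  abstract
    cyc-through : ∀ {Z} → Even G Z → ∀ {d} → Z d ≡ true → ∃[ C ] (Cyc G C × C ⊑ Z × C d ≡ true)
    cyc-through ev zd = let (C , c , s , p) = cycle-through ev zd in lookup C , IsCycle→Cyc G c , s , p

  -- A closed walk found through one edge of `X` is itself a minimal even set, hence all of `X`.
  Cyc→IsCycle : ∀ {X} → Cyc G (lookup X) → IsCycle G X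
  Cyc→IsCycle {X} c with cycle-through (Cyc.even c) (proj₂ (Cyc.ne c))
  ... | C , c' , s , _ = subst (IsCycle G) (lookup-ext (cyc-eq G (IsCycle→Cyc G c') c s)) c'

  Cyc→IsCycle′ : ∀ {Z} → Cyc G Z → IsCycle G (tabulate Z)
  Cyc→IsCycle′ {Z} c = Cyc→IsCycle (cyc-resp G (λ e → sym (lookup∘tabulate Z e)) c)

  abstract
    -- The return path might at first omit edges of `C`; together with `d` it is a nonempty even
    -- subset, so minimality of `C` leaves none out.
    cyc-open : ∀ {C} → Cyc G C → ∀ {d u w} → C d ≡ true → Joins G d u w →
               Σ (Walk G w u) λ W → IsPath G W × wset G W ≗ C ⊖ sing d
    cyc-open {C} c {d} {u} {w} cd j with conn-path G (even-conn (Cyc.even c) cd j)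
    ... | W , uq , s = W , uq , ⊑-antisym s back
      where
      d∉ : ∀ {f} → f ∈ₗ edges G W → d ≢ f
      d∉ p refl = t≢f (s d (memb-in G p)) (∧-f₂ {C d} (cong not (sing-self d)))
      Y : ESet m
      Y = wset G (cons d j W)
      C⊑Y : C ⊑ Y
      C⊑Y = Cyc.min c Y
        (λ f p → case ∨-elim {sing d f} p of λ where
          (inj₁ a) → subst (λ x → C x ≡ true) (sym (sing-elim {e = d} a)) cd
          (inj₂ b) → ∧-fst (s f b))
        (λ U → trans (bd-walk G (cons d j W) (All.tabulate d∉ ∷ path-edges G W uq) U) (xor-same (U u)))
        (d , ∨-inl (sing-self d))
      back : C ⊖ sing d ⊑ wset G W
      back f p with ∨-elim {sing d f} (C⊑Y f (∧-fst p))
      ... | inj₁ a = ⊥-elim (t≢f a (⊖-snd {X = C} {sing d} p))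
      ... | inj₂ b = b

  -- Cutting and reversing paths

  record SplitAt {u v : Fin (nV G)} (W : Walk G u v) (y : Fin (nV G)) : Set where
    field
      W₁   : Walk G u y
      W₂   : Walk G y v
      p₁   : IsPath G W₁
      p₂   : IsPath G W₂
      meet : ∀ {x} → x ∈ₗ verts G W₁ → x ∈ₗ verts G W₂ → x ≡ y
      un   : wset G W ≗ wset G W₁ ⊔ wset G W₂
      v₁   : ∀ {x} → x ∈ₗ verts G W₁ → x ∈ₗ verts G W
      v₂   : ∀ {x} → x ∈ₗ verts G W₂ → x ∈ₗ verts G W

  cut-at : ∀ {u v y} (W : Walk G u v) → IsPath G W → y ∈ₗ verts G W → SplitAt W y
  cut-at (nil v) uq (here refl) = record
    { W₁ = nil v ; W₂ = nil v ; p₁ = uq ; p₂ = uq ; meet = λ { (here p) _ → p } ; un = λ _ → refl ; v₁ = id ; v₂ = id }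
  cut-at {u} (cons e j W) uq (here refl) = record
    { W₁ = nil u ; W₂ = cons e j W ; p₁ = [] ∷ [] ; p₂ = uq ; meet = λ { (here p) _ → p }
    ; un = λ _ → refl ; v₁ = λ { (here p) → here p } ; v₂ = id }
  cut-at {u} (cons e j W) (n ∷ uq) (there p) = let module R = SplitAt (cut-at W uq p) in record
    { W₁ = cons e j R.W₁ ; W₂ = R.W₂
    ; p₁ = All.tabulate (λ q → All.lookup n (R.v₁ q)) ∷ R.p₁ ; p₂ = R.p₂
    ; meet = λ { (here refl) q → ⊥-elim (All.lookup n (R.v₂ q) refl) ; (there q) r → R.meet q r }
    ; un = λ f → trans (cong (sing e f ∨_) (R.un f)) (sym (∨-assoc (sing e f) _ _))
    ; v₁ = λ { (here q) → here q ; (there q) → there (R.v₁ q) } ; v₂ = λ q → there (R.v₂ q) }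

  snoc : ∀ {u v w} → Walk G u v → (e : Fin m) → Joins G e v w → Walk G u w
  snoc (nil v) e j = cons e j (nil _)
  snoc (cons f k W) e j = cons f k (snoc W e j)

  rev : ∀ {u v} → Walk G u v → Walk G v u
  rev (nil v) = nil v
  rev (cons e j W) = snoc (rev W) e (joins-sym G j)

  snoc-verts : ∀ {u v w} (W : Walk G u v) e (j : Joins G e v w) {x} →
               x ∈ₗ verts G (snoc W e j) → x ∈ₗ verts G W ⊎ x ≡ w
  snoc-verts (nil v) e j (here p) = inj₁ (here p)
  snoc-verts (nil v) e j (there (here p)) = inj₂ p
  snoc-verts (cons f k W) e j (here p) = inj₁ (here p)
  snoc-verts (cons f k W) e j (there p) = Sum.map₁ there (snoc-verts W e j p)

  snoc-wset : ∀ {u v w} (W : Walk G u v) e (j : Joins G e v w) → wset G (snoc W e j) ≗ wset G W ⊔ sing e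
  snoc-wset (nil v) e j f = ∨-identityʳ _
  snoc-wset (cons g k W) e j f = trans (cong (sing g f ∨_) (snoc-wset W e j f))
    (sym (∨-assoc (sing g f) _ _))

  snoc-path : ∀ {u v w} (W : Walk G u v) e (j : Joins G e v w) → IsPath G W → ¬ w ∈ₗ verts G W → IsPath G (snoc W e j)
  snoc-path (nil v) e j uq n = ((λ { refl → n (here refl) }) ∷ []) ∷ ([] ∷ [])
  snoc-path (cons f k W) e j (a ∷ uq) n =
    All.tabulate (λ p → case snoc-verts W e j p of λ where
      (inj₁ q) → All.lookup a q
      (inj₂ refl) → λ { refl → n (here refl) }) ∷ snoc-path W e j uq (n ∘ there)

  rev-verts : ∀ {u v} (W : Walk G u v) {x} → x ∈ₗ verts G (rev W) → x ∈ₗ verts G W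
  rev-verts (nil v) p = p
  rev-verts (cons e j W) p with snoc-verts (rev W) e (joins-sym G j) p
  ... | inj₁ q = there (rev-verts W q)
  ... | inj₂ refl = here refl

  rev-path : ∀ {u v} (W : Walk G u v) → IsPath G W → IsPath G (rev W)
  rev-path (nil v) p = p
  rev-path (cons e j W) (n ∷ uq) = snoc-path (rev W) e (joins-sym G j) (rev-path W uq)
    (λ p → All.lookup n (rev-verts W p) refl)

  rev-wset : ∀ {u v} (W : Walk G u v) → wset G (rev W) ≗ wset G W
  rev-wset (nil v) e = refl
  rev-wset (cons e j W) f = trans (snoc-wset (rev W) e (joins-sym G j) f)
    (trans (cong (_∨ sing e f) (rev-wset W f)) (∨-comm _ (sing e f)))

  record Hit (U : ESet (nV G)) {u v : Fin (nV G)} (W : Walk G u v) : Set where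
    field
      y     : Fin (nV G)
      W'    : Walk G u y
      Uy    : U y ≡ true
      clean : ∀ {x} → x ∈ₗ verts G W' → U x ≡ true → x ≡ y
      sub   : ∀ {e} → e ∈ₗ edges G W' → e ∈ₗ edges G W
      vsub  : ∀ {x} → x ∈ₗ verts G W' → x ∈ₗ verts G W
      path  : IsPath G W → IsPath G W'

  hit : ∀ U {u v} (W : Walk G u v) → U v ≡ true → Hit U W
  hit U (nil v) p = record { W' = nil v ; Uy = p ; clean = λ { (here q) _ → q } ; sub = id ; vsub = id ; path = id }
  hit U {u} (cons e j W) p with U u in eq
  ... | true = record { W' = nil u ; Uy = eq ; clean = λ { (here q) _ → q } ; sub = λ () ; vsub = λ { (here q) → here q } ; path = λ _ → [] ∷ [] }
  ... | false = let module R = Hit (hit U W p) in record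
    { W' = cons e j R.W' ; Uy = R.Uy
    ; clean = λ { (here refl) q → ⊥-elim (t≢f q eq) ; (there q) r → R.clean q r }
    ; sub = λ { (here q) → here q ; (there q) → there (R.sub q) }
    ; vsub = λ { (here q) → here q ; (there q) → there (R.vsub q) }
    ; path = λ { (n ∷ uq) → All.tabulate (λ q → All.lookup n (R.vsub q)) ∷ R.path uq } }

  vert-cases : ∀ {u v} (W : Walk G u v) → ∀ {x} → x ∈ₗ verts G W → x ≡ u ⊎ InV G (wset G W) x
  vert-cases (nil v) (here p) = inj₁ p
  vert-cases (cons e j W) (here p) = inj₁ p
  vert-cases (cons e j W) (there p) with vert-cases W p
  ... | inj₁ refl = inj₂ (e , ∨-inl (sing-self e) , joins-inc₂ G j)
  ... | inj₂ (f , q , i) = inj₂ (f , ∨-inr {sing e f} q , i)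

  vert-InV : ∀ {u v} (W : Walk G u v) → u ≢ v → ∀ {x} → x ∈ₗ verts G W → InV G (wset G W) x
  vert-InV (nil v) n p = ⊥-elim (n refl)
  vert-InV W@(cons e j _) n p with vert-cases W p
  ... | inj₁ refl = e , ∨-inl (sing-self e) , joins-inc G j
  ... | inj₂ q = q

module _ {m : ℕ} (G : Graph m) where

  record CycSplit (C : ESet m) (x y : Fin (nV G)) : Set where
    field
      P₁ P₂ : Walk G x y
      p₁    : IsPath G P₁
      p₂    : IsPath G P₂
      meet  : ∀ {z} → z ∈ₗ verts G P₁ → z ∈ₗ verts G P₂ → z ≡ x ⊎ z ≡ y
      un    : C ≗ wset G P₁ ⊔ wset G P₂
      disj  : ∀ e → wset G P₁ e ≡ true → wset G P₂ e ≡ false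

  abstract
    -- The cycle is opened at an edge incident with `x` and the remaining path is cut at `y`; the
    -- second arc is read backwards.
    cyc-split : ∀ {C} → Cyc G C → ∀ {x y} → x ≢ y → InV G C x → InV G C y → CycSplit C x y
    cyc-split {C} c {x} {y} x≢y (d , cd , (w , j)) (f , cf , iy) with cyc-open G c cd j
    ... | W , uq , W≗ = record
      { P₁ = cons d j W₁ ; P₂ = rev G W₂
      ; p₁ = All.tabulate (λ { q refl → x∉W₁ q }) ∷ p₁
      ; p₂ = rev-path G W₂ p₂
      ; meet = λ { (here refl) q → inj₁ refl ; (there q) r → inj₂ (meet q (rev-verts G W₂ r)) }
      ; un = λ g → trans (C≗ g) (trans (cong (sing d g ∨_) (un g)) (trans (sym (∨-assoc (sing d g) _ _))
               (cong ((sing d g ∨ wset G W₁ g) ∨_) (sym (rev-wset G W₂ g)))))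
      ; disj = λ g q → trans (rev-wset G W₂ g) (≢true λ r → case ∨-elim {sing d g} q of λ where
          (inj₁ a) → t≢f a (⊖-snd {X = C} {sing d} (trans (sym (W≗ g)) (trans (un g) (∨-inr {wset G W₁ g} r))))
          -- An edge in both halves of the path would have both ends at `y`, and a path has no
          -- loops.
          (inj₂ b) → path-noloop G W₁ p₁ (memb-out G b)
            (trans (meet (edge-verts G W₁ (memb-out G b) (inc-src G g)) (edge-verts G W₂ (memb-out G r) (inc-src G g)))
              (sym (meet (edge-verts G W₁ (memb-out G b) (inc-tgt G g)) (edge-verts G W₂ (memb-out G r) (inc-tgt G g)))))) }
      where
      C≗ : C ≗ sing d ⊔ wset G W
      C≗ g = true-iff
        (λ cg → case bool-cases (sing d g) of λ where
          (inj₁ a) → ∨-inl a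
          (inj₂ b) → ∨-inr {sing d g} (trans (W≗ g) (⊖-in {X = C} {sing d} cg b)))
        (λ r → case ∨-elim {sing d g} r of λ where
          (inj₁ a) → subst (λ z → C z ≡ true) (sym (sing-elim {e = d} a)) cd
          (inj₂ b) → ∧-fst (trans (sym (W≗ g)) b))
      y∈ : y ∈ₗ verts G W
      y∈ with ∨-elim {sing d f} (trans (sym (C≗ f)) cf)
      ... | inj₂ b = edge-verts G W (memb-out G b) iy
      ... | inj₁ a with joins-ends G j (subst (λ z → Incident G z y) (sing-elim {e = d} a) iy)
      ... | inj₁ refl = end-in G W
      ... | inj₂ refl = start-in G W
      open SplitAt (cut-at G W uq y∈)
      x∉W₁ : ¬ x ∈ₗ verts G W₁
      x∉W₁ q = x≢y (meet q (end-in G W₂))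

  -- Both paths have the same boundary, so the union is even. Once the first edge of `P₁` is
  -- excluded, the rest of `P₁` meets `P₂` only at `v` and can be peeled off, leaving the path `P₂`.
  two-paths-cyc : ∀ {u v} (P₁ P₂ : Walk G u v) → u ≢ v → IsPath G P₁ → IsPath G P₂ →
    (∀ x → x ∈ₗ verts G P₁ → x ∈ₗ verts G P₂ → x ≡ u ⊎ x ≡ v) →
    (∀ e → wset G P₁ e ≡ true → wset G P₂ e ≡ false) → Cyc G (wset G P₁ ⊔ wset G P₂)
  two-paths-cyc (nil _) P₂ n p₁ p₂ meet disj = ⊥-elim (n refl)
  two-paths-cyc {u} {v} P₁@(cons e j W) P₂ n p₁@(a ∷ uq) p₂ meet disj =
    cyc-by-edge G (wset G P₁ ⊔ wset G P₂) e ev (∨-inl (∨-inl (sing-self e))) h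
    where
    ⊔≗△ : wset G P₁ △ wset G P₂ ≗ wset G P₁ ⊔ wset G P₂
    ⊔≗△ f with wset G P₁ f | disj f
    ... | true | q rewrite q refl = refl
    ... | false | q = refl
    ev : Even G (wset G P₁ ⊔ wset G P₂)
    ev U = trans (sym (bd-cong G ⊔≗△ U)) (trans (bd-△ G (wset G P₁) (wset G P₂) U)
      (eq-xor (trans (bd-walk G P₁ (path-edges G P₁ p₁) U) (sym (bd-walk G P₂ (path-edges G P₂ p₂) U)))))
    h : ∀ Y → Even G Y → Y ⊑ wset G P₁ ⊔ wset G P₂ → Y e ≡ false → ¬ NE Y
    h Y evY s ye = no-even-in-path G P₂ p₂ Y evY (peel G W uq Y (wset G P₂) evY
      (λ f yf → case ∨-elim {wset G P₁ f} (s f yf) of λ where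
        (inj₂ b) → ∨-inr {wset G W f} b
        (inj₁ b) → case ∨-elim {sing e f} b of λ where
          (inj₁ c) → ⊥-elim (t≢f yf (subst (λ z → Y z ≡ false) (sym (sing-elim {e = e} c)) ye))
          (inj₂ c) → ∨-inl c)
      (λ x p i → case meet x (there p) (wset-verts G P₂ i) of λ where
        (inj₁ refl) → ⊥-elim (All.lookup a p refl)
        (inj₂ q) → q))

  ∩≡∅→disj : ∀ {u v u' v'} (P : Walk G u v) (P' : Walk G u' v') → edgeSet G P ∩ edgeSet G P' ≡ ∅ →
             ∀ e → wset G P e ≡ true → wset G P' e ≡ false
  ∩≡∅→disj P P' q e r = ≢true λ s → t≢f
    (∧-in (trans (edgeSet-memb G P e) r) (trans (edgeSet-memb G P' e) s))
    (trans (sym (lookup-∩ G (edgeSet G P) (edgeSet G P') e)) (trans (cong (λ z → lookup z e) q) (lookup-∅ G e)))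

  disj→∩≡∅ : ∀ {u v u' v'} (P : Walk G u v) (P' : Walk G u' v') →
             (∀ e → wset G P e ≡ true → wset G P' e ≡ false) → edgeSet G P ∩ edgeSet G P' ≡ ∅
  disj→∩≡∅ P P' d = lookup-ext λ e → trans (lookup-∩ G (edgeSet G P) (edgeSet G P') e) (trans (≢true λ q →
    t≢f (trans (sym (edgeSet-memb G P' e)) (∧-snd {lookup (edgeSet G P) e} q))
        (d e (trans (sym (edgeSet-memb G P e)) (∧-fst q)))) (sym (lookup-∅ G e)))

  lookup-edgeSet-∪ : ∀ {u v u' v'} (P : Walk G u v) (P' : Walk G u' v') →
    lookup (edgeSet G P ∪ edgeSet G P') ≗ wset G P ⊔ wset G P'
  lookup-edgeSet-∪ P P' e = trans (lookup-∪ G (edgeSet G P) (edgeSet G P') e) (cong₂ _∨_ (edgeSet-memb G P e) (edgeSet-memb G P' e))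

  module ThetaFacts (Th : Theta G) where
    open Theta Th

    w₁ w₂ w₃ c₁₂ c₁₃ c₂₃ θ : ESet m
    w₁ = wset G P₁
    w₂ = wset G P₂
    w₃ = wset G P₃
    c₁₂ = w₁ ⊔ w₂
    c₁₃ = w₁ ⊔ w₃
    c₂₃ = w₂ ⊔ w₃
    θ = w₁ ⊔ (w₂ ⊔ w₃)

    cyc-c₁₂ : Cyc G c₁₂
    cyc-c₁₂ = two-paths-cyc P₁ P₂ u≢v path₁ path₂ int₁₂ (∩≡∅→disj P₁ P₂ edisj₁₂)

    cyc-c₁₃ : Cyc G c₁₃
    cyc-c₁₃ = two-paths-cyc P₁ P₃ u≢v path₁ path₃ int₁₃ (∩≡∅→disj P₁ P₃ edisj₁₃)

    cyc-c₂₃ : Cyc G c₂₃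
    cyc-c₂₃ = two-paths-cyc P₂ P₃ u≢v path₂ path₃ int₂₃ (∩≡∅→disj P₂ P₃ edisj₂₃)

    lookup-c₁₂ : lookup cyc₁₂ ≗ c₁₂
    lookup-c₁₂ = lookup-edgeSet-∪ P₁ P₂

    lookup-c₁₃ : lookup cyc₁₃ ≗ c₁₃
    lookup-c₁₃ = lookup-edgeSet-∪ P₁ P₃

    lookup-c₂₃ : lookup cyc₂₃ ≗ c₂₃
    lookup-c₂₃ = lookup-edgeSet-∪ P₂ P₃

    lookup-θ : lookup thetaEdges ≗ θ
    lookup-θ e = trans (lookup-∪ G (edgeSet G P₁) (edgeSet G P₂ ∪ edgeSet G P₃) e) (cong₂ _∨_ (edgeSet-memb G P₁ e) (lookup-edgeSet-∪ P₂ P₃ e))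

    disj₁₂ : ∀ e → w₁ e ≡ true → w₂ e ≡ false
    disj₁₂ = ∩≡∅→disj P₁ P₂ edisj₁₂

    disj₁₃ : ∀ e → w₁ e ≡ true → w₃ e ≡ false
    disj₁₃ = ∩≡∅→disj P₁ P₃ edisj₁₃

    disj₂₃ : ∀ e → w₂ e ≡ true → w₃ e ≡ false
    disj₂₃ = ∩≡∅→disj P₂ P₃ edisj₂₃

    ne-w : ∀ {u v} → u ≢ v → (P : Walk G u v) → NE (wset G P)
    ne-w n (nil _) = ⊥-elim (n refl)
    ne-w n (cons e j P) = e , ∨-inl (sing-self e)

    c₂₃≗ : c₂₃ ≗ c₁₂ △ c₁₃
    c₂₃≗ e with w₁ e | w₂ e | w₃ e | disj₁₂ e | disj₁₃ e | disj₂₃ e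
    ... | true | b | c | p | q | r rewrite p refl | q refl = refl
    ... | false | true | c | p | q | r rewrite r refl = refl
    ... | false | false | c | p | q | r = refl

    private
      -- Without the first edges of `P₁` and `P₂` the theta is a tree: two paths hanging at `v` from
      -- `P₃`, peeled off in turn.
      none-left : ∀ {e₁ e₂ x y} (j₁ : Joins G e₁ u x) (j₂ : Joins G e₂ u y) (W₁ : Walk G x v) (W₂ : Walk G y v) →
        P₁ ≡ cons e₁ j₁ W₁ → P₂ ≡ cons e₂ j₂ W₂ →
        ∀ Z → Even G Z → Z ⊑ θ → Z e₁ ≡ false → Z e₂ ≡ false → ¬ NE Z
      none-left {e₁} {e₂} j₁ j₂ W₁ W₂ refl refl Z ev s z₁ z₂ =
        no-even-in-path G P₃ path₃ Z ev (peel G W₂ uq₂ Z w₃ ev s₂ (λ x p i → case int₂₃ x (there p) (wset-verts G P₃ i) of λ where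
            (inj₁ refl) → ⊥-elim (All.lookup a₂ p refl)
            (inj₂ q) → q))
        where
        a₁ : All (u ≢_) (verts G W₁)
        a₁ = case path₁ of λ { (a ∷ _) → a }
        a₂ : All (u ≢_) (verts G W₂)
        a₂ = case path₂ of λ { (a ∷ _) → a }
        uq₁ : IsPath G W₁
        uq₁ = case path₁ of λ { (_ ∷ p) → p }
        uq₂ : IsPath G W₂
        uq₂ = case path₂ of λ { (_ ∷ p) → p }
        s₁ : Z ⊑ w₂ ⊔ w₃
        s₁ = peel G W₁ uq₁ Z (w₂ ⊔ w₃) ev
          (λ f zf → case ∨-elim {w₁ f} (s f zf) of λ where
            (inj₂ b) → ∨-inr {wset G W₁ f} b
            (inj₁ b) → case ∨-elim {sing e₁ f} b of λ where
              (inj₁ c) → ⊥-elim (t≢f zf (subst (λ z → Z z ≡ false) (sym (sing-elim {e = e₁} c)) z₁))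
              (inj₂ c) → ∨-inl c)
          (λ { x p (f , q , i) → case ∨-elim {w₂ f} q of λ where
            (inj₁ b) → case int₁₂ x (there p) (wset-verts G P₂ (f , b , i)) of λ where
              (inj₁ refl) → ⊥-elim (All.lookup a₁ p refl)
              (inj₂ r) → r
            (inj₂ b) → case int₁₃ x (there p) (wset-verts G P₃ (f , b , i)) of λ where
              (inj₁ refl) → ⊥-elim (All.lookup a₁ p refl)
              (inj₂ r) → r })
        s₂ : Z ⊑ wset G W₂ ⊔ w₃
        s₂ f zf with ∨-elim {w₂ f} (s₁ f zf)
        ... | inj₂ b = ∨-inr {wset G W₂ f} b
        ... | inj₁ b with ∨-elim {sing e₂ f} b
        ... | inj₁ c = ⊥-elim (t≢f zf (subst (λ z → Z z ≡ false) (sym (sing-elim {e = e₂} c)) z₂))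
        ... | inj₂ c = ∨-inl c

    -- The cycle space of a theta has dimension two, hence four elements.
    data EvenKind (Z : ESet m) : Set where
      is-none : ¬ NE Z → EvenKind Z
      is₁₂ : Z ≗ c₁₂ → EvenKind Z
      is₁₃ : Z ≗ c₁₃ → EvenKind Z
      is₂₃ : Z ≗ c₂₃ → EvenKind Z

    -- Membership of the first edges of `P₁` and `P₂` selects one of the four sets; adding it to `Z`
    -- clears both edges, and `none-left` applies to the sum.
    theta-even : ∀ Z → Even G Z → Z ⊑ θ → EvenKind Z
    theta-even Z ev s = go P₁ P₂ refl refl
      where
      ⊑θ₁₂ : c₁₂ ⊑ θ
      ⊑θ₁₂ e p with ∨-elim {w₁ e} p
      ... | inj₁ a = ∨-inl a
      ... | inj₂ b = ∨-inr {w₁ e} (∨-inl b)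
      ⊑θ₁₃ : c₁₃ ⊑ θ
      ⊑θ₁₃ e p with ∨-elim {w₁ e} p
      ... | inj₁ a = ∨-inl a
      ... | inj₂ b = ∨-inr {w₁ e} (∨-inr {w₂ e} b)
      ⊑θ₂₃ : c₂₃ ⊑ θ
      ⊑θ₂₃ e p = ∨-inr {w₁ e} p
      sub : ∀ {C} → C ⊑ θ → Z △ C ⊑ θ
      sub t e p with xor-elim {Z e} p
      ... | inj₁ (a , _) = s e a
      ... | inj₂ (_ , b) = t e b
      eq : ∀ {C} → ¬ NE (Z △ C) → Z ≗ C
      eq n e = xor-eq (NE-not n e)
      go : (A : Walk G u v) (A' : Walk G u v) → P₁ ≡ A → P₂ ≡ A' → EvenKind Z
      go (nil _) _ _ _ = ⊥-elim (u≢v refl)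
      go (cons _ _ _) (nil _) _ _ = ⊥-elim (u≢v refl)
      go (cons e₁ j₁ W₁) (cons e₂ j₂ W₂) q₁ q₂ with Z e₁ in z₁ | Z e₂ in z₂
      ... | false | false = is-none (none-left j₁ j₂ W₁ W₂ q₁ q₂ Z ev s z₁ z₂)
      ... | true | true = is₁₂ (eq (none-left j₁ j₂ W₁ W₂ q₁ q₂ (Z △ c₁₂) (even-△ G {Z} {c₁₂} ev (Cyc.even cyc-c₁₂)) (sub ⊑θ₁₂)
                            (cong₂ _xor_ z₁ (∨-inl in₁)) (cong₂ _xor_ z₂ (∨-inr {w₁ e₂} in₂))))
        where
        in₁ : w₁ e₁ ≡ true
        in₁ rewrite q₁ = ∨-inl (sing-self e₁)
        in₂ : w₂ e₂ ≡ true
        in₂ rewrite q₂ = ∨-inl (sing-self e₂)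
      ... | true | false = is₁₃ (eq (none-left j₁ j₂ W₁ W₂ q₁ q₂ (Z △ c₁₃) (even-△ G {Z} {c₁₃} ev (Cyc.even cyc-c₁₃)) (sub ⊑θ₁₃)
                            (cong₂ _xor_ z₁ (∨-inl in₁)) (cong₂ _xor_ z₂ (∨-nil (≢true (λ p → t≢f in₂ (disj₁₂ e₂ p))) (disj₂₃ e₂ in₂)))))
        where
        in₁ : w₁ e₁ ≡ true
        in₁ rewrite q₁ = ∨-inl (sing-self e₁)
        in₂ : w₂ e₂ ≡ true
        in₂ rewrite q₂ = ∨-inl (sing-self e₂)
      ... | false | true = is₂₃ (eq (none-left j₁ j₂ W₁ W₂ q₁ q₂ (Z △ c₂₃) (even-△ G {Z} {c₂₃} ev (Cyc.even cyc-c₂₃)) (sub ⊑θ₂₃)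
                            (cong₂ _xor_ z₁ (∨-nil (disj₁₂ e₁ in₁) (disj₁₃ e₁ in₁))) (cong₂ _xor_ z₂ (∨-inl in₂))))
        where
        in₁ : w₁ e₁ ≡ true
        in₁ rewrite q₁ = ∨-inl (sing-self e₁)
        in₂ : w₂ e₂ ≡ true
        in₂ rewrite q₂ = ∨-inl (sing-self e₂)

  -- Ears

  record Ear (C D : ESet m) : Set where
    field
      x y   : Fin (nV G)
      E     : Walk G x y
      path  : IsPath G E
      x≢y   : x ≢ y
      xC    : InV G C x
      yC    : InV G C y
      clean : ∀ {z} → z ∈ₗ verts G E → InV G C z → z ≡ x ⊎ z ≡ y
      sub   : wset G E ⊑ D
      out   : ∀ e → wset G E e ≡ true → C e ≡ false

  ear-sub : ∀ {C D D'} → D ⊑ D' → Ear C D → Ear C D'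
  ear-sub s R = record { E = E ; path = path ; x≢y = x≢y ; xC = xC ; yC = yC ; clean = clean
                       ; sub = ⊑-trans sub s ; out = out }
    where open Ear R

  -- The ear begins with the first edge of `W` off `C` and stops at the next vertex of `C`. Every
  -- edge skipped before that lies in `C`, so the start remains on `C`.
  path-ear : ∀ C {u v} (W : Walk G u v) → IsPath G W → InV G C u → InV G C v →
        ∀ {d} → d ∈ₗ edges G W → C d ≡ false → Ear C (wset G W)
  path-ear C {u} {v} (cons {w = w} e j W) (n ∷ uq) iu iv {d} d∈ cd with C e in eq
  ... | true = ear-sub (λ f p → ∨-inr {sing e f} p) (path-ear C W uq (e , eq , joins-inc₂ G j) iv (d∈' d∈) cd)
    where
    d∈' : d ∈ₗ (e ∷ edges G W) → d ∈ₗ edges G W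
    d∈' (here refl) = ⊥-elim (t≢f eq cd)
    d∈' (there p) = p
  ... | false = record
    { E = cons e j W' ; path = All.tabulate (λ q → All.lookup n (vsub q)) ∷ path uq
    ; x≢y = All.lookup n (vsub (end-in G W'))
    ; xC = iu ; yC = vset-out G Uy
    ; clean = λ { (here p) _ → inj₁ p ; (there p) i → inj₂ (clean p (vset-in G i)) }
    ; sub = λ f p → case ∨-elim {sing e f} p of λ where
        (inj₁ a) → ∨-inl a
        (inj₂ b) → ∨-inr {sing e f} (memb-in G (sub (memb-out G b)))
    ; out = out' }
    where
    open Hit (hit G (vset G C) W (vset-in G iv))
    out' : ∀ f → sing e f ∨ wset G W' f ≡ true → C f ≡ false
    out' f p with ∨-elim {sing e f} p
    ... | inj₁ a = subst (λ z → C z ≡ false) (sym (sing-elim {e = e} a)) eq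
    -- An edge of `C` on this segment would have both ends on `C`, hence both at its last vertex.
    ... | inj₂ b = ≢true λ q → path-noloop G W' (path uq) (memb-out G b)
        (trans (clean (edge-verts G W' (memb-out G b) (inc-src G f)) (vset-in G (f , q , inc-src G f)))
          (sym (clean (edge-verts G W' (memb-out G b) (inc-tgt G f)) (vset-in G (f , q , inc-tgt G f)))))

  abstract
    -- Two common vertices cut `D` into arcs with ends on `C`; an edge of `D` off `C` lies on one of
    -- the arcs and so on an ear.
    cyc-ear : ∀ {C D} → Cyc G C → Cyc G D → ¬ C ≗ D → ∀ {x y} → x ≢ y →
      InV G C x → InV G C y → InV G D x → InV G D y → Ear C D
    cyc-ear {C} {D} c d n {x} {y} x≢y cx cy dx dy = go (∨-elim {wset G P₁ f} (trans (sym (un f)) df))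
      where
      open CycSplit (cyc-split d x≢y dx dy)
      f : Fin m
      f = proj₁ (cyc-diff G c d n)
      df : D f ≡ true
      df = proj₁ (proj₂ (cyc-diff G c d n))
      cf : C f ≡ false
      cf = proj₂ (proj₂ (cyc-diff G c d n))
      go : wset G P₁ f ≡ true ⊎ wset G P₂ f ≡ true → Ear C D
      go (inj₁ p) = ear-sub (λ e q → trans (un e) (∨-inl q)) (path-ear C P₁ p₁ cx cy (memb-out G p) cf)
      go (inj₂ p) = ear-sub (λ e q → trans (un e) (∨-inr {wset G P₁ e} q)) (path-ear C P₂ p₂ cx cy (memb-out G p) cf)

  record EarTheta (C D : ESet m) : Set where
    field
      Th : Theta G
    open ThetaFacts Th public
    field
      C≗ : c₁₂ ≗ C
      w₃⊑D : w₃ ⊑ D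
      w₃∌C : ∀ e → w₃ e ≡ true → C e ≡ false

  abstract
    cyc-ear-theta : ∀ {C D} → Cyc G C → Ear C D → EarTheta C D
    cyc-ear-theta {C} {D} c R = record { Th = Th ; C≗ = λ e → sym (K.un e) ; w₃⊑D = sub ; w₃∌C = out }
      where
      open Ear R
      module K = CycSplit (cyc-split c x≢y xC yC)
      P₁C : wset G K.P₁ ⊑ C
      P₁C e p = trans (K.un e) (∨-inl p)
      P₂C : wset G K.P₂ ⊑ C
      P₂C e p = trans (K.un e) (∨-inr {wset G K.P₁ e} p)
      Th : Theta G
      Th = record
        { u = x ; v = y ; u≢v = x≢y ; P₁ = K.P₁ ; P₂ = K.P₂ ; P₃ = E
        ; path₁ = K.p₁ ; path₂ = K.p₂ ; path₃ = path
        ; int₁₂ = λ _ p q → K.meet p q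
        ; int₁₃ = λ z p q → clean q (InV-mono G P₁C (vert-InV G K.P₁ x≢y p))
        ; int₂₃ = λ z p q → clean q (InV-mono G P₂C (vert-InV G K.P₂ x≢y p))
        ; edisj₁₂ = disj→∩≡∅ K.P₁ K.P₂ K.disj
        ; edisj₁₃ = disj→∩≡∅ K.P₁ E (λ e p → ≢true λ q → t≢f (P₁C e p) (out e q))
        ; edisj₂₃ = disj→∩≡∅ K.P₂ E (λ e p → ≢true λ q → t≢f (P₂C e p) (out e q)) }

  abstract
    ear-theta : ∀ {C D} → Cyc G C → Cyc G D → ¬ C ≗ D → ∀ {x y} → x ≢ y →
      InV G C x → InV G C y → InV G D x → InV G D y → EarTheta C D
    ear-theta c d n x≢y cx cy dx dy = cyc-ear-theta c (cyc-ear c d n x≢y cx cy dx dy)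

  -- Even sets and cycles across an edge bipartition

  -- Off the vertices of `Z ⊓ X` the test set may be changed freely. Making it constant with value
  -- `U s` there removes the contribution of `Z ⊖ X`, and evenness of `Z` gives the rest.
  even-split : ∀ {Z} X s → Even G Z → (∀ x → InV G (Z ⊓ X) x → InV G (Z ⊖ X) x → x ≡ s) → Even G (Z ⊓ X)
  even-split {Z} X s ev h U = trans (bd-U G (Z ⊓ X) {U} {U₁} inX)
      (xor-eq {b = false} (trans (cong (bd G (Z ⊓ X) U₁ xor_) (sym outX))
        (trans (sym (bd-△ G (Z ⊓ X) (Z ⊖ X) U₁)) (trans (bd-cong G un U₁) (ev U₁)))))
    where
    U₁ : ESet (nV G)
    U₁ x = if vset G (Z ⊓ X) x then U x else U s
    inX : ∀ x → InV G (Z ⊓ X) x → U x ≡ U₁ x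
    inX x p rewrite vset-in G p = refl
    outX : bd G (Z ⊖ X) U₁ ≡ false
    outX = bd-const G (Z ⊖ X) U₁ (U s) aux
      where
      aux : ∀ x → InV G (Z ⊖ X) x → U₁ x ≡ U s
      aux x p with InV? G (Z ⊓ X) x
      ... | yes q = cong U (h x q p)
      ... | no _ = refl
    un : (Z ⊓ X) △ (Z ⊖ X) ≗ Z
    un e with Z e | X e
    ... | true | true = refl
    ... | true | false = refl
    ... | false | _ = refl

  abstract
    -- With at most one crossing vertex `even-split` would make `C ⊓ X` a proper nonempty even
    -- subset of `C`.
    cyc-cross : ∀ {C} → Cyc G C → ∀ X {e f} → C e ≡ true → X e ≡ true → C f ≡ true → X f ≡ false →
      ∃[ p ] ∃[ q ] (p ≢ q × InV G (C ⊓ X) p × InV G (C ⊖ X) p × InV G (C ⊓ X) q × InV G (C ⊖ X) q)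
    cyc-cross {C} c X {e} {f} ce xe cf xf with any? (λ p → InV? G (C ⊓ X) p ×-dec InV? G (C ⊖ X) p)
    ... | no n = ⊥-elim (t≢f (∧-snd {C f} (Cyc.min c (C ⊓ X) (λ _ → ∧-fst)
          (even-split X (src G e) (Cyc.even c) (λ x a b → ⊥-elim (n (x , a , b)))) (e , ∧-in ce xe) f cf)) xf)
    ... | yes (p , a , b) with any? (λ q → ¬? (p ≟ q) ×-dec InV? G (C ⊓ X) q ×-dec InV? G (C ⊖ X) q)
    ... | yes (q , r , s , t) = p , q , r , a , b , s , t
    ... | no n = ⊥-elim (t≢f (∧-snd {C f} (Cyc.min c (C ⊓ X) (λ _ → ∧-fst)
          (even-split X p (Cyc.even c) single) (e , ∧-in ce xe) f cf)) xf)
      where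
      single : ∀ x → InV G (C ⊓ X) x → InV G (C ⊖ X) x → x ≡ p
      single x u v with p ≟ x
      ... | yes q = sym q
      ... | no r = ⊥-elim (n (x , r , u , v))

-- Classes of cycles, and cuts in handcuffs

_≟ᶜ_ : (a b : Class) → Dec (a ≡ b)
B ≟ᶜ B = yes refl
B ≟ᶜ L = no λ ()
B ≟ᶜ F = no λ ()
L ≟ᶜ B = no λ ()
L ≟ᶜ L = yes refl
L ≟ᶜ F = no λ ()
F ≟ᶜ B = no λ ()
F ≟ᶜ L = no λ ()
F ≟ᶜ F = yes refl

nonB : ∀ {c} → c ≢ B → c ≡ L ⊎ c ≡ F
nonB {B} n = ⊥-elim (n refl)
nonB {L} n = inj₁ refl
nonB {F} n = inj₂ refl

module _ {m : ℕ} (G : Graph m) where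

  vo→InV : ∀ {X x} → VertexOf G X x → InV G (lookup X) x
  vo→InV (e , p , i) = e , []=⇒lookup p , i

  InV→vo : ∀ {X x} → InV G (lookup X) x → VertexOf G X x
  InV→vo {X} (e , p , i) = e , lookup⇒[]= e X p , i

  InV-tab : ∀ {Z x} → InV G Z x → InV G (lookup (tabulate Z)) x
  InV-tab {Z} = InV-mono G (λ e p → trans (lookup∘tabulate Z e) p)

  tab-InV : ∀ {Z x} → InV G (lookup (tabulate Z)) x → InV G Z x
  tab-InV {Z} = InV-mono G (λ e p → trans (sym (lookup∘tabulate Z e)) p)

  -- `A ⊖ C` lies in `D` and so touches `A ⊓ C` at `s` at most; hence `A ⊓ C` is even and is empty
  -- or all of `C`.
  cyc-only : ∀ {C D s} → Cyc G C → Cyc G D → (∀ x → InV G C x → InV G D x → x ≡ s) →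
             ∀ A → Cyc G A → A ⊑ C ⊔ D → A ≗ C ⊎ A ≗ D
  cyc-only {C} {D} {s} c d h A a sub with NE? (A ⊓ C)
  ... | yes n = inj₁ λ e → sym (cyc-eq G c a (λ f p → ∧-fst (Cyc.min c (A ⊓ C) (λ g q → ∧-snd {A g} q)
          (even-split G C s (Cyc.even a) (λ x i j → h x (InV-mono G (λ g q → ∧-snd {A g} q) i) (InV-mono G ⊖D j))) n f p)) e)
    where
    ⊖D : A ⊖ C ⊑ D
    ⊖D g q with ∨-elim {C g} (sub g (∧-fst q))
    ... | inj₁ r = ⊥-elim (t≢f r (⊖-snd {X = A} {C} q))
    ... | inj₂ r = r
  ... | no n = inj₂ (cyc-eq G a d (λ e p → case ∨-elim {C e} (sub e p) of λ where
          (inj₁ q) → ⊥-elim (n (e , ∧-in p q))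
          (inj₂ q) → q))

  -- A certificate that `p` is a bridge of `Y₁ ∪ Y₂ ∪ W`: a vertex set whose cut meets the union in
  -- `p` only and that separates `Y₁` from `Y₂`.
  record Bridge (Y₁ Y₂ W : ESet m) (p : Fin m) : Set where
    field
      U    : ESet (nV G)
      cut  : δ G U p ≡ true
      flat : ∀ f → f ≢ p → Y₁ f ≡ true ⊎ Y₂ f ≡ true ⊎ W f ≡ true → δ G U f ≡ false
      on₁  : ∀ x → InV G Y₁ x → U x ≡ true
      on₂  : ∀ x → InV G Y₂ x → U x ≡ false

  -- For the first edge the cut isolates `Y₁` and `u`; for a later edge the first one is absorbed
  -- into `Y₁`. Disjointness is phrased with conclusion `u ≡ v` so that it survives this growth when
  -- the enlarged `Y₁` reaches the last vertex.
  bridge : ∀ {u v} (P : Walk G u v) → IsPath G P → ∀ Y₁ Y₂ →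
    (∀ x → x ∈ₗ verts G P → InV G Y₁ x → x ≡ u) → (∀ x → x ∈ₗ verts G P → InV G Y₂ x → x ≡ v) →
    (∀ x → InV G Y₁ x → InV G Y₂ x → u ≡ v) → ∀ {p} → p ∈ₗ edges G P → Bridge Y₁ Y₂ (wset G P) p
  bridge {u} {v} (cons {w = w} e j W) (n ∷ uq) Y₁ Y₂ a₁ a₂ dis {p} p∈ = go p∈
    where
    u∉ : ∀ {x} → x ∈ₗ verts G W → x ≢ u
    u∉ q refl = All.lookup n q refl
    u≢v : u ≢ v
    u≢v q = u∉ (end-in G W) (sym q)
    U : ESet (nV G)
    U x = vset G Y₁ x ∨ sing u x
    offW : ∀ x → x ∈ₗ verts G W → U x ≡ false
    offW x q = ∨-nil (≢true λ r → u∉ q (a₁ x (there q) (vset-out G r))) (sing-ne (u∉ q))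
    off₂ : ∀ x → InV G Y₂ x → U x ≡ false
    off₂ x q = ∨-nil (≢true λ r → u≢v (dis x (vset-out G r) q)) (sing-ne {e = u} {x} λ { refl → u≢v (a₂ x (here refl) q) })
    on₁ : ∀ x → InV G Y₁ x → U x ≡ true
    on₁ x q = ∨-inl (vset-in G q)
    both : ∀ f {b} → (∀ x → Incident G f x → U x ≡ b) → δ G U f ≡ false
    both f h = eq-xor (trans (h _ (inc-src G f)) (sym (h _ (inc-tgt G f))))
    go : p ∈ₗ edges G (cons e j W) → Bridge Y₁ Y₂ (wset G (cons e j W)) p
    go (here refl) = record
      { U = U
      ; cut = trans (δ-joins G U j) (cong₂ _xor_ (∨-inr {vset G Y₁ u} (sing-self u)) (offW w (start-in G W)))
      ; flat = λ { f q (inj₁ r) → both f (λ x i → on₁ x (f , r , i))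
                 ; f q (inj₂ (inj₁ r)) → both f (λ x i → off₂ x (f , r , i))
                 ; f q (inj₂ (inj₂ r)) → case ∨-elim {sing e f} r of λ where
                     (inj₁ s) → ⊥-elim (q (sing-elim {e = e} s))
                     (inj₂ s) → both f (λ x i → offW x (edge-verts G W (memb-out G s) i)) }
      ; on₁ = on₁ ; on₂ = off₂ }
    go (there q) = record { U = R.U ; cut = R.cut ; flat = flat ; on₁ = λ x i → R.on₁ x (InV-mono G {Y₁} {Y₁ ⊔ sing e} (λ _ → ∨-inl) i) ; on₂ = R.on₂ }
      where
      Y' : ESet m
      Y' = Y₁ ⊔ sing e
      inY' : ∀ {x} → InV G Y' x → InV G Y₁ x ⊎ (x ≡ u ⊎ x ≡ w)
      inY' (f , r , i) with ∨-elim {Y₁ f} r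
      ... | inj₁ s = inj₁ (f , s , i)
      ... | inj₂ s with sing-elim {e = e} {f} s
      ... | refl = inj₂ (joins-ends G j i)
      b₁ : ∀ x → x ∈ₗ verts G W → InV G Y' x → x ≡ w
      b₁ x r i with inY' i
      ... | inj₁ s = ⊥-elim (u∉ r (a₁ x (there r) s))
      ... | inj₂ (inj₁ s) = ⊥-elim (u∉ r s)
      ... | inj₂ (inj₂ s) = s
      b₃ : ∀ x → InV G Y' x → InV G Y₂ x → w ≡ v
      b₃ x i k with inY' i
      ... | inj₁ s = ⊥-elim (u≢v (dis x s k))
      ... | inj₂ (inj₁ refl) = ⊥-elim (u≢v (a₂ x (here refl) k))
      ... | inj₂ (inj₂ refl) = a₂ x (there (start-in G W)) k
      module R = Bridge (bridge W uq Y' Y₂ b₁ (λ x r → a₂ x (there r)) b₃ q)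
      flat : ∀ f → f ≢ p → Y₁ f ≡ true ⊎ Y₂ f ≡ true ⊎ wset G (cons e j W) f ≡ true → δ G R.U f ≡ false
      flat f r (inj₁ s) = R.flat f r (inj₁ (∨-inl s))
      flat f r (inj₂ (inj₁ s)) = R.flat f r (inj₂ (inj₁ s))
      flat f r (inj₂ (inj₂ s)) with ∨-elim {sing e f} s
      ... | inj₁ t = R.flat f r (inj₁ (∨-inr {Y₁ f} t))
      ... | inj₂ t = R.flat f r (inj₂ (inj₂ t))

-- Dependent sets

module _ {m : ℕ} {G : Graph m} (Q : QuasiBiased G) where

  κ : ESet m → Class
  κ Z = cls Q (tabulate Z)

  κ-cong : ∀ {Z Y} → Z ≗ Y → κ Z ≡ κ Y
  κ-cong p = cong (cls Q) (tabulate-cong p)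

  κ-lookup : ∀ X → κ (lookup X) ≡ cls Q X
  κ-lookup X = cong (cls Q) (tabulate∘lookup X)

  LF-meet : ∀ {C D} → Cyc G C → Cyc G D → κ C ≡ L → κ D ≡ F → ∃[ x ] (InV G C x × InV G D x)
  LF-meet {C} {D} c d p q with LF-cond Q (tabulate C) (tabulate D) (Cyc→IsCycle′ G c) (Cyc→IsCycle′ G d) p q
  ... | x , a , b = x , tab-InV G (vo→InV G a) , tab-InV G (vo→InV G b)

  theta-two : (T : Theta G) → let open ThetaFacts G T in ¬ ExactlyTwoB (κ c₁₂) (κ c₁₃) (κ c₂₃)
  theta-two T x = theta-cond Q T (subst id (cong₂ (λ f z → f z) (cong₂ ExactlyTwoB (eq lookup-c₁₂) (eq lookup-c₁₃)) (eq lookup-c₂₃)) x)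
    where
    open ThetaFacts G T
    eq : ∀ {X : Subset m} {Z} → lookup X ≗ Z → κ Z ≡ cls Q X
    eq {X} p = trans (κ-cong (λ e → sym (p e))) (κ-lookup X)

  -- A cycle of `L` and a cycle of `F` always meet, so a mixed pair is an instance of `depC` and
  -- needs no constructor. Likewise `depC` asks for no classes: a pair with a member in `B` is
  -- already dependent.
  data Dep (X : ESet m) : Set where
    depB : ∀ {C} → Cyc G C → C ⊑ X → κ C ≡ B → Dep X
    depL : ∀ {C D} → Cyc G C → Cyc G D → ¬ C ≗ D → C ⊑ X → D ⊑ X → κ C ≡ L → κ D ≡ L → Dep X
    depC : ∀ {C D x y} → Cyc G C → Cyc G D → ¬ C ≗ D → C ⊑ X → D ⊑ X →
           InV G C x → InV G D y → Conn G X x y → Dep X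

  dep-mono : ∀ {X Y} → X ⊑ Y → Dep X → Dep Y
  dep-mono s (depB c p k) = depB c (⊑-trans p s) k
  dep-mono s (depL c d n p q k l) = depL c d n (⊑-trans p s) (⊑-trans q s) k l
  dep-mono s (depC c d n p q i j cn) = depC c d n (⊑-trans p s) (⊑-trans q s) i j (conn-mono G s cn)

  Dep? : ∀ X → Dec (Dep X)
  Dep? X = map′ to from
    (any-ESet? BC (λ p (a , b , c) → cyc-resp G p a , (λ e q → b e (trans (p e) q)) , trans (κ-cong (λ e → sym (p e))) c)
        (λ C → Cyc? G C ×-dec ⊑? C X ×-dec (κ C ≟ᶜ B))
     ⊎-dec any-ESet? (λ C → ∃ (LC C))
        (λ p (D , a , b , n , c , d , f) → D , cyc-resp G p a , b , (λ q → n (λ e → trans (p e) (q e))) ,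
          (λ e q → c e (trans (p e) q)) , d , back p f)
        (λ C → any-ESet? (LC C)
          (λ p (a , b , n , c , d , f) → a , cyc-resp G p b , (λ q → n (λ e → trans (q e) (sym (p e)))) , c ,
            (λ e q → d e (trans (p e) q)) , forth p f)
          (λ D → Cyc? G C ×-dec Cyc? G D ×-dec ¬? (≗? C D) ×-dec ⊑? C X ×-dec ⊑? D X ×-dec
            (((κ C ≟ᶜ L) ×-dec (κ D ≟ᶜ L)) ⊎-dec
             any? (λ x → any? (λ y → InV? G C x ×-dec InV? G D y ×-dec Conn? G X x y))))))
    where
    BC : ESet m → Set
    BC C = Cyc G C × C ⊑ X × κ C ≡ B
    Link : ESet m → ESet m → Set
    Link C D = (κ C ≡ L × κ D ≡ L) ⊎ ∃[ x ] ∃[ y ] (InV G C x × InV G D y × Conn G X x y)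
    LC : ESet m → ESet m → Set
    LC C D = Cyc G C × Cyc G D × ¬ C ≗ D × C ⊑ X × D ⊑ X × Link C D
    back : ∀ {C C' D} → C ≗ C' → Link C D → Link C' D
    back p (inj₁ (a , b)) = inj₁ (trans (κ-cong (λ e → sym (p e))) a , b)
    back p (inj₂ (x , y , i , j , c)) = inj₂ (x , y , InV-mono G (≗→⊑ p) i , j , c)
    forth : ∀ {C D D'} → D ≗ D' → Link C D → Link C D'
    forth p (inj₁ (a , b)) = inj₁ (a , trans (κ-cong (λ e → sym (p e))) b)
    forth p (inj₂ (x , y , i , j , c)) = inj₂ (x , y , i , InV-mono G (≗→⊑ p) j , c)
    to : ∃ BC ⊎ ∃ (λ C → ∃ (LC C)) → Dep X
    to (inj₁ (C , a , b , c)) = depB a b c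
    to (inj₂ (C , D , a , b , n , p , q , inj₁ (k , l))) = depL a b n p q k l
    to (inj₂ (C , D , a , b , n , p , q , inj₂ (x , y , i , j , c))) = depC a b n p q i j c
    from : Dep X → ∃ BC ⊎ ∃ (λ C → ∃ (LC C))
    from (depB a b c) = inj₁ (_ , a , b , c)
    from (depL a b n p q k l) = inj₂ (_ , _ , a , b , n , p , q , inj₁ (k , l))
    from (depC a b n p q i j c) = inj₂ (_ , _ , a , b , n , p , q , inj₂ (_ , _ , i , j , c))

  record MinDep (X : ESet m) : Set where
    field
      dep : Dep X
      min : ∀ Y → Y ⊑ X → Dep Y → X ⊑ Y

  loop-cyc : ∀ {C} → Cyc G C → ∀ {e} → C e ≡ true → src G e ≡ tgt G e → C ≗ sing e
  loop-cyc {C} c {e} ce l = ⊑-antisym (Cyc.min c (sing e) (λ f p → subst (λ z → C z ≡ true) (sym (sing-elim {e = e} p)) ce)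
      (λ U → xsum-zero (λ f → aux U f)) (e , sing-self e))
      (λ f p → subst (λ z → C z ≡ true) (sym (sing-elim {e = e} p)) ce)
    where
    aux : ∀ U f → sing e f ∧ δ G U f ≡ false
    aux U f with f ≟ e
    ... | yes refl = eq-xor (cong U l)
    ... | no _ = refl

  private
    module Build (X : ESet m) (noB : ∀ C → Cyc G C → C ⊑ X → κ C ≢ B) where

      noB' : ∀ {C} → Cyc G C → C ⊑ X → cls Q (tabulate C) ≢ B
      noB' {C} c s = noB C c s

      InC : ESet m → ESet m → Set
      InC C D = (κ C ≡ L × κ D ≡ L) ⊎ ∃[ x ] ∃[ y ] (InV G C x × InV G D y × Conn G X x y)

      ∪-sub : ∀ {C D} → C ⊑ X → D ⊑ X → ∀ e → lookup (tabulate C ∪ tabulate D) e ≡ true → X e ≡ true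
      ∪-sub {C} {D} s t e p with ∨-elim {lookup (tabulate C) e} (trans (sym (lookup-∪ G (tabulate C) (tabulate D) e)) p)
      ... | inj₁ q = s e (trans (sym (lookup∘tabulate C e)) q)
      ... | inj₂ q = t e (trans (sym (lookup∘tabulate D e)) q)

      Circ : Set
      Circ = ∃[ Z ] (qbCircuit Q Z × lookup Z ⊑ X)

      via-theta : ∀ {C D} → C ⊑ X → D ⊑ X → EarTheta G C D → Circ
      via-theta s t ET = Theta.thetaEdges Th ,
          inj₂ (inj₁ (Th , refl , nb lookup-c₁₂ cyc-c₁₂ s₁₂ , nb lookup-c₁₃ cyc-c₁₃ s₁₃ , nb lookup-c₂₃ cyc-c₂₃ s₂₃)) ,
          sub
        where
        open EarTheta ET
        s₁₂ : c₁₂ ⊑ X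
        s₁₂ e p = s e (trans (sym (C≗ e)) p)
        s₃ : w₃ ⊑ X
        s₃ e p = t e (w₃⊑D e p)
        s₁₃ : c₁₃ ⊑ X
        s₁₃ e p with ∨-elim {w₁ e} p
        ... | inj₁ a = s₁₂ e (∨-inl a)
        ... | inj₂ b = s₃ e b
        s₂₃ : c₂₃ ⊑ X
        s₂₃ e p with ∨-elim {w₂ e} p
        ... | inj₁ a = s₁₂ e (∨-inr {w₁ e} a)
        ... | inj₂ b = s₃ e b
        nb : ∀ {Y : Subset m} {Z} → lookup Y ≗ Z → Cyc G Z → Z ⊑ X → cls Q Y ≢ B
        nb {Y} {Z} p z q r = noB Z z q (trans (κ-cong (λ e → sym (p e))) (trans (κ-lookup Y) r))
        sub : lookup (Theta.thetaEdges Th) ⊑ X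
        sub e p with ∨-elim {w₁ e} (trans (sym (lookup-θ e)) p)
        ... | inj₁ a = s₁₂ e (∨-inl a)
        ... | inj₂ b = s₂₃ e b

      via-tight : ∀ {C D x} → Cyc G C → Cyc G D → ¬ C ≗ D → C ⊑ X → D ⊑ X → InV G C x → InV G D x →
                  (∀ y → InV G C y → InV G D y → x ≡ y) → Circ
      via-tight {C} {D} {x} c d n s t cx dx one = tabulate C ∪ tabulate D ,
              inj₂ (inj₂ (inj₁ (tabulate C , tabulate D , Cyc→IsCycle′ G c , Cyc→IsCycle′ G d , dis ,
                (x , InV→vo G (InV-tab G cx) , InV→vo G (InV-tab G dx) ,
                  λ w a b → sym (one w (tab-InV G (vo→InV G a)) (tab-InV G (vo→InV G b)))) , noB' c s , noB' d t , refl))) ,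
              ∪-sub s t
        where
        no-common : ∀ e → C e ≡ true → ¬ D e ≡ true
        -- Both ends of a common edge are the unique common vertex, so it is a loop and each cycle
        -- equals it.
        no-common e ce de = n (λ f → trans (loop-cyc c ce l f) (sym (loop-cyc d de l f)))
          where
          l : src G e ≡ tgt G e
          l = trans (sym (one _ (e , ce , inc-src G e) (e , de , inc-src G e))) (one _ (e , ce , inc-tgt G e) (e , de , inc-tgt G e))
        dis : tabulate C ∩ tabulate D ≡ ∅
        dis = lookup-ext λ e → trans (lookup-∩ G (tabulate C) (tabulate D) e)
          (trans (cong₂ _∧_ (lookup∘tabulate C e) (lookup∘tabulate D e))
            (trans (≢true λ p → no-common e (∧-fst p) (∧-snd {C e} p)) (sym (lookup-∅ G e))))

      apart : ∀ {C D} → ¬ (∃[ x ] (InV G C x × InV G D x)) → VertexDisjoint G (tabulate C) (tabulate D)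
      apart h (x , a , b) = h (x , tab-InV G (vo→InV G a) , tab-InV G (vo→InV G b))

      via-path : ∀ {C D x y} → Cyc G C → Cyc G D → ¬ (∃[ x ] (InV G C x × InV G D x)) → C ⊑ X → D ⊑ X →
                 κ C ≡ F → κ D ≡ F → InV G C x → InV G D y → (W : Walk G x y) → IsPath G W → wset G W ⊑ X → Circ
      via-path {C} {D} c d ns s t k l i j W uq sub = tabulate C ∪ tabulate D ∪ edgeSet G P ,
          inj₂ (inj₂ (inj₂ (inj₂ (tabulate C , tabulate D , Cyc→IsCycle′ G c , Cyc→IsCycle′ G d , apart ns , k , l ,
            H₂.y , H₁.y , P , rev-path G H₂.W' (H₂.path (rev-path G H₁.W' (H₁.path uq))) ,
            InV→vo G (InV-tab G (vset-out G H₂.Uy)) , InV→vo G (InV-tab G (vset-out G H₁.Uy)) ,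
            (λ z p q → H₂.clean (rev-verts G H₂.W' p) (vset-in G (tab-InV G (vo→InV G q)))) ,
            (λ z p q → H₁.clean (rev-verts G H₁.W' (H₂.vsub (rev-verts G H₂.W' p))) (vset-in G (tab-InV G (vo→InV G q)))) , refl)))) ,
          all-sub
          where
          -- The path is trimmed at both ends: stopped on reaching `D`, then read backwards and
          -- stopped on reaching `C`.
          module H₁ = Hit (hit G (vset G D) W (vset-in G j))
          module H₂ = Hit (hit G (vset G C) (rev G H₁.W') (vset-in G i))
          P : Walk G H₂.y H₁.y
          P = rev G H₂.W'
          P⊑ : wset G P ⊑ X
          P⊑ e p = sub e (memb-in G (H₁.sub (memb-out G (trans (sym (rev-wset G H₁.W' e))
                (memb-in G (H₂.sub (memb-out G (trans (sym (rev-wset G H₂.W' e)) p))))))))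
          all-sub : lookup (tabulate C ∪ tabulate D ∪ edgeSet G P) ⊑ X
          all-sub e p with ∨-elim {lookup (tabulate C) e} (trans (sym (lookup-∪ G (tabulate C) (tabulate D ∪ edgeSet G P) e)) p)
          ... | inj₁ q = s e (trans (sym (lookup∘tabulate C e)) q)
          ... | inj₂ q with ∨-elim {lookup (tabulate D) e} (trans (sym (lookup-∪ G (tabulate D) (edgeSet G P) e)) q)
          ... | inj₁ r = t e (trans (sym (lookup∘tabulate D e)) r)
          ... | inj₂ r = P⊑ e (trans (sym (edgeSet-memb G P e)) r)

      via-disjoint : ∀ {C D} → Cyc G C → Cyc G D → ¬ (∃[ x ] (InV G C x × InV G D x)) → C ⊑ X → D ⊑ X →
                     κ C ≡ L ⊎ κ C ≡ F → κ D ≡ L ⊎ κ D ≡ F → InC C D → Circ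
      via-disjoint c d ns s t (inj₁ kl) (inj₂ kf) _ = ⊥-elim (ns (LF-meet c d kl kf))
      via-disjoint c d ns s t (inj₂ kf) (inj₁ kl) _ = ⊥-elim (ns (let (x , a , b) = LF-meet d c kl kf in x , b , a))
      via-disjoint {C} {D} c d ns s t (inj₁ k) (inj₁ l) _ = tabulate C ∪ tabulate D ,
          inj₂ (inj₂ (inj₂ (inj₁ (tabulate C , tabulate D , Cyc→IsCycle′ G c , Cyc→IsCycle′ G d , apart ns , k , l , refl)))) , ∪-sub s t
      via-disjoint c d ns s t (inj₂ k) (inj₂ l) (inj₁ (k' , _)) = case trans (sym k) k' of λ ()
      via-disjoint c d ns s t (inj₂ k) (inj₂ l) (inj₂ (x , y , i , j , cn)) =
        let (W , uq , sub) = conn-path G cn in via-path c d ns s t k l i j W uq sub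

      -- The number of common vertices decides the type of circuit: two give a theta, one a tight
      -- handcuff, none a pair from `L` or a loose handcuff in `F`.
      two : ∀ {C D} → Cyc G C → Cyc G D → ¬ C ≗ D → C ⊑ X → D ⊑ X → InC C D → Circ
      two {C} {D} c d n s t link = shared (any? (λ x → InV? G C x ×-dec InV? G D x))
        where
        second : ∀ {x} → InV G C x → InV G D x → Dec (∃[ y ] (x ≢ y × InV G C y × InV G D y)) → Circ
        second cx dx (yes (y , x≢y , cy , dy)) = via-theta s t (ear-theta G c d n x≢y cx cy dx dy)
        second {x} cx dx (no ny) = via-tight c d n s t cx dx one
          where
          one : ∀ y → InV G C y → InV G D y → x ≡ y
          one y a b with x ≟ y
          ... | yes p = p
          ... | no p = ⊥-elim (ny (y , p , a , b))
        shared : Dec (∃[ x ] (InV G C x × InV G D x)) → Circ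
        shared (yes (x , cx , dx)) = second cx dx (any? (λ y → ¬? (x ≟ y) ×-dec InV? G C y ×-dec InV? G D y))
        shared (no ns) = via-disjoint c d ns s t (nonB (noB C c s)) (nonB (noB D d t)) link

  dep-circuit : ∀ {X} → Dep X → ∃[ Z ] (qbCircuit Q Z × lookup Z ⊑ X)
  dep-circuit {X} dp with any-ESet? (λ C → Cyc G C × C ⊑ X × κ C ≡ B)
      (λ p (a , b , c) → cyc-resp G p a , (λ e q → b e (trans (p e) q)) , trans (κ-cong (λ e → sym (p e))) c)
      (λ C → Cyc? G C ×-dec ⊑? C X ×-dec (κ C ≟ᶜ B))
  ... | yes (C , c , s , k) = tabulate C , inj₁ (Cyc→IsCycle′ G c , k) , λ e p → s e (trans (sym (lookup∘tabulate C e)) p)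
  ... | no nb with dp
  ...   | depB c s k = ⊥-elim (nb (_ , c , s , k))
  ...   | depL c d n s t k l = Build.two X (λ C c s k → nb (C , c , s , k)) c d n s t (inj₁ (k , l))
  ...   | depC c d n s t i j cn = Build.two X (λ C c s k → nb (C , c , s , k)) c d n s t (inj₂ (_ , _ , i , j , cn))

-- The circuits are exactly the minimal dependent sets

module _ {m : ℕ} {G : Graph m} (Q : QuasiBiased G) where

  minDep-resp : ∀ {X Y} → X ≗ Y → MinDep Q X → MinDep Q Y
  minDep-resp p md = record
    { dep = dep-mono Q (≗→⊑ p) (MinDep.dep md)
    ; min = λ Z s d e q → MinDep.min md Z (λ f r → trans (p f) (s f r)) d e (trans (p e) q) }

  -- With no cycle of `B` available, dependence requires two distinct cycles, and only these two
  -- exist.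
  pair-in : ∀ {C D Z} → (∀ A → Cyc G A → A ⊑ Z → A ≗ C ⊎ A ≗ D) → κ Q C ≢ B → κ Q D ≢ B →
            ∀ {Y} → Y ⊑ Z → Dep Q Y → C ⊑ Y × D ⊑ Y
  pair-in {C} {D} only nc nd {Y} s dp = go dp
    where
    two : ∀ {A A'} → Cyc G A → Cyc G A' → ¬ A ≗ A' → A ⊑ Y → A' ⊑ Y → C ⊑ Y × D ⊑ Y
    two {A} {A'} a a' n p q with only A a (⊑-trans p s) | only A' a' (⊑-trans q s)
    ... | inj₁ x | inj₁ y = ⊥-elim (n (λ e → trans (x e) (sym (y e))))
    ... | inj₂ x | inj₂ y = ⊥-elim (n (λ e → trans (x e) (sym (y e))))
    ... | inj₁ x | inj₂ y = (λ e r → p e (trans (x e) r)) , (λ e r → q e (trans (y e) r))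
    ... | inj₂ x | inj₁ y = (λ e r → q e (trans (y e) r)) , (λ e r → p e (trans (x e) r))
    go : Dep Q Y → C ⊑ Y × D ⊑ Y
    go (depB {A} a p k) with only A a (⊑-trans p s)
    ... | inj₁ x = ⊥-elim (nc (trans (κ-cong Q (λ e → sym (x e))) k))
    ... | inj₂ x = ⊥-elim (nd (trans (κ-cong Q (λ e → sym (x e))) k))
    go (depL a a' n p q _ _) = two a a' n p q
    go (depC a a' n p q _ _ _) = two a a' n p q

  disjoint-≉ : ∀ {C D} → Cyc G C → (∀ e → C e ≡ true → D e ≡ false) → ¬ C ≗ D
  disjoint-≉ c h p = let (e , q) = Cyc.ne c in t≢f (trans (sym (p e)) q) (h e q)

  minDep-B : ∀ {C} → Cyc G C → κ Q C ≡ B → MinDep Q C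
  minDep-B {C} c k = record { dep = depB c ⊑-refl k ; min = λ Y s d → go Y s d }
    where
    one : ∀ {A Y} → Cyc G A → A ⊑ Y → Y ⊑ C → C ⊑ Y
    one {A} a p s e q = p e (Cyc.min c A (⊑-trans p s) (Cyc.even a) (Cyc.ne a) e q)
    go : ∀ Y → Y ⊑ C → Dep Q Y → C ⊑ Y
    go Y s (depB a p _) = one a p s
    go Y s (depL a _ _ p _ _ _) = one a p s
    go Y s (depC a _ _ p _ _ _ _) = one a p s

  -- A dependent subset contains two of the three cycles, and any two of them cover the theta.
  minDep-θ : (T : Theta G) → let open ThetaFacts G T in
    κ Q c₁₂ ≢ B → κ Q c₁₃ ≢ B → κ Q c₂₃ ≢ B → MinDep Q θ
  minDep-θ T n₁₂ n₁₃ n₂₃ = record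
    { dep = depC cyc-c₁₂ cyc-c₁₃ ne (λ e p → case ∨-elim {w₁ e} p of λ where
                (inj₁ a) → ∨-inl a
                (inj₂ b) → ∨-inr {w₁ e} (∨-inl b))
              (λ e p → case ∨-elim {w₁ e} p of λ where
                (inj₁ a) → ∨-inl a
                (inj₂ b) → ∨-inr {w₁ e} (∨-inr {w₂ e} b))
              (vI c₁₂ (λ _ → ∨-inl)) (vI c₁₃ (λ _ → ∨-inl)) stop
    ; min = λ Y s d → go Y s d }
    where
    open Theta T
    open ThetaFacts G T
    vI : ∀ C → w₁ ⊑ C → InV G C u
    vI C s = InV-mono G s (vert-InV G P₁ u≢v (start-in G P₁))
    ne : ¬ c₁₂ ≗ c₁₃
    ne p = let (e , q) = ne-w u≢v P₂ in t≢f (trans (sym (p e)) (∨-inr {w₁ e} q))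
             (∨-nil (≢true (λ r → t≢f q (disj₁₂ e r))) (disj₂₃ e q))
    kind : ∀ {A} → Cyc G A → A ⊑ θ → A ≗ c₁₂ ⊎ A ≗ c₁₃ ⊎ A ≗ c₂₃
    kind {A} a s with theta-even A (Cyc.even a) s
    ... | is-none n = ⊥-elim (n (Cyc.ne a))
    ... | is₁₂ p = inj₁ p
    ... | is₁₃ p = inj₂ (inj₁ p)
    ... | is₂₃ p = inj₂ (inj₂ p)
    cover : ∀ {Y} {i j : ESet m} → (∀ e → θ e ≡ true → i e ≡ true ⊎ j e ≡ true) →
            ∀ {A A'} → A ≗ i → A' ≗ j → A ⊑ Y → A' ⊑ Y → θ ⊑ Y
    cover h p q s t e r with h e r
    ... | inj₁ a = s e (trans (p e) a)
    ... | inj₂ a = t e (trans (q e) a)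
    θ-cases : ∀ e → θ e ≡ true → w₁ e ≡ true ⊎ w₂ e ≡ true ⊎ w₃ e ≡ true
    θ-cases e p with ∨-elim {w₁ e} p
    ... | inj₁ a = inj₁ a
    ... | inj₂ b = inj₂ (∨-elim {w₂ e} b)
    h₁ : ∀ e → θ e ≡ true → c₁₂ e ≡ true ⊎ c₁₃ e ≡ true
    h₁ e p with θ-cases e p
    ... | inj₁ a = inj₁ (∨-inl a)
    ... | inj₂ (inj₁ a) = inj₁ (∨-inr {w₁ e} a)
    ... | inj₂ (inj₂ a) = inj₂ (∨-inr {w₁ e} a)
    h₂ : ∀ e → θ e ≡ true → c₁₂ e ≡ true ⊎ c₂₃ e ≡ true
    h₂ e p with θ-cases e p
    ... | inj₁ a = inj₁ (∨-inl a)
    ... | inj₂ (inj₁ a) = inj₁ (∨-inr {w₁ e} a)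
    ... | inj₂ (inj₂ a) = inj₂ (∨-inr {w₂ e} a)
    h₃ : ∀ e → θ e ≡ true → c₁₃ e ≡ true ⊎ c₂₃ e ≡ true
    h₃ e p with θ-cases e p
    ... | inj₁ a = inj₁ (∨-inl a)
    ... | inj₂ (inj₁ a) = inj₂ (∨-inl a)
    ... | inj₂ (inj₂ a) = inj₁ (∨-inr {w₁ e} a)
    two : ∀ {A A' Y} → Cyc G A → Cyc G A' → ¬ A ≗ A' → A ⊑ Y → A' ⊑ Y → Y ⊑ θ → θ ⊑ Y
    two {A} {A'} {Y} a a' n p q s with kind a (⊑-trans p s) | kind a' (⊑-trans q s)
    ... | inj₁ x | inj₁ y = ⊥-elim (n (λ e → trans (x e) (sym (y e))))
    ... | inj₁ x | inj₂ (inj₁ y) = cover h₁ x y p q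
    ... | inj₁ x | inj₂ (inj₂ y) = cover h₂ x y p q
    ... | inj₂ (inj₁ x) | inj₁ y = cover h₁ y x q p
    ... | inj₂ (inj₁ x) | inj₂ (inj₁ y) = ⊥-elim (n (λ e → trans (x e) (sym (y e))))
    ... | inj₂ (inj₁ x) | inj₂ (inj₂ y) = cover h₃ x y p q
    ... | inj₂ (inj₂ x) | inj₁ y = cover h₂ y x q p
    ... | inj₂ (inj₂ x) | inj₂ (inj₁ y) = cover h₃ y x q p
    ... | inj₂ (inj₂ x) | inj₂ (inj₂ y) = ⊥-elim (n (λ e → trans (x e) (sym (y e))))
    go : ∀ Y → Y ⊑ θ → Dep Q Y → θ ⊑ Y
    go Y s (depB {A} a p k) with kind a (⊑-trans p s)
    ... | inj₁ x = ⊥-elim (n₁₂ (trans (κ-cong Q (λ e → sym (x e))) k))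
    ... | inj₂ (inj₁ x) = ⊥-elim (n₁₃ (trans (κ-cong Q (λ e → sym (x e))) k))
    ... | inj₂ (inj₂ x) = ⊥-elim (n₂₃ (trans (κ-cong Q (λ e → sym (x e))) k))
    go Y s (depL a a' n p q _ _) = two a a' n p q s
    go Y s (depC a a' n p q _ _ _) = two a a' n p q s

  ⊔-lub : ∀ {X Y Z : ESet m} → X ⊑ Z → Y ⊑ Z → X ⊔ Y ⊑ Z
  ⊔-lub {X} s t e p with ∨-elim {X e} p
  ... | inj₁ a = s e a
  ... | inj₂ b = t e b

  ⊑-inl : ∀ {X Y : ESet m} → X ⊑ X ⊔ Y
  ⊑-inl e p = ∨-inl p

  ⊑-inr : ∀ {X Y : ESet m} → Y ⊑ X ⊔ Y
  ⊑-inr {X} e p = ∨-inr {X e} p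

  minDep-tight : ∀ {C D v} → Cyc G C → Cyc G D → (∀ e → C e ≡ true → D e ≡ false) →
    InV G C v → InV G D v → (∀ w → InV G C w → InV G D w → w ≡ v) → κ Q C ≢ B → κ Q D ≢ B → MinDep Q (C ⊔ D)
  minDep-tight {C} {D} c d dis cv dv one nc nd = record
    { dep = depC c d (disjoint-≉ c dis) ⊑-inl (⊑-inr {C}) cv dv stop
    ; min = λ Y s dp → let (p , q) = pair-in (cyc-only G c d one) nc nd s dp in ⊔-lub {C} p q }

  minDep-LL : ∀ {C D} → Cyc G C → Cyc G D → ¬ (∃[ x ] (InV G C x × InV G D x)) →
    κ Q C ≡ L → κ Q D ≡ L → MinDep Q (C ⊔ D)
  minDep-LL {C} {D} c d dis k l = record
    { dep = depL c d ne ⊑-inl (⊑-inr {C}) k l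
    ; min = λ Y s dp → let (p , q) = pair-in (cyc-only G {s = src G (proj₁ (Cyc.ne c))} c d (λ x i j → ⊥-elim (dis (x , i , j)))) (nl k) (nl l) s dp in ⊔-lub {C} p q }
    where
    nl : ∀ {c} → c ≡ L → c ≢ B
    nl refl ()
    ne : ¬ C ≗ D
    ne = disjoint-≉ c (λ e p → ≢true λ q → dis (_ , (e , p , inc-src G e) , (e , q , inc-src G e)))

  -- The only two cycles are `C` and `D`, both in `F`, so dependence can arise only through `depC`;
  -- its connection must use every edge of `P`, each being a bridge between them.
  minDep-FF : ∀ {C D u v} → Cyc G C → Cyc G D → ¬ (∃[ x ] (InV G C x × InV G D x)) → κ Q C ≡ F → κ Q D ≡ F →
    (P : Walk G u v) → IsPath G P → InV G C u → InV G D v →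
    (∀ x → x ∈ₗ verts G P → InV G C x → x ≡ u) → (∀ x → x ∈ₗ verts G P → InV G D x → x ≡ v) →
    MinDep Q (C ⊔ (D ⊔ wset G P))
  minDep-FF {C} {D} {u} {v} c d dis k l P pp cu dv a₁ a₂ = record
    { dep = depC c d ne ⊑-inl (λ e p → ∨-inr {C e} (∨-inl p)) cu dv (conn-mono G (λ e p → ∨-inr {C e} (∨-inr {D e} p)) (conn-walk G P))
    ; min = λ Y s dp → let (p , q) = pair-in only (nf k) (nf l) s dp in
        ⊔-lub {C} p (⊔-lub {D} q (path-in Y s dp)) }
    where
    Z : ESet m
    Z = C ⊔ (D ⊔ wset G P)
    nf : ∀ {c} → c ≡ F → c ≢ B
    nf refl ()
    ne : ¬ C ≗ D
    ne = disjoint-≉ c (λ e p → ≢true λ q → dis (_ , (e , p , inc-src G e) , (e , q , inc-src G e)))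
    br : ∀ {p} → p ∈ₗ edges G P → Bridge G C D (wset G P) p
    br = bridge G P pp C D a₁ a₂ (λ x i j → ⊥-elim (dis (x , i , j)))
    Z-cases : ∀ e → Z e ≡ true → C e ≡ true ⊎ D e ≡ true ⊎ wset G P e ≡ true
    Z-cases e p with ∨-elim {C e} p
    ... | inj₁ a = inj₁ a
    ... | inj₂ b = inj₂ (∨-elim {D e} b)
    offP : ∀ {A} → Even G A → A ⊑ Z → ∀ p → p ∈ₗ edges G P → A p ≡ false
    offP {A} ev s p q = ≢true λ ap → t≢f (xsum-one p (∧-in ap cut) others) (ev U)
      where
      open Bridge (br q)
      others : ∀ f → f ≢ p → A f ∧ δ G U f ≡ false
      others f n with A f in eq
      ... | false = refl
      ... | true = flat f n (Z-cases f (s f eq))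
    only : ∀ A → Cyc G A → A ⊑ Z → A ≗ C ⊎ A ≗ D
    only A a s = cyc-only G {s = u} c d (λ x i j → ⊥-elim (dis (x , i , j))) A a λ e p → case Z-cases e (s e p) of λ where
      (inj₁ q) → ∨-inl q
      (inj₂ (inj₁ q)) → ∨-inr {C e} q
      (inj₂ (inj₂ q)) → ⊥-elim (t≢f p (offP (Cyc.even a) s e (memb-out G q)))
    path-in : ∀ Y → Y ⊑ Z → Dep Q Y → wset G P ⊑ Y
    path-in Y s (depB {A} a p κB) e q with only A a (⊑-trans p s)
    ... | inj₁ x = ⊥-elim (nf k (trans (κ-cong Q (λ e → sym (x e))) κB))
    ... | inj₂ x = ⊥-elim (nf l (trans (κ-cong Q (λ e → sym (x e))) κB))
    path-in Y s (depL {A} a a' n p q kA _) e r with only A a (⊑-trans p s)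
    ... | inj₁ x = case trans (sym k) (trans (κ-cong Q (λ e → sym (x e))) kA) of λ ()
    ... | inj₂ x = case trans (sym l) (trans (κ-cong Q (λ e → sym (x e))) kA) of λ ()
    path-in Y s (depC {A} {A'} {x} {y} a a' n p q ix iy cn) e r = ≢false λ ye → contra ye (only A a (⊑-trans p s)) (only A' a' (⊑-trans q s))
      where
      open Bridge (br (memb-out G r))
      contra : Y e ≡ false → A ≗ C ⊎ A ≗ D → A' ≗ C ⊎ A' ≗ D → ⊥
      contra ye z z' = go z z'
        where
        same : U x ≡ U y
        same = conn-const G U (λ f yf → xor-eq (flat f (λ { refl → t≢f yf ye }) (Z-cases f (s f yf)))) cn
        go : A ≗ C ⊎ A ≗ D → A' ≗ C ⊎ A' ≗ D → ⊥
        go (inj₁ α) (inj₁ β) = n (λ e → trans (α e) (sym (β e)))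
        go (inj₂ α) (inj₂ β) = n (λ e → trans (α e) (sym (β e)))
        go (inj₁ α) (inj₂ β) = t≢f (on₁ x (InV-mono G (≗→⊑ α) ix)) (trans same (on₂ y (InV-mono G (≗→⊑ β) iy)))
        go (inj₂ α) (inj₁ β) = t≢f (on₁ y (InV-mono G (≗→⊑ β) iy)) (trans (sym same) (on₂ x (InV-mono G (≗→⊑ α) ix)))

  circuit→minDep : ∀ {X} → qbCircuit Q X → MinDep Q (lookup X)
  circuit→minDep {X} (inj₁ (c , k)) = minDep-B (IsCycle→Cyc G c) (trans (κ-lookup Q X) k)
  circuit→minDep (inj₂ (inj₁ (T , refl , n₁ , n₂ , n₃))) =
    minDep-resp (λ e → sym (lookup-θ e)) (minDep-θ T (nb lookup-c₁₂ n₁) (nb lookup-c₁₃ n₂) (nb lookup-c₂₃ n₃))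
    where
    open ThetaFacts G T
    nb : ∀ {Y : Subset m} {Z} → lookup Y ≗ Z → cls Q Y ≢ B → κ Q Z ≢ B
    nb {Y} p n q = n (trans (sym (κ-lookup Q Y)) (trans (κ-cong Q p) q))
  circuit→minDep (inj₂ (inj₂ (inj₁ (C , D , c , d , dis , (v , cv , dv , one) , nc , nd , refl)))) =
    minDep-resp (λ e → sym (lookup-∪ G C D e)) (minDep-tight (IsCycle→Cyc G c) (IsCycle→Cyc G d)
      (λ e p → ≢true λ q → t≢f (∧-in p q) (trans (sym (lookup-∩ G C D e)) (trans (cong (λ z → lookup z e) dis) (lookup-∅ G e))))
      (vo→InV G cv) (vo→InV G dv) (λ w i j → one w (InV→vo G i) (InV→vo G j))
      (λ p → nc (trans (sym (κ-lookup Q C)) p)) (λ p → nd (trans (sym (κ-lookup Q D)) p)))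
  circuit→minDep (inj₂ (inj₂ (inj₂ (inj₁ (C , D , c , d , dis , k , l , refl))))) =
    minDep-resp (λ e → sym (lookup-∪ G C D e)) (minDep-LL (IsCycle→Cyc G c) (IsCycle→Cyc G d)
      (λ (x , i , j) → dis (x , InV→vo G i , InV→vo G j)) (trans (κ-lookup Q C) k) (trans (κ-lookup Q D) l))
  circuit→minDep (inj₂ (inj₂ (inj₂ (inj₂ (C , D , c , d , dis , k , l , u , v , P , pp , cu , dv , a₁ , a₂ , refl))))) =
    minDep-resp (λ e → sym (trans (lookup-∪ G C (D ∪ edgeSet G P) e) (cong (lookup C e ∨_) (trans (lookup-∪ G D (edgeSet G P) e) (cong (lookup D e ∨_) (edgeSet-memb G P e))))))
      (minDep-FF (IsCycle→Cyc G c) (IsCycle→Cyc G d)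
      (λ (x , i , j) → dis (x , InV→vo G i , InV→vo G j)) (trans (κ-lookup Q C) k) (trans (κ-lookup Q D) l)
      P pp (vo→InV G cu) (vo→InV G dv) (λ x p i → a₁ x p (InV→vo G i)) (λ x p i → a₂ x p (InV→vo G i)))

  -- The circuit contained in `X` is itself dependent, so minimality makes it equal to `X`.
  minDep→circuit : ∀ {X} → MinDep Q (lookup X) → qbCircuit Q X
  minDep→circuit {X} md = let (Z , z , s) = dep-circuit Q (MinDep.dep md) in
    subst (qbCircuit Q) (lookup-ext (⊑-antisym s (MinDep.min md (lookup Z) s (MinDep.dep (circuit→minDep z))))) z

  indep→ : ∀ {I} → Indep (qbCircuit Q) I → ¬ Dep Q (lookup I)
  indep→ {I} ind d = let (Z , z , s) = dep-circuit Q d in ind Z (λ {x} p → lookup⇒[]= x I (s x ([]=⇒lookup p))) z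

  indep← : ∀ {I} → ¬ Dep Q (lookup I) → Indep (qbCircuit Q) I
  indep← n C s c = n (dep-mono Q (λ e p → []=⇒lookup (s (lookup⇒[]= e C p))) (MinDep.dep (circuit→minDep c)))

-- Exchanging cycles of `B` through a fixed edge

two-B₁₃ : ∀ {c} → ¬ ExactlyTwoB B c B → c ≡ B
two-B₁₃ {B} n = refl
two-B₁₃ {L} n = ⊥-elim (n _)
two-B₁₃ {F} n = ⊥-elim (n _)

two-B₁₂ : ∀ {c} → ¬ ExactlyTwoB B B c → c ≡ B
two-B₁₂ {B} n = refl
two-B₁₂ {L} n = ⊥-elim (n _)
two-B₁₂ {F} n = ⊥-elim (n _)

two-B₂₃ : ∀ {c} → ¬ ExactlyTwoB c B B → c ≡ B
two-B₂₃ {B} n = refl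
two-B₂₃ {L} n = ⊥-elim (n _)
two-B₂₃ {F} n = ⊥-elim (n _)

module _ {m : ℕ} {G : Graph m} (Q : QuasiBiased G) where

  -- Exchanging an ear of C taken from D brings C closer to D, and the third cycle of the theta avoids f.
  reroute-ear : ∀ f {C D} → Cyc G D → C f ≡ true → D f ≡ true →
    (∀ Z → Cyc G Z → Z ⊑ C ⊔ D → Z f ≡ false → κ Q Z ≡ B) → κ Q C ≡ B → EarTheta G C D →
    ∃[ C' ] (Cyc G C' × count (C' ⊖ D) < count (C ⊖ D) × C' f ≡ true × C' ⊑ C ⊔ D × κ Q C' ≡ B)
  reroute-ear f {C} {D} d cf df bal kc ET = go (∨-elim {w₁ f} (trans (C≗ f) cf))
    where
    open EarTheta ET
    w₁C : w₁ ⊑ C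
    w₁C e p = trans (sym (C≗ e)) (∨-inl p)
    w₂C : w₂ ⊑ C
    w₂C e p = trans (sym (C≗ e)) (∨-inr {w₁ e} p)
    w₃f : w₃ f ≡ false
    w₃f = ≢true λ p → t≢f cf (w₃∌C f p)
    κ₁₂ : κ Q c₁₂ ≡ B
    κ₁₂ = trans (κ-cong Q C≗) kc
    in∪ : ∀ {w} → w ⊑ C → w ⊔ w₃ ⊑ C ⊔ D
    in∪ {w} s e p with ∨-elim {w e} p
    ... | inj₁ a = ∨-inl (s e a)
    ... | inj₂ b = ∨-inr {C e} (w₃⊑D e b)
    -- w is the side of C through f, w' the other one
    exchange : ∀ w w' → w ⊑ C → w' ⊑ C → w f ≡ true → (∀ e → w' e ≡ true → w e ≡ false) → Cyc G (w ⊔ w₃) → Cyc G (w' ⊔ w₃) →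
           w' f ≡ false → (κ Q (w' ⊔ w₃) ≡ B → κ Q (w ⊔ w₃) ≡ B) →
           ∃[ C' ] (Cyc G C' × count (C' ⊖ D) < count (C ⊖ D) × C' f ≡ true × C' ⊑ C ⊔ D × κ Q C' ≡ B)
    exchange w w' wC w'C wf dis cw cw' w'f th =
      w ⊔ w₃ , cw , less , ∨-inl wf , in∪ wC , th (bal (w' ⊔ w₃) cw' (in∪ w'C) (∨-nil w'f w₃f))
      where
      missing : ∃[ e ] (w' e ≡ true × D e ≡ false)
      -- If the discarded side lay in `D`, the cycle it forms with the ear would be all of `D`,
      -- although it avoids `f`. The edge found here is what makes the count drop.
      missing = ⋢ λ s → t≢f df (trans (sym (cyc-eq G cw' d (⊔-lub Q {w'} s w₃⊑D) f)) (∨-nil w'f w₃f))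
      less : count ((w ⊔ w₃) ⊖ D) < count (C ⊖ D)
      less = count-< {f = (w ⊔ w₃) ⊖ D} {C ⊖ D} (proj₁ missing)
        (λ g r → case ∨-elim {w g} (∧-fst r) of λ where
          (inj₁ a) → ⊖-in {X = C} {D} (wC g a) (⊖-snd {X = w ⊔ w₃} {D} r)
          (inj₂ b) → ⊥-elim (t≢f (w₃⊑D g b) (⊖-snd {X = w ⊔ w₃} {D} r)))
        (∧-f₁ (∨-nil (dis _ (proj₁ (proj₂ missing))) (≢true λ r → t≢f (w'C _ (proj₁ (proj₂ missing))) (w₃∌C _ r))))
        (⊖-in {X = C} {D} (w'C _ (proj₁ (proj₂ missing))) (proj₂ (proj₂ missing)))
    go : w₁ f ≡ true ⊎ w₂ f ≡ true → _
    go (inj₁ p) = exchange w₁ w₂ w₁C w₂C p (λ e q → ≢true λ r → t≢f q (disj₁₂ e r)) cyc-c₁₃ cyc-c₂₃ (disj₁₂ f p)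
      (λ kB → two-B₁₃ (λ x → theta-two Q Th (subst id (cong₂ (λ a b → ExactlyTwoB a (κ Q c₁₃) b) (sym κ₁₂) (sym kB)) x)))
    go (inj₂ p) = exchange w₂ w₁ w₂C w₁C p disj₁₂ cyc-c₂₃ cyc-c₁₃ (≢true λ r → t≢f p (disj₁₂ f r))
      (λ kB → two-B₁₂ (λ x → theta-two Q Th (subst id (cong₂ (λ a b → ExactlyTwoB a b (κ Q c₂₃)) (sym κ₁₂) (sym kB)) x)))

  reroute-by : ∀ k f {C D} → count (C ⊖ D) < k → Cyc G C → Cyc G D → C f ≡ true → D f ≡ true →
    (∀ Z → Cyc G Z → Z ⊑ C ⊔ D → Z f ≡ false → κ Q Z ≡ B) → κ Q C ≡ B → κ Q D ≡ B
  reroute-by (suc k) f {C} {D} (s≤s lt) c d cf df bal kc = decide (≗? C D)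
    where
    decide : Dec (C ≗ D) → κ Q D ≡ B
    decide (yes p) = trans (sym (κ-cong Q p)) kc
    decide (no n) =
      -- Both cycles contain `f`; were it a loop they would coincide, so its ends are two distinct
      -- common vertices.
      let nl = λ l → n (λ e → trans (loop-cyc Q c cf l e) (sym (loop-cyc Q d df l e)))
          (C' , c' , less , c'f , sub , k') = reroute-ear f d cf df bal kc
            (ear-theta G c d n {src G f} {tgt G f} nl (f , cf , inc-src G f) (f , cf , inc-tgt G f) (f , df , inc-src G f) (f , df , inc-tgt G f))
      in reroute-by k f (≤-trans less lt) c' d c'f df
           (λ Z z s → bal Z z (⊑-trans s (⊔-lub Q {C'} sub (⊑-inr Q {C})))) k'

  -- Both reductions rest on this: it makes membership in `B` independent of the path through a
  -- balanced part, and puts every cycle through exactly one edge of a balancing pair outside `B`.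
  reroute : ∀ f {C D} → Cyc G C → Cyc G D → C f ≡ true → D f ≡ true →
    (∀ Z → Cyc G Z → Z ⊑ C ⊔ D → Z f ≡ false → κ Q Z ≡ B) → κ Q C ≡ B → κ Q D ≡ B
  reroute f = reroute-by _ f ≤-refl

  -- Disjoint pairs and ranks by finite search

  Meet : ESet m → ESet m → Set
  Meet C D = ∃[ x ] (InV G C x × InV G D x)

  meet-sym : ∀ {C D} → Meet C D → Meet D C
  meet-sym (x , a , b) = x , b , a

  record NonDeg (c : Class) : Set where
    field
      C D   : ESet m
      cycC  : Cyc G C
      cycD  : Cyc G D
      κC    : κ Q C ≡ c
      κD    : κ Q D ≡ c
      apart : ¬ Meet C D

  nonDeg→ : ∀ {c} → NonDeg c → NonDegenerate Q c
  nonDeg→ N = tabulate C , tabulate D , Cyc→IsCycle′ G cycC , Cyc→IsCycle′ G cycD , κC , κD ,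
      λ (x , a , b) → apart (x , tab-InV G (vo→InV G a) , tab-InV G (vo→InV G b))
    where open NonDeg N

  -- All conditions are decidable and edge sets are finite, so the negated universal statement
  -- yields an actual disjoint pair.
  ¬deg→ : ∀ {c} → ¬ Degenerate Q c → NonDeg c
  ¬deg→ {c} nd with anySubset? (λ C → anySubset? (λ D → Cyc? G (lookup C) ×-dec Cyc? G (lookup D) ×-dec (cls Q C ≟ᶜ c) ×-dec (cls Q D ≟ᶜ c)
                      ×-dec ¬? (any? (λ x → InV? G (lookup C) x ×-dec InV? G (lookup D) x))))
  ... | yes (C , D , a , b , k , l , n) = record
        { C = lookup C ; D = lookup D ; cycC = a ; cycD = b ; κC = trans (κ-lookup Q C) k ; κD = trans (κ-lookup Q D) l ; apart = n }
  ... | no n = ⊥-elim (nd λ C D c d k l → case any? (λ x → InV? G (lookup C) x ×-dec InV? G (lookup D) x) of λ where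
        (yes (x , a , b)) → x , InV→vo G a , InV→vo G b
        (no q) → ⊥-elim (n (C , D , IsCycle→Cyc G c , IsCycle→Cyc G d , k , l , q)))

  -- `Rank` is a maximum cardinality, so a downward search from `m` finds it; the empty set is
  -- independent and ends the search.
  rank-exists : ∀ X → ∃ (Rank (qbCircuit Q) X)
  rank-exists X = go m (λ J _ → ∣p∣≤n J)
    where
    Good : Subset m → Set
    Good J = lookup J ⊑ lookup X × ¬ Dep Q (lookup J)
    toGood : ∀ {J} → J ⊆ X → Indep (qbCircuit Q) J → Good J
    toGood {J} s i = (λ e p → []=⇒lookup (s (lookup⇒[]= e J p))) , indep→ Q i
    fromGood : ∀ {J} → Good J → J ⊆ X × Indep (qbCircuit Q) J
    fromGood (s , n) = (λ {x} p → lookup⇒[]= x X (s x ([]=⇒lookup p))) , indep← Q n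
    find : ∀ k → Dec (∃[ J ] (Good J × ∣ J ∣ ≡ k))
    find k = anySubset? (λ J → (⊑? (lookup J) (lookup X) ×-dec ¬? (Dep? Q (lookup J))) ×-dec (∣ J ∣ ℕₚ.≟ k))
    done : ∀ k → (∀ J → Good J → ∣ J ∣ ≤ k) → (∃[ J ] (Good J × ∣ J ∣ ≡ k)) → ∃ (Rank (qbCircuit Q) X)
    done k b (J , g , e) = k , (J , proj₁ (fromGood g) , proj₂ (fromGood g) , e) , λ J' s i → b J' (toGood s i)
    empty : Good ∅
    empty = (λ e p → ⊥-elim (t≢f p (lookup-∅ G e))) , λ d → bad (MinDep.dep (circuit→minDep Q (proj₁ (proj₂ (dep-circuit Q d))))) (proj₂ (proj₂ (dep-circuit Q d)))
      where
      none-cyc : ∀ {A Y : ESet m} → Cyc G A → A ⊑ Y → Y ⊑ lookup (∅ {m}) → ⊥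
      none-cyc a s t = let (e , p) = Cyc.ne a in t≢f (t e (s e p)) (lookup-∅ G e)
      bad : ∀ {Y} → Dep Q Y → Y ⊑ lookup (∅ {m}) → ⊥
      bad (depB a s _) t = none-cyc a s t
      bad (depL a _ _ s _ _ _) t = none-cyc a s t
      bad (depC a _ _ s _ _ _ _) t = none-cyc a s t
    go : ∀ k → (∀ J → Good J → ∣ J ∣ ≤ k) → ∃ (Rank (qbCircuit Q) X)
    go zero b = done zero b (∅ , empty , ℕₚ.n≤0⇒n≡0 (b ∅ empty))
    go (suc k) b with find (suc k)
    ... | yes p = done (suc k) b p
    ... | no n = go k (λ J g → ℕₚ.≤-pred (ℕₚ.≤∧≢⇒< (b J g) (λ e → n (J , g , e))))

-- Serves for retractions onto one side of a vertex cut, for collapsing a two-terminal part, and for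
-- contraction.
conn-map : ∀ {m m'} {G : Graph m} {G' : Graph m'} {X Y} (φ : Fin (nV G) → Fin (nV G')) →
  (∀ e → X e ≡ true → Conn G' Y (φ (src G e)) (φ (tgt G e))) → ∀ {u v} → Conn G X u v → Conn G' Y (φ u) (φ v)
conn-map φ h stop = stop
conn-map {G = G} {G'} {X} {Y} φ h (step e p j c) = conn-trans G' (aux j) (conn-map φ h c)
  where
  aux : ∀ {u w} → Joins G e u w → Conn G' Y (φ u) (φ w)
  aux (inj₁ q) = subst (λ z → Conn G' Y (φ (proj₁ z)) (φ (proj₂ z))) q (h e p)
  aux (inj₂ q) = conn-sym G' (subst (λ z → Conn G' Y (φ (proj₁ z)) (φ (proj₂ z))) q (h e p))

comp : ∀ {m} → ESet m → ESet m
comp X e = not (X e)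

-- A connected matroid has a two-connected graph

record TwoShared {m : ℕ} (G : Graph m) (X : ESet m) : Set where
  constructor shared₂
  field
    p q  : Fin (nV G)
    p≢q  : p ≢ q
    pX   : InV G X p
    pY   : InV G (comp X) p
    qX   : InV G X q
    qY   : InV G (comp X) q

-- The condition speaks of edge sets only, so isolated vertices are allowed and the reductions may
-- keep the vertex set unchanged. It forbids loops as soon as there are two edges.
TwoConn : ∀ {m} → Graph m → Set
TwoConn {m} G = ∀ X {e f} → X e ≡ true → X f ≡ false → TwoShared G X

module CutVertex {m : ℕ} {G : Graph m} (Q : QuasiBiased G) (NL : NonDeg Q L) (NF : NonDeg Q F) where

  module NL = NonDeg NL
  module NF = NonDeg NF

  module Sides (X Y : ESet m) (side : ∀ C → Cyc G C → C ⊑ X ⊎ C ⊑ Y)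
               (s : Fin (nV G)) (uniq : ∀ x → InV G X x → InV G Y x → x ≡ s) where

    at-s : ∀ {C D} → C ⊑ X → D ⊑ Y → Meet Q C D → InV G C s × InV G D s
    at-s p q (x , a , b) with uniq x (InV-mono G p a) (InV-mono G q b)
    ... | refl = a , b

    -- Cycles on opposite sides can meet only at `s`, so a cycle meeting two across forces both
    -- through `s`.
    opp : ∀ {C A A'} → C ⊑ X → A ⊑ Y → A' ⊑ Y → Meet Q C A → Meet Q C A' → ¬ Meet Q A A' → ⊥
    opp c a a' m₁ m₂ n = n (s , proj₂ (at-s c a m₁) , proj₂ (at-s c a' m₂))

    opp' : ∀ {C A A'} → C ⊑ Y → A ⊑ X → A' ⊑ X → Meet Q C A → Meet Q C A' → ¬ Meet Q A A' → ⊥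
    opp' c a a' m₁ m₂ n = n (s , proj₁ (at-s a c (meet-sym Q m₁)) , proj₁ (at-s a' c (meet-sym Q m₂)))

    m₁₁ : Meet Q NL.C NF.C
    m₁₁ = LF-meet Q NL.cycC NF.cycC NL.κC NF.κC
    m₁₂ : Meet Q NL.C NF.D
    m₁₂ = LF-meet Q NL.cycC NF.cycD NL.κC NF.κD
    m₂₁ : Meet Q NL.D NF.C
    m₂₁ = LF-meet Q NL.cycD NF.cycC NL.κD NF.κC
    m₂₂ : Meet Q NL.D NF.D
    m₂₂ = LF-meet Q NL.cycD NF.cycD NL.κD NF.κD

    InX InY : Set
    InX = NL.C ⊑ X × NL.D ⊑ X × NF.C ⊑ X × NF.D ⊑ X
    InY = NL.C ⊑ Y × NL.D ⊑ Y × NF.C ⊑ Y × NF.D ⊑ Y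

    -- Each of the two cycles of `L` meets each of the two of `F`. In every mixed distribution these
    -- meetings force both members of one disjoint pair through `s`.
    all-one-side : InX ⊎ InY
    all-one-side with side NL.C NL.cycC | side NL.D NL.cycD | side NF.C NF.cycC | side NF.D NF.cycD
    ... | inj₁ a | inj₁ b | inj₁ c | inj₁ d = inj₁ (a , b , c , d)
    ... | inj₂ a | inj₂ b | inj₂ c | inj₂ d = inj₂ (a , b , c , d)
    ... | inj₁ a | _ | inj₂ c | inj₂ d = ⊥-elim (opp a c d m₁₁ m₁₂ NF.apart)
    ... | inj₂ a | _ | inj₁ c | inj₁ d = ⊥-elim (opp' a c d m₁₁ m₁₂ NF.apart)
    ... | inj₁ a | inj₂ b | inj₁ c | inj₁ d = ⊥-elim (opp' b c d m₂₁ m₂₂ NF.apart)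
    ... | inj₂ a | inj₁ b | inj₂ c | inj₂ d = ⊥-elim (opp b c d m₂₁ m₂₂ NF.apart)
    ... | inj₁ a | inj₁ b | inj₁ c | inj₂ d = ⊥-elim (opp' d a b (meet-sym Q m₁₂) (meet-sym Q m₂₂) NL.apart)
    ... | inj₁ a | inj₁ b | inj₂ c | inj₁ d = ⊥-elim (opp' c a b (meet-sym Q m₁₁) (meet-sym Q m₂₁) NL.apart)
    ... | inj₂ a | inj₂ b | inj₁ c | inj₂ d = ⊥-elim (opp c a b (meet-sym Q m₁₁) (meet-sym Q m₂₁) NL.apart)
    ... | inj₂ a | inj₂ b | inj₂ c | inj₁ d = ⊥-elim (opp d a b (meet-sym Q m₁₂) (meet-sym Q m₂₂) NL.apart)
    ... | inj₁ a | inj₂ b | inj₁ c | inj₂ d = ⊥-elim (NL.apart (s , proj₁ (at-s a d m₁₂) , proj₂ (at-s c b (meet-sym Q m₂₁))))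
    ... | inj₁ a | inj₂ b | inj₂ c | inj₁ d = ⊥-elim (NL.apart (s , proj₁ (at-s a c m₁₁) , proj₂ (at-s d b (meet-sym Q m₂₂))))
    ... | inj₂ a | inj₁ b | inj₁ c | inj₂ d = ⊥-elim (NL.apart (s , proj₂ (at-s c a (meet-sym Q m₁₁)) , proj₁ (at-s b d m₂₂)))
    ... | inj₂ a | inj₁ b | inj₂ c | inj₁ d = ⊥-elim (NL.apart (s , proj₂ (at-s d a (meet-sym Q m₁₂)) , proj₁ (at-s b c m₂₁)))

    unbal-X : InX → ∀ A → Cyc G A → κ Q A ≢ B → A ⊑ X
    unbal-X (a , b , c , d) A cy n with side A cy
    ... | inj₁ p = p
    ... | inj₂ p with nonB n
    ... | inj₁ k = ⊥-elim (opp' p c d (LF-meet Q cy NF.cycC k NF.κC) (LF-meet Q cy NF.cycD k NF.κD) NF.apart)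
    ... | inj₂ k = ⊥-elim (opp' p a b (meet-sym Q (LF-meet Q NL.cycC cy NL.κC k)) (meet-sym Q (LF-meet Q NL.cycD cy NL.κD k)) NL.apart)

    -- Every cycle of the union lies in one part, so none is in `B`; by `unbal-X` all of them then
    -- lie in `I`. A connection between two of them is pulled into `I` by collapsing `J` to the cut
    -- vertex.
    indep-⊔ : (∀ e → X e ≡ true → Y e ≡ true → ⊥) → InX → ∀ {I J} → I ⊑ X → J ⊑ Y → ¬ Dep Q I → ¬ Dep Q J → ¬ Dep Q (I ⊔ J)
    indep-⊔ dis inX {I} {J} sI sJ nI nJ = bad
      where
      toI : ∀ {A} → A ⊑ I ⊔ J → A ⊑ X → A ⊑ I
      toI p q e r with ∨-elim {I e} (p e r)
      ... | inj₁ a = a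
      ... | inj₂ b = ⊥-elim (dis e (q e r) (sJ e b))
      toJ : ∀ {A} → A ⊑ I ⊔ J → A ⊑ Y → A ⊑ J
      toJ p q e r with ∨-elim {I e} (p e r)
      ... | inj₁ a = ⊥-elim (dis e (sI e a) (q e r))
      ... | inj₂ b = b
      balanced : ∀ {A} → Cyc G A → A ⊑ I ⊔ J → κ Q A ≢ B
      balanced {A} a p k with side A a
      ... | inj₁ q = nI (depB a (toI p q) k)
      ... | inj₂ q = nJ (depB a (toJ p q) k)
      toI' : ∀ {A} → Cyc G A → A ⊑ I ⊔ J → A ⊑ I
      toI' {A} a p = toI p (unbal-X inX A a (balanced a p))
      φ : Fin (nV G) → Fin (nV G)
      φ z = if vset G I z then z else s
      φ-in : ∀ {z} → InV G I z → φ z ≡ z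
      φ-in p rewrite vset-in G p = refl
      φ-s : ∀ {z} → InV G J z → φ z ≡ s
      φ-s {z} p with InV? G I z
      ... | yes q = uniq z (InV-mono G sI q) (InV-mono G sJ p)
      ... | no _ = refl
      h : ∀ e → (I ⊔ J) e ≡ true → Conn G I (φ (src G e)) (φ (tgt G e))
      h e p with ∨-elim {I e} p
      ... | inj₁ a rewrite φ-in (e , a , inc-src G e) | φ-in (e , a , inc-tgt G e) = conn-edge G e a
      ... | inj₂ b rewrite φ-s (e , b , inc-src G e) | φ-s (e , b , inc-tgt G e) = stop
      bad : ¬ Dep Q (I ⊔ J)
      bad (depB a p k) = balanced a p k
      bad (depL a a' n p q k l) = nI (depL a a' n (toI' a p) (toI' a' q) k l)
      bad (depC {x = x} {y} a a' n p q i j cn) = nI (depC a a' n (toI' a p) (toI' a' q) i j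
        (subst (λ z → Conn G I z y) (φ-in (InV-mono G (toI' a p) i))
          (subst (Conn G I (φ x)) (φ-in (InV-mono G (toI' a' q) j)) (conn-map φ h cn))))

  -- If at most one vertex is shared, maximum independent sets of the two sides have an independent
  -- union; the ranks add up to at most the full rank, which is a separation of order 1.
  connected→twoConn : Connected (qbCircuit Q) → TwoConn G
  connected→twoConn con X {e} {f} xe xf = decide (any? (λ p → InV? G X p ×-dec InV? G Y p))
    where
    Y : ESet m
    Y = comp X
    dis : ∀ e → X e ≡ true → Y e ≡ true → ⊥
    dis e p q = t≢f p (not-t q)
    sep : ∀ s → (∀ x → InV G X x → InV G Y x → x ≡ s) → ⊥
    sep s uniq = con SX (rx , ry , re , RX , RY , RE , szX , szY , s≤s bound)
      where
      SX : Subset m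
      SX = tabulate X
      side : ∀ C → Cyc G C → C ⊑ X ⊎ C ⊑ Y
      side C c with ⊑? C X | ⊑? C Y
      ... | yes p | _ = inj₁ p
      ... | _ | yes p = inj₂ p
      ... | no p | no q with ⋢ p | ⋢ q
      ... | a , ca , xa | b , cb , yb with cyc-cross G c X {b} {a} cb (≢false λ z → t≢f (not-f z) yb) ca xa
      ... | x , y , n , i₁ , i₂ , i₃ , i₄ = ⊥-elim (n (trans (uniq x (inl i₁) (inr i₂)) (sym (uniq y (inl i₃) (inr i₄)))))
        where
        inl : ∀ {z} → InV G (C ⊓ X) z → InV G X z
        inl = InV-mono G (λ g r → ∧-snd {C g} r)
        inr : ∀ {z} → InV G (C ⊖ X) z → InV G Y z
        inr = InV-mono G (λ g r → ∧-snd {C g} r)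
      rx ry re : ℕ
      rx = proj₁ (rank-exists Q SX)
      ry = proj₁ (rank-exists Q (∁ SX))
      re = proj₁ (rank-exists Q full)
      RX = proj₂ (rank-exists Q SX)
      RY = proj₂ (rank-exists Q (∁ SX))
      RE = proj₂ (rank-exists Q full)
      lX : ∀ g → lookup SX g ≡ X g
      lX = lookup∘tabulate X
      lY : ∀ g → lookup (∁ SX) g ≡ Y g
      lY g = trans (lookup-map g not SX) (cong not (lX g))
      sz : ∀ {Z : Subset m} {g} → lookup Z g ≡ true → 1 ≤ ∣ Z ∣
      sz {Z} {g} p = ≤-trans (count-≥ (lookup Z) (g ∷ []) ([] ∷ []) (p ∷ [])) (≤-reflexive (sym (∣∣≡count Z)))
      szX : 1 ≤ ∣ SX ∣
      szX = sz {SX} {e} (trans (lX e) xe)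
      szY : 1 ≤ ∣ ∁ SX ∣
      szY = sz {∁ SX} {f} (trans (lY f) (not-f xf))
      I J : Subset m
      I = proj₁ (proj₁ RX)
      J = proj₁ (proj₁ RY)
      I⊑ : lookup I ⊑ X
      I⊑ g p = trans (sym (lX g)) ([]=⇒lookup (proj₁ (proj₂ (proj₁ RX)) (lookup⇒[]= g I p)))
      J⊑ : lookup J ⊑ Y
      J⊑ g p = trans (sym (lY g)) ([]=⇒lookup (proj₁ (proj₂ (proj₁ RY)) (lookup⇒[]= g J p)))
      nI : ¬ Dep Q (lookup I)
      nI = indep→ Q (proj₁ (proj₂ (proj₂ (proj₁ RX))))
      nJ : ¬ Dep Q (lookup J)
      nJ = indep→ Q (proj₁ (proj₂ (proj₂ (proj₁ RY))))
      module S₁ = Sides X Y side s uniq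
      module S₂ = Sides Y X (λ C c → Sum.swap (side C c)) s (λ x a b → uniq x b a)
      nIJ : ¬ Dep Q (lookup I ⊔ lookup J)
      nIJ with S₁.all-one-side
      ... | inj₁ a = S₁.indep-⊔ dis a I⊑ J⊑ nI nJ
      ... | inj₂ b = λ d → S₂.indep-⊔ (λ g p q → dis g q p) b J⊑ I⊑ nJ nI
              (dep-mono Q (λ g p → trans (∨-comm (lookup J g) (lookup I g)) p) d)
      bound : rx + ry ≤ re
      bound = ≤-trans (≤-reflexive (trans (cong₂ _+_ (sym (trans (sym (∣∣≡count I)) (proj₂ (proj₂ (proj₂ (proj₁ RX))))))
                                                     (sym (trans (sym (∣∣≡count J)) (proj₂ (proj₂ (proj₂ (proj₁ RY)))))))
                (trans (sym (count-⊔ (lookup I) (lookup J) (λ g p → ≢true λ q → dis g (I⊑ g p) (J⊑ g q))))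
                  (trans (count-cong (λ g → sym (lookup-∪ G I J g))) (sym (∣∣≡count (I ∪ J)))))))
              (proj₂ RE (I ∪ J) (λ {x} _ → ∈⊤)
                (indep← Q λ d → nIJ (dep-mono Q (≗→⊑ (lookup-∪ G I J)) d)))
    decide : Dec (∃[ p ] (InV G X p × InV G Y p)) → TwoShared G X
    -- No vertex is shared, so any vertex may stand in for the cut vertex.
    decide (no n) = ⊥-elim (sep (src G e) λ x a b → ⊥-elim (n (x , a , b)))
    decide (yes (p , a , b)) with any? (λ q → ¬? (p ≟ q) ×-dec InV? G X q ×-dec InV? G Y q)
    ... | yes (q , n , c , d) = shared₂ p q n a b c d
    ... | no n = ⊥-elim (sep p one)
      where
      one : ∀ x → InV G X x → InV G Y x → x ≡ p
      one x c d with p ≟ x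
      ... | yes r = sym r
      ... | no r = ⊥-elim (n (x , r , c , d))

-- Balanced edge sets and rank estimates

module _ {m : ℕ} {G : Graph m} (Q : QuasiBiased G) where

  Bal : ESet m → Set
  Bal X = ∀ C → Cyc G C → C ⊑ X → κ Q C ≡ B

  Unbal : ESet m → Set
  Unbal X = ∃[ C ] (Cyc G C × C ⊑ X × κ Q C ≢ B)

  bal? : ∀ X → Bal X ⊎ Unbal X
  bal? X with any-ESet? (λ C → Cyc G C × C ⊑ X × κ Q C ≢ B)
      (λ p (a , b , c) → cyc-resp G p a , (λ e q → b e (trans (p e) q)) , λ k → c (trans (κ-cong Q p) k))
      (λ C → Cyc? G C ×-dec ⊑? C X ×-dec ¬? (κ Q C ≟ᶜ B))
  ... | yes u = inj₂ u
  ... | no n = inj₁ λ C c s → case κ Q C ≟ᶜ B of λ where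
    (yes k) → k
    (no k) → ⊥-elim (n (C , c , s , k))

  -- Ranks

  -- One vertex per component of `X`; the second test drops isolated vertices, which represent
  -- themselves.
  roots : ∀ {X} → Span G X → ESet (nV G)
  roots {X} S r = does (Span.rep S r ≟ r) ∧ vset G X r

  forest-size : ∀ {X} (S : Span G X) → count (Span.T S) + count (roots S) ≡ count (vset G X)
  forest-size {X} S = ℕₚ.+-cancelʳ-≡ (count nv) _ _
      (trans (+-assoc (count T) (count (roots S)) (count nv))
        (trans (cong (count T +_) (trans (cong (count (roots S) +_) (sym (count-cong iso))) (count-split fx (vset G X))))
          (trans size (sym (count-comp (vset G X))))))
    where
    open Span S
    fx nv : ESet (nV G)
    fx r = does (rep r ≟ r)
    nv x = not (vset G X x)
    iso : fx ⊖ vset G X ≗ nv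
    iso x = true-iff (λ p → ∧-snd {fx x} p) (λ p → ∧-in (dec-true (rep x ≟ x)
      (sym (conn-isolated G (conn-mono G T⊑X (toRep x)) (λ i → t≢f (vset-in G i) (not-t p))))) p)

  -- An independent set has at most one edge per component beyond a spanning forest: two would close
  -- two distinct cycles joined inside `I`. Forest edges and components add up to the vertices of
  -- `I`.
  rank-upper : ∀ I → ¬ Dep Q I → count I ≤ count (vset G all)
  rank-upper I ind = ≤-trans (≤-reflexive (trans (sym (count-split I T)) (cong (_+ count (I ⊖ T)) (count-cong I⊓T))))
      (≤-trans (+-mono-≤ (≤-refl {count T}) extra)
        (≤-trans (≤-reflexive (forest-size S)) (count-mono {f = vset G I} {vset G all} λ x p → vset-in G {all} {x} (InV-mono G {I} {all} (λ _ _ → refl) (vset-out G p)))))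
    where
    S : Span G I
    S = span G I
    open Span S
    I⊓T : I ⊓ T ≗ T
    I⊓T e = true-iff (λ p → ∧-snd {I e} p) (λ p → ∧-in (T⊑X e p) p)
    inj : ∀ i j → (I ⊖ T) i ≡ true → (I ⊖ T) j ≡ true → rep (src G i) ≡ rep (src G j) → i ≡ j
    inj i j p q r with i ≟ j
    ... | yes e = e
    ... | no n = ⊥-elim (ind (both (cyc-at i p) (cyc-at j q)))
      where
      cyc-at : ∀ i → (I ⊖ T) i ≡ true → ∃[ C ] (IsCycle G C × lookup C ⊑ T ⊔ sing i × lookup C i ≡ true)
      cyc-at i p = close G {T} i (⊖-snd {X = I} {T} p) (joins-self G i) (rep-conn (sym (spans i (∧-fst p))))
      into : ∀ {i} → (I ⊖ T) i ≡ true → T ⊔ sing i ⊑ I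
      into {i} p = ⊔-lub Q {T} T⊑X (λ f s → subst (λ z → I z ≡ true) (sym (sing-elim {e = i} {f} s)) (∧-fst p))
      both : ∃[ C ] (IsCycle G C × lookup C ⊑ T ⊔ sing i × lookup C i ≡ true) →
             ∃[ C ] (IsCycle G C × lookup C ⊑ T ⊔ sing j × lookup C j ≡ true) → Dep Q I
      both (C , c , s , ci) (D , d , t , dj) = depC (IsCycle→Cyc G c) (IsCycle→Cyc G d) ne
          (⊑-trans s (into p)) (⊑-trans t (into q)) (i , ci , inc-src G i) (j , dj , inc-src G j) (conn-mono G T⊑X (rep-conn r))
        where
        ne : ¬ lookup C ≗ lookup D
        ne h with ∨-elim {T i} (t i (trans (sym (h i)) ci))
        ... | inj₁ a = t≢f a (⊖-snd {X = I} {T} p)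
        ... | inj₂ b = n (sing-elim {e = j} {i} b)
    extra : count (I ⊖ T) ≤ count (roots S)
    extra = count-inj (I ⊖ T) (roots S) (λ e → rep (src G e))
      (λ e p → ∧-in (dec-true (rep (rep (src G e)) ≟ rep (src G e)) (idem (src G e)))
        (vset-in G (conn-InV G (conn-mono G T⊑X (toRep (src G e))) (e , ∧-fst p , inc-src G e)))) inj

  -- A lower bound for the rank of `X`, not its value: a single extra edge is counted even if
  -- several components contain cycles outside `B`.
  record Side (X : ESet m) : Set where
    field
      S    : Span G X
      I    : ESet m
      I⊑X  : I ⊑ X
      ind  : ¬ Dep Q I
      u    : ℕ
      size : count I ≡ u + count (Span.T S)
      kind : (u ≡ 0 × Bal X) ⊎ (u ≡ 1 × Unbal X)

  side-of : ∀ X → Side X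
  side-of X with bal? X
  ... | inj₁ b = record { S = S₀ ; I = Span.T S₀ ; I⊑X = Span.T⊑X S₀ ; ind = bad ; u = 0 ; size = refl ; kind = inj₁ (refl , b) }
    where
    S₀ : Span G X
    S₀ = span G X
    no-cyc : ∀ {C} → Cyc G C → ¬ C ⊑ Span.T S₀
    no-cyc {C} c s = Span.acyc S₀ C (Cyc.even c) s (Cyc.ne c)
    bad : ¬ Dep Q (Span.T S₀)
    bad (depB c s _) = no-cyc c s
    bad (depL c _ _ s _ _ _) = no-cyc c s
    bad (depC c _ _ s _ _ _ _) = no-cyc c s
  -- The forest is grown over `C` minus `d`, so that adding `d` creates `C` and no other cycle.
  ... | inj₂ ub@(C , c , s , k) = go (span-over G X (C ⊖ sing d) (λ e p → s e (∧-fst p)) acy)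
    where
    d : Fin m
    d = proj₁ (Cyc.ne c)
    cd : C d ≡ true
    cd = proj₂ (Cyc.ne c)
    acy : ∀ Z → Even G Z → Z ⊑ C ⊖ sing d → ¬ NE Z
    acy Z ev z ne = t≢f (∧-snd {C d} (z d (Cyc.min c Z (λ e p → ∧-fst (z e p)) ev ne d cd))) (cong not (sing-self d))
    go : (Σ (Span G X) λ S → C ⊖ sing d ⊑ Span.T S) → Side X
    go (S , above) = record
        { S = S ; I = T ⊔ sing d ; I⊑X = ⊔-lub Q {T} T⊑X (λ e p → subst (λ z → X z ≡ true) (sym (sing-elim {e = d} {e} p)) (s d cd))
        ; ind = bad ; u = 1 ; size = count-insert T d Td ; kind = inj₂ (refl , ub) }
      where
      open Span S
      C⊑ : C ⊑ T ⊔ sing d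
      C⊑ e p with bool-cases (sing d e)
      ... | inj₁ a = ∨-inr {T e} a
      ... | inj₂ b = ∨-inl (above e (⊖-in {X = C} {sing d} p b))
      Td : T d ≡ false
      Td = ≢true λ t → acyc C (Cyc.even c) (λ e p → case ∨-elim {T e} (C⊑ e p) of λ where
        (inj₁ a) → a
        (inj₂ b) → subst (λ z → T z ≡ true) (sym (sing-elim {e = d} {e} b)) t) (Cyc.ne c)
      off-d : ∀ {Z} → Z ⊑ T ⊔ sing d → Z d ≡ false → Z ⊑ T
      off-d {Z} z zd e p with ∨-elim {T e} (z e p)
      ... | inj₁ a = a
      ... | inj₂ b = ⊥-elim (t≢f p (subst (λ x → Z x ≡ false) (sym (sing-elim {e = d} {e} b)) zd))
      only : ∀ {D} → Cyc G D → D ⊑ T ⊔ sing d → D ≗ C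
      only {D} cy z e = xor-eq (NE-not {X = D △ C} (acyc (D △ C) (even-△ G {D} {C} (Cyc.even cy) (Cyc.even c))
          (off-d (λ f p → case xor-elim {D f} p of λ { (inj₁ (a , _)) → z f a ; (inj₂ (_ , b)) → C⊑ f b }) (cong₂ _xor_ Dd cd))) e)
        where
        Dd : D d ≡ true
        Dd = ≢false λ p → acyc D (Cyc.even cy) (off-d z p) (Cyc.ne cy)
      bad : ¬ Dep Q (T ⊔ sing d)
      bad (depB cy z kB) = k (trans (sym (κ-cong Q (only cy z))) kB)
      bad (depL cy cy' n z z' _ _) = n (λ e → trans (only cy z e) (sym (only cy' z' e)))
      bad (depC cy cy' n z z' _ _ _) = n (λ e → trans (only cy z e) (sym (only cy' z' e)))

-- Components of one side of an edge bipartition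

module Pieces {m : ℕ} {G : Graph m} (tc : TwoConn G) (X Y : ESet m)
              (cov : ∀ e → X e ≡ true ⊎ Y e ≡ true) (dis : ∀ e → X e ≡ true → Y e ≡ true → ⊥)
              (neY : NE Y) (S : Span G X) where

  open Span S public using (rep; inc-rep; conn-rep)

  A : Fin (nV G) → ESet m
  A r e = X e ∧ does (rep (src G e) ≟ r)

  A-in : ∀ {r e x} → X e ≡ true → Incident G e x → rep x ≡ r → A r e ≡ true
  A-in {r} {e} xe i p = ∧-in xe (dec-true (rep (src G e) ≟ r) (trans (inc-rep xe (inc-src G e) i) p))

  A-rep : ∀ {r e x} → A r e ≡ true → Incident G e x → rep x ≡ r
  A-rep {r} {e} p i = trans (inc-rep (∧-fst p) i (inc-src G e)) (sing-elim {e = r} {rep (src G e)} (∧-snd {X e} p))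

  AV-rep : ∀ {r x} → InV G (A r) x → rep x ≡ r
  AV-rep (e , p , i) = A-rep p i

  A⊑X : ∀ {r} → A r ⊑ X
  A⊑X e p = ∧-fst p

  other : ∀ {r x f} → comp (A r) f ≡ true → Incident G f x → rep x ≡ r → Y f ≡ true
  other {f = f} p i q with cov f
  ... | inj₁ xf = ⊥-elim (t≢f (A-in xf i q) (not-t p))
  ... | inj₂ yf = yf

  attach : ∀ {r x} → InV G (A r) x → InV G (comp (A r)) x → InV G Y x
  attach a (f , p , i) = f , other p i (AV-rep a) , i

  conn-A : ∀ {r x y} → Conn G X x y → rep x ≡ r → Conn G (A r) x y
  conn-A stop p = stop
  conn-A (step e q j c) p = step e (A-in q (joins-inc G j) p) j
    (conn-A c (trans (sym (inc-rep q (joins-inc G j) (joins-inc₂ G j))) p))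

  in-A : ∀ {x} → InV G X x → InV G (A (rep x)) x
  in-A (e , p , i) = e , A-in p i refl , i

  record Two (r : Fin (nV G)) : Set where
    field
      p q : Fin (nV G)
      p≢q : p ≢ q
      pA  : InV G (A r) p
      pY  : InV G Y p
      qA  : InV G (A r) q
      qY  : InV G Y q

  -- `neY` makes the component a proper edge set, so two-connectedness applies; whatever lies
  -- outside the component at one of its vertices belongs to `Y`.
  two : ∀ {x} → InV G X x → Two (rep x)
  two (e , p , i) = let (f , yf) = neY
                        open TwoShared (tc (A (rep _)) (A-in p i refl) (≢true λ a → dis f (A⊑X f a) yf))
                    in record { p≢q = p≢q ; pA = pX ; pY = attach pX pY ; qA = qX ; qY = attach qX qY }

  Sh : ESet (nV G)
  Sh z = vset G X z ∧ vset G Y z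

  fib : Fin (nV G) → ESet (nV G)
  fib r z = Sh z ∧ does (rep z ≟ r)

  -- The excess s(K) - 2. Truncated subtraction is harmless: a represented component has at least
  -- two attachments, and for any other `r` the fibre is empty.
  exc : Fin (nV G) → ℕ
  exc r = count (fib r) ∸ 2

  InF : Fin (nV G) → Fin (nV G) → Set
  InF r z = InV G X z × InV G Y z × rep z ≡ r

  fib-in : ∀ {r z} → InF r z → fib r z ≡ true
  fib-in {r} {z} (a , b , c) = ∧-in (∧-in (vset-in G a) (vset-in G b)) (dec-true (rep z ≟ r) c)

  fib₂ : ∀ {x} → InV G X x → 2 ≤ count (fib (rep x))
  fib₂ {x} i = count-≥ (fib (rep x)) (p ∷ q ∷ []) ((p≢q ∷ []) ∷ ([] ∷ []))
      (fib-in (InV-mono G A⊑X pA , pY , AV-rep pA) ∷ fib-in (InV-mono G A⊑X qA , qY , AV-rep qA) ∷ [])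
    where open Two (two i)

  exc≤→ : ∀ {r k} → exc r ≤ k → count (fib r) ≤ 2 + k
  exc≤→ {r} h = ≤-trans (ℕₚ.m≤n+m∸n (count (fib r)) 2) (ℕₚ.+-monoʳ-≤ 2 h)

  fib≤2 : ∀ {r} → exc r ≤ 0 → ∀ {a b c} → InF r a → InF r b → InF r c → a ≢ b → a ≢ c → b ≢ c → ⊥
  fib≤2 {r} h fa fb fc ab ac bc = ℕₚ.<-irrefl refl (≤-trans
    (count-≥ (fib r) (_ ∷ _ ∷ _ ∷ []) ((ab ∷ ac ∷ []) ∷ (bc ∷ []) ∷ ([] ∷ [])) (fib-in fa ∷ fib-in fb ∷ fib-in fc ∷ [])) (exc≤→ {r} h))

  fib≤3 : ∀ {r} → exc r ≤ 1 → ∀ {a b c d} → InF r a → InF r b → InF r c → InF r d →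
          a ≢ b → a ≢ c → a ≢ d → b ≢ c → b ≢ d → c ≢ d → ⊥
  fib≤3 {r} h fa fb fc fd ab ac ad bc bd cd = ℕₚ.<-irrefl refl (≤-trans
    (count-≥ (fib r) (_ ∷ _ ∷ _ ∷ _ ∷ []) ((ab ∷ ac ∷ ad ∷ []) ∷ (bc ∷ bd ∷ []) ∷ (cd ∷ []) ∷ ([] ∷ []))
      (fib-in fa ∷ fib-in fb ∷ fib-in fc ∷ fib-in fd ∷ [])) (exc≤→ {r} h))

  root : ESet (nV G)
  root r = does (rep r ≟ r) ∧ vset G X r

  -- Each shared vertex lies in exactly one component of `X`, so the attachment numbers of these
  -- components sum to the number of shared vertices.
  exc-sum : nsum exc + (count root + count root) ≡ count Sh
  exc-sum = trans (cong (nsum exc +_) (sym (nsum-+ (b2n ∘ root) (b2n ∘ root))))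
    (trans (sym (nsum-+ exc (λ r → b2n (root r) + b2n (root r))))
      (trans (nsum-cong aux) (fiber Sh rep)))
    where
    aux : ∀ r → exc r + (b2n (root r) + b2n (root r)) ≡ count (fib r)
    aux r with root r in eq
    ... | true = ℕₚ.m∸n+n≡m (subst (λ z → 2 ≤ count (fib z)) (sing-elim {e = r} {rep r} (∧-fst eq)) (fib₂ (vset-out G (∧-snd {does (rep r ≟ r)} eq))))
    ... | false = trans (+-identityʳ (exc r)) (trans (cong (_∸ 2) zero-fib) (sym zero-fib))
      where
      zero-fib : count (fib r) ≡ 0
      zero-fib = nsum-zero λ z → cong b2n (≢true λ p →
        let rz = sing-elim {e = r} {rep z} (∧-snd {Sh z} p)
            xz = vset-out G {X} (∧-fst (∧-fst {Sh z} p))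
            cn = conn-mono G (Span.T⊑X S) (Span.toRep S z)
        in t≢f (∧-in (dec-true (rep r ≟ r) (subst (λ w → rep w ≡ w) rz (Span.idem S z)))
                     (vset-in G (subst (InV G X) rz (conn-InV G cn xz)))) eq)

nsum-≥₃ : ∀ {n} (f : Fin n → ℕ) i j k → i ≢ j → i ≢ k → j ≢ k → f i + (f j + f k) ≤ nsum f
nsum-≥₃ f i j k ij ik jk = ≤-trans
    (+-mono-≤ (≤-trans (≤-reflexive (sym at-i)) (nsum-≥ h i))
              (≤-trans (≤-reflexive (sym (cong₂ _+_ (off j (ij ∘ sym)) (off k (ik ∘ sym))))) (nsum-≥₂ g j k jk)))
    (≤-reflexive (trans (sym (nsum-+ h g)) (nsum-cong hg)))
  where
  h g : Fin _ → ℕ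
  h l = if sing i l then f l else 0
  g l = if sing i l then 0 else f l
  at-i : h i ≡ f i
  at-i rewrite sing-self i = refl
  off : ∀ l → l ≢ i → g l ≡ f l
  off l n rewrite sing-ne n = refl
  hg : ∀ l → h l + g l ≡ f l
  hg l with sing i l
  ... | true = +-identityʳ (f l)
  ... | false = refl

two-elements : ∀ {n} (f : ESet n) → 2 ≤ count f → ∃[ i ] ∃[ j ] (i ≢ j × f i ≡ true × f j ≡ true)
two-elements f h with any? (λ i → any? (λ j → ¬? (i ≟ j) ×-dec (f i Bool.≟ true) ×-dec (f j Bool.≟ true)))
... | yes p = p
... | no n = ⊥-elim (ℕₚ.<-irrefl refl (≤-trans h (count-≤1 f λ i j p q → case i ≟ j of λ where
    (yes r) → r
    (no r) → ⊥-elim (n (i , j , r , p , q)))))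

-- Reducible configurations and what their absence implies

module _ {m : ℕ} {G : Graph m} (Q : QuasiBiased G) where

  -- Two distinct edges make the replacement shrink the graph. `conn` supplies the path that the new
  -- edge stands for.
  record BalancedPart : Set where
    field
      R      : ESet m
      v w    : Fin (nV G)
      v≢w    : v ≢ w
      e f    : Fin m
      e≢f    : e ≢ f
      eR     : R e ≡ true
      fR     : R f ≡ true
      shared : ∀ x → InV G R x → InV G (comp R) x → x ≡ v ⊎ x ≡ w
      conn   : Conn G R v w
      bal    : Bal Q R

  record BalancingPair : Set where
    field
      f g : Fin m
      f≢g : f ≢ g
      bal : ∀ C → Cyc G C → C f ≡ false → C g ≡ false → κ Q C ≡ B

joins-loop : ∀ {m} (G : Graph m) {e u} → Joins G e u u → src G e ≡ tgt G e
joins-loop G (inj₁ p) = trans (cong proj₁ p) (sym (cong proj₂ p))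
joins-loop G (inj₂ p) = trans (cong proj₁ p) (sym (cong proj₂ p))

-- A loop has a single end and so could share only one vertex with the rest.
noloop : ∀ {m} {G : Graph m} → TwoConn G → ∀ {e f} → f ≢ e → src G e ≢ tgt G e
noloop {G = G} tc {e} {f} n l = p≢q (trans (at pX) (sym (at qX)))
  where
  open TwoShared (tc (sing e) {e} {f} (sing-self e) (sing-ne n))
  at : ∀ {x} → InV G (sing e) x → x ≡ src G e
  at (g , p , i) with sing-elim {e = e} {g} p
  ... | refl with inc-cases G i
  ... | inj₁ q = q
  ... | inj₂ q = trans q (sym l)

Single : ∀ {m} → ESet m → Set
Single A = ∀ e f → A e ≡ true → A f ≡ true → e ≡ f

module Half {m : ℕ} {G : Graph m} (Q : QuasiBiased G) (tc : TwoConn G) (NL : NonDeg Q L) (no₁ : ¬ BalancedPart Q)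
            (X Y : ESet m) (cov : ∀ e → X e ≡ true ⊎ Y e ≡ true) (dis : ∀ e → X e ≡ true → Y e ≡ true → ⊥)
            (neX : NE X) (neY : NE Y) (SX : Span G X) (SY : Span G Y) where

  module PX = Pieces tc X Y cov dis neY SX
  module PY = Pieces tc Y X (λ e → Sum.swap (cov e)) (λ e p q → dis e q p) neX SY

  small : ∀ {z} → InV G X z → PX.exc (PX.rep z) ≤ 0 → Bal Q (PX.A (PX.rep z)) → Single (PX.A (PX.rep z))
  small {z} iz h b e f ae af with e ≟ f
  ... | yes p = p
  ... | no n = ⊥-elim (no₁ (record { R = PX.A r ; v = p ; w = q ; v≢w = p≢q ; e≢f = n ; eR = ae ; fR = af ; shared = shared
      ; conn = PX.conn-A (conn-mono G (Span.T⊑X SX) (Span.rep-conn SX (trans (PX.AV-rep pA) (sym (PX.AV-rep qA))))) (PX.AV-rep pA)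
      ; bal = b }))
    where
    r : Fin (nV G)
    r = PX.rep z
    open PX.Two (PX.two iz)
    mem : ∀ {x} → InV G (PX.A r) x → InV G Y x → PX.InF r x
    mem a y = InV-mono G PX.A⊑X a , y , PX.AV-rep a
    shared : ∀ x → InV G (PX.A r) x → InV G (comp (PX.A r)) x → x ≡ p ⊎ x ≡ q
    shared x a c with x ≟ p | x ≟ q
    ... | yes s | _ = inj₁ s
    ... | no _ | yes s = inj₂ s
    ... | no s | no t = ⊥-elim (PX.fib≤2 {r} h (mem a (PX.attach a c)) (mem pA pY) (mem qA qY) s t p≢q)

  -- `z` would have exactly two edges `f` and `g`. If their other ends differ they form a path, a
  -- balanced part attached at those ends; if the ends coincide the pair is attached at one vertex
  -- only.
  adj : ∀ {z} → InV G X z → InV G Y z → Single (PX.A (PX.rep z)) → Single (PY.A (PY.rep z)) → ⊥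
  adj {z} (f , xf , (x' , jf)) (g , yg , (y' , jg)) sX sY = decide (x' ≟ y')
    where
    f≢g : f ≢ g
    f≢g p = dis f xf (subst (λ h → Y h ≡ true) (sym p) yg)
    x'≢z : x' ≢ z
    x'≢z refl = noloop tc (f≢g ∘ sym) (joins-loop G jf)
    y'≢z : y' ≢ z
    y'≢z refl = noloop tc f≢g (joins-loop G jg)
    R : ESet m
    R = sing f ⊔ sing g
    R-cases : ∀ h → R h ≡ true → h ≡ f ⊎ h ≡ g
    R-cases h p with ∨-elim {sing f h} p
    ... | inj₁ a = inj₁ (sing-elim {e = f} {h} a)
    ... | inj₂ b = inj₂ (sing-elim {e = g} {h} b)
    Rf : R f ≡ true
    Rf = ∨-inl (sing-self f)
    Rg : R g ≡ true
    Rg = ∨-inr {sing f g} (sing-self g)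
    not-z : ∀ {h} → comp R h ≡ true → ¬ Incident G h z
    not-z {h} p i with cov h
    ... | inj₁ xh = t≢f (subst (λ k → R k ≡ true) (sX f h (PX.A-in xf (joins-inc G jf) refl) (PX.A-in xh i refl)) Rf) (not-t p)
    ... | inj₂ yh = t≢f (subst (λ k → R k ≡ true) (sY g h (PY.A-in yg (joins-inc G jg) refl) (PY.A-in yh i refl)) Rg) (not-t p)
    shared : ∀ x → InV G R x → InV G (comp R) x → x ≡ x' ⊎ x ≡ y'
    shared x (h , p , i) (k , q , j) with R-cases h p
    ... | inj₁ refl = case joins-ends G jf i of λ where
      (inj₁ refl) → ⊥-elim (not-z q j)
      (inj₂ r) → inj₁ r
    ... | inj₂ refl = case joins-ends G jg i of λ where
      (inj₁ refl) → ⊥-elim (not-z q j)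
      (inj₂ r) → inj₂ r
    decide : Dec (x' ≡ y') → ⊥
    decide (no n) = f≢g (⊥-elim (no₁ (record
      { R = R ; v≢w = n ; e≢f = f≢g ; eR = Rf ; fR = Rg ; shared = shared
      ; conn = step f Rf (joins-sym G jf) (step g Rg jg stop)
      ; bal = λ C c s → ⊥-elim (no-even-in-path G W ((x'≢z ∷ n ∷ []) ∷ ((y'≢z ∘ sym) ∷ []) ∷ ([] ∷ [])) C (Cyc.even c)
                (λ h p → case R-cases h (s h p) of λ where
                  (inj₁ refl) → ∨-inl (sing-self h)
                  (inj₂ refl) → ∨-inr {sing f h} (∨-inl (sing-self h))) (Cyc.ne c)) })))
      where
      W : Walk G x' y'
      W = cons f (joins-sym G jf) (cons g jg (nil y'))
    decide (yes refl) with any? (λ h → R h Bool.≟ false)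
    ... | yes (h , rh) = p≢q (trans (at pX pY) (sym (at qX qY)))
      where
      open TwoShared (tc R {f} {h} Rf rh)
      at : ∀ {x} → InV G R x → InV G (comp R) x → x ≡ x'
      at a b with shared _ a b
      ... | inj₁ r = r
      ... | inj₂ r = r
    -- Here `f` and `g` are all the edges, so both cycles of the disjoint pair would pass through
    -- `z`.
    ... | no n = NL.apart (z , through NL.cycC , through NL.cycD)
      where
      module NL = NonDeg NL
      through : ∀ {C} → Cyc G C → InV G C z
      through c = let (h , p) = Cyc.ne c in h , p , (case R-cases h (≢false λ q → n (h , q)) of λ where
        (inj₁ refl) → joins-inc G jf
        (inj₂ refl) → joins-inc G jg)

  Crossing : ESet m → Fin (nV G) → Set
  Crossing C z = InV G (C ⊓ X) z × InV G (C ⊓ Y) z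

  -- A single edge of Y with both ends on a component K of X with three attachments leaves K only one attachment.
  pend : ∀ {C r z} → Cyc G C → PX.exc r ≤ 1 →
    (∀ z → Crossing C z → PX.rep z ≡ r × Single (PY.A (PY.rep z))) →
    ∀ {e₀} → PX.A r e₀ ≡ false → C e₀ ≡ false → Crossing C z → ⊥
  pend {C} {r} {z} c h cross {e₀} ae ce cz@((d , pd , id') , (f , pf , (z₁ , j))) =
      -- Once `f` joins the component its ends `z` and `z₁` are no longer shared, yet
      -- two-connectedness still gives shared vertices `p` and `q`; that makes four attachments,
      -- where at most three are allowed.
      PX.fib≤3 {r} h (memF cz) (memF cz₁) (InF-p pX pY) (InF-p qX qY) z≢z₁ (away pX pY z-off) (away qX qY z-off) (away pX pY z₁-off) (away qX qY z₁-off) p≢q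
    where
    yf : Y f ≡ true
    yf = ∧-snd {C f} pf
    cf : C f ≡ true
    cf = ∧-fst pf
    d≢f : d ≢ f
    d≢f q = dis d (∧-snd {C d} pd) (subst (λ k → Y k ≡ true) (sym q) yf)
    z≢z₁ : z ≢ z₁
    z≢z₁ refl = noloop tc d≢f (joins-loop G j)
    sf : ∀ {k} → Y k ≡ true → Incident G k z → k ≡ f
    sf yk i = proj₂ (cross z cz) _ f (PY.A-in yk i refl) (PY.A-in yf (joins-inc G j) refl)
    sf₁ : ∀ {k} → Y k ≡ true → Incident G k z₁ → k ≡ f
    sf₁ yk i = proj₂ (cross z cz) _ f (PY.A-in yk i (PY.inc-rep yf (joins-inc₂ G j) (joins-inc G j))) (PY.A-in yf (joins-inc G j) refl)
    cz₁ : Crossing C z₁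
    cz₁ with cyc-cross G c (sing f) {f} {d} cf (sing-self f) (∧-fst pd) (sing-ne d≢f)
    ... | p , q , n , a , b , a' , b' = back (pick (ends-of a) (ends-of a'))
      where
      ends-of : ∀ {x} → InV G (C ⊓ sing f) x → x ≡ z ⊎ x ≡ z₁
      ends-of (k , r , i) with sing-elim {e = f} {k} (∧-snd {C k} r)
      ... | refl = joins-ends G j i
      pick : p ≡ z ⊎ p ≡ z₁ → q ≡ z ⊎ q ≡ z₁ → InV G (C ⊖ sing f) z₁
      pick (inj₂ refl) _ = b
      pick (inj₁ _) (inj₂ refl) = b'
      pick (inj₁ refl) (inj₁ refl) = ⊥-elim (n refl)
      back : InV G (C ⊖ sing f) z₁ → Crossing C z₁
      back (k , t , i) with cov k
      ... | inj₁ xk = (k , ∧-in (∧-fst t) xk , i) , (f , pf , joins-inc₂ G j)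
      ... | inj₂ yk = ⊥-elim (t≢f (trans (cong (sing f) (sf₁ yk i)) (sing-self f)) (⊖-snd {X = C} {sing f} t))
    memF : ∀ {x} → Crossing C x → PX.InF r x
    memF k@(a , b) = InV-mono G (λ g q → ∧-snd {C g} q) a , InV-mono G (λ g q → ∧-snd {C g} q) b , proj₁ (cross _ k)
    K : ESet m
    K = PX.A r ⊔ sing f
    -- `e₀` only certifies that `K` is not the whole edge set.
    e₀∉K : K e₀ ≡ false
    e₀∉K = ∨-nil ae (sing-ne {e = f} {e₀} λ { refl → t≢f cf ce })
    open TwoShared (tc K {f} {e₀} (∨-inr {PX.A r f} (sing-self f)) e₀∉K)
    notA : ∀ {k} → comp K k ≡ true → comp (PX.A r) k ≡ true
    notA {k} p = not-f (≢true λ q → t≢f (∨-inl q) (not-t p))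
    notf : ∀ {k} → comp K k ≡ true → k ≢ f
    notf {k} p q = t≢f (∨-inr {PX.A r k} (trans (cong (sing f) q) (sing-self f))) (not-t p)
    z-off : ∀ {k} → comp K k ≡ true → ¬ Incident G k z
    z-off p i = notf p (sf (PX.other (notA p) i (proj₁ (cross z cz))) i)
    z₁-off : ∀ {k} → comp K k ≡ true → ¬ Incident G k z₁
    z₁-off p i = notf p (sf₁ (PX.other (notA p) i (proj₁ (cross z₁ cz₁))) i)
    away : ∀ {x y} → InV G K x → InV G (comp K) x → (∀ {k} → comp K k ≡ true → ¬ Incident G k y) → y ≢ x
    away _ (k , p , i) off refl = off p i
    InF-p : ∀ {x} → InV G K x → InV G (comp K) x → PX.InF r x
    InF-p {x} (k , p , i) (l , q , i') with ∨-elim {PX.A r k} p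
    ... | inj₁ a = (k , PX.A⊑X k a , i) , (l , PX.other (notA q) i' (PX.A-rep a i) , i') , PX.A-rep a i
    ... | inj₂ b with sing-elim {e = f} {k} b
    ... | refl with joins-ends G j i
    ... | inj₁ refl = ⊥-elim (z-off q i')
    ... | inj₂ refl = ⊥-elim (z₁-off q i')

L≢B : ∀ {c} → c ≡ L → c ≢ B
L≢B refl ()

-- Excluding small excess

module Cases {m : ℕ} {G : Graph m} (Q : QuasiBiased G) (tc : TwoConn G) (NL : NonDeg Q L) (NF : NonDeg Q F)
             (no₁ : ¬ BalancedPart Q) (no₂ : ¬ BalancingPair Q)
             (X Y : ESet m) (cov : ∀ e → X e ≡ true ⊎ Y e ≡ true) (dis : ∀ e → X e ≡ true → Y e ≡ true → ⊥)
             (neX : NE X) (neY : NE Y) (SX : Span G X) (SY : Span G Y) where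

  module H = Half Q tc NL no₁ X Y cov dis neX neY SX SY
  module H' = Half Q tc NL no₁ Y X (λ e → Sum.swap (cov e)) (λ e p q → dis e q p) neY neX SY SX
  open H using (module PX; module PY)
  module NL = NonDeg NL
  module NF = NonDeg NF

  EX EY : ℕ
  EX = nsum PX.exc
  EY = nsum PY.exc

  singleY : Bal Q Y → ∀ {z} → InV G Y z → PY.exc (PY.rep z) ≤ 0 → Single (PY.A (PY.rep z))
  singleY bY i h = H'.small i h (λ C c s → bY C c (⊑-trans s PY.A⊑X))

  -- The case of order 1: all components have excess 0 and are single edges, and two of them would
  -- meet at a shared vertex.
  flat : Bal Q X → Bal Q Y → EX + EY ≤ 0 → ∀ {z} → InV G X z → InV G Y z → ⊥
  flat bX bY h {z} i j = H.adj i j (H.small i (≤-trans (nsum-≥ PX.exc _) (≤-trans (m≤m+n EX EY) h)) (λ C c s → bX C c (⊑-trans s PX.A⊑X)))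
    (singleY bY j (≤-trans (nsum-≥ PY.exc _) (≤-trans (m≤n+m EY EX) h)))

  module Balanced (bX : Bal Q X) (bY : Bal Q Y) (E≤2 : EX + EY ≤ 2) where

    singleX : ∀ {z} → InV G X z → PX.exc (PX.rep z) ≤ 0 → Single (PX.A (PX.rep z))
    singleX i h = H.small i h (λ C c s → bX C c (⊑-trans s PX.A⊑X))

    either : ∀ {z} → InV G X z → InV G Y z → 1 ≤ PX.exc (PX.rep z) ⊎ 1 ≤ PY.exc (PY.rep z)
    either {z} i j with 1 ≤? PX.exc (PX.rep z) | 1 ≤? PY.exc (PY.rep z)
    ... | yes p | _ = inj₁ p
    ... | no _ | yes q = inj₂ q
    ... | no p | no q = ⊥-elim (H.adj i j (singleX i (ℕₚ.≤-pred (ℕₚ.≰⇒> p))) (singleY bY j (ℕₚ.≤-pred (ℕₚ.≰⇒> q))))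

    bigX : ∀ {z} → InV G X z → InV G Y z → PY.exc (PY.rep z) ≤ 0 → 1 ≤ PX.exc (PX.rep z)
    bigX i j h with either i j
    ... | inj₁ p = p
    ... | inj₂ q = ⊥-elim (ℕₚ.<-irrefl refl (≤-trans q h))

    bigY : ∀ {z} → InV G X z → InV G Y z → PX.exc (PX.rep z) ≤ 0 → 1 ≤ PY.exc (PY.rep z)
    bigY i j h with either i j
    ... | inj₂ p = p
    ... | inj₁ q = ⊥-elim (ℕₚ.<-irrefl refl (≤-trans q h))

    EX≤2 : EX ≤ 2
    EX≤2 = ≤-trans (m≤m+n EX EY) E≤2

    EY≤ : ∀ {a b} → a ≤ EX → a + b ≡ 2 → EY ≤ b
    EY≤ {a} p q = ℕₚ.+-cancelˡ-≤ a _ _ (≤-trans (+-mono-≤ p (≤-refl {EY})) (≤-trans E≤2 (≤-reflexive (sym q))))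

    module _ {z₀ : Fin (nV G)} (x₀ : InV G X z₀) (y₀ : InV G Y z₀) (big : 1 ≤ PX.exc (PX.rep z₀)) where

      r₀ : Fin (nV G)
      r₀ = PX.rep z₀

      -- The component `r₀` takes the whole excess 2 and with it all shared vertices, at most four.
      -- Every component of `Y` is a single edge using two of them, so `Y` consists of `f` and `g`,
      -- a balancing pair because `X` is balanced.
      four : 2 ≤ PX.exc r₀ → ∀ {f g} → f ≢ g → Y f ≡ true → Y g ≡ true → ⊥
      four h {f} {g} f≢g yf yg = no₂ (record { f = f ; g = g ; f≢g = f≢g ; bal = λ C c cf cg → bX C c (λ k ck → inX k ck cf cg) })
        where
        EY0 : EY ≤ 0
        EY0 = EY≤ {2} (≤-trans h (nsum-≥ PX.exc r₀)) refl
        excY : ∀ r → PY.exc r ≤ 0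
        excY r = ≤-trans (nsum-≥ PY.exc r) EY0
        all-r₀ : ∀ {z} → InV G X z → InV G Y z → PX.rep z ≡ r₀
        all-r₀ {z} i j with PX.rep z ≟ r₀
        ... | yes p = p
        ... | no n = ⊥-elim (ℕₚ.<-irrefl refl (≤-trans (+-mono-≤ (bigX i j (excY _)) h) (≤-trans (nsum-≥₂ PX.exc _ r₀ n) EX≤2)))
        Sh≤ : count PY.Sh ≤ 4
        Sh≤ = ≤-trans (count-mono {f = PY.Sh} {PX.fib r₀} λ z p →
                let y = vset-out G {Y} (∧-fst p) ; x = vset-out G {X} (∧-snd {vset G Y z} p) in PX.fib-in (x , y , all-r₀ x y))
              (PX.exc≤→ {r₀} (≤-trans (nsum-≥ PX.exc r₀) EX≤2))
        rootY : ESet (nV G)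
        rootY = PY.root
        root≤ : count rootY ≤ 2
        root≤ with 3 ≤? count rootY
        ... | no n = ℕₚ.≤-pred (ℕₚ.≰⇒> n)
        ... | yes p = case ≤-trans (+-mono-≤ p p) (≤-trans (m≤n+m (count rootY + count rootY) EY)
                        (≤-trans (≤-reflexive PY.exc-sum) Sh≤)) of λ { (s≤s (s≤s (s≤s (s≤s ())))) }
        rt : ∀ {k} → Y k ≡ true → PY.root (PY.rep (src G k)) ≡ true
        rt {k} yk = ∧-in (dec-true (PY.rep (PY.rep (src G k)) ≟ PY.rep (src G k)) (Span.idem SY (src G k)))
          (vset-in G (conn-InV G (conn-mono G (Span.T⊑X SY) (Span.toRep SY (src G k))) (k , yk , inc-src G k)))
        diff : ∀ {k l} → Y k ≡ true → Y l ≡ true → k ≢ l → PY.rep (src G k) ≢ PY.rep (src G l)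
        diff {k} {l} yk yl n p = n (singleY bY (k , yk , inc-src G k) (excY _) k l (PY.A-in yk (inc-src G k) refl) (PY.A-in yl (inc-src G l) (sym p)))
        inX : ∀ k {C : ESet m} → C k ≡ true → C f ≡ false → C g ≡ false → X k ≡ true
        inX k {C} ck cf cg with cov k
        ... | inj₁ xk = xk
        ... | inj₂ yk = ⊥-elim (ℕₚ.<-irrefl refl (≤-trans (count-≥ PY.root (_ ∷ _ ∷ _ ∷ [])
                ((diff yf yg f≢g ∷ diff yf yk (λ { refl → t≢f ck cf }) ∷ []) ∷ (diff yg yk (λ { refl → t≢f ck cg }) ∷ []) ∷ ([] ∷ []))
                (rt yf ∷ rt yg ∷ rt yk ∷ [])) root≤))

      to-cross : ∀ {C z} → InV G (C ⊓ X) z → InV G (C ⊖ X) z → H.Crossing C z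
      to-cross {C} a (k , p , i) = a , (k , ∧-in (∧-fst p) (y k (⊖-snd {X = C} {X} p)) , i)
        where
        y : ∀ k → X k ≡ false → Y k ≡ true
        y k q with cov k
        ... | inj₁ xk = ⊥-elim (t≢f xk q)
        ... | inj₂ yk = yk

      -- Outside `B`, `C` must cross between the sides, away from `r₀`. The one unit of excess left
      -- over from `r₀` then sits on a single component carrying all crossings of `C`, with single
      -- edges opposite; `pend` excludes this, whichever side that component is on.
      avoid : PX.exc r₀ ≤ 1 → ∀ C → Cyc G C → κ Q C ≢ B → (∀ e → C e ≡ true → PX.A r₀ e ≡ false) → ⊥
      avoid h C c nb off = start (⋢ (λ s → nb (bX C c s))) (⋢ (λ s → nb (bY C c s)))
        where
        e₀ : Fin m
        e₀ = proj₁ (PX.in-A x₀)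
        e₀A : PX.A r₀ e₀ ≡ true
        e₀A = proj₁ (proj₂ (PX.in-A x₀))
        e₀C : C e₀ ≡ false
        e₀C = ≢true λ p → t≢f e₀A (off e₀ p)
        sX : ∀ {z} → H.Crossing C z → InV G X z
        sX (a , _) = InV-mono G (λ g q → ∧-snd {C g} q) a
        sY : ∀ {z} → H.Crossing C z → InV G Y z
        sY (_ , b) = InV-mono G (λ g q → ∧-snd {C g} q) b
        not-r₀ : ∀ {z} → H.Crossing C z → PX.rep z ≢ r₀
        not-r₀ ((k , p , i) , _) q = t≢f (PX.A-in (∧-snd {C k} p) i q) (off k (∧-fst p))
        go : ∀ {z} → H.Crossing C z → 1 ≤ PX.exc (PX.rep z) ⊎ 1 ≤ PY.exc (PY.rep z) → ⊥
        go {z} cz (inj₁ p) = H.pend {C} {r₁} c r₁≤1 cross {e₀} (≢true λ a → n (trans (sym (PX.A-rep a (inc-src G e₀))) (PX.A-rep e₀A (inc-src G e₀)))) e₀C cz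
          where
          r₁ : Fin (nV G)
          r₁ = PX.rep z
          n : r₁ ≢ r₀
          n = not-r₀ cz
          EY0 : EY ≤ 0
          EY0 = EY≤ {2} (≤-trans (+-mono-≤ p big) (nsum-≥₂ PX.exc r₁ r₀ n)) refl
          r₁≤1 : PX.exc r₁ ≤ 1
          r₁≤1 = ℕₚ.+-cancelʳ-≤ 1 _ _ (≤-trans (+-mono-≤ (≤-refl {PX.exc r₁}) big) (≤-trans (nsum-≥₂ PX.exc r₁ r₀ n) EX≤2))
          cross : ∀ z → H.Crossing C z → PX.rep z ≡ r₁ × Single (PY.A (PY.rep z))
          cross z' cz' = eq , singleY bY (sY cz') e0
            where
            e0 : PY.exc (PY.rep z') ≤ 0
            e0 = ≤-trans (nsum-≥ PY.exc _) EY0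
            eq : PX.rep z' ≡ r₁
            eq with PX.rep z' ≟ r₁
            ... | yes q = q
            ... | no q = ⊥-elim (ℕₚ.<-irrefl refl (≤-trans (+-mono-≤ (bigX (sX cz') (sY cz') e0) (+-mono-≤ p big))
                    (≤-trans (nsum-≥₃ PX.exc _ r₁ r₀ q (not-r₀ cz') n) EX≤2)))
        go {z} cz (inj₂ p) = H'.pend {C} {r₁} c r₁≤1 (λ z' (a , b) → cross z' (b , a)) {e₀} (≢true λ a → dis e₀ (PX.A⊑X e₀ e₀A) (PY.A⊑X e₀ a)) e₀C (proj₂ cz , proj₁ cz)
          where
          r₁ : Fin (nV G)
          r₁ = PY.rep z
          EY1 : EY ≤ 1
          EY1 = EY≤ {1} (≤-trans big (nsum-≥ PX.exc r₀)) refl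
          EX1 : EX ≤ 1
          EX1 = ℕₚ.+-cancelʳ-≤ 1 _ _ (≤-trans (+-mono-≤ (≤-refl {EX}) (≤-trans p (nsum-≥ PY.exc r₁))) E≤2)
          r₁≤1 : PY.exc r₁ ≤ 1
          r₁≤1 = ≤-trans (nsum-≥ PY.exc r₁) EY1
          cross : ∀ z → H.Crossing C z → PY.rep z ≡ r₁ × Single (PX.A (PX.rep z))
          cross z' cz' = eq , singleX (sX cz') e0
            where
            e0 : PX.exc (PX.rep z') ≤ 0
            e0 = ℕₚ.+-cancelʳ-≤ 1 _ _ (≤-trans (+-mono-≤ (≤-refl {PX.exc (PX.rep z')}) big) (≤-trans (nsum-≥₂ PX.exc _ r₀ (not-r₀ cz')) EX1))
            eq : PY.rep z' ≡ r₁
            eq with PY.rep z' ≟ r₁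
            ... | yes q = q
            ... | no q = ⊥-elim (ℕₚ.<-irrefl refl (≤-trans (+-mono-≤ (bigY (sX cz') (sY cz') e0) p) (≤-trans (nsum-≥₂ PY.exc _ r₁ q) EY1)))
        start : ∃[ e ] (C e ≡ true × X e ≡ false) → ∃[ e ] (C e ≡ true × Y e ≡ false) → ⊥
        start (a , ca , xa) (b , cb , yb) with cyc-cross G c X {b} {a} cb (case cov b of λ { (inj₁ x) → x ; (inj₂ y) → ⊥-elim (t≢f y yb) }) ca xa
        ... | z , _ , _ , i , j , _ = let cz = to-cross {C} i j in go cz (either (sX cz) (sY cz))

      record Passes (C : ESet m) : Set where
        field
          p q : Fin (nV G)
          p≢q : p ≢ q
          pC  : InV G C p
          qC  : InV G C q
          pF  : PX.InF r₀ p
          qF  : PX.InF r₀ q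

      passes : PX.exc r₀ ≤ 1 → ∀ C → Cyc G C → κ Q C ≢ B → Passes C
      passes h C c nb with NE? (C ⊓ PX.A r₀)
      ... | no n = ⊥-elim (avoid h C c nb (λ e p → ≢true λ a → n (e , ∧-in p a)))
      ... | yes (e , t) = go (⋢ (λ s → nb (bX C c (⊑-trans s PX.A⊑X))))
        where
        F' : ∀ {x} → InV G (C ⊓ PX.A r₀) x → InV G (C ⊖ PX.A r₀) x → PX.InF r₀ x
        F' a b = let a' = InV-mono G (λ g q → ∧-snd {C g} q) a in
          InV-mono G PX.A⊑X a' , PX.attach a' (InV-mono G (λ g q → ∧-snd {C g} q) b) , PX.AV-rep a'
        go : ∃[ f ] (C f ≡ true × PX.A r₀ f ≡ false) → Passes C
        go (f , cf , af) = let (p , q , n , a , b , a' , b') = cyc-cross G c (PX.A r₀) (∧-fst t) (∧-snd {C e} t) cf af in record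
          { p≢q = n ; pC = InV-mono G (λ _ → ∧-fst) a ; qC = InV-mono G (λ _ → ∧-fst) a' ; pF = F' a b ; qF = F' a' b' }

      -- Each of the two disjoint cycles of `L` passes through two attachments of `r₀`, which has
      -- only three.
      three : PX.exc r₀ ≤ 1 → ⊥
      three h = PX.fib≤3 {r₀} h P₁.pF P₁.qF P₂.pF P₂.qF P₁.p≢q (ne P₁.pC P₂.pC) (ne P₁.pC P₂.qC) (ne P₁.qC P₂.pC) (ne P₁.qC P₂.qC) P₂.p≢q
        where
        module P₁ = Passes (passes h NL.C NL.cycC (L≢B NL.κC))
        module P₂ = Passes (passes h NL.D NL.cycD (L≢B NL.κD))
        ne : ∀ {x y} → InV G NL.C x → InV G NL.D y → x ≢ y
        ne a b refl = NL.apart (_ , a , b)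

      contra : ∀ {f g} → f ≢ g → Y f ≡ true → Y g ≡ true → ⊥
      contra n p q with 2 ≤? PX.exc r₀
      ... | yes h = four h n p q
      ... | no h = three (ℕₚ.≤-pred (ℕₚ.≰⇒> h))

  module Unbalanced (bY : Bal Q Y) (EX0 : EX ≤ 0) (EY0 : EY ≤ 0) where

    excX : ∀ r → PX.exc r ≤ 0
    excX r = ≤-trans (nsum-≥ PX.exc r) EX0

    single : ∀ {z} → InV G Y z → Single (PY.A (PY.rep z))
    single i = singleY bY i (≤-trans (nsum-≥ PY.exc _) EY0)

    unbal : ∀ {z} → InV G X z → InV G Y z → Unbal Q (PX.A (PX.rep z))
    unbal {z} i j with bal? Q (PX.A (PX.rep z))
    ... | inj₂ u = u
    ... | inj₁ b = ⊥-elim (H.adj i j (H.small i (excX _) b) (single j))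

    -- If `D` uses edges of the component of `p₁`, it leaves through both of its attachments, one
    -- being `p₁`. Otherwise its two edges at `y₁` both lie in `Y`, where the component at `y₁` is a
    -- single edge.
    thru : ∀ {p₁ r₂ y₁ y₂ D} → InV G X p₁ → InV G Y p₁ → r₂ ≢ PX.rep p₁ → Cyc G D →
      InV G D y₁ → InV G (PX.A (PX.rep p₁)) y₁ → InV G D y₂ → PX.rep y₂ ≡ r₂ → InV G D p₁
    thru {p₁} {r₂} {y₁} {y₂} {D} xp yp n d (d₁ , dd₁ , i₁) a₁ (d₂ , dd₂ , i₂) q = go (NE? (D ⊓ PX.A r₁))
      where
      r₁ : Fin (nV G)
      r₁ = PX.rep p₁
      d₂∉ : PX.A r₁ d₂ ≡ false
      d₂∉ = ≢true λ a → n (trans (sym q) (PX.A-rep a i₂))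
      go : Dec (NE (D ⊓ PX.A r₁)) → InV G D p₁
      go (yes (e , t)) with cyc-cross G d (PX.A r₁) (∧-fst t) (∧-snd {D e} t) dd₂ d₂∉
      ... | p , s , p≢s , a , b , a' , b' with p₁ ≟ p | p₁ ≟ s
      ... | yes refl | _ = InV-mono G (λ _ → ∧-fst) a
      ... | no _ | yes refl = InV-mono G (λ _ → ∧-fst) a'
      ... | no u | no v = ⊥-elim (PX.fib≤2 {r₁} (excX r₁) (xp , yp , refl) (F' a b) (F' a' b') u v p≢s)
        where
        F' : ∀ {x} → InV G (D ⊓ PX.A r₁) x → InV G (D ⊖ PX.A r₁) x → PX.InF r₁ x
        F' a b = let a' = InV-mono G (λ g q → ∧-snd {D g} q) a in
          InV-mono G PX.A⊑X a' , PX.attach a' (InV-mono G (λ g q → ∧-snd {D g} q) b) , PX.AV-rep a'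
      go (no ne) = ⊥-elim (stuck (⋢ not-single))
        where
        offA : ∀ {k} → D k ≡ true → comp (PX.A r₁) k ≡ true
        offA {k} p = not-f (≢true λ a → ne (k , ∧-in p a))
        r-y₁ : PX.rep y₁ ≡ r₁
        r-y₁ = PX.AV-rep a₁
        inY : ∀ {k} → D k ≡ true → Incident G k y₁ → Y k ≡ true
        inY p i = PX.other (offA p) i r-y₁
        e₁ : Fin m
        e₁ = proj₁ a₁
        loopless : src G d₁ ≢ tgt G d₁
        loopless = noloop tc {d₁} {e₁} λ { refl → dis d₁ (PX.A⊑X d₁ (proj₁ (proj₂ a₁))) (inY dd₁ i₁) }
        not-single : ¬ D ⊑ sing d₁
        not-single s = t≢f (xsum-one d₁ (∧-in dd₁ (cong₂ _xor_ (sing-self (src G d₁)) (sing-ne (loopless ∘ sym))))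
            (λ k r → ∧-f₁ (≢true λ p → r (sing-elim {e = d₁} {k} (s k p))))) (Cyc.even d (sing (src G d₁)))
        stuck : ∃[ k ] (D k ≡ true × sing d₁ k ≡ false) → ⊥
        stuck (k , dk , sk) with cyc-cross G d (sing d₁) {d₁} {k} dd₁ (sing-self d₁) dk sk
        ... | p , s , p≢s , a , b , a' , b' = fin (pick (ends-of a) (ends-of a'))
          where
          other-end : Fin (nV G)
          other-end = proj₁ i₁
          ends-of : ∀ {x} → InV G (D ⊓ sing d₁) x → x ≡ y₁ ⊎ x ≡ other-end
          ends-of (l , t , i) with sing-elim {e = d₁} {l} (∧-snd {D l} t)
          ... | refl = joins-ends G (proj₂ i₁) i
          pick : p ≡ y₁ ⊎ p ≡ other-end → s ≡ y₁ ⊎ s ≡ other-end → InV G (D ⊖ sing d₁) y₁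
          pick (inj₁ refl) _ = b
          pick (inj₂ _) (inj₁ refl) = b'
          pick (inj₂ refl) (inj₂ refl) = ⊥-elim (p≢s refl)
          fin : InV G (D ⊖ sing d₁) y₁ → ⊥
          fin (l , t , i) = t≢f (trans (cong (sing d₁) (single (d₁ , inY dd₁ i₁ , i₁) l d₁ (PY.A-in (inY (∧-fst t) i) i refl) (PY.A-in (inY dd₁ i₁) i₁ refl))) (sing-self d₁))
            (⊖-snd {X = D} {sing d₁} t)

    -- The two ends of `g` and the end `p₁` of `f` cannot all be attachments of one component of
    -- `X`, so some end of `g` lies on a different one. The two components contain disjoint cycles
    -- outside `B`, necessarily of one class; both cycles of the disjoint pair of the other class
    -- meet both, hence pass through `p₁`.
    contra : ∀ {f g} → f ≢ g → Y f ≡ true → Y g ≡ true → ⊥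
    contra {f} {g} f≢g yf yg = pick (PX.rep T₂.p ≟ PX.rep p₁) (PX.rep T₂.q ≟ PX.rep p₁)
      where
      module T₁ = PY.Two (PY.two (f , yf , inc-src G f))
      module T₂ = PY.Two (PY.two (g , yg , inc-src G g))
      p₁ : Fin (nV G)
      p₁ = T₁.p
      Yp₁ : InV G Y p₁
      Yp₁ = InV-mono G PY.A⊑X T₁.pA
      sep : ∀ {x} → InV G (PY.A (PY.rep (src G g))) x → p₁ ≢ x
      sep b refl = f≢g (single (f , yf , inc-src G f) f g (PY.A-in yf (inc-src G f) refl)
        (PY.A-in yg (inc-src G g) (trans (sym (PY.AV-rep b)) (PY.AV-rep T₁.pA))))
      main : ∀ {z} → InV G X z → InV G Y z → PX.rep z ≢ PX.rep p₁ → ⊥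
      main {z} xz yz n = go (unbal T₁.pY Yp₁) (unbal xz yz)
        where
        go : Unbal Q (PX.A (PX.rep p₁)) → Unbal Q (PX.A (PX.rep z)) → ⊥
        go (C₁ , c₁ , s₁ , k₁) (C₂ , c₂ , s₂ , k₂) = cls-cases (nonB k₁) (nonB k₂)
          where
          apart : ¬ Meet Q C₁ C₂
          apart (x , a , b) = n (trans (sym (PX.AV-rep (InV-mono G s₂ b))) (PX.AV-rep (InV-mono G s₁ a)))
          t : ∀ {D} → Cyc G D → Meet Q D C₁ → Meet Q D C₂ → InV G D p₁
          t d (y₁ , a , b) (y₂ , a' , b') = thru T₁.pY Yp₁ n d a (InV-mono G s₁ b) a' (PX.AV-rep (InV-mono G s₂ b'))
          cls-cases : κ Q C₁ ≡ L ⊎ κ Q C₁ ≡ F → κ Q C₂ ≡ L ⊎ κ Q C₂ ≡ F → ⊥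
          cls-cases (inj₁ l) (inj₂ f) = apart (LF-meet Q c₁ c₂ l f)
          cls-cases (inj₂ f) (inj₁ l) = apart (meet-sym Q (LF-meet Q c₂ c₁ l f))
          cls-cases (inj₁ l₁) (inj₁ l₂) = NF.apart (p₁ ,
            t NF.cycC (meet-sym Q (LF-meet Q c₁ NF.cycC l₁ NF.κC)) (meet-sym Q (LF-meet Q c₂ NF.cycC l₂ NF.κC)) ,
            t NF.cycD (meet-sym Q (LF-meet Q c₁ NF.cycD l₁ NF.κD)) (meet-sym Q (LF-meet Q c₂ NF.cycD l₂ NF.κD)))
          cls-cases (inj₂ f₁) (inj₂ f₂) = NL.apart (p₁ ,
            t NL.cycC (LF-meet Q NL.cycC c₁ NL.κC f₁) (LF-meet Q NL.cycC c₂ NL.κC f₂) ,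
            t NL.cycD (LF-meet Q NL.cycD c₁ NL.κD f₁) (LF-meet Q NL.cycD c₂ NL.κD f₂))
      pick : Dec (PX.rep T₂.p ≡ PX.rep p₁) → Dec (PX.rep T₂.q ≡ PX.rep p₁) → ⊥
      pick (no n) _ = main T₂.pY (InV-mono G PY.A⊑X T₂.pA) n
      pick (yes _) (no n) = main T₂.qY (InV-mono G PY.A⊑X T₂.qA) n
      pick (yes a) (yes b) = PX.fib≤2 {PX.rep p₁} (excX _) (T₁.pY , Yp₁ , refl) (T₂.pY , InV-mono G PY.A⊑X T₂.pA , a)
        (T₂.qY , InV-mono G PY.A⊑X T₂.qA , b) (sep T₂.pA) (sep T₂.qA) T₂.p≢q

-- From rank inequalities to three-connectedness

excess-bound : ∀ {tx ty px py vx vy ve sh ex ey ux uy rx ry re k} →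
  tx + px ≡ vx → ty + py ≡ vy → vx + vy ≡ ve + sh → ux + tx ≤ rx → uy + ty ≤ ry → re ≤ ve →
  rx + ry < k + re → ex + (px + px) ≡ sh → ey + (py + py) ≡ sh →
  2 + ((ux + uy) + (ux + uy) + (ex + ey)) ≤ k + k
excess-bound {tx} {ty} {px} {py} {vx} {vy} {ve} {sh} {ex} {ey} {ux} {uy} {rx} {ry} {re} {k} refl refl v hx hy he lt sx sy =
  ℕₚ.+-cancelʳ-≤ ((px + py) + (px + py)) _ _ (≤-trans (≤-reflexive rearr) (≤-trans (+-mono-≤ half half) (≤-reflexive swap)))
  where
  open +-*-Solver
  -- Forest sizes and inclusion-exclusion for the vertex sets turn the separation into this
  -- inequality. It is doubled because `sh` is expressed both through `ex` and through `ey`.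
  half : 1 + (ux + uy) + sh ≤ k + (px + py)
  half = ℕₚ.+-cancelˡ-≤ ve _ _ (≤-trans (≤-reflexive
      (trans (solve 3 (λ ve u sh → ve :+ (con 1 :+ u :+ sh) := con 1 :+ u :+ (ve :+ sh)) refl ve (ux + uy) sh)
        (trans (cong (1 + (ux + uy) +_) (sym v))
          (solve 6 (λ ux uy tx px ty py → con 1 :+ (ux :+ uy) :+ ((tx :+ px) :+ (ty :+ py)) := (con 1 :+ ((ux :+ tx) :+ (uy :+ ty))) :+ (px :+ py)) refl ux uy tx px ty py))))
      (≤-trans (+-mono-≤ (≤-trans (s≤s (+-mono-≤ hx hy)) (≤-trans lt (ℕₚ.+-monoʳ-≤ k he))) (≤-refl {px + py}))
        (≤-reflexive (solve 3 (λ k ve p → k :+ ve :+ p := ve :+ (k :+ p)) refl k ve (px + py)))))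
  rearr : 2 + ((ux + uy) + (ux + uy) + (ex + ey)) + ((px + py) + (px + py)) ≡ (1 + (ux + uy) + sh) + (1 + (ux + uy) + sh)
  rearr = trans (solve 5 (λ u ex ey px py → con 2 :+ (u :+ u :+ (ex :+ ey)) :+ ((px :+ py) :+ (px :+ py)) :=
                    (con 1 :+ u :+ (ex :+ (px :+ px))) :+ (con 1 :+ u :+ (ey :+ (py :+ py)))) refl (ux + uy) ex ey px py)
            (cong₂ (λ a b → (1 + (ux + uy) + a) + (1 + (ux + uy) + b)) sx sy)
  swap : (k + (px + py)) + (k + (px + py)) ≡ (k + k) + ((px + py) + (px + py))
  swap = +-swap k (px + py) k (px + py)

module _ {m : ℕ} {G : Graph m} (Q : QuasiBiased G) (tc : TwoConn G) (NL : NonDeg Q L) (NF : NonDeg Q F)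
         (no₁ : ¬ BalancedPart Q) (no₂ : ¬ BalancingPair Q) where

  vset-sum : ∀ X → count (vset G X) + count (vset G (comp X)) ≡
    count (vset G all) + count (λ z → vset G X z ∧ vset G (comp X) z)
  vset-sum X = trans (sym (nsum-+ (b2n ∘ vset G X) (b2n ∘ vset G (comp X))))
    (trans (nsum-cong (λ z → aux z)) (nsum-+ (b2n ∘ vset G all) (λ z → b2n (vset G X z ∧ vset G (comp X) z))))
    where
    or : ∀ z → vset G all z ≡ vset G X z ∨ vset G (comp X) z
    or z = true-iff
      (λ p → let (e , _ , i) = vset-out G {all} {z} p in case bool-cases (X e) of λ where
        (inj₁ a) → ∨-inl (vset-in G {X} {z} (e , a , i))
        (inj₂ b) → ∨-inr {vset G X z} (vset-in G {comp X} {z} (e , not-f b , i)))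
      (λ p → vset-in G {all} {z} (case ∨-elim {vset G X z} p of λ where
        (inj₁ a) → InV-mono G {X} {all} (λ _ _ → refl) (vset-out G {X} {z} a)
        (inj₂ b) → InV-mono G {comp X} {all} (λ _ _ → refl) (vset-out G {comp X} {z} b)))
    bool : ∀ a b → b2n a + b2n b ≡ b2n (a ∨ b) + b2n (a ∧ b)
    bool true true = refl
    bool true false = refl
    bool false true = refl
    bool false false = refl
    aux : ∀ z → b2n (vset G X z) + b2n (vset G (comp X) z) ≡ b2n (vset G all z) + b2n (vset G X z ∧ vset G (comp X) z)
    aux z = trans (bool (vset G X z) (vset G (comp X) z)) (cong (λ b → b2n b + b2n (vset G X z ∧ vset G (comp X) z)) (sym (or z)))

  module NoSep (X : ESet m) (neX : NE X) (neY : NE (comp X)) (SX : Side Q X) (SY : Side Q (comp X)) where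
    Y : ESet m
    Y = comp X
    cov : ∀ e → X e ≡ true ⊎ Y e ≡ true
    cov e with X e
    ... | true = inj₁ refl
    ... | false = inj₂ refl
    dis : ∀ e → X e ≡ true → Y e ≡ true → ⊥
    dis e p q = t≢f p (not-t q)
    module SX = Side SX
    module SY = Side SY
    module K = Cases Q tc NL NF no₁ no₂ X Y cov dis neX neY SX.S SY.S
    module K' = Cases Q tc NL NF no₁ no₂ Y X (λ e → Sum.swap (cov e)) (λ e p q → dis e q p) neY neX SY.S SX.S
    open K.H using (module PX; module PY)

    bound : ∀ {rx ry re k} → count SX.I ≤ rx → count SY.I ≤ ry → re ≤ count (vset G all) → rx + ry < k + re →
      2 + ((SX.u + SY.u) + (SX.u + SY.u) + (K.EX + K.EY)) ≤ k + k
    bound hx hy he lt = excess-bound {count (Span.T SX.S)} {count (Span.T SY.S)} {count (roots Q SX.S)} {count (roots Q SY.S)} {ex = K.EX} {K.EY} {SX.u} {SY.u} (forest-size Q SX.S) (forest-size Q SY.S) (vset-sum X)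
      (≤-trans {SX.u + count (Span.T SX.S)} (≤-reflexive (sym SX.size)) hx) (≤-trans {SY.u + count (Span.T SY.S)} (≤-reflexive (sym SY.size)) hy) he lt
      PX.exc-sum (trans PY.exc-sum (count-cong (λ z → ∧-comm (vset G Y z) (vset G X z))))

    zShared : TwoShared G X
    zShared = tc X (proj₂ neX) (not-t (proj₂ neY))

    -- j + 1 is the order of the separation
    go : ∀ j → j ≤ 1 → (j ≡ 1 → ∃[ f ] ∃[ g ] (f ≢ g × X f ≡ true × X g ≡ true)) →
         (j ≡ 1 → ∃[ f ] ∃[ g ] (f ≢ g × Y f ≡ true × Y g ≡ true)) →
         2 + ((SX.u + SY.u) + (SX.u + SY.u) + (K.EX + K.EY)) ≤ suc j + suc j → ⊥
    go j j≤ twoX twoY h with SX.kind | SY.kind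
    ... | inj₁ (refl , bX) | inj₁ (refl , bY) = bal j j≤ twoX twoY h
      where
      open TwoShared zShared using (p; pX; pY)
      bal : ∀ j → j ≤ 1 → (j ≡ 1 → ∃[ f ] ∃[ g ] (f ≢ g × X f ≡ true × X g ≡ true)) →
         (j ≡ 1 → ∃[ f ] ∃[ g ] (f ≢ g × Y f ≡ true × Y g ≡ true)) → 2 + (K.EX + K.EY) ≤ suc j + suc j → ⊥
      bal zero _ _ _ (s≤s (s≤s h)) = K.flat bX bY h pX pY
      bal (suc (suc _)) (s≤s ()) _ _ _
      bal (suc zero) _ twoX twoY (s≤s (s≤s h)) with K.Balanced.either bX bY h pX pY
      ... | inj₁ big = let (f , g , n , a , b) = twoY refl in K.Balanced.contra bX bY h pX pY big n a b
      ... | inj₂ big = let (f , g , n , a , b) = twoX refl in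
              K'.Balanced.contra bY bX (≤-trans (≤-reflexive (+-comm K.EY K.EX)) h) pY pX big n a b
    go zero j≤ _ _ (s≤s (s≤s ())) | inj₂ (refl , uX) | inj₁ (refl , bY)
    go (suc (suc _)) (s≤s ()) _ _ _ | inj₂ (refl , uX) | inj₁ (refl , bY)
    go (suc zero) j≤ twoX twoY (s≤s (s≤s (s≤s (s≤s h)))) | inj₂ (refl , uX) | inj₁ (refl , bY) =
      let (f , g , n , a , b) = twoY refl in
      K.Unbalanced.contra bY (≤-trans (m≤m+n K.EX K.EY) h) (≤-trans (m≤n+m K.EY K.EX) h) n a b
    go zero j≤ _ _ (s≤s (s≤s ())) | inj₁ (refl , bX) | inj₂ (refl , uY)
    go (suc (suc _)) (s≤s ()) _ _ _ | inj₁ (refl , bX) | inj₂ (refl , uY)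
    go (suc zero) j≤ twoX twoY (s≤s (s≤s (s≤s (s≤s h)))) | inj₁ (refl , bX) | inj₂ (refl , uY) =
      let (f , g , n , a , b) = twoX refl in
      K'.Unbalanced.contra bX (≤-trans (m≤n+m K.EY K.EX) h) (≤-trans (m≤m+n K.EX K.EY) h) n a b
    go zero j≤ _ _ (s≤s (s≤s ())) | inj₂ (refl , uX) | inj₂ (refl , uY)
    go (suc (suc _)) (s≤s ()) _ _ _ | inj₂ (refl , uX) | inj₂ (refl , uY)
    go (suc zero) j≤ _ _ (s≤s (s≤s (s≤s (s≤s ())))) | inj₂ (refl , uX) | inj₂ (refl , uY)

  -- The sides enter through lower bounds on their ranks and the whole matroid through an upper
  -- bound, which is the direction the inequality of a separation needs.
  no-separation : ∀ j → j ≤ 1 → ∀ X → ¬ Separation (qbCircuit Q) (suc j) X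
  no-separation j j≤ X (rx , ry , re , RX , RY , RE , szX , szY , lt) =
      N.go j j≤ (λ { refl → two-elements X̂ (subst (2 ≤_) cX szX) }) (λ { refl → two-elements (comp X̂) (subst (2 ≤_) cY szY) })
        (N.bound (≤-trans (≤-reflexive (cI (Side.I SX))) (proj₂ RX (tabulate (Side.I SX)) (λ {x} p → lookup⇒[]= x X (Side.I⊑X SX x (tI p))) (ti (Side.ind SX))))
                 (≤-trans (≤-reflexive (cI (Side.I SY))) (proj₂ RY (tabulate (Side.I SY)) (λ {x} p → lookup⇒[]= x (∁ X) (trans (lookup-map x not X) (Side.I⊑X SY x (tI p)))) (ti (Side.ind SY))))
                 upper lt)
    where
    X̂ : ESet m
    X̂ = lookup X
    cX : ∣ X ∣ ≡ count X̂
    cX = ∣∣≡count X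
    cY : ∣ ∁ X ∣ ≡ count (comp X̂)
    cY = trans (∣∣≡count (∁ X)) (count-cong (λ e → lookup-map e not X))
    SX : Side Q X̂
    SX = side-of Q X̂
    SY : Side Q (comp X̂)
    SY = side-of Q (comp X̂)
    ne : ∀ {f : ESet m} {k} → suc k ≤ count f → NE f
    ne {f} h with NE? f
    ... | yes p = p
    ... | no n = case ≤-trans h (≤-reflexive (trans (count-cong (NE-not n)) (count-none {m}))) of λ ()
    module N = NoSep X̂ (ne (subst (suc j ≤_) cX szX)) (ne (subst (suc j ≤_) cY szY)) SX SY
    cI : ∀ I → count I ≡ ∣ tabulate I ∣
    cI I = trans (count-cong (λ e → sym (lookup∘tabulate I e))) (sym (∣∣≡count (tabulate I)))
    tI : ∀ {I : ESet m} {x} → x ∈ tabulate I → I x ≡ true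
    tI {I} {x} p = trans (sym (lookup∘tabulate I x)) ([]=⇒lookup p)
    ti : ∀ {I} → ¬ Dep Q I → Indep (qbCircuit Q) (tabulate I)
    ti {I} n = indep← Q λ d → n (dep-mono Q (λ e p → trans (sym (lookup∘tabulate I e)) p) d)
    upper : re ≤ count (vset G all)
    upper = let (J , _ , ind , sz) = proj₁ RE in
      ≤-trans (≤-reflexive (trans (sym sz) (∣∣≡count J))) (rank-upper Q (lookup J) (indep→ Q ind))

  three-connected : ThreeConnected (qbCircuit Q)
  three-connected X = no-separation 0 z≤n X , no-separation 1 ≤-refl X

-- Splitting the ground set

infixr 5 _◁_
_◁_ : ∀ {a} → Bool → ESet a → ESet (suc a)
(b ◁ A) zero = b
(b ◁ A) (suc i) = A i

◁-mono : ∀ {a} b {A A' : ESet a} → A ⊑ A' → b ◁ A ⊑ b ◁ A'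
◁-mono b s zero p = p
◁-mono b s (suc i) p = s i p

◁-up : ∀ {a} b {A : ESet a} → false ◁ A ⊑ b ◁ A
◁-up b (suc i) p = p

-- Separate numberings of the edges outside `R` (those kept) and inside it. `xs` is the property
-- that lets boundaries be computed on the two parts.
record Enum {m : ℕ} (R : ESet m) (a b : ℕ) : Set where
  field
    ιK     : Fin a → Fin m
    ιR     : Fin b → Fin m
    pick   : Fin m → Fin a ⊎ Fin b
    pick-K : ∀ i → pick (ιK i) ≡ inj₁ i
    pick-R : ∀ j → pick (ιR j) ≡ inj₂ j
    sect   : ∀ e → [ ιK , ιR ]′ (pick e) ≡ e
    K-out  : ∀ i → R (ιK i) ≡ false
    R-in   : ∀ j → R (ιR j) ≡ true
    xs     : ∀ f → xsum f ≡ xsum (f ∘ ιK) xor xsum (f ∘ ιR)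
    b≡     : b ≡ count R
    a+b≡   : a + b ≡ m

  glue : ESet a → ESet b → ESet m
  glue A Z e = [ A , Z ]′ (pick e)

  glue-K : ∀ A Z i → glue A Z (ιK i) ≡ A i
  glue-K A Z i = cong [ A , Z ]′ (pick-K i)

  glue-R : ∀ A Z j → glue A Z (ιR j) ≡ Z j
  glue-R A Z j = cong [ A , Z ]′ (pick-R j)

  data View (e : Fin m) : Set where
    inK : ∀ i → e ≡ ιK i → View e
    inR : ∀ j → e ≡ ιR j → View e

  view : ∀ e → View e
  view e with pick e | sect e
  ... | inj₁ i | p = inK i (sym p)
  ... | inj₂ j | p = inR j (sym p)

  ext : ∀ {X Y : ESet m} → X ∘ ιK ⊑ Y ∘ ιK → X ∘ ιR ⊑ Y ∘ ιR → X ⊑ Y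
  ext s t e p with view e
  ... | inK i refl = s i p
  ... | inR j refl = t j p

  glue-⊑ : ∀ {A Z X} → A ⊑ X ∘ ιK → Z ⊑ X ∘ ιR → glue A Z ⊑ X
  glue-⊑ {A} {Z} s t = ext (λ i p → s i (trans (sym (glue-K A Z i)) p)) (λ j p → t j (trans (sym (glue-R A Z j)) p))

  ⊑-glue : ∀ {A Z X} → X ∘ ιK ⊑ A → X ∘ ιR ⊑ Z → X ⊑ glue A Z
  ⊑-glue {A} {Z} s t = ext (λ i p → trans (glue-K A Z i) (s i p)) (λ j p → trans (glue-R A Z j) (t j p))

  glue-eta : ∀ X → glue (X ∘ ιK) (X ∘ ιR) ≗ X
  glue-eta X = ⊑-antisym (glue-⊑ (λ _ p → p) (λ _ p → p)) (⊑-glue (λ _ p → p) (λ _ p → p))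

  glue-cong : ∀ {A A' Z Z'} → A ≗ A' → Z ≗ Z' → glue A Z ≗ glue A' Z'
  glue-cong {A' = A'} {Z' = Z'} p q = ⊑-antisym
    (glue-⊑ (λ i r → trans (glue-K A' Z' i) (trans (sym (p i)) r)) (λ j r → trans (glue-R A' Z' j) (trans (sym (q j)) r)))
    (⊑-glue (λ i r → trans (p i) (trans (sym (glue-K A' Z' i)) r)) (λ j r → trans (q j) (trans (sym (glue-R A' Z' j)) r)))

enum : ∀ {m} (R : ESet m) → ∃[ a ] ∃[ b ] Enum R a b
enum {zero} R = 0 , 0 , record
  { ιK = λ () ; ιR = λ () ; pick = λ () ; pick-K = λ () ; pick-R = λ () ; sect = λ () ; K-out = λ () ; R-in = λ ()
  ; xs = λ f → refl ; b≡ = refl ; a+b≡ = refl }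
enum {suc m} R with R zero in eq | enum (R ∘ suc)
... | false | a , b , E = suc a , b , record
  { ιK = ιK' ; ιR = suc ∘ ιR
  ; pick = λ { zero → inj₁ zero ; (suc e) → Sum.map₁ suc (pick e) }
  ; pick-K = λ { zero → refl ; (suc i) → cong (Sum.map₁ suc) (pick-K i) }
  ; pick-R = λ j → cong (Sum.map₁ suc) (pick-R j)
  ; sect = λ { zero → refl ; (suc e) → trans (aux (pick e)) (cong suc (sect e)) }
  ; K-out = λ { zero → eq ; (suc i) → K-out i } ; R-in = R-in
  ; xs = λ f → trans (cong (f zero xor_) (xs (f ∘ suc))) (sym (xor-assoc (f zero) _ _))
  ; b≡ = trans b≡ (cong (_+ count (R ∘ suc)) (sym (cong b2n eq))) ; a+b≡ = cong suc a+b≡ }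
  where
  open Enum E
  ιK' : Fin (suc a) → Fin (suc m)
  ιK' zero = zero
  ιK' (suc i) = suc (ιK i)
  aux : ∀ s → [ ιK' , suc ∘ ιR ]′ (Sum.map₁ suc s) ≡ suc ([ ιK , ιR ]′ s)
  aux (inj₁ i) = refl
  aux (inj₂ j) = refl
... | true | a , b , E = a , suc b , record
  { ιK = suc ∘ ιK ; ιR = ιR'
  ; pick = λ { zero → inj₂ zero ; (suc e) → Sum.map₂ suc (pick e) }
  ; pick-R = λ { zero → refl ; (suc i) → cong (Sum.map₂ suc) (pick-R i) }
  ; pick-K = λ j → cong (Sum.map₂ suc) (pick-K j)
  ; sect = λ { zero → refl ; (suc e) → trans (aux (pick e)) (cong suc (sect e)) }
  ; R-in = λ { zero → eq ; (suc i) → R-in i } ; K-out = K-out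
  ; xs = λ f → trans (cong (f zero xor_) (xs (f ∘ suc))) (x3 (f zero) (xsum (f ∘ suc ∘ ιK)) (xsum (f ∘ suc ∘ ιR)))
  ; b≡ = trans (cong suc b≡) (cong (_+ count (R ∘ suc)) (sym (cong b2n eq))) ; a+b≡ = trans (+-suc a b) (cong suc a+b≡) }
  where
  open Enum E
  ιR' : Fin (suc b) → Fin (suc m)
  ιR' zero = zero
  ιR' (suc i) = suc (ιR i)
  aux : ∀ s → [ suc ∘ ιK , ιR' ]′ (Sum.map₂ suc s) ≡ suc ([ ιK , ιR ]′ s)
  aux (inj₁ i) = refl
  aux (inj₂ j) = refl
  x3 : ∀ x y z → x xor (y xor z) ≡ y xor (x xor z)
  x3 true true true = refl
  x3 true true false = refl
  x3 true false z = refl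
  x3 false y z = refl

-- 2-sums through families of dependent sets

record Min {m : ℕ} (D : ESet m → Set) (X : ESet m) : Set where
  constructor mkMin
  field
    dep : D X
    min : ∀ Y → Y ⊑ X → D Y → X ⊑ Y

min-resp : ∀ {m} {D : ESet m → Set} → (∀ {X Y} → X ⊑ Y → D X → D Y) → ∀ {X Y} → X ≗ Y → Min D X → Min D Y
min-resp mono p (mkMin d h) = mkMin (mono (≗→⊑ p) d) λ Z s dz e q → h Z (λ f r → trans (p f) (s f r)) dz e (trans (p e) q)

module TwoSum {m : ℕ} {R : ESet m} {a b : ℕ} (E : Enum R a b) (D : ESet m → Set)
  (D₁ : ESet (suc a) → Set) (D₂ : ESet (suc b) → Set)
  (mono : ∀ {X Y} → X ⊑ Y → D X → D Y)
  (mono₁ : ∀ {X Y} → X ⊑ Y → D₁ X → D₁ Y) (mono₂ : ∀ {X Y} → X ⊑ Y → D₂ X → D₂ Y)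
  (to : ∀ Z → D Z → D₁ (false ◁ (Z ∘ Enum.ιK E)) ⊎ D₂ (false ◁ (Z ∘ Enum.ιR E)) ⊎
          (D₁ (true ◁ (Z ∘ Enum.ιK E)) × D₂ (true ◁ (Z ∘ Enum.ιR E))))
  (fromK : ∀ Z → D₁ (false ◁ (Z ∘ Enum.ιK E)) → D Z)
  (fromR : ∀ Z → D₂ (false ◁ (Z ∘ Enum.ιR E)) → D Z)
  (from× : ∀ Z → D₁ (true ◁ (Z ∘ Enum.ιK E)) → D₂ (true ◁ (Z ∘ Enum.ιR E)) → D Z)
  (nl₁ : ¬ D₁ (true ◁ none)) (nl₂ : ¬ D₂ (true ◁ none)) where

  open Enum E

  -- The three alternatives of `twoSum`, read on minimal dependent sets.
  data Summed (Z : ESet m) : Set where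
    sumK : Min D₁ (false ◁ (Z ∘ ιK)) → Z ∘ ιR ⊑ none → Summed Z
    sumR : Min D₂ (false ◁ (Z ∘ ιR)) → Z ∘ ιK ⊑ none → Summed Z
    sum× : Min D₁ (true ◁ (Z ∘ ιK)) → Min D₂ (true ◁ (Z ∘ ιR)) → Summed Z

  private
    K-glue : ∀ {A Y c} → D₁ (c ◁ A) → D₁ (c ◁ (glue A Y ∘ ιK))
    K-glue {A} {Y} {c} = mono₁ (◁-mono c (λ i p → trans (glue-K A Y i) p))
    R-glue : ∀ {A Y c} → D₂ (c ◁ Y) → D₂ (c ◁ (glue A Y ∘ ιR))
    R-glue {A} {Y} {c} = mono₂ (◁-mono c (λ i p → trans (glue-R A Y i) p))
    getK : ∀ {A Y Z} → Z ⊑ glue A Y → Z ∘ ιK ⊑ A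
    getK {A} {Y} s i p = trans (sym (glue-K A Y i)) (s (ιK i) p)
    getR : ∀ {A Y Z} → Z ⊑ glue A Y → Z ∘ ιR ⊑ Y
    getR {A} {Y} s i p = trans (sym (glue-R A Y i)) (s (ιR i) p)

  -- A smaller dependent set in one summand, glued to the other part, contradicts minimality of `Z`.
  -- If it lost the basepoint, it would be dependent without the other part, so that part of `Z`
  -- would be empty and the basepoint of the other summand a loop.
  min→sum : ∀ {Z} → Min D Z → Summed Z
  min→sum {Z} (mkMin d h) with to Z d
  ... | inj₁ d₁ = sumK (mkMin d₁ m₁) (getR (h _ (glue-⊑ (λ _ p → p) (λ _ ())) (fromK _ (K-glue d₁))))
    where
    m₁ : ∀ Y → Y ⊑ false ◁ (Z ∘ ιK) → D₁ Y → false ◁ (Z ∘ ιK) ⊑ Y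
    m₁ Y s dY (suc i) p = getK (h (glue (Y ∘ suc) none) (glue-⊑ (λ i → s (suc i)) (λ _ ()))
      (fromK _ (K-glue (mono₁ (λ { zero q → s zero q ; (suc i) q → q }) dY)))) i p
  ... | inj₂ (inj₁ d₂) = sumR (mkMin d₂ m₂) (getK (h _ (glue-⊑ (λ _ ()) (λ _ p → p)) (fromR _ (R-glue d₂))))
    where
    m₂ : ∀ Y → Y ⊑ false ◁ (Z ∘ ιR) → D₂ Y → false ◁ (Z ∘ ιR) ⊑ Y
    m₂ Y s dY (suc i) p = getR (h (glue none (Y ∘ suc)) (glue-⊑ (λ _ ()) (λ i → s (suc i)))
      (fromR _ (R-glue (mono₂ (λ { zero q → s zero q ; (suc i) q → q }) dY)))) i p
  ... | inj₂ (inj₂ (d₁ , d₂)) = sum× (mkMin d₁ m₁) (mkMin d₂ m₂)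
    where
    m₁ : ∀ Y → Y ⊑ true ◁ (Z ∘ ιK) → D₁ Y → true ◁ (Z ∘ ιK) ⊑ Y
    m₁ Y s dY with Y zero in eq
    ... | true = λ { zero _ → eq ; (suc i) p → getK (h (glue (Y ∘ suc) (Z ∘ ιR)) (glue-⊑ (λ i → s (suc i)) (λ _ p → p))
            (from× _ (K-glue (mono₁ (λ { zero q → refl ; (suc i) q → q }) dY)) (R-glue d₂))) i p }
    ... | false = ⊥-elim (nl₂ (mono₂ (◁-mono true (getR (h (glue (Y ∘ suc) none) (glue-⊑ (λ i → s (suc i)) (λ _ ()))
            (fromK _ (K-glue (mono₁ (λ { zero q → ⊥-elim (t≢f q eq) ; (suc i) q → q }) dY)))))) d₂))
    m₂ : ∀ Y → Y ⊑ true ◁ (Z ∘ ιR) → D₂ Y → true ◁ (Z ∘ ιR) ⊑ Y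
    m₂ Y s dY with Y zero in eq
    ... | true = λ { zero _ → eq ; (suc i) p → getR (h (glue (Z ∘ ιK) (Y ∘ suc)) (glue-⊑ (λ _ p → p) (λ i → s (suc i)))
            (from× _ (K-glue d₁) (R-glue (mono₂ (λ { zero q → refl ; (suc i) q → q }) dY)))) i p }
    ... | false = ⊥-elim (nl₁ (mono₁ (◁-mono true (getK (h (glue none (Y ∘ suc)) (glue-⊑ (λ _ ()) (λ i → s (suc i)))
            (fromR _ (R-glue (mono₂ (λ { zero q → ⊥-elim (t≢f q eq) ; (suc i) q → q }) dY)))))) d₁))

  -- In the mixed case a set dependent in one summand without its basepoint is too small for the
  -- minimal set there; in the pure cases the other part is empty and could contribute only a loop.
  sum→min : ∀ {Z} → Summed Z → Min D Z
  sum→min {Z} (sumK (mkMin d₁ h₁) e) = mkMin (fromK Z d₁) go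
    where
    emp : ∀ {Y} → Y ⊑ Z → Y ∘ ιR ⊑ none
    emp s j p = e j (s (ιR j) p)
    go : ∀ Y → Y ⊑ Z → D Y → Z ⊑ Y
    go Y s dY with to Y dY
    ... | inj₁ a = ext (λ i p → h₁ _ (◁-mono false (λ i → s (ιK i))) a (suc i) p) (λ j p → case e j p of λ ())
    ... | inj₂ (inj₁ b) = ⊥-elim (nl₂ (mono₂ (⊑-trans (◁-mono false (emp s)) (◁-up true)) b))
    ... | inj₂ (inj₂ (_ , b)) = ⊥-elim (nl₂ (mono₂ (◁-mono true (emp s)) b))
  sum→min {Z} (sumR (mkMin d₂ h₂) e) = mkMin (fromR Z d₂) go
    where
    emp : ∀ {Y} → Y ⊑ Z → Y ∘ ιK ⊑ none
    emp s j p = e j (s (ιK j) p)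
    go : ∀ Y → Y ⊑ Z → D Y → Z ⊑ Y
    go Y s dY with to Y dY
    ... | inj₂ (inj₁ a) = ext (λ j p → case e j p of λ ()) (λ i p → h₂ _ (◁-mono false (λ i → s (ιR i))) a (suc i) p)
    ... | inj₁ b = ⊥-elim (nl₁ (mono₁ (⊑-trans (◁-mono false (emp s)) (◁-up true)) b))
    ... | inj₂ (inj₂ (b , _)) = ⊥-elim (nl₁ (mono₁ (◁-mono true (emp s)) b))
  sum→min {Z} (sum× (mkMin d₁ h₁) (mkMin d₂ h₂)) = mkMin (from× Z d₁ d₂) go
    where
    go : ∀ Y → Y ⊑ Z → D Y → Z ⊑ Y
    go Y s dY with to Y dY
    ... | inj₁ a = case h₁ _ (⊑-trans (◁-mono false (λ i → s (ιK i))) (◁-up true)) a zero refl of λ ()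
    ... | inj₂ (inj₁ b) = case h₂ _ (⊑-trans (◁-mono false (λ i → s (ιR i))) (◁-up true)) b zero refl of λ ()
    ... | inj₂ (inj₂ (a , b)) = ext (λ i p → h₁ _ (◁-mono true (λ i → s (ιK i))) a (suc i) p)
                                    (λ i p → h₂ _ (◁-mono true (λ i → s (ιR i))) b (suc i) p)

  σ : Fin (a + b) ↔ Fin m
  σ = mk↔ₛ′ (λ i → [ ιK , ιR ]′ (splitAt a i)) (λ e → join a b (pick e))
    (λ e → trans (cong [ ιK , ιR ]′ (splitAt-join a b (pick e))) (sect e))
    (λ i → trans (cong (join a b) (back (splitAt a i))) (join-splitAt a b i))
    where
    back : ∀ s → pick ([ ιK , ιR ]′ s) ≡ s
    back (inj₁ i) = pick-K i
    back (inj₂ j) = pick-R j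

  module _ (M : CircFam m) (M₁ : CircFam (suc a)) (M₂ : CircFam (suc b))
           (M⇔ : ∀ X → M X ⇔ Min D (lookup X)) (M₁⇔ : ∀ X → M₁ X ⇔ Min D₁ (lookup X)) (M₂⇔ : ∀ X → M₂ X ⇔ Min D₂ (lookup X)) where

    private
      vec-◁ : ∀ {n} c (X : Subset n) {A : ESet n} → lookup X ≗ A → lookup (c ∷ X) ≗ c ◁ A
      vec-◁ c X p zero = refl
      vec-◁ c X p (suc i) = p i

      pull : Subset m → Subset (a + b)
      pull Y = tabulate (λ i → lookup Y (Inverse.to σ i))

      YK : Subset m → Subset a
      YK Y = tabulate (lookup Y ∘ ιK)
      YR : Subset m → Subset b
      YR Y = tabulate (lookup Y ∘ ιR)

      pull≡ : ∀ Y → pull Y ≡ YK Y Vec.++ YR Y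
      pull≡ Y = lookup-ext λ i → trans (lookup∘tabulate _ i) (trans (aux (splitAt a i)) (sym (lookup-splitAt a (YK Y) (YR Y) i)))
        where
        aux : ∀ s → lookup Y ([ ιK , ιR ]′ s) ≡ [ lookup (YK Y) , lookup (YR Y) ]′ s
        aux (inj₁ i) = sym (lookup∘tabulate _ i)
        aux (inj₂ j) = sym (lookup∘tabulate _ j)

      parts : ∀ Y {X' Y'} → pull Y ≡ X' Vec.++ Y' → lookup X' ≗ lookup Y ∘ ιK × lookup Y' ≗ lookup Y ∘ ιR
      parts Y {X'} {Y'} p =
        (λ i → trans (sym (lookup-++ˡ X' Y' i)) (trans (cong (λ z → lookup z (i ↑ˡ b)) (sym p))
                 (trans (lookup∘tabulate _ (i ↑ˡ b)) (cong (λ s → lookup Y ([ ιK , ιR ]′ s)) (splitAt-↑ˡ a i b))))) ,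
        (λ j → trans (sym (lookup-++ʳ X' Y' j)) (trans (cong (λ z → lookup z (a ↑ʳ j)) (sym p))
                 (trans (lookup∘tabulate _ (a ↑ʳ j)) (cong (λ s → lookup Y ([ ιK , ιR ]′ s)) (splitAt-↑ʳ a b j)))))

      empty≡ : ∀ {n} {Y : ESet n} → Y ⊑ none → tabulate Y ≡ ∅
      empty≡ {Y = Y} s = lookup-ext λ i → trans (lookup∘tabulate Y i) (trans (≢true λ p → case s i p of λ ()) (sym (lookup-replicate i false)))

      empty⊑ : ∀ {n} {Y : ESet n} {Y' : Subset n} → lookup Y' ≗ Y → Y' ≡ ∅ → Y ⊑ none
      empty⊑ p refl i q = trans (sym (lookup-replicate i false)) (trans (p i) q)

      push : ∀ Y → Summed (lookup Y) → twoSum M₁ M₂ (pull Y)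
      push Y (sumK m₁ e) = YK Y , YR Y , pull≡ Y , inj₁ (Equivalence.from (M₁⇔ _)
        (min-resp mono₁ (λ i → sym (vec-◁ false (YK Y) (lookup∘tabulate _) i)) m₁) , empty≡ e)
      push Y (sumR m₂ e) = YK Y , YR Y , pull≡ Y , inj₂ (inj₁ (empty≡ e , Equivalence.from (M₂⇔ _)
        (min-resp mono₂ (λ i → sym (vec-◁ false (YR Y) (lookup∘tabulate _) i)) m₂)))
      push Y (sum× m₁ m₂) = YK Y , YR Y , pull≡ Y , inj₂ (inj₂ (
        Equivalence.from (M₁⇔ _) (min-resp mono₁ (λ i → sym (vec-◁ true (YK Y) (lookup∘tabulate _) i)) m₁) ,
        Equivalence.from (M₂⇔ _) (min-resp mono₂ (λ i → sym (vec-◁ true (YR Y) (lookup∘tabulate _) i)) m₂)))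

      unpush : ∀ Y → twoSum M₁ M₂ (pull Y) → Summed (lookup Y)
      unpush Y (X' , Y' , p , inj₁ (c , e)) = let (α , β) = parts Y {X'} {Y'} p in
        sumK (min-resp mono₁ (vec-◁ false X' α) (Equivalence.to (M₁⇔ _) c)) (empty⊑ β e)
      unpush Y (X' , Y' , p , inj₂ (inj₁ (e , c))) = let (α , β) = parts Y {X'} {Y'} p in
        sumR (min-resp mono₂ (vec-◁ false Y' β) (Equivalence.to (M₂⇔ _) c)) (empty⊑ α e)
      unpush Y (X' , Y' , p , inj₂ (inj₂ (c , d))) = let (α , β) = parts Y {X'} {Y'} p in
        sum× (min-resp mono₁ (vec-◁ true X' α) (Equivalence.to (M₁⇔ _) c)) (min-resp mono₂ (vec-◁ true Y' β) (Equivalence.to (M₂⇔ _) d))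

    twoSum-iso : Iso (twoSum M₁ M₂) M
    twoSum-iso = σ , λ Y → mk⇔ (λ c → push Y (min→sum (Equivalence.to (M⇔ Y) c))) (λ t → Equivalence.from (M⇔ Y) (sum→min (unpush Y t)))

-- The side conditions of the 2-sums

qb⇔ : ∀ {m} {G : Graph m} (Q : QuasiBiased G) X → qbCircuit Q X ⇔ Min (Dep Q) (lookup X)
qb⇔ Q X = mk⇔ (λ c → let md = circuit→minDep Q c in mkMin (MinDep.dep md) (MinDep.min md))
  (λ (mkMin d h) → minDep→circuit Q (record { dep = d ; min = h }))

Cyclic : ∀ {m} (G : Graph m) → ESet m → Set
Cyclic G X = ∃[ C ] (Cyc G C × C ⊑ X)

cyclic-mono : ∀ {m} {G : Graph m} {X Y} → X ⊑ Y → Cyclic G X → Cyclic G Y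
cyclic-mono s (C , c , t) = C , c , ⊑-trans t s

cyc⇔ : ∀ {m} (G : Graph m) X → IsCycle G X ⇔ Min (Cyclic G) (lookup X)
cyc⇔ G X = mk⇔
  (λ x → let c = IsCycle→Cyc G x in mkMin (lookup X , c , ⊑-refl)
    λ { Y s (C , cc , t) → ⊑-trans (Cyc.min c C (⊑-trans t s) (Cyc.even cc) (Cyc.ne cc)) t })
  (λ { (mkMin (C , c , s) h) → Cyc→IsCycle G (cyc-resp G (⊑-antisym s (h C s (C , c , ⊑-refl))) c) })

-- One of two disjoint cycles avoids `e`, so the rest of the graph is unbalanced; by
-- two-connectedness it is also connected on the same vertices. It thus carries an independent set
-- with as many edges as there are vertices, and adding `e` exceeds the rank bound.
no-coloop : ∀ {m} {G : Graph m} (Q : QuasiBiased G) → TwoConn G → NonDeg Q L → ∀ e → ¬ Coloop (qbCircuit Q) e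
no-coloop {m} {G} Q tc NL e col = finish (side-of Q K)
  where
  module NL = NonDeg NL
  K : ESet m
  K = comp (sing e)
  off : ∀ {C : ESet m} → C e ≡ false → C ⊑ K
  off {C} p f q = not-f (sing-ne {e = e} {f} λ { refl → t≢f q p })
  ub : Unbal Q K
  ub with bool-cases (NL.C e)
  ... | inj₂ p = NL.C , NL.cycC , off p , L≢B NL.κC
  ... | inj₁ p = NL.D , NL.cycD , off (≢true λ q → NL.apart (src G e , (e , p , inc-src G e) , (e , q , inc-src G e))) , L≢B NL.κD
  ke : ∃[ f ] K f ≡ true
  ke = let (C , c , s , _) = ub ; (f , p) = Cyc.ne c in f , s f p
  finish : Side Q K → ⊥
  finish S = SS.ind (no-dep (Dep? Q (SS.I ⊔ sing e)))
    where
    module SS = Side S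
    cov : ∀ f → K f ≡ true ⊎ sing e f ≡ true
    cov f with sing e f
    ... | true = inj₂ refl
    ... | false = inj₁ refl
    module P = Pieces tc K (sing e) cov (λ f p q → t≢f q (not-t p)) (e , sing-self e) SS.S
    u≡1 : SS.u ≡ 1
    u≡1 with SS.kind
    ... | inj₂ (p , _) = p
    ... | inj₁ (_ , b) = let (C , c , s , k) = ub in ⊥-elim (k (b C c s))
    at : ∀ {x} → InV G (sing e) x → x ≡ src G e ⊎ x ≡ tgt G e
    at (f , p , i) with sing-elim {e = e} {f} p
    ... | refl = inc-cases G i
    rep-src : ∀ {x} → InV G K x → P.rep (src G e) ≡ P.rep x
    rep-src i = go (at pY) (at qY)
      where
      open P.Two (P.two i)
      go : p ≡ src G e ⊎ p ≡ tgt G e → q ≡ src G e ⊎ q ≡ tgt G e → P.rep (src G e) ≡ P.rep _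
      go (inj₁ h) _ = trans (cong P.rep (sym h)) (P.AV-rep pA)
      go (inj₂ _) (inj₁ h) = trans (cong P.rep (sym h)) (P.AV-rep qA)
      go (inj₂ h) (inj₂ h') = ⊥-elim (p≢q (trans h (sym h')))
    one-root : count (roots Q SS.S) ≤ 1
    one-root = count-≤1 (roots Q SS.S) λ i j p q → trans (sym (root-eq i p)) (root-eq j q)
      where
      root-eq : ∀ i → roots Q SS.S i ≡ true → P.rep (src G e) ≡ i
      root-eq i p = trans (rep-src (vset-out G (∧-snd {does (P.rep i ≟ i)} p))) (sing-elim {e = i} {P.rep i} (∧-fst p))
    V≤ : count (vset G all) ≤ count (vset G K)
    V≤ = count-mono {f = vset G all} {vset G K} λ x p → vset-in G (inK x (vset-out G {all} {x} p))
      where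
      open TwoShared (tc (sing e) {e} {proj₁ ke} (sing-self e) (not-t (proj₂ ke)))
      ends-in : ∀ {x} → x ≡ src G e ⊎ x ≡ tgt G e → p ≡ src G e ⊎ p ≡ tgt G e → q ≡ src G e ⊎ q ≡ tgt G e → InV G K x
      ends-in (inj₁ refl) (inj₁ h) _ = subst (InV G K) h pY
      ends-in (inj₁ refl) (inj₂ _) (inj₁ h) = subst (InV G K) h qY
      ends-in (inj₂ refl) (inj₂ h) _ = subst (InV G K) h pY
      ends-in (inj₂ refl) (inj₁ _) (inj₂ h) = subst (InV G K) h qY
      ends-in (inj₂ _) (inj₁ h) (inj₁ h') = ⊥-elim (p≢q (trans h (sym h')))
      ends-in (inj₁ _) (inj₂ h) (inj₂ h') = ⊥-elim (p≢q (trans h (sym h')))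
      inK : ∀ x → InV G all x → InV G K x
      inK x (f , _ , i) with f ≟ e
      ... | yes refl = ends-in (inc-cases G i) (at pX) (at qX)
      ... | no n = f , not-f (sing-ne n) , i
    big : count (vset G all) < count (SS.I ⊔ sing e)
    big = ≤-trans (s≤s (≤-trans V≤ (≤-trans (≤-reflexive (sym (forest-size Q SS.S)))
            (≤-trans (+-mono-≤ (≤-refl {count (Span.T SS.S)}) one-root) (≤-reflexive (trans (+-comm (count (Span.T SS.S)) 1)
              (trans (cong (_+ count (Span.T SS.S)) (sym u≡1)) (sym SS.size))))))))
          (≤-reflexive (sym (count-insert SS.I e (≢true λ p → t≢f (sing-self e) (not-t (SS.I⊑X e p))))))
    no-dep : Dec (Dep Q (SS.I ⊔ sing e)) → Dep Q SS.I
    no-dep (no n) = ⊥-elim (ℕₚ.<-irrefl refl (≤-trans big (rank-upper Q (SS.I ⊔ sing e) n)))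
    no-dep (yes d) = let (Z , z , s) = dep-circuit Q d in
      dep-mono Q (λ f p → case ∨-elim {SS.I f} (s f p) of λ where
        (inj₁ a) → a
        (inj₂ b) → ⊥-elim (col Z z (lookup⇒[]= e Z (subst (λ x → lookup Z x ≡ true) (sing-elim {e = e} {f} b) p)))) (MinDep.dep (circuit→minDep Q z))

-- The theta property for sums of cycles

notTwo : ∀ {a b c} → (a ≡ B → b ≡ B → c ≡ B) → (a ≡ B → c ≡ B → b ≡ B) → (b ≡ B → c ≡ B → a ≡ B) → ¬ ExactlyTwoB a b c
notTwo {B} {B} {B} f g h ()
notTwo {B} {B} {L} f g h _ = case f refl refl of λ ()
notTwo {B} {B} {F} f g h _ = case f refl refl of λ ()
notTwo {B} {L} {B} f g h _ = case g refl refl of λ ()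
notTwo {B} {F} {B} f g h _ = case g refl refl of λ ()
notTwo {L} {B} {B} f g h _ = case h refl refl of λ ()
notTwo {F} {B} {B} f g h _ = case h refl refl of λ ()
notTwo {B} {L} {L} f g h ()
notTwo {B} {L} {F} f g h ()
notTwo {B} {F} {L} f g h ()
notTwo {B} {F} {F} f g h ()
notTwo {L} {B} {L} f g h ()
notTwo {L} {B} {F} f g h ()
notTwo {F} {B} {L} f g h ()
notTwo {F} {B} {F} f g h ()
notTwo {L} {L} {_} f g h ()
notTwo {L} {F} {_} f g h ()
notTwo {F} {L} {_} f g h ()
notTwo {F} {F} {_} f g h ()

notTwo-swap : ∀ {a b c} → ¬ ExactlyTwoB a b c → ¬ ExactlyTwoB a c b
notTwo-swap n = notTwo (λ { refl refl → two-B₁₃ n }) (λ { refl refl → two-B₁₂ n }) (λ { refl refl → two-B₂₃ n })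

module _ {m : ℕ} {G : Graph m} (Q : QuasiBiased G) where

  -- The lift of a theta from a reduced graph is known only through its cycles as edge sets. An ear
  -- of `D₁` inside `D₂` produces a genuine theta; its other two cycles are distinct from each other
  -- and from `D₁`, so they are `D₂` and `D₃` in some order.
  alg-theta : ∀ {D₁ D₂ D₃} → Cyc G D₁ → Cyc G D₂ → Cyc G D₃ → D₃ ≗ D₁ △ D₂ →
    (∀ Z → Even G Z → Z ⊑ D₁ ⊔ D₂ → NE Z → Z ≗ D₁ ⊎ Z ≗ D₂ ⊎ Z ≗ D₃) → ¬ ExactlyTwoB (κ Q D₁) (κ Q D₂) (κ Q D₃)
  alg-theta {D₁} {D₂} {D₃} c₁ c₂ c₃ eq kinds = go (common (NE? (D₁ ⊓ D₂)))
    where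
    ne : ¬ D₁ ≗ D₂
    ne p = let (e , q) = Cyc.ne c₃ in t≢f q (trans (eq e) (eq-xor (p e)))
    common : Dec (NE (D₁ ⊓ D₂)) → NE (D₁ ⊓ D₂)
    common (yes p) = p
    -- Edge-disjoint `D₁` and `D₂` would make `D₃` their union, a cycle properly containing the
    -- cycle `D₁`.
    common (no n) = ⊥-elim (let (e , q) = Cyc.ne c₂
                                d₁e = ≢true λ p → n (e , ∧-in p q)
                            in t≢f (trans (eq e) (xor-ft d₁e q)) (trans (sym (same e)) d₁e))
      where
      same : D₁ ≗ D₃
      same = cyc-eq G c₁ c₃ (λ e p → trans (eq e) (xor-tf p (≢true λ q → n (e , ∧-in p q))))
    finish : EarTheta G D₁ D₂ → ¬ ExactlyTwoB (κ Q D₁) (κ Q D₂) (κ Q D₃)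
    finish ET = pick (kinds c₁₃ (Cyc.even cyc-c₁₃) s₁₃ (Cyc.ne cyc-c₁₃)) (kinds c₂₃ (Cyc.even cyc-c₂₃) s₂₃ (Cyc.ne cyc-c₂₃))
      where
      open EarTheta ET
      w₁D : w₁ ⊑ D₁
      w₁D e p = trans (sym (C≗ e)) (∨-inl p)
      w₂D : w₂ ⊑ D₁
      w₂D e p = trans (sym (C≗ e)) (∨-inr {w₁ e} p)
      s₁₃ : c₁₃ ⊑ D₁ ⊔ D₂
      s₁₃ = ⊔-lub Q {w₁} (⊑-trans w₁D (⊑-inl Q)) (⊑-trans w₃⊑D (⊑-inr Q {D₁}))
      s₂₃ : c₂₃ ⊑ D₁ ⊔ D₂
      s₂₃ = ⊔-lub Q {w₂} (⊑-trans w₂D (⊑-inl Q)) (⊑-trans w₃⊑D (⊑-inr Q {D₁}))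
      open Theta Th using (u≢v; P₁; P₃)
      n₃ : NE w₃
      n₃ = ne-w u≢v P₃
      n₁ : NE w₁
      n₁ = ne-w u≢v P₁
      c₁₃≉c₂₃ : ¬ c₁₃ ≗ c₂₃
      c₁₃≉c₂₃ p = let (e , q) = n₁ in t≢f (trans (sym (p e)) (∨-inl q)) (∨-nil (disj₁₂ e q) (disj₁₃ e q))
      two' : ¬ ExactlyTwoB (κ Q D₁) (κ Q c₁₃) (κ Q c₂₃)
      two' = subst (λ k → ¬ ExactlyTwoB k (κ Q c₁₃) (κ Q c₂₃)) (κ-cong Q C≗) (theta-two Q Th)
      pick : c₁₃ ≗ D₁ ⊎ c₁₃ ≗ D₂ ⊎ c₁₃ ≗ D₃ → c₂₃ ≗ D₁ ⊎ c₂₃ ≗ D₂ ⊎ c₂₃ ≗ D₃ → ¬ ExactlyTwoB (κ Q D₁) (κ Q D₂) (κ Q D₃)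
      pick (inj₁ p) _ = ⊥-elim (let (e , q) = n₃ in t≢f (trans (sym (p e)) (∨-inr {w₁ e} q)) (w₃∌C e q))
      pick _ (inj₁ p) = ⊥-elim (let (e , q) = n₃ in t≢f (trans (sym (p e)) (∨-inr {w₂ e} q)) (w₃∌C e q))
      pick (inj₂ (inj₁ p)) (inj₂ (inj₁ q)) = ⊥-elim (c₁₃≉c₂₃ (λ e → trans (p e) (sym (q e))))
      pick (inj₂ (inj₂ p)) (inj₂ (inj₂ q)) = ⊥-elim (c₁₃≉c₂₃ (λ e → trans (p e) (sym (q e))))
      pick (inj₂ (inj₁ p)) (inj₂ (inj₂ q)) = subst id (cong₂ (λ a b → ¬ ExactlyTwoB (κ Q D₁) a b) (κ-cong Q p) (κ-cong Q q)) two'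
      pick (inj₂ (inj₂ p)) (inj₂ (inj₁ q)) = notTwo-swap (subst id (cong₂ (λ a b → ¬ ExactlyTwoB (κ Q D₁) a b) (κ-cong Q p) (κ-cong Q q)) two')
    go : NE (D₁ ⊓ D₂) → ¬ ExactlyTwoB (κ Q D₁) (κ Q D₂) (κ Q D₃)
    go (f , p) = finish (ear-theta G c₁ c₂ ne {src G f} {tgt G f}
        (λ l → ne (λ e → trans (loop-cyc Q c₁ a l e) (sym (loop-cyc Q c₂ b l e))))
        (f , a , inc-src G f) (f , a , inc-tgt G f) (f , b , inc-src G f) (f , b , inc-tgt G f))
      where
      a : D₁ f ≡ true
      a = ∧-fst p
      b : D₂ f ≡ true
      b = ∧-snd {D₁ f} p

  same-class : ∀ {C D} → Cyc G C → Cyc G D → κ Q C ≢ B → κ Q D ≢ B → ¬ Meet Q C D → κ Q C ≡ κ Q D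
  same-class c d nc nd ap with nonB nc | nonB nd
  ... | inj₁ p | inj₁ q = trans p (sym q)
  ... | inj₂ p | inj₂ q = trans p (sym q)
  ... | inj₁ p | inj₂ q = ⊥-elim (ap (LF-meet Q c d p q))
  ... | inj₂ p | inj₁ q = ⊥-elim (ap (meet-sym Q (LF-meet Q d c q p)))

  -- Only a pair in `F` needs a connection. This absorbs the uncertainty between `L` and `F` for
  -- cycles through a new edge.
  dep-pair : ∀ {C D X} → Cyc G C → Cyc G D → ¬ C ≗ D → C ⊑ X → D ⊑ X →
    (κ Q C ≡ F → κ Q D ≡ F → ∃[ x ] ∃[ y ] (InV G C x × InV G D y × Conn G X x y)) → Dep Q X
  dep-pair {C} {D} c d n s t h with κ Q C in k | κ Q D in l
  ... | B | _ = depB c s k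
  ... | _ | B = depB d t l
  ... | L | L = depL c d n s t k l
  ... | L | F = let (x , a , b) = LF-meet Q c d k l in depC c d n s t a b stop
  ... | F | L = let (x , a , b) = LF-meet Q d c l k in depC c d n s t b a stop
  ... | F | F = let (x , y , a , b , cn) = h refl refl in depC c d n s t a b cn

-- What a reduction step must deliver

record Reduction {m : ℕ} {G : Graph m} (Q : QuasiBiased G) : Set where
  field
    a b     : ℕ
    G'      : Graph (suc a)
    Q'      : QuasiBiased G'
    Γ       : Graph (suc b)
    NL'     : NonDeg Q' L
    NF'     : NonDeg Q' F
    tc'     : TwoConn G'
    smaller : suc a < m
    ok      : TwoSumOK (qbCircuit Q') (IsCycle Γ)
    iso     : Iso (twoSum (qbCircuit Q') (IsCycle Γ)) (qbCircuit Q)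

-- Two-terminal decompositions

xsum-scale : ∀ {m} d (f : ESet m) → xsum (λ e → d ∧ f e) ≡ d ∧ xsum f
xsum-scale true f = refl
xsum-scale {m} false f = xsum-none {m}

-- The boundary of `Z ⊓ X` is that of a virtual edge vw, taken once or not at all. As in
-- `even-split` the test set is adjusted where it does not count; seen from the complement it
-- becomes the constant `U v` plus a multiple of the star of `w`, and the boundary is linear.
two-terminal : ∀ {m} (G : Graph m) Z X {v w} → Even G Z → (∀ x → InV G X x → InV G (comp X) x → x ≡ v ⊎ x ≡ w) →
  ∀ U → bd G (Z ⊓ X) U ≡ (U v xor U w) ∧ bd G (Z ⊓ X) (sing w)
two-terminal {m} G Z X {v} {w} ev sh U =
    trans (bd-U G (Z ⊓ X) {U} {U₁} onX) (trans (flip U₁) (trans (bd-U G (Z ⊖ X) {U₁} {U₂} onY)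
      (trans lin (cong (d ∧_) (sym (flip (sing w)))))))
  where
  d : Bool
  d = U v xor U w
  U₁ U₂ : ESet (nV G)
  U₁ x = if sing w x then U w else (if vset G X x then U x else U v)
  U₂ x = U v xor (d ∧ sing w x)
  flip : ∀ V → bd G (Z ⊓ X) V ≡ bd G (Z ⊖ X) V
  flip V = xor-eq (trans (sym (bd-△ G (Z ⊓ X) (Z ⊖ X) V)) (trans (bd-cong G un V) (ev V)))
    where
    un : (Z ⊓ X) △ (Z ⊖ X) ≗ Z
    un e with Z e | X e
    ... | true | true = refl
    ... | true | false = refl
    ... | false | _ = refl
  onX : ∀ x → InV G (Z ⊓ X) x → U x ≡ U₁ x
  onX x i with x ≟ w
  ... | yes refl = refl
  ... | no _ rewrite vset-in G {X} {x} (InV-mono G (λ e p → ∧-snd {Z e} p) i) = refl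
  b₁ : ∀ a c → c ≡ a xor ((a xor c) ∧ true)
  b₁ true true = refl
  b₁ true false = refl
  b₁ false true = refl
  b₁ false false = refl
  b₀ : ∀ a c → a ≡ a xor ((a xor c) ∧ false)
  b₀ a c rewrite ∧-zeroʳ (a xor c) = sym (xor-identityʳ a)
  onY : ∀ x → InV G (Z ⊖ X) x → U₁ x ≡ U₂ x
  onY x i with x ≟ w
  ... | yes refl = b₁ (U v) (U w)
  ... | no n with InV? G X x
  ... | no _ = b₀ (U v) (U w)
  ... | yes j with sh x j (InV-mono G (λ e p → ∧-snd {Z e} p) i)
  ... | inj₁ refl = b₀ (U v) (U w)
  ... | inj₂ q = ⊥-elim (n q)
  lin : bd G (Z ⊖ X) U₂ ≡ d ∧ bd G (Z ⊖ X) (sing w)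
  lin = trans (xsum-cong (λ e → aux ((Z ⊖ X) e) (U v) d (sing w (src G e)) (sing w (tgt G e)))) (xsum-scale d (λ e → (Z ⊖ X) e ∧ δ G (sing w) e))
    where
    aux : ∀ z a d p q → z ∧ ((a xor (d ∧ p)) xor (a xor (d ∧ q))) ≡ d ∧ (z ∧ (p xor q))
    aux false a d p q = sym (∧-zeroʳ d)
    aux true a false p q = trans (xor-swap a false a false) (cong (_xor false) (xor-same a))
    aux true a true p q = trans (xor-swap a p a q) (cong (_xor (p xor q)) (xor-same a))

module TwoTerm {m : ℕ} (G : Graph m) {R : ESet m} {a b : ℕ} (E : Enum R a b) (v w : Fin (nV G)) (v≢w : v ≢ w)
  (shared : ∀ x → InV G R x → InV G (comp R) x → x ≡ v ⊎ x ≡ w) where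

  open Enum E

  G' : Graph (suc a)
  G' = record { nV = nV G ; ends = λ { zero → v , w ; (suc i) → ends G (ιK i) } }

  Γ : Graph (suc b)
  Γ = record { nV = nV G ; ends = λ { zero → v , w ; (suc j) → ends G (ιR j) } }

  bdK : ESet a → ESet (nV G) → Bool
  bdK A U = xsum (λ i → A i ∧ δ G U (ιK i))

  bdR : ESet b → ESet (nV G) → Bool
  bdR Z U = xsum (λ j → Z j ∧ δ G U (ιR j))

  bd-parts : ∀ Z U → bd G Z U ≡ bdK (Z ∘ ιK) U xor bdR (Z ∘ ιR) U
  bd-parts Z U = xs (λ e → Z e ∧ δ G U e)

  bd-R : ∀ Z U → bd G (Z ⊓ R) U ≡ bdR (Z ∘ ιR) U
  bd-R Z U = trans (bd-parts (Z ⊓ R) U) (cong₂ _xor_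
    (xsum-zero (λ i → ∧-f₁ (∧-f₂ {Z (ιK i)} (K-out i))))
    (xsum-cong (λ j → cong (_∧ δ G U (ιR j)) (trans (cong (Z (ιR j) ∧_) (R-in j)) (∧-identityʳ _)))))

  bd-K : ∀ Z U → bd G (Z ⊓ comp R) U ≡ bdK (Z ∘ ιK) U
  bd-K Z U = trans (bd-parts (Z ⊓ comp R) U) (trans (cong₂ _xor_
    (xsum-cong (λ i → cong (_∧ δ G U (ιK i)) (trans (cong (λ b → Z (ιK i) ∧ not b) (K-out i)) (∧-identityʳ _))))
    (xsum-zero (λ j → ∧-f₁ (∧-f₂ {Z (ιR j)} (cong not (R-in j)))))) (xor-identityʳ _))

  -- The bit `c`, the parity of the `R`-part at `w`, decides whether the virtual edge is used;
  -- evenness of `Z` makes the other part agree.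
  evenParts : ∀ {Z} → Even G Z → ∃[ c ] (Even G' (c ◁ (Z ∘ ιK)) × Even Γ (c ◁ (Z ∘ ιR)))
  evenParts {Z} ev = c , evK , evR
    where
    c : Bool
    c = bdR (Z ∘ ιR) (sing w)
    cK : bdK (Z ∘ ιK) (sing w) ≡ c
    cK = xor-eq (trans (sym (bd-parts Z (sing w))) (ev (sing w)))
    evR : Even Γ (c ◁ (Z ∘ ιR))
    evR U = eq-xor (sym (trans (sym (bd-R Z U)) (trans (two-terminal G Z R ev shared U)
      (trans (cong ((U v xor U w) ∧_) (bd-R Z (sing w))) (∧-comm (U v xor U w) c)))))
    shared' : ∀ x → InV G (comp R) x → InV G (comp (comp R)) x → x ≡ v ⊎ x ≡ w
    shared' x i j = shared x (InV-mono G (λ e p → trans (sym (not-involutive (R e))) p) j) i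
    evK : Even G' (c ◁ (Z ∘ ιK))
    evK U = eq-xor (sym (trans (sym (bd-K Z U)) (trans (two-terminal G Z (comp R) ev shared' U)
      (trans (cong ((U v xor U w) ∧_) (trans (bd-K Z (sing w)) cK)) (∧-comm (U v xor U w) c)))))

  evenGlue : ∀ c A Z → Even G' (c ◁ A) → Even Γ (c ◁ Z) → Even G (glue A Z)
  evenGlue c A Z evK evR U = trans (bd-parts (glue A Z) U) (eq-xor
    (trans (xsum-cong (λ i → cong (_∧ δ G U (ιK i)) (glue-K A Z i)))
      (trans (sym (xor-eq {c ∧ (U v xor U w)} (evK U))) (trans (xor-eq {c ∧ (U v xor U w)} (evR U)) (sym (xsum-cong (λ j → cong (_∧ δ G U (ιR j)) (glue-R A Z j))))))))

  none-K : Even G' (false ◁ none)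
  none-K U = xsum-none {a}

  none-R : Even Γ (false ◁ none)
  none-R U = xsum-none {b}

  e-odd-K : ∀ {A} → ¬ NE A → ¬ Even G' (true ◁ A)
  e-odd-K {A} n ev = t≢f (cong₂ _xor_ (cong₂ _xor_ (sing-self v) (sing-ne (v≢w ∘ sym))) (xsum-zero λ i → ∧-f₁ (NE-not n i))) (ev (sing v))

  e-odd-R : ∀ {A} → ¬ NE A → ¬ Even Γ (true ◁ A)
  e-odd-R {A} n ev = t≢f (cong₂ _xor_ (cong₂ _xor_ (sing-self v) (sing-ne (v≢w ∘ sym))) (xsum-zero λ i → ∧-f₁ (NE-not n i))) (ev (sing v))

  ne-K : ∀ {A} → Even G' (true ◁ A) → NE A
  ne-K {A} ev with NE? A
  ... | yes p = p
  ... | no n = ⊥-elim (e-odd-K n ev)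

  ne-R : ∀ {A} → Even Γ (true ◁ A) → NE A
  ne-R {A} ev with NE? A
  ... | yes p = p
  ... | no n = ⊥-elim (e-odd-R n ev)

  data Kind (C : ESet m) : Set where
    isK : C ∘ ιR ⊑ none → Cyc G' (false ◁ (C ∘ ιK)) → Kind C
    isR : C ∘ ιK ⊑ none → Cyc Γ (false ◁ (C ∘ ιR)) → Kind C
    isX : Cyc G' (true ◁ (C ∘ ιK)) → Cyc Γ (true ◁ (C ∘ ιR)) → Kind C

  private
    glue-ne₁ : ∀ {A Z} → NE A → NE (glue A Z)
    glue-ne₁ {A} {Z} (i , p) = ιK i , trans (glue-K A Z i) p
    glue-ne₂ : ∀ {A Z} → NE Z → NE (glue A Z)
    glue-ne₂ {A} {Z} (i , p) = ιR i , trans (glue-R A Z i) p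
    ne-tail : ∀ {n} {Y : ESet (suc n)} → NE Y → Y zero ≡ false → NE (Y ∘ suc)
    ne-tail (zero , p) q = ⊥-elim (t≢f p q)
    ne-tail (suc i , p) q = i , p
    retail : ∀ {n} {Y : ESet (suc n)} {c} → Y zero ≡ c → Y ≗ c ◁ (Y ∘ suc)
    retail p zero = p
    retail p (suc i) = refl
    getK : ∀ {A Z C} → C ⊑ glue A Z → C ∘ ιK ⊑ A
    getK {A} {Z} s i p = trans (sym (glue-K A Z i)) (s (ιK i) p)
    getR : ∀ {A Z C} → C ⊑ glue A Z → C ∘ ιR ⊑ Z
    getR {A} {Z} s i p = trans (sym (glue-R A Z i)) (s (ιR i) p)

  -- A smaller even set in one part with the same use of the virtual edge is glued to the other part
  -- of `C`, one avoiding the edge to nothing; either way minimality of `C` applies.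
  kind : ∀ {C} → Cyc G C → Kind C
  kind {C} cy = go (evenParts (Cyc.even cy))
    where
    CK : ESet a
    CK = C ∘ ιK
    CR : ESet b
    CR = C ∘ ιR
    below : ∀ c A Z → A ⊑ CK → Z ⊑ CR → Even G' (c ◁ A) → Even Γ (c ◁ Z) → NE (glue A Z) → C ⊑ glue A Z
    below c A Z s t evA evZ n = Cyc.min cy (glue A Z) (glue-⊑ s t) (evenGlue c A Z evA evZ) n
    go : ∃[ c ] (Even G' (c ◁ CK) × Even Γ (c ◁ CR)) → Kind C
    go (true , evK , evR) = isX
      (record { even = evK ; ne = zero , refl ; min = mK })
      (record { even = evR ; ne = zero , refl ; min = mR })
      where
      mK : ∀ Y → Y ⊑ true ◁ CK → Even G' Y → NE Y → true ◁ CK ⊑ Y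
      mK Y s ev n = by (bool-cases (Y zero))
        where
        by : Y zero ≡ true ⊎ Y zero ≡ false → true ◁ CK ⊑ Y
        by (inj₁ eq) = λ { zero _ → eq ; (suc i) p → getK (below true (Y ∘ suc) CR (λ i → s (suc i)) (λ _ p → p) (even-resp G' {Y} (retail eq) ev) evR (glue-ne₂ (ne-R evR))) i p }
        by (inj₂ eq) = ⊥-elim (let (j , p) = ne-R evR in case getR (below false (Y ∘ suc) none (λ i → s (suc i)) (λ _ ()) (even-resp G' {Y} (retail eq) ev) none-R (glue-ne₁ (ne-tail n eq))) j p of λ ())
      mR : ∀ Y → Y ⊑ true ◁ CR → Even Γ Y → NE Y → true ◁ CR ⊑ Y
      mR Y s ev n = by (bool-cases (Y zero))
        where
        by : Y zero ≡ true ⊎ Y zero ≡ false → true ◁ CR ⊑ Y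
        by (inj₁ eq) = λ { zero _ → eq ; (suc i) p → getR (below true CK (Y ∘ suc) (λ _ p → p) (λ i → s (suc i)) evK (even-resp Γ {Y} (retail eq) ev) (glue-ne₁ (ne-K evK))) i p }
        by (inj₂ eq) = ⊥-elim (let (j , p) = ne-K evK in case getK (below false none (Y ∘ suc) (λ _ ()) (λ i → s (suc i)) none-K (even-resp Γ {Y} (retail eq) ev) (glue-ne₂ (ne-tail n eq))) j p of λ ())
    go (false , evK , evR) = side (NE? CK)
      where
      side : Dec (NE CK) → Kind C
      side (yes n) = isK (getR (below false CK none (λ _ p → p) (λ _ ()) evK none-R (glue-ne₁ n)))
        (record { even = evK ; ne = suc (proj₁ n) , proj₂ n ; min = λ { Y s ev ny (suc i) p →
          let eq = ≢true λ q → case s zero q of λ () in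
          getK (below false (Y ∘ suc) none (λ i → s (suc i)) (λ _ ()) (even-resp G' {Y} (retail eq) ev) none-R (glue-ne₁ (ne-tail ny eq))) i p } })
      side (no n) = isR (λ i p → ⊥-elim (n (i , p)))
        (record { even = evR ; ne = neR (Cyc.ne cy) ; min = λ { Y s ev ny (suc i) p →
          let eq = ≢true λ q → case s zero q of λ () in
          getR (below false none (Y ∘ suc) (λ _ ()) (λ i → s (suc i)) none-K (even-resp Γ {Y} (retail eq) ev) (glue-ne₂ (ne-tail ny eq))) i p } })
        where
        neR : NE C → NE (false ◁ CR)
        neR (e , p) with view e
        ... | inK i refl = ⊥-elim (n (i , p))
        ... | inR j refl = suc j , p

  cycK : ∀ {A} → Cyc G' (false ◁ A) → Cyc G (glue A none)
  cycK {A} cy = record { even = evenGlue false A none (Cyc.even cy) none-R ; ne = glue-ne₁ {A} (ne-tail (Cyc.ne cy) refl) ; min = go }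
    where
    go : ∀ Y → Y ⊑ glue A none → Even G Y → NE Y → glue A none ⊑ Y
    go Y s ev (e , q) with evenParts ev
    ... | true , evK , evR = ⊥-elim (e-odd-R (λ (j , p) → case getR s j p of λ ()) evR)
    ... | false , evK , evR = glue-⊑ (λ i p → Cyc.min cy (false ◁ (Y ∘ ιK)) (◁-mono false (getK s)) evK (ne e q) (suc i) p) (λ _ ())
      where
      ne : ∀ e → Y e ≡ true → NE (false ◁ (Y ∘ ιK))
      ne e q with view e
      ... | inK i refl = suc i , q
      ... | inR j refl = case getR s j q of λ ()

  cycR : ∀ {Z} → Cyc Γ (false ◁ Z) → Cyc G (glue none Z)
  cycR {Z} cy = record { even = evenGlue false none Z none-K (Cyc.even cy) ; ne = glue-ne₂ {none} (ne-tail (Cyc.ne cy) refl) ; min = go }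
    where
    go : ∀ Y → Y ⊑ glue none Z → Even G Y → NE Y → glue none Z ⊑ Y
    go Y s ev (e , q) with evenParts ev
    ... | true , evK , evR = ⊥-elim (e-odd-K (λ (j , p) → case getK s j p of λ ()) evK)
    ... | false , evK , evR = glue-⊑ (λ _ ()) (λ i p → Cyc.min cy (false ◁ (Y ∘ ιR)) (◁-mono false (getR s)) evR (ne e q) (suc i) p)
      where
      ne : ∀ e → Y e ≡ true → NE (false ◁ (Y ∘ ιR))
      ne e q with view e
      ... | inR i refl = suc i , q
      ... | inK j refl = case getK s j q of λ ()

  cycX : ∀ {A Z} → Cyc G' (true ◁ A) → Cyc Γ (true ◁ Z) → Cyc G (glue A Z)
  cycX {A} {Z} cK cR = record { even = evenGlue true A Z (Cyc.even cK) (Cyc.even cR) ; ne = glue-ne₁ (ne-K (Cyc.even cK)) ; min = go }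
    where
    go : ∀ Y → Y ⊑ glue A Z → Even G Y → NE Y → glue A Z ⊑ Y
    go Y s ev (e , q) with evenParts ev
    ... | true , evK , evR = glue-⊑ (λ i p → Cyc.min cK _ (◁-mono true (getK s)) evK (zero , refl) (suc i) p)
                                    (λ i p → Cyc.min cR _ (◁-mono true (getR s)) evR (zero , refl) (suc i) p)
    ... | false , evK , evR with view e
    ... | inK i refl = case Cyc.min cK _ (⊑-trans (◁-mono false (getK s)) (◁-up true)) evK (suc i , q) zero refl of λ ()
    ... | inR j refl = case Cyc.min cR _ (⊑-trans (◁-mono false (getR s)) (◁-up true)) evR (suc j , q) zero refl of λ ()

-- Replacing a balanced two-terminal part by an edge

retail : ∀ {n} {Y : ESet (suc n)} {c} → Y zero ≡ c → Y ≗ c ◁ (Y ∘ suc)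
retail p zero = p
retail p (suc i) = refl

Cyclic? : ∀ {m} (G : Graph m) X → Dec (Cyclic G X)
Cyclic? G X = any-ESet? (λ C → Cyc G C × C ⊑ X) (λ p (c , s) → cyc-resp G p c , λ e q → s e (trans (p e) q)) (λ C → Cyc? G C ×-dec ⊑? C X)

module Replace {m : ℕ} {G : Graph m} (Q : QuasiBiased G) (tc : TwoConn G)
            (O : BalancedPart Q) {a b : ℕ} (E : Enum (BalancedPart.R O) a b) where

  open BalancedPart O
  open Enum E
  open TwoTerm G E v w v≢w shared

  -- Inserts the v-w path `Z` in place of the new edge, if `Y` uses it.
  lift : ESet b → ESet (suc a) → ESet m
  lift Z Y = glue (Y ∘ suc) (λ j → Y zero ∧ Z j)

  lift-cong : ∀ Z {Y Y'} → Y ≗ Y' → lift Z Y ≗ lift Z Y'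
  lift-cong Z p = glue-cong (λ i → p (suc i)) (λ j → cong (_∧ Z j) (p zero))

  lift-cyc : ∀ {Z Y} → Cyc Γ (true ◁ Z) → Cyc G' Y → Cyc G (lift Z Y)
  lift-cyc {Z} {Y} z y = go (bool-cases (Y zero))
    where
    go : Y zero ≡ true ⊎ Y zero ≡ false → Cyc G (lift Z Y)
    go (inj₁ p) = cyc-resp G (glue-cong (λ _ → refl) (λ j → sym (cong (_∧ Z j) p))) (cycX (cyc-resp G' (retail p) y) z)
    go (inj₂ p) = cyc-resp G (glue-cong (λ _ → refl) (λ j → sym (cong (_∧ Z j) p))) (cycK (cyc-resp G' (retail p) y))

  lift-inj : ∀ {Z Y Y'} → NE Z → lift Z Y ≗ lift Z Y' → Y ≗ Y'
  lift-inj {Z} {Y} {Y'} (j , q) p zero = trans (trans (sym (∧-identityʳ _)) (cong (Y zero ∧_) (sym q))) (trans (sym (glue-R (Y ∘ suc) _ j))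
    (trans (p (ιR j)) (trans (glue-R (Y' ∘ suc) _ j) (trans (cong (Y' zero ∧_) q) (∧-identityʳ _)))))
  lift-inj {Z} {Y} {Y'} _ p (suc i) = trans (sym (glue-K (Y ∘ suc) _ i)) (trans (p (ιK i)) (glue-K (Y' ∘ suc) _ i))

  lift-⊑ : ∀ {Z Y X} → Y ∘ suc ⊑ X ∘ ιK → (Y zero ≡ true → Z ⊑ X ∘ ιR) → lift Z Y ⊑ X
  lift-⊑ {Z} {Y} s t = glue-⊑ s (λ j p → t (∧-fst p) j (∧-snd {Y zero} p))

  lift-InV : ∀ {Z Y x} → InV G (lift Z Y) x → InV G' Y x ⊎ (Y zero ≡ true × InV G R x)
  lift-InV {Z} {Y} (e , p , i) with view e
  ... | inK k refl = inj₁ (suc k , trans (sym (glue-K (Y ∘ suc) _ k)) p , i)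
  ... | inR j refl = inj₂ (∧-fst (trans (sym (glue-R (Y ∘ suc) _ j)) p) , (ιR j , R-in j , i))

  v-in : ∀ {Y} → Y zero ≡ true → InV G' Y v
  v-in p = zero , p , inc-src G' zero

  w-in : ∀ {Y} → Y zero ≡ true → InV G' Y w
  w-in p = zero , p , inc-tgt G' zero

  terminal : ∀ {Y Y' x} → InV G' Y x → InV G R x → Y' zero ≡ true → InV G' Y' x
  terminal (zero , p , i) r q = zero , q , i
  terminal {x = x} (suc k , p , i) r q with shared x r (ιK k , not-f (K-out k) , i)
  ... | inj₁ refl = v-in q
  ... | inj₂ refl = w-in q

  -- A meeting inside the part involves an inserted path: if both cycles contain it they share `v`,
  -- and if one does, the meeting vertex is a terminal.
  lift-meet : ∀ {Z Y Y'} → Meet Q (lift Z Y) (lift Z Y') → ∃[ x ] (InV G' Y x × InV G' Y' x)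
  lift-meet {Z} {Y} {Y'} (x , p , q) with lift-InV {Z} {Y} p | lift-InV {Z} {Y'} q
  ... | inj₁ s | inj₁ t = x , s , t
  ... | inj₁ s | inj₂ (z , r) = x , s , terminal s r z
  ... | inj₂ (z , r) | inj₁ t = x , terminal t r z , t
  ... | inj₂ (z , _) | inj₂ (z' , _) = v , v-in z , v-in z'

  -- The two neighbours of the edge e on a cycle through it reach v and w.
  ends-in : ∀ {Z} → Cyc Γ (true ◁ Z) → ∀ A → InV G (glue A Z) v × InV G (glue A Z) w
  ends-in {Z} z A = go (ne-R (Cyc.even z))
    where
    at : ∀ {x} → InV Γ ((true ◁ Z) ⊓ sing zero) x → x ≡ v ⊎ x ≡ w
    at (zero , p , i) = inc-cases Γ {zero} i
    at (suc j , p , i) = ⊥-elim (t≢f (∧-snd {Z j} p) refl)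
    out : ∀ {x} → InV Γ ((true ◁ Z) ⊖ sing zero) x → InV G (glue A Z) x
    out (suc j , p , i) = ιR j , trans (glue-R A Z j) (∧-fst p) , i
    go : NE Z → InV G (glue A Z) v × InV G (glue A Z) w
    go (j , q) with cyc-cross Γ z (sing zero) {zero} {suc j} refl refl q refl
    ... | x , y , n , i₁ , i₂ , i₃ , i₄ with at i₁ | at i₃
    ... | inj₁ refl | inj₂ refl = out i₂ , out i₄
    ... | inj₂ refl | inj₁ refl = out i₄ , out i₂
    ... | inj₁ refl | inj₁ refl = ⊥-elim (n refl)
    ... | inj₂ refl | inj₂ refl = ⊥-elim (n refl)

  -- The exchange is made at an edge of `A`. A cycle of the union avoiding that edge cannot use `A`
  -- at all, by minimality of `true ◁ A`, so it lies in the balanced part.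
  reroute-R : ∀ {A Z Z'} → Cyc G' (true ◁ A) → Cyc Γ (true ◁ Z) → Cyc Γ (true ◁ Z') → κ Q (glue A Z) ≡ B → κ Q (glue A Z') ≡ B
  reroute-R {A} {Z} {Z'} cA z z' = reroute Q (ιK i) (cycX cA z) (cycX cA z') (trans (glue-K A Z i) ai) (trans (glue-K A Z' i) ai) balanced
    where
    i : Fin a
    i = proj₁ (ne-K (Cyc.even cA))
    ai : A i ≡ true
    ai = proj₂ (ne-K (Cyc.even cA))
    balanced : ∀ C → Cyc G C → C ⊑ glue A Z ⊔ glue A Z' → C (ιK i) ≡ false → κ Q C ≡ B
    balanced C c s ci with kind c
    ... | isR e _ = bal C c (λ f p → in-R f p)
      where
      in-R : ∀ f → C f ≡ true → R f ≡ true
      in-R f p with view f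
      ... | inK k refl = case e k p of λ ()
      ... | inR j refl = R-in j
    ... | isK _ cK = case Cyc.min cA (false ◁ (C ∘ ιK)) (⊑-trans (◁-mono false sK) (◁-up true)) (Cyc.even cK) (Cyc.ne cK) zero refl of λ ()
      where
      sK : C ∘ ιK ⊑ A
      sK k p with ∨-elim {glue A Z (ιK k)} (s (ιK k) p)
      ... | inj₁ q = trans (sym (glue-K A Z k)) q
      ... | inj₂ q = trans (sym (glue-K A Z' k)) q
    ... | isX cK _ = ⊥-elim (t≢f (Cyc.min cA (true ◁ (C ∘ ιK)) (◁-mono true sK) (Cyc.even cK) (Cyc.ne cK) (suc i) ai) ci)
      where
      sK : C ∘ ιK ⊑ A
      sK k p with ∨-elim {glue A Z (ιK k)} (s (ιK k) p)
      ... | inj₁ q = trans (sym (glue-K A Z k)) q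
      ... | inj₂ q = trans (sym (glue-K A Z' k)) q

  to-Γ : ∀ {Y x y} → Conn G (Y ⊓ R) x y → Conn Γ (false ◁ (Y ∘ ιR)) x y
  to-Γ {Y} = conn-map id h
    where
    h : ∀ e → (Y ⊓ R) e ≡ true → Conn Γ (false ◁ (Y ∘ ιR)) (src G e) (tgt G e)
    h e p with view e
    ... | inK k refl = ⊥-elim (t≢f (∧-snd {Y (ιK k)} p) (K-out k))
    ... | inR j refl = conn-edge Γ (suc j) (∧-fst p)

  through-e : ∀ {Y} → Conn G (Y ⊓ R) v w → ∃[ Z ] (Cyc Γ (true ◁ Z) × Z ⊑ Y ∘ ιR)
  through-e {Y} cn with close Γ {false ◁ (Y ∘ ιR)} zero refl (joins-self Γ zero) (conn-sym Γ (to-Γ {Y} cn))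
  ... | C , c , s , p = lookup C ∘ suc , cyc-resp Γ (retail p) (IsCycle→Cyc Γ c) ,
        λ j q → case ∨-elim {Y (ιR j)} (s (suc j) q) of λ { (inj₁ r) → r ; (inj₂ ()) }

  module WithPath (Z₀ : ESet b) (z₀ : Cyc Γ (true ◁ Z₀)) where

    -- Classes are read along the reference path `Z₀`. Another path gives the same answer on
    -- membership in `B`, but possibly not on `L` against `F`.
    κ₀ : ESet (suc a) → Class
    κ₀ Y = κ Q (lift Z₀ Y)

    κ₀-cong : ∀ {Y Y'} → Y ≗ Y' → κ₀ Y ≡ κ₀ Y'
    κ₀-cong p = κ-cong Q (lift-cong Z₀ p)

    module _ (T : Theta G') where
      open ThetaFacts G' T

      -- An even subset of the lifted union contains all or none of the path `Z₀`, so it is the lift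
      -- of an even subset of the theta, and there are only three nonempty ones.
      lift-theta : ¬ ExactlyTwoB (κ₀ c₁₂) (κ₀ c₁₃) (κ₀ c₂₃)
      lift-theta = alg-theta Q (lift-cyc z₀ cyc-c₁₂) (lift-cyc z₀ cyc-c₁₃) (lift-cyc z₀ cyc-c₂₃) sum≗ kinds
        where
        sum≗ : lift Z₀ c₂₃ ≗ lift Z₀ c₁₂ △ lift Z₀ c₁₃
        sum≗ e with view e
        ... | inK k refl = trans (glue-K _ _ k) (trans (c₂₃≗ (suc k)) (sym (cong₂ _xor_ (glue-K (c₁₂ ∘ suc) _ k) (glue-K (c₁₃ ∘ suc) _ k))))
        ... | inR j refl = trans (glue-R _ _ j) (trans (cong (_∧ Z₀ j) (c₂₃≗ zero)) (trans (∧-distribʳ-xor (Z₀ j) (c₁₂ zero) (c₁₃ zero))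
                             (sym (cong₂ _xor_ (glue-R (c₁₂ ∘ suc) _ j) (glue-R (c₁₃ ∘ suc) _ j)))))
        ⊑θ : c₁₂ ⊔ c₁₃ ⊑ θ
        ⊑θ i p with ∨-elim {c₁₂ i} p
        ... | inj₁ q = case ∨-elim {w₁ i} q of λ { (inj₁ r) → ∨-inl r ; (inj₂ r) → ∨-inr {w₁ i} (∨-inl r) }
        ... | inj₂ q = case ∨-elim {w₁ i} q of λ { (inj₁ r) → ∨-inl r ; (inj₂ r) → ∨-inr {w₁ i} (∨-inr {w₂ i} r) }
        kinds : ∀ Z → Even G Z → Z ⊑ lift Z₀ c₁₂ ⊔ lift Z₀ c₁₃ → NE Z → Z ≗ lift Z₀ c₁₂ ⊎ Z ≗ lift Z₀ c₁₃ ⊎ Z ≗ lift Z₀ c₂₃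
        kinds Z ev s ne = go (evenParts ev)
          where
          sK : ∀ k → Z (ιK k) ≡ true → (c₁₂ ⊔ c₁₃) (suc k) ≡ true
          sK k p with ∨-elim {lift Z₀ c₁₂ (ιK k)} (s (ιK k) p)
          ... | inj₁ q = ∨-inl (trans (sym (glue-K (c₁₂ ∘ suc) _ k)) q)
          ... | inj₂ q = ∨-inr {c₁₂ (suc k)} (trans (sym (glue-K (c₁₃ ∘ suc) _ k)) q)
          sR : ∀ j → Z (ιR j) ≡ true → (c₁₂ ⊔ c₁₃) zero ≡ true × Z₀ j ≡ true
          sR j p with ∨-elim {lift Z₀ c₁₂ (ιR j)} (s (ιR j) p)
          ... | inj₁ q = let r = trans (sym (glue-R (c₁₂ ∘ suc) (λ j → c₁₂ zero ∧ Z₀ j) j)) q in ∨-inl (∧-fst {c₁₂ zero} r) , ∧-snd {c₁₂ zero} r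
          ... | inj₂ q = let r = trans (sym (glue-R (c₁₃ ∘ suc) (λ j → c₁₃ zero ∧ Z₀ j) j)) q in ∨-inr {c₁₂ zero} (∧-fst {c₁₃ zero} r) , ∧-snd {c₁₃ zero} r
          go : ∃[ c ] (Even G' (c ◁ (Z ∘ ιK)) × Even Γ (c ◁ (Z ∘ ιR))) → Z ≗ lift Z₀ c₁₂ ⊎ Z ≗ lift Z₀ c₁₃ ⊎ Z ≗ lift Z₀ c₂₃
          go (c , evK , evR) = fin (theta-even Y evK Y⊑θ)
            where
            Y : ESet (suc a)
            Y = c ◁ (Z ∘ ιK)
            Y⊑θ : Y ⊑ θ
            Y⊑θ zero refl = ⊑θ zero (let (j , p) = ne-R evR in proj₁ (sR j p))
            Y⊑θ (suc k) p = ⊑θ (suc k) (sK k p)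
            R≗ : ∀ c → Even Γ (c ◁ (Z ∘ ιR)) → ∀ j → Z (ιR j) ≡ c ∧ Z₀ j
            R≗ true ev' j = true-iff (λ p → proj₂ (sR j p))
              (λ p → Cyc.min z₀ (true ◁ (Z ∘ ιR)) (◁-mono true (λ i q → proj₂ (sR i q))) ev' (zero , refl) (suc j) p)
            R≗ false ev' j = ≢true λ p → case Cyc.min z₀ (false ◁ (Z ∘ ιR)) (⊑-trans (◁-mono false (λ i q → proj₂ (sR i q))) (◁-up true)) ev' (suc j , p) zero refl of λ ()
            Z≗ : Z ≗ lift Z₀ Y
            Z≗ e with view e
            ... | inK k refl = sym (glue-K _ _ k)
            ... | inR j refl = trans (R≗ c evR j) (sym (glue-R _ _ j))
            via : ∀ {D} → Y ≗ D → Z ≗ lift Z₀ D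
            via p e = trans (Z≗ e) (lift-cong Z₀ p e)
            nonempty : NE Z → NE Y
            nonempty (e , p) with view e
            ... | inK k refl = suc k , p
            ... | inR j refl = zero , ∧-fst (trans (sym (R≗ c evR j)) p)
            fin : EvenKind Y → Z ≗ lift Z₀ c₁₂ ⊎ Z ≗ lift Z₀ c₁₃ ⊎ Z ≗ lift Z₀ c₂₃
            fin (is-none n) = ⊥-elim (n (nonempty ne))
            fin (is₁₂ p) = inj₁ (via p)
            fin (is₁₃ p) = inj₂ (inj₁ (via p))
            fin (is₂₃ p) = inj₂ (inj₂ (via p))

      theta-ok : ¬ ExactlyTwoB (κ₀ (lookup (Theta.cyc₁₂ T))) (κ₀ (lookup (Theta.cyc₁₃ T))) (κ₀ (lookup (Theta.cyc₂₃ T)))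
      theta-ok x = lift-theta (subst id (cong₂ (λ f z → f z) (cong₂ ExactlyTwoB (κ₀-cong lookup-c₁₂) (κ₀-cong lookup-c₁₃)) (κ₀-cong lookup-c₂₃)) x)

    Q' : QuasiBiased G'
    Q' = record
      { cls = λ X → κ₀ (lookup X)
      ; theta-cond = theta-ok
      ; LF-cond = λ C D c d k l → let (x , p , q) = lift-meet {Z₀} {lookup C} {lookup D}
                                        (LF-meet Q (lift-cyc z₀ (IsCycle→Cyc G' c)) (lift-cyc z₀ (IsCycle→Cyc G' d)) k l)
                                  in x , InV→vo G' p , InV→vo G' q }

    κ'≡ : ∀ Y → κ Q' Y ≡ κ₀ Y
    κ'≡ Y = κ₀-cong (lookup∘tabulate Y)

    data Trace (C : ESet m) : Bool → Set where
      trK : C ∘ ιR ⊑ none → Trace C false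
      trX : Cyc Γ (true ◁ (C ∘ ιR)) → Trace C true

    record Proj (C : ESet m) : Set where
      field
        c     : Bool
        cyc   : Cyc G' (c ◁ (C ∘ ιK))
        trace : Trace C c
      P : ESet (suc a)
      P = c ◁ (C ∘ ιK)

    C≗liftK : ∀ {C} → C ∘ ιR ⊑ none → lift Z₀ (false ◁ (C ∘ ιK)) ≗ C
    C≗liftK {C} s e = trans (glue-cong (λ _ → refl) (λ j → sym (≢true λ p → case s j p of λ ())) e) (glue-eta C e)

    κ-proj→ : ∀ {C} (p : Proj C) → κ Q C ≡ B → κ Q' (Proj.P p) ≡ B
    κ-proj→ {C} record { c = .false ; cyc = cyc ; trace = trK s } k = trans (κ'≡ (false ◁ (C ∘ ιK))) (trans (κ-cong Q (C≗liftK {C} s)) k)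
    κ-proj→ {C} record { c = .true ; cyc = cyc ; trace = trX z } k =
      trans (κ'≡ (true ◁ (C ∘ ιK))) (reroute-R {C ∘ ιK} {C ∘ ιR} cyc z z₀ (trans (κ-cong Q (glue-eta C)) k))

    κ-proj← : ∀ {C} (p : Proj C) → κ Q' (Proj.P p) ≡ B → κ Q C ≡ B
    κ-proj← {C} record { c = .false ; cyc = cyc ; trace = trK s } k = trans (sym (κ-cong Q (C≗liftK {C} s))) (trans (sym (κ'≡ (false ◁ (C ∘ ιK)))) k)
    κ-proj← {C} record { c = .true ; cyc = cyc ; trace = trX z } k =
      trans (sym (κ-cong Q (glue-eta C))) (reroute-R {C ∘ ιK} {Z₀} {C ∘ ιR} cyc z₀ z (trans (sym (κ'≡ (true ◁ (C ∘ ιK)))) k))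

    κ-projK : ∀ {C} (p : Proj C) → Proj.c p ≡ false → κ Q' (Proj.P p) ≡ κ Q C
    κ-projK {C} record { c = .false ; cyc = cyc ; trace = trK s } refl = trans (κ'≡ (false ◁ (C ∘ ιK))) (κ-cong Q (C≗liftK {C} s))

    proj-InV : ∀ {C x} (p : Proj C) → InV G' (Proj.P p) x → InV G C x
    proj-InV p (suc k , q , i) = ιK k , q , i
    proj-InV {C} record { c = .true ; cyc = cyc ; trace = trX z } (zero , q , i) with inc-cases G' {zero} i
    ... | inj₁ refl = InV-mono G (≗→⊑ (glue-eta C)) (proj₁ (ends-in z (C ∘ ιK)))
    ... | inj₂ refl = InV-mono G (≗→⊑ (glue-eta C)) (proj₂ (ends-in z (C ∘ ιK)))

    unbal-proj : ∀ {C} → Cyc G C → κ Q C ≢ B → Proj C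
    unbal-proj {C} c n with kind c
    ... | isK s cK = record { cyc = cK ; trace = trK s }
    ... | isX cK cR = record { cyc = cK ; trace = trX cR }
    ... | isR s _ = ⊥-elim (n (bal C c in-R))
      where
      in-R : C ⊑ R
      in-R f p with view f
      ... | inK k refl = case s k p of λ ()
      ... | inR j refl = R-in j

    -- At most one of the two projections uses the new edge, since they stay disjoint. The other
    -- keeps its class, and disjoint cycles outside `B` have the same class.
    nonDeg' : ∀ {k} → k ≢ B → NonDeg Q k → NonDeg Q' k
    nonDeg' {k} k≢B N = go (unbal-proj N.cycC (λ q → k≢B (trans (sym N.κC) q))) (unbal-proj N.cycD (λ q → k≢B (trans (sym N.κD) q)))
      where
      module N = NonDeg N
      go : Proj N.C → Proj N.D → NonDeg Q' k
      go p q = record { C = Proj.P p ; D = Proj.P q ; cycC = Proj.cyc p ; cycD = Proj.cyc q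
                      ; κC = proj₁ classes ; κD = proj₂ classes ; apart = ap }
        where
        ap : ¬ Meet Q' (Proj.P p) (Proj.P q)
        ap (x , s , t) = N.apart (x , proj-InV p s , proj-InV q t)
        same : κ Q' (Proj.P p) ≡ κ Q' (Proj.P q)
        same = same-class Q' (Proj.cyc p) (Proj.cyc q) (λ z → k≢B (trans (sym N.κC) (κ-proj← p z))) (λ z → k≢B (trans (sym N.κD) (κ-proj← q z))) ap
        classes : κ Q' (Proj.P p) ≡ k × κ Q' (Proj.P q) ≡ k
        classes with bool-cases (Proj.c p) | bool-cases (Proj.c q)
        ... | inj₂ x | _ = let y = trans (κ-projK p x) N.κC in y , trans (sym same) y
        ... | inj₁ _ | inj₂ x = let y = trans (κ-projK q x) N.κD in trans same y , y
        ... | inj₁ x | inj₁ y = ⊥-elim (ap (v , v-in x , v-in y))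

    -- All edges of the part are put on the side of the new edge. The shared vertices found in `G`
    -- then cannot involve two edges of the part, and those on its boundary are ends of the new
    -- edge.
    twoConn' : TwoConn G'
    twoConn' Y {e'} {f'} p q = conv (tc Ŷ {rep e'} {rep f'} (trans (Ŷ-rep e') p) (trans (Ŷ-rep f') q))
      where
      Ŷ : ESet m
      Ŷ = glue (Y ∘ suc) (λ _ → Y zero)
      j₀ : Fin b
      j₀ = proj₁ (ne-R (Cyc.even z₀))
      rep : Fin (suc a) → Fin m
      rep zero = ιR j₀
      rep (suc i) = ιK i
      Ŷ-rep : ∀ e → Ŷ (rep e) ≡ Y e
      Ŷ-rep zero = glue-R (Y ∘ suc) _ j₀
      Ŷ-rep (suc i) = glue-K (Y ∘ suc) _ i
      data Where (c : Bool) (x : Fin (nV G)) : Set where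
        onK : ∀ i → Y (suc i) ≡ c → Incident G (ιK i) x → Where c x
        onR : Y zero ≡ c → InV G R x → Where c x
      find : ∀ c e {x} → Ŷ e ≡ c → Incident G e x → Where c x
      find c e p i with view e
      ... | inK k refl = onK k (trans (sym (glue-K (Y ∘ suc) _ k)) p) i
      ... | inR j refl = onR (trans (sym (glue-R (Y ∘ suc) _ j)) p) (ιR j , R-in j , i)
      term : ∀ {x i} → Incident G (ιK i) x → InV G R x → Incident G' zero x
      term {x} {i} k r with shared x r (ιK i , not-f (K-out i) , k)
      ... | inj₁ refl = inc-src G' zero
      ... | inj₂ refl = inc-tgt G' zero
      both : ∀ {x} → Where true x → Where false x → InV G' Y x × InV G' (comp Y) x
      both (onK i s k) (onK i' s' k') = (suc i , s , k) , (suc i' , not-f s' , k')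
      both (onK i s k) (onR s' r) = (suc i , s , k) , (zero , not-f s' , term k r)
      both (onR s r) (onK i' s' k') = (zero , s , term k' r) , (suc i' , not-f s' , k')
      both (onR s r) (onR s' r') = ⊥-elim (t≢f s s')
      tr : ∀ {x} → InV G Ŷ x → InV G (comp Ŷ) x → InV G' Y x × InV G' (comp Y) x
      tr (e , p , i) (f , q , j) = both (find true e p i) (find false f (not-t q) j)
      conv : TwoShared G Ŷ → TwoShared G' Y
      conv (shared₂ x y n a₁ a₂ b₁ b₂) = shared₂ x y n (proj₁ (tr a₁ a₂)) (proj₂ (tr a₁ a₂)) (proj₁ (tr b₁ b₂)) (proj₂ (tr b₁ b₂))

    fromR : ∀ Z → Cyclic Γ (false ◁ (Z ∘ ιR)) → Dep Q Z
    fromR Z (C , c , s) = depB cg (glue-⊑ {X = Z} (λ _ ()) (λ j → s (suc j))) (bal _ cg (glue-⊑ {X = R} (λ _ ()) (λ j _ → R-in j)))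
      where
      cg : Cyc G (glue none (C ∘ suc))
      cg = cycR (cyc-resp Γ (retail (≢true λ p → case s zero p of λ ())) c)

    -- The path `Z₁` available in the given set may differ from the reference path by which the
    -- classes were defined.
    lift-dep : ∀ Z₁ → Cyc Γ (true ◁ Z₁) → ∀ {X Z} → (∀ {Y} → Cyc G' Y → Y ⊑ X → lift Z₁ Y ⊑ Z) →
      (∀ {x y} → Conn G' X x y → Conn G Z x y) → Dep Q' X → Dep Q Z
    lift-dep Z₁ z₁ {X} {Z} into cn = go
      where
      κB : ∀ {Y} → Cyc G' Y → κ₀ Y ≡ B → κ Q (lift Z₁ Y) ≡ B
      κB {Y} y k with bool-cases (Y zero)
      ... | inj₁ p = trans (κ-cong Q (lift-cong Z₁ {Y} (retail p))) (reroute-R {Y ∘ suc} {Z₀} {Z₁} (cyc-resp G' {Y} (retail p) y) z₀ z₁ (trans (sym (κ₀-cong {Y} (retail p))) k))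
      ... | inj₂ p = trans (κ-cong Q (trans-K Y p)) k
        where
        trans-K : ∀ Y → Y zero ≡ false → lift Z₁ Y ≗ lift Z₀ Y
        trans-K Y p = glue-cong (λ _ → refl) (λ j → trans (cong (_∧ Z₁ j) p) (sym (cong (_∧ Z₀ j) p)))
      inV : ∀ {Y x} → InV G' Y x → InV G (lift Z₁ Y) x
      inV {Y} (suc k , p , i) = ιK k , trans (glue-K (Y ∘ suc) _ k) p , i
      inV {Y} (zero , p , i) = InV-mono G (≗→⊑ (glue-cong (λ _ → refl) (λ j → sym (cong (_∧ Z₁ j) p)))) (case inc-cases G' {zero} i of λ where
        (inj₁ refl) → proj₁ (ends-in z₁ (Y ∘ suc))
        (inj₂ refl) → proj₂ (ends-in z₁ (Y ∘ suc)))
      ne₁ : NE Z₁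
      ne₁ = ne-R (Cyc.even z₁)
      -- a cycle avoiding e keeps its class, and two cycles through e meet
      pair : ∀ {Y Y'} → Cyc G' Y → Cyc G' Y' → ¬ Y ≗ Y' → Y ⊑ X → Y' ⊑ X → κ₀ Y ≡ L → κ₀ Y' ≡ L → Dep Q Z
      pair {Y} {Y'} y y' n s s' k l = dep-pair Q (lift-cyc z₁ y) (lift-cyc z₁ y') (λ p → n (lift-inj ne₁ p)) (into y s) (into y' s') both
        where
        clash : ∀ {Y} → Y zero ≡ false → κ₀ Y ≡ L → κ Q (lift Z₁ Y) ≡ F → ⊥
        clash {Y} p k f = case trans (sym k) (trans (κ-cong Q (glue-cong (λ _ → refl) (λ j → trans (cong (_∧ Z₀ j) p) (sym (cong (_∧ Z₁ j) p))))) f) of λ ()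
        both : κ Q (lift Z₁ Y) ≡ F → κ Q (lift Z₁ Y') ≡ F → ∃[ x ] ∃[ y ] (InV G (lift Z₁ Y) x × InV G (lift Z₁ Y') y × Conn G Z x y)
        both f f' with bool-cases (Y zero) | bool-cases (Y' zero)
        ... | inj₁ p | inj₁ p' = v , v , inV {Y} (v-in {Y} p) , inV {Y'} (v-in {Y'} p') , stop
        ... | inj₂ p | _ = ⊥-elim (clash {Y} p k f)
        ... | inj₁ _ | inj₂ p' = ⊥-elim (clash {Y'} p' l f')
      go : Dep Q' X → Dep Q Z
      go (depB {Y} y s k) = depB (lift-cyc z₁ y) (into y s) (κB y (trans (sym (κ'≡ Y)) k))
      go (depL {Y} {Y'} y y' n s s' k l) = pair y y' n s s' (trans (sym (κ'≡ Y)) k) (trans (sym (κ'≡ Y')) l)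
      go (depC {Y} {Y'} y y' n s s' i j c) = depC (lift-cyc z₁ y) (lift-cyc z₁ y') (λ p → n (lift-inj ne₁ p)) (into y s) (into y' s') (inV i) (inV j) (cn c)

    conn-K : ∀ {c Z} → (c ≡ true → Conn G Z v w) → ∀ {x y} → Conn G' (c ◁ (Z ∘ ιK)) x y → Conn G Z x y
    conn-K {c} {Z} h = conn-map id λ where
      zero p → h p
      (suc i) p → conn-edge G (ιK i) p

    fromK : ∀ Z → Dep Q' (false ◁ (Z ∘ ιK)) → Dep Q Z
    fromK Z = lift-dep Z₀ z₀ (λ {Y} y s → lift-⊑ {Z₀} {Y} (λ i → s (suc i)) (λ p → case s zero p of λ ())) (conn-K (λ ()))

    from× : ∀ Z → Dep Q' (true ◁ (Z ∘ ιK)) → Cyclic Γ (true ◁ (Z ∘ ιR)) → Dep Q Z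
    from× Z d (C , c , s) = go (bool-cases (C zero))
      where
      go : C zero ≡ true ⊎ C zero ≡ false → Dep Q Z
      go (inj₂ p) = fromR Z (C , c , λ { zero q → ⊥-elim (t≢f q p) ; (suc j) q → s (suc j) q })
      go (inj₁ p) = lift-dep (C ∘ suc) z₁ (λ {Y} y t → lift-⊑ {C ∘ suc} {Y} (λ i → t (suc i)) (λ _ j → s (suc j))) (conn-K (λ _ → vw)) d
        where
        z₁ : Cyc Γ (true ◁ (C ∘ suc))
        z₁ = cyc-resp Γ (retail p) c
        vw : Conn G Z v w
        vw = conn-sym G (conn-map {X = (true ◁ (C ∘ suc)) ⊖ sing zero} id (λ where
          (suc j) q → conn-edge G (ιR j) (s (suc j) (∧-fst q))) (even-conn Γ {true ◁ (C ∘ suc)} (Cyc.even z₁) {zero} refl (joins-self Γ zero)))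

    -- Three cases: the part of `Z` inside `R` contains a cycle, or contains no cycle but a v-w
    -- path, or neither. Only in the second is the new edge present in the projection.
    to : ∀ Z → Dep Q Z → Dep Q' (false ◁ (Z ∘ ιK)) ⊎ Cyclic Γ (false ◁ (Z ∘ ιR)) ⊎ (Dep Q' (true ◁ (Z ∘ ιK)) × Cyclic Γ (true ◁ (Z ∘ ιR)))
    to Z d = decR (Cyclic? Γ (false ◁ (Z ∘ ιR))) (Cyclic? Γ (true ◁ (Z ∘ ιR)))
      where
      module _ (noR : ¬ Cyclic Γ (false ◁ (Z ∘ ιR))) where
        proj : ∀ {C} → Cyc G C → C ⊑ Z → Proj C
        proj {C} c s with kind c
        ... | isK t cK = record { cyc = cK ; trace = trK t }
        ... | isX cK cR = record { cyc = cK ; trace = trX cR }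
        ... | isR _ cR = ⊥-elim (noR (_ , cR , ◁-mono false (λ j → s (ιR j))))
        proj-inj : ∀ {C D} (p : Proj C) (q : Proj D) → C ⊑ Z → D ⊑ Z → Proj.P p ≗ Proj.P q → C ≗ D
        proj-inj {C} {D} record { c = .false ; trace = trK s } record { c = .false ; trace = trK t } _ _ h e with view e
        ... | inK k refl = h (suc k)
        ... | inR j refl = trans (≢true λ p → case s j p of λ ()) (sym (≢true λ p → case t j p of λ ()))
        proj-inj {C} {D} record { c = .true ; trace = trX s } record { c = .true ; trace = trX t } sC sD h e with view e
        ... | inK k refl = h (suc k)
        -- Two different v-w paths inside `Z` would have a cycle in their sum, contrary to `noR`.
        ... | inR j refl = xor-eq (≢true λ p → let (Y , y , u , _) = cyc-through Γ {(true ◁ (C ∘ ιR)) △ (true ◁ (D ∘ ιR))} (even-△ Γ {true ◁ (C ∘ ιR)} {true ◁ (D ∘ ιR)} (Cyc.even s) (Cyc.even t)) {suc j} p in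
                noR (Y , y , λ { zero q → u zero q ; (suc i) q → case xor-elim {C (ιR i)} (u (suc i) q) of λ { (inj₁ (a , _)) → sC (ιR i) a ; (inj₂ (_ , b)) → sD (ιR i) b } }))
        proj-inj record { c = .false ; trace = trK s } record { c = .true ; trace = trX t } _ _ h = case h zero of λ ()
        proj-inj record { c = .true ; trace = trX s } record { c = .false ; trace = trK t } _ _ h = case h zero of λ ()

        module _ (X : ESet (suc a)) (into : ∀ {C} (p : Proj C) → C ⊑ Z → Proj.P p ⊑ X)
                 (φ : Fin (nV G) → Fin (nV G)) (hφ : ∀ e → Z e ≡ true → Conn G' X (φ (src G e)) (φ (tgt G e)))
                 (inV : ∀ {C x} (p : Proj C) → C ⊑ Z → InV G C x → InV G' (Proj.P p) (φ x)) where
          pair-L : ∀ {C D} (p : Proj C) (q : Proj D) → ¬ C ≗ D → C ⊑ Z → D ⊑ Z → κ Q C ≡ L → κ Q D ≡ L → Dep Q' X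
          pair-L p q n s t k l = dep-pair Q' (Proj.cyc p) (Proj.cyc q) (λ h → n (proj-inj p q s t h)) (into p s) (into q t) both
            where
            both : κ Q' (Proj.P p) ≡ F → κ Q' (Proj.P q) ≡ F → ∃[ x ] ∃[ y ] (InV G' (Proj.P p) x × InV G' (Proj.P q) y × Conn G' X x y)
            both f f' with bool-cases (Proj.c p) | bool-cases (Proj.c q)
            ... | inj₁ x | inj₁ y = v , v , v-in x , v-in y , stop
            ... | inj₂ x | _ = case trans (sym f) (trans (κ-projK p x) k) of λ ()
            ... | inj₁ _ | inj₂ y = case trans (sym f') (trans (κ-projK q y) l) of λ ()
          down : Dep Q Z → Dep Q' X
          down (depB c s k) = let p = proj c s in depB (Proj.cyc p) (into p s) (κ-proj→ p k)
          down (depL c d n s t k l) = pair-L (proj c s) (proj d t) n s t k l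
          down (depC c d n s t i j cn) = let p = proj c s ; q = proj d t in
            depC (Proj.cyc p) (Proj.cyc q) (λ h → n (proj-inj p q s t h)) (into p s) (into q t) (inV p s i) (inV q t j) (conn-map φ hφ cn)

      -- e present: vertices off K go to v
      withE : ¬ Cyclic Γ (false ◁ (Z ∘ ιR)) → Dep Q' (true ◁ (Z ∘ ιK))
      withE noR = down noR (true ◁ (Z ∘ ιK)) into φ hφ inV d
        where
        into : ∀ {C} (p : Proj C) → C ⊑ Z → Proj.P p ⊑ true ◁ (Z ∘ ιK)
        into p s zero q = refl
        into p s (suc k) q = s (ιK k) q
        φ : Fin (nV G) → Fin (nV G)
        φ x = if vset G (comp R) x then x else v
        φK : ∀ {x} → InV G (comp R) x → φ x ≡ x
        φK p rewrite vset-in G p = refl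
        φR : ∀ {x} → InV G R x → φ x ≡ v ⊎ φ x ≡ w
        φR {x} r with InV? G (comp R) x
        ... | yes p = shared x r p
        ... | no _ = inj₁ refl
        ev : Conn G' (true ◁ (Z ∘ ιK)) v w
        ev = conn-edge G' zero refl
        link : ∀ {x y} → x ≡ v ⊎ x ≡ w → y ≡ v ⊎ y ≡ w → Conn G' (true ◁ (Z ∘ ιK)) x y
        link (inj₁ refl) (inj₁ refl) = stop
        link (inj₁ refl) (inj₂ refl) = ev
        link (inj₂ refl) (inj₁ refl) = conn-sym G' ev
        link (inj₂ refl) (inj₂ refl) = stop
        hφ : ∀ e → Z e ≡ true → Conn G' (true ◁ (Z ∘ ιK)) (φ (src G e)) (φ (tgt G e))
        hφ e p with view e
        ... | inK k refl rewrite φK (ιK k , not-f (K-out k) , inc-src G (ιK k)) | φK (ιK k , not-f (K-out k) , inc-tgt G (ιK k)) = conn-edge G' (suc k) p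
        ... | inR j refl = link (φR (ιR j , R-in j , inc-src G (ιR j))) (φR (ιR j , R-in j , inc-tgt G (ιR j)))
        inV : ∀ {C x} (p : Proj C) → C ⊑ Z → InV G C x → InV G' (Proj.P p) (φ x)
        inV {C} p s (e , q , i) with view e
        ... | inK k refl rewrite φK (ιK k , not-f (K-out k) , i) = suc k , q , i
        ... | inR j refl = on-R p (φR (ιR j , R-in j , i))
          where
          on-R : ∀ {y} (p : Proj C) → y ≡ v ⊎ y ≡ w → InV G' (Proj.P p) y
          on-R record { trace = trK t } _ = case t j q of λ ()
          on-R record { trace = trX _ } (inj₁ refl) = zero , refl , inc-src G' zero
          on-R record { trace = trX _ } (inj₂ refl) = zero , refl , inc-tgt G' zero

      -- v and w apart in Z ∩ R: vertices off K go to the terminal they are attached to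
      without : ¬ Cyclic Γ (false ◁ (Z ∘ ιR)) → ¬ Cyclic Γ (true ◁ (Z ∘ ιR)) → Dep Q' (false ◁ (Z ∘ ιK))
      without noR noE = down noR (false ◁ (Z ∘ ιK)) into φ hφ inV d
        where
        noX : ∀ {C} → C ⊑ Z → ¬ Cyc Γ (true ◁ (C ∘ ιR))
        noX s z = noE (_ , z , ◁-mono true (λ j → s (ιR j)))
        into : ∀ {C} (p : Proj C) → C ⊑ Z → Proj.P p ⊑ false ◁ (Z ∘ ιK)
        into record { trace = trX z } s zero q = ⊥-elim (noX s z)
        into p s (suc k) q = s (ιK k) q
        apart : ¬ Conn G (Z ⊓ R) v w
        apart cn = let (Y , y , s) = through-e {Z} cn in noE (_ , y , ◁-mono true s)
        ψ : Fin (nV G) → Fin (nV G)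
        ψ x = if does (Conn? G (Z ⊓ R) x w) then w else v
        ψ-yes : ∀ {x} → Conn G (Z ⊓ R) x w → ψ x ≡ w
        ψ-yes {x} p rewrite dec-true (Conn? G (Z ⊓ R) x w) p = refl
        ψ-no : ∀ {x} → ¬ Conn G (Z ⊓ R) x w → ψ x ≡ v
        ψ-no {x} p rewrite dec-false (Conn? G (Z ⊓ R) x w) p = refl
        ψ-edge : ∀ e → (Z ⊓ R) e ≡ true → ψ (src G e) ≡ ψ (tgt G e)
        ψ-edge e p = go (Conn? G (Z ⊓ R) (src G e) w)
          where
          go : Dec (Conn G (Z ⊓ R) (src G e) w) → ψ (src G e) ≡ ψ (tgt G e)
          go (yes q) = trans (ψ-yes q) (sym (ψ-yes (conn-trans G (conn-sym G (conn-edge G e p)) q)))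
          go (no q) = trans (ψ-no q) (sym (ψ-no (λ r → q (conn-trans G (conn-edge G e p) r))))
        φ : Fin (nV G) → Fin (nV G)
        φ x = if vset G (comp R) x then x else ψ x
        φK : ∀ {x} → InV G (comp R) x → φ x ≡ x
        φK p rewrite vset-in G p = refl
        φR : ∀ {x} → InV G R x → φ x ≡ ψ x
        φR {x} r with InV? G (comp R) x
        ... | no _ = refl
        ... | yes p with shared x r p
        ... | inj₁ refl = sym (ψ-no apart)
        ... | inj₂ refl = sym (ψ-yes stop)
        hφ : ∀ e → Z e ≡ true → Conn G' (false ◁ (Z ∘ ιK)) (φ (src G e)) (φ (tgt G e))
        hφ e p with view e
        ... | inK k refl rewrite φK (ιK k , not-f (K-out k) , inc-src G (ιK k)) | φK (ιK k , not-f (K-out k) , inc-tgt G (ιK k)) = conn-edge G' (suc k) p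
        ... | inR j refl = subst (Conn G' (false ◁ (Z ∘ ιK)) (φ (src G (ιR j))))
                (trans (φR (ιR j , R-in j , inc-src G (ιR j))) (trans (ψ-edge (ιR j) (∧-in p (R-in j))) (sym (φR (ιR j , R-in j , inc-tgt G (ιR j)))))) stop
        inV : ∀ {C x} (p : Proj C) → C ⊑ Z → InV G C x → InV G' (Proj.P p) (φ x)
        inV {C} p s (e , q , i) with view e
        ... | inK k refl rewrite φK (ιK k , not-f (K-out k) , i) = suc k , q , i
        ... | inR j refl = ⊥-elim (on-R p)
          where
          on-R : Proj C → ⊥
          on-R record { trace = trK t } = case t j q of λ ()
          on-R record { trace = trX z } = noX s z

      decR : Dec (Cyclic Γ (false ◁ (Z ∘ ιR))) → Dec (Cyclic Γ (true ◁ (Z ∘ ιR))) → _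
      decR (yes p) _ = inj₂ (inj₁ p)
      decR (no n) (yes p) = inj₂ (inj₂ (withE n , p))
      decR (no n) (no n') = inj₁ (without n n')

    no-loop₁ : ¬ Dep Q' (true ◁ none)
    no-loop₁ = bad
      where
      no-cyc : ∀ {C} → Cyc G' C → ¬ C ⊑ true ◁ none
      no-cyc {C} c s with bool-cases (C zero)
      ... | inj₁ p = e-odd-K {C ∘ suc} (λ (i , q) → case s (suc i) q of λ ()) (even-resp G' {C} (retail p) (Cyc.even c))
      ... | inj₂ p = let (e , q) = Cyc.ne c in emp e q
        where
        emp : ∀ e → C e ≡ true → ⊥
        emp zero q = t≢f q p
        emp (suc i) q = case s (suc i) q of λ ()
      bad : ¬ Dep Q' (true ◁ none)
      bad (depB c s _) = no-cyc c s
      bad (depL c _ _ s _ _ _) = no-cyc c s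
      bad (depC c _ _ s _ _ _ _) = no-cyc c s

    no-loop₂ : ¬ Cyclic Γ (true ◁ none)
    no-loop₂ (C , c , s) with bool-cases (C zero)
    ... | inj₁ p = e-odd-R {C ∘ suc} (λ (i , q) → case s (suc i) q of λ ()) (even-resp Γ {C} (retail p) (Cyc.even c))
    ... | inj₂ p = let (e , q) = Cyc.ne c in emp e q
      where
      emp : ∀ e → C e ≡ true → ⊥
      emp zero q = t≢f q p
      emp (suc i) q = case s (suc i) q of λ ()

    iso : Iso (twoSum (qbCircuit Q') (IsCycle Γ)) (qbCircuit Q)
    iso = TwoSum.twoSum-iso E (Dep Q) (Dep Q') (Cyclic Γ) (dep-mono Q) (dep-mono Q') (cyclic-mono {G = Γ}) to fromK fromR from× no-loop₁ no-loop₂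
      (qbCircuit Q) (qbCircuit Q') (IsCycle Γ) (qb⇔ Q) (qb⇔ Q') (cyc⇔ Γ)

-- Assembling the first reduction

even-not-single : ∀ {m} {G : Graph m} {C e} → Even G C → C e ≡ true → src G e ≢ tgt G e → ∃[ f ] (C f ≡ true × f ≢ e)
even-not-single {G = G} {C} {e} ev ce nl = let (f , p , q) = ⋢ not-single in f , p , λ h → t≢f (trans (cong (sing e) h) (sing-self e)) q
  where
  not-single : ¬ C ⊑ sing e
  not-single s = t≢f (xsum-one e (∧-in ce (cong₂ _xor_ (sing-self (src G e)) (sing-ne (nl ∘ sym))))
    (λ k r → ∧-f₁ (≢true λ p → r (sing-elim {e = e} {k} (s k p))))) (ev (sing (src G e)))

-- Without loops a cycle has two edges, and a disjoint cycle supplies a third.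
three-edges : ∀ {a} {G : Graph (suc a)} (Q : QuasiBiased G) → TwoConn G → NonDeg Q L → 2 ≤ a
three-edges {a} {G} Q tc NL = ℕₚ.≤-pred (≤-trans (count-≥ all (i ∷ j ∷ k ∷ [])
    (((proj₂ (proj₂ other)) ∘ sym ∷ sep ci ∷ []) ∷ (sep (proj₁ (proj₂ other)) ∷ []) ∷ ([] ∷ [])) (refl ∷ refl ∷ refl ∷ []))
    (≤-reflexive (count-all {suc a})))
  where
  open NonDeg NL
  i k : Fin (suc a)
  i = proj₁ (Cyc.ne cycC)
  k = proj₁ (Cyc.ne cycD)
  ci : C i ≡ true
  ci = proj₂ (Cyc.ne cycC)
  sep : ∀ {e} → C e ≡ true → e ≢ k
  sep p refl = apart (_ , (k , p , inc-src G k) , (k , proj₂ (Cyc.ne cycD) , inc-src G k))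
  other : ∃[ f ] (C f ≡ true × f ≢ i)
  other = even-not-single {G = G} {C} (Cyc.even cycC) ci (noloop tc {i} {k} (sep ci ∘ sym))
  j : Fin (suc a)
  j = proj₁ other

reduction₁ : ∀ {m} {G : Graph m} (Q : QuasiBiased G) → TwoConn G → NonDeg Q L → NonDeg Q F → BalancedPart Q → Reduction Q
reduction₁ {m} {G} Q tc NL NF O = go (enum (BalancedPart.R O))
  where
  open BalancedPart O using (R; e; f; e≢f; eR; fR; conn; v; w; v≢w; shared)
  go : ∃[ a ] ∃[ b ] Enum R a b → Reduction Q
  go (a , b , E) = fin (X.through-e {all} conn)
    where
    module X = Replace Q tc O E
    2≤b : 2 ≤ b
    2≤b = ≤-trans (count-≥ R (e ∷ f ∷ []) ((e≢f ∷ []) ∷ ([] ∷ [])) (eR ∷ fR ∷ [])) (≤-reflexive (sym (Enum.b≡ E)))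
    fin : (∃[ Z ] (Cyc (TwoTerm.Γ G E v w v≢w shared) (true ◁ Z) × Z ⊑ (λ _ → true))) → Reduction Q
    fin (Z₀ , z₀ , _) = record
      { Q' = Y.Q' ; Γ = TwoTerm.Γ G E v w v≢w shared ; NL' = NL' ; NF' = Y.nonDeg' (λ ()) NF ; tc' = Y.twoConn'
      ; smaller = ≤-trans (≤-trans (≤-reflexive (+-comm 2 a)) (+-mono-≤ (≤-refl {a}) 2≤b)) (≤-reflexive (Enum.a+b≡ E))
      ; ok = three-edges Y.Q' Y.twoConn' NL' , 2≤b ,
          (λ l → Y.no-loop₁ (dep-mono Y.Q' sing⊑ (MinDep.dep (circuit→minDep Y.Q' l)))) ,
          no-coloop Y.Q' Y.twoConn' NL' zero ,
          (λ l → Y.no-loop₂ (_ , IsCycle→Cyc (TwoTerm.Γ G E v w v≢w shared) l , sing⊑)) ,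
          (λ col → col _ (Cyc→IsCycle′ (TwoTerm.Γ G E v w v≢w shared) z₀) (lookup⇒[]= zero (tabulate (true ◁ Z₀)) refl))
      ; iso = Y.iso }
      where
      module Y = X.WithPath Z₀ z₀
      NL' : NonDeg Y.Q' L
      NL' = Y.nonDeg' (λ ()) NL
      sing⊑ : ∀ {n} → lookup (⁅ zero {n} ⁆) ⊑ true ◁ none
      sing⊑ zero p = refl
      sing⊑ {n} (suc i) p = trans (sym (lookup-replicate i false)) p

-- The triangle as graphic summand

triangle : Graph 3
triangle = record { nV = 3 ; ends = λ { zero → zero , suc zero ; (suc zero) → suc zero , suc (suc zero) ; (suc (suc zero)) → suc (suc zero) , zero } }

triangle-even : ∀ {Y} → Even triangle Y → ∀ e → Y e ≡ Y zero
triangle-even {Y} ev zero = refl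
triangle-even {Y} ev (suc zero) = sym (aux (Y zero) (Y (suc zero)) (Y (suc (suc zero))) (ev (sing (suc zero))))
  where
  aux : ∀ a b c → (a ∧ true) xor ((b ∧ true) xor ((c ∧ false) xor false)) ≡ false → a ≡ b
  aux true true c p = refl
  aux false false c p = refl
  aux true false true ()
  aux true false false ()
  aux false true true ()
  aux false true false ()
triangle-even {Y} ev (suc (suc zero)) = sym (aux (Y zero) (Y (suc zero)) (Y (suc (suc zero))) (ev (sing zero)))
  where
  aux : ∀ a b c → (a ∧ true) xor ((b ∧ false) xor ((c ∧ true) xor false)) ≡ false → a ≡ c
  aux true b true p = refl
  aux false b false p = refl
  aux true true false ()
  aux true false false ()
  aux false true true ()
  aux false false true ()

triangle-cyc : Cyc triangle all
triangle-cyc = cyc-by-edge triangle all zero (λ U → aux (U zero) (U (suc zero)) (U (suc (suc zero)))) refl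
    λ { Y ev s p (e , q) → t≢f q (trans (triangle-even {Y} ev e) p) }
  where
  aux : ∀ a b c → (a xor b) xor ((b xor c) xor ((c xor a) xor false)) ≡ false
  aux true true true = refl
  aux true true false = refl
  aux true false true = refl
  aux true false false = refl
  aux false true true = refl
  aux false true false = refl
  aux false false true = refl
  aux false false false = refl

triangle-cyclic : ∀ {X} → Cyclic triangle X → ∀ e → X e ≡ true
triangle-cyclic (C , c , s) e = let (f , p) = Cyc.ne c in
  s e (trans (triangle-even {C} (Cyc.even c) e) (trans (sym (triangle-even {C} (Cyc.even c) f)) p))

-- Contracting one edge of a series pair

bd-lin : ∀ {m} (G : Graph m) Z U V → bd G Z (U △ V) ≡ bd G Z U xor bd G Z V
bd-lin G Z U V = trans (xsum-cong (λ e → aux (Z e) (U (src G e)) (V (src G e)) (U (tgt G e)) (V (tgt G e))))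
    (xsum-△ (λ e → Z e ∧ δ G U e) (λ e → Z e ∧ δ G V e))
  where
  aux : ∀ z a b c d → z ∧ ((a xor b) xor (c xor d)) ≡ (z ∧ (a xor c)) xor (z ∧ (b xor d))
  aux false a b c d = refl
  aux true a b c d = xor-swap a b c d

-- `h` becomes a coloop once `h'` is deleted: of two cycles avoiding `h'`, one that also avoids `h`
-- is in `B`, and if both use `h` their sum contains a cycle of `B` avoiding both edges.
series : ∀ {m} {G : Graph m} (Q : QuasiBiased G) h h' → (∀ C → Cyc G C → C h ≡ true → C h' ≡ false → κ Q C ≢ B) →
  (∀ C → Cyc G C → C h ≡ false → C h' ≡ false → κ Q C ≡ B) → ∀ {Z} → Z h' ≡ false → Dep Q Z → Dep Q (Z ⊖ sing h)
series {m} {G} Q h h' only bal {Z} zh = go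
  where
  off : ∀ {C} → C ⊑ Z → C h' ≡ false
  off s = ≢true λ p → t≢f (s h' p) zh
  in⊖ : ∀ {C} → C ⊑ Z → C h ≡ false → C ⊑ Z ⊖ sing h
  in⊖ {C} s p e q = ⊖-in {X = Z} {sing h} (s e q) (sing-ne {e = h} {e} λ { refl → t≢f q p })
  two : ∀ {C D} → Cyc G C → Cyc G D → ¬ C ≗ D → C ⊑ Z → D ⊑ Z → Dep Q (Z ⊖ sing h)
  two {C} {D} c d n s t with bool-cases (C h) | bool-cases (D h)
  ... | inj₂ p | _ = depB c (in⊖ s p) (bal C c p (off s))
  ... | inj₁ _ | inj₂ p = depB d (in⊖ t p) (bal D d p (off t))
  ... | inj₁ p | inj₁ q =
    let (e , de , ce) = cyc-diff G c d n
        (A , cA , sA , _) = cyc-through G {C △ D} (even-△ G {C} {D} (Cyc.even c) (Cyc.even d)) {e} (xor-ft ce de)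
        sZ : A ⊑ Z
        sZ = λ f r → case xor-elim {C f} (sA f r) of λ { (inj₁ (x , _)) → s f x ; (inj₂ (_ , y)) → t f y }
        Ah : A h ≡ false
        Ah = ≢true λ r → t≢f (sA h r) (cong₂ _xor_ p q)
    in depB cA (in⊖ sZ Ah) (bal A cA Ah (off sZ))
  go : Dep Q Z → Dep Q (Z ⊖ sing h)
  go (depB {C} c s k) = depB c (in⊖ s (≢true λ p → only C c p (off s) k)) k
  go (depL c d n s t _ _) = two c d n s t
  go (depC c d n s t _ _ _) = two c d n s t

module Contract {m : ℕ} {G : Graph m} (Q : QuasiBiased G) (tc : TwoConn G) (NL : NonDeg Q L) (NF : NonDeg Q F)
            {R : ESet m} {a : ℕ} (E : Enum R a 2)
            (bal₀ : ∀ C → Cyc G C → C ∘ Enum.ιR E ⊑ none → κ Q C ≡ B) where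

  open Enum E

  f g : Fin m
  f = ιR zero
  g = ιR (suc zero)

  c d : Fin (nV G)
  c = src G g
  d = tgt G g

  f≢g : f ≢ g
  f≢g p = case trans (sym (pick-R zero)) (trans (cong pick p) (pick-R (suc zero))) of λ ()

  c≢d : c ≢ d
  c≢d = noloop tc {g} {f} f≢g

  bal : ∀ C → Cyc G C → C f ≡ false → C g ≡ false → κ Q C ≡ B
  bal C cy p q = bal₀ C cy λ { zero r → trans (sym p) r ; (suc zero) r → trans (sym q) r }

  record Pair (k : Class) : Set where
    field
      Cf Cg : ESet m
      cycf  : Cyc G Cf
      cycg  : Cyc G Cg
      ff    : Cf f ≡ true
      fg    : Cf g ≡ false
      gf    : Cg f ≡ false
      gg    : Cg g ≡ true
      κf    : κ Q Cf ≡ k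
      κg    : κ Q Cg ≡ k
      apart : ¬ Meet Q Cf Cg

  -- Each of the two cycles must use `f` or `g`, and being disjoint they cannot use the same one.
  pair : ∀ {k} → k ≢ B → NonDeg Q k → Pair k
  pair k≢B N = go (bool-cases (C f)) (bool-cases (C g)) (bool-cases (D f)) (bool-cases (D g))
    where
    open NonDeg N
    clash : ∀ {e} → C e ≡ true → D e ≡ true → ⊥
    clash {e} p q = apart (_ , (e , p , inc-src G e) , (e , q , inc-src G e))
    go : C f ≡ true ⊎ C f ≡ false → C g ≡ true ⊎ C g ≡ false → D f ≡ true ⊎ D f ≡ false → D g ≡ true ⊎ D g ≡ false → Pair _
    go (inj₁ p) (inj₂ q) (inj₂ r) (inj₁ s) = record { cycf = cycC ; cycg = cycD ; ff = p ; fg = q ; gf = r ; gg = s ; κf = κC ; κg = κD ; apart = apart }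
    go (inj₂ p) (inj₁ q) (inj₁ r) (inj₂ s) = record { cycf = cycD ; cycg = cycC ; ff = r ; fg = s ; gf = p ; gg = q ; κf = κD ; κg = κC ; apart = apart ∘ meet-sym Q }
    go (inj₁ p) _ (inj₁ r) _ = ⊥-elim (clash p r)
    go _ (inj₁ q) _ (inj₁ s) = ⊥-elim (clash q s)
    go (inj₂ p) (inj₂ q) _ _ = ⊥-elim (k≢B (trans (sym κC) (bal C cycC p q)))
    go _ _ (inj₂ r) (inj₂ s) = ⊥-elim (k≢B (trans (sym κD) (bal D cycD r s)))

  PL : Pair L
  PL = pair (λ ()) NL

  PF : Pair F
  PF = pair (λ ()) NF

  -- If `C` were in `B`, rerouting at `f` would put the cycle of `L` through `f` in `B`, since
  -- neither cycle uses `g`.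
  f-only : ∀ C → Cyc G C → C f ≡ true → C g ≡ false → κ Q C ≢ B
  f-only C cy p q k = L≢B κf (reroute Q f cy cycf p ff
      (λ Z z s zf → bal Z z zf (≢true λ zg → case ∨-elim {C g} (s g zg) of λ { (inj₁ x) → t≢f x q ; (inj₂ y) → t≢f y fg })) k)
    where open Pair PL

  g-only : ∀ C → Cyc G C → C g ≡ true → C f ≡ false → κ Q C ≢ B
  g-only C cy p q k = L≢B κg (reroute Q g cy cycg p gg
      (λ Z z s zg → bal Z z (≢true λ zf → case ∨-elim {C f} (s f zf) of λ { (inj₁ x) → t≢f x q ; (inj₂ y) → t≢f y gf }) zg) k)
    where open Pair PL

  pr : Bool → Bool → ESet 2
  pr x y zero = x
  pr x y (suc zero) = y

  -- Undoes the contraction with the membership of `g` prescribed; the basepoint of the contracted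
  -- matroid is `f`.
  Lg : ESet (suc a) → Bool → ESet m
  Lg Y γ = glue (Y ∘ suc) (pr (Y zero) γ)

  Lg-K : ∀ Y γ i → Lg Y γ (ιK i) ≡ Y (suc i)
  Lg-K Y γ i = glue-K (Y ∘ suc) (pr (Y zero) γ) i

  Lg-f : ∀ Y γ → Lg Y γ f ≡ Y zero
  Lg-f Y γ = glue-R (Y ∘ suc) (pr (Y zero) γ) zero

  Lg-g : ∀ Y γ → Lg Y γ g ≡ γ
  Lg-g Y γ = glue-R (Y ∘ suc) (pr (Y zero) γ) (suc zero)

  data At (e : Fin m) : Set where
    atK : ∀ i → e ≡ ιK i → At e
    atf : e ≡ f → At e
    atg : e ≡ g → At e

  at : ∀ e → At e
  at e with view e
  ... | inK i p = atK i p
  ... | inR zero p = atf p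
  ... | inR (suc zero) p = atg p

  restr : ESet m → ESet (suc a)
  restr Z = Z f ◁ (Z ∘ ιK)

  restr-mono : ∀ {Z Z'} → Z ⊑ Z' → restr Z ⊑ restr Z'
  restr-mono s zero p = s f p
  restr-mono s (suc i) p = s (ιK i) p

  restr-cong : ∀ {Z Z'} → Z ≗ Z' → restr Z ≗ restr Z'
  restr-cong s zero = s f
  restr-cong s (suc i) = s (ιK i)

  restr-Lg : ∀ Y γ → restr (Lg Y γ) ≗ Y
  restr-Lg Y γ zero = Lg-f Y γ
  restr-Lg Y γ (suc i) = Lg-K Y γ i

  Lg-restr : ∀ Z {γ} → γ ≡ Z g → Lg (restr Z) γ ≗ Z
  Lg-restr Z {γ} p e with at e
  ... | atK i refl = Lg-K (restr Z) γ i
  ... | atf refl = Lg-f (restr Z) γ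
  ... | atg refl = trans (Lg-g (restr Z) γ) p

  -- Contraction of `g` onto its end `c`; the other end `d` stays as an isolated vertex.
  π : Fin (nV G) → Fin (nV G)
  π x = if sing d x then c else x

  π-d : π d ≡ c
  π-d rewrite sing-self d = refl

  π-off : ∀ {x} → x ≢ d → π x ≡ x
  π-off {x} n rewrite sing-ne {e = d} {x} n = refl

  π-c : π c ≡ c
  π-c = π-off c≢d

  π-cases : ∀ {x} → π x ≡ c → x ≡ c ⊎ x ≡ d
  π-cases {x} p with x ≟ d
  ... | yes q = inj₂ q
  ... | no _ = inj₁ p

  G' : Graph (suc a)
  G' = record { nV = nV G ; ends = λ { zero → π (src G f) , π (tgt G f) ; (suc i) → π (src G (ιK i)) , π (tgt G (ιK i)) } }

  bdK : ESet a → ESet (nV G) → Bool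
  bdK A V = xsum (λ i → A i ∧ δ G V (ιK i))

  bd-Lg : ∀ Y γ V → bd G (Lg Y γ) V ≡ bdK (Y ∘ suc) V xor ((Y zero ∧ δ G V f) xor (γ ∧ δ G V g))
  bd-Lg Y γ V = trans (xs (λ e → Lg Y γ e ∧ δ G V e)) (cong₂ _xor_ (xsum-cong (λ i → cong (_∧ δ G V (ιK i)) (Lg-K Y γ i)))
    (cong₂ _xor_ (cong (_∧ δ G V f) (Lg-f Y γ)) (trans (xor-identityʳ _) (cong (_∧ δ G V g) (Lg-g Y γ)))))

  bd-γ : ∀ Y γ V → bd G (Lg Y γ) V ≡ bd G (Lg Y false) V xor (γ ∧ δ G V g)
  bd-γ Y γ V = trans (bd-Lg Y γ V) (trans (sym (xor-assoc (bdK (Y ∘ suc) V) (Y zero ∧ δ G V f) (γ ∧ δ G V g)))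
    (cong (_xor (γ ∧ δ G V g)) (sym (trans (bd-Lg Y false V) (cong (bdK (Y ∘ suc) V xor_) (xor-identityʳ _))))))

  bd' : ∀ Y U → bd G' Y U ≡ bd G (Lg Y false) (U ∘ π)
  bd' Y U = sym (trans (bd-Lg Y false (U ∘ π)) (trans (cong (bdK (Y ∘ suc) (U ∘ π) xor_) (xor-identityʳ _))
    (xor-comm (bdK (Y ∘ suc) (U ∘ π)) (Y zero ∧ δ G (U ∘ π) f))))

  -- The degree parity at `d` tells whether `g` is needed to make the lift even.
  γ : ESet (suc a) → Bool
  γ Y = bd G (Lg Y false) (sing d)

  lift : ESet (suc a) → ESet m
  lift Y = Lg Y (γ Y)

  δd : δ G (sing d) g ≡ true
  δd = cong₂ _xor_ (sing-ne c≢d) (sing-self d)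

  -- A test set that agrees on `c` and `d` factors through `π`, and evenness in `G'` applies. Any
  -- other becomes such a set on adding the vertex `d`, and `γ` was chosen to balance the star of
  -- `d`.
  even-lift : ∀ {Y} → Even G' Y → Even G (lift Y)
  even-lift {Y} ev U = trans (bd-γ Y (γ Y) U) (go (bool-cases (U c xor U d)))
    where
    flat : ∀ V → V c ≡ V d → bd G (Lg Y false) V ≡ false
    flat V p = trans (bd-U G (Lg Y false) {V} {V ∘ π} (λ x _ → aux x)) (trans (sym (bd' Y V)) (ev V))
      where
      aux : ∀ x → V x ≡ V (π x)
      aux x with x ≟ d
      ... | yes refl = sym p
      ... | no _ = refl
    go : U c xor U d ≡ true ⊎ U c xor U d ≡ false → bd G (Lg Y false) U xor (γ Y ∧ (U c xor U d)) ≡ false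
    go (inj₂ p) = cong₂ _xor_ (flat U (xor-eq p)) (∧-f₂ {γ Y} p)
    go (inj₁ p) = eq-xor (trans (xor-eq {bd G (Lg Y false) U} {γ Y} (trans (sym (bd-lin G (Lg Y false) U (sing d))) (flat (U △ sing d) eqV))) (sym (trans (cong (γ Y ∧_) p) (∧-identityʳ _))))
      where
      eqV : (U △ sing d) c ≡ (U △ sing d) d
      eqV rewrite sing-ne {e = d} {c} c≢d | sing-self d = aux (U c) (U d) p
        where
        aux : ∀ a b → a xor b ≡ true → a xor false ≡ b xor true
        aux true false _ = refl
        aux false true _ = refl

  even-restr : ∀ {Z} → Even G Z → Even G' (restr Z)
  even-restr {Z} ev U = trans (bd' (restr Z) U) (trans (sym (xor-identityʳ _))
    (trans (cong (bd G (Lg (restr Z) false) (U ∘ π) xor_) (sym (∧-f₂ {Z g} (eq-xor (cong U (trans π-c (sym π-d)))))))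
      (trans (sym (bd-γ (restr Z) (Z g) (U ∘ π))) (trans (bd-cong G (Lg-restr Z refl) (U ∘ π)) (ev (U ∘ π))))))

  γ-restr : ∀ {Z} → Even G Z → γ (restr Z) ≡ Z g
  γ-restr {Z} ev = trans (xor-eq (trans (sym (bd-γ (restr Z) (Z g) (sing d))) (trans (bd-cong G (Lg-restr Z refl) (sing d)) (ev (sing d)))))
    (trans (cong (Z g ∧_) δd) (∧-identityʳ _))

  -- With `restr-lift` this identifies the even sets of `G` and `G'`: contracting a non-loop
  -- preserves the cycle space.
  lift-restr : ∀ {Z} → Even G Z → lift (restr Z) ≗ Z
  lift-restr {Z} ev = Lg-restr Z (γ-restr {Z} ev)

  Lg-cong : ∀ {Y Y' x} → Y ≗ Y' → Lg Y x ≗ Lg Y' x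
  Lg-cong p = glue-cong (λ i → p (suc i)) (λ { zero → p zero ; (suc zero) → refl })

  γ-cong : ∀ {Y Y'} → Y ≗ Y' → γ Y ≡ γ Y'
  γ-cong p = bd-cong G (Lg-cong p) (sing d)

  lift-cong : ∀ {Y Y'} → Y ≗ Y' → lift Y ≗ lift Y'
  lift-cong {Y} {Y'} p e = trans (Lg-cong {Y} {Y'} {γ Y} p e) (cong (λ x → Lg Y' x e) (γ-cong p))

  restr-lift : ∀ Y → restr (lift Y) ≗ Y
  restr-lift Y = restr-Lg Y (γ Y)

  lift-inj : ∀ {Y Y'} → lift Y ≗ lift Y' → Y ≗ Y'
  lift-inj {Y} {Y'} p e = trans (sym (restr-lift Y e)) (trans (restr-cong p e) (restr-lift Y' e))

  ne-restr : ∀ {Z} → Even G Z → NE Z → NE (restr Z)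
  ne-restr {Z} ev (e , p) with at e
  ... | atK i refl = suc i , p
  ... | atf refl = zero , p
  ... | atg refl with even-not-single {G = G} {Z} {g} ev p c≢d
  ... | h , q , n with at h
  ... | atK i refl = suc i , q
  ... | atf refl = zero , q
  ... | atg refl = ⊥-elim (n refl)

  lift-cyc : ∀ {Y} → Cyc G' Y → Cyc G (lift Y)
  lift-cyc {Y} y = record { even = even-lift {Y} (Cyc.even y) ; ne = ne (Cyc.ne y) ; min = mn }
    where
    ne : NE Y → NE (lift Y)
    ne (zero , p) = f , trans (Lg-f Y (γ Y)) p
    ne (suc i , p) = ιK i , trans (Lg-K Y (γ Y) i) p
    mn : ∀ Z → Z ⊑ lift Y → Even G Z → NE Z → lift Y ⊑ Z
    mn Z s ev n = ≗→⊑ λ e → trans (lift-cong (⊑-antisym (Cyc.min y (restr Z) sub (even-restr {Z} ev) (ne-restr {Z} ev n)) sub) e) (lift-restr {Z} ev e)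
      where
      sub : restr Z ⊑ Y
      sub e p = trans (sym (restr-lift Y e)) (restr-mono s e p)

  inc-f : ∀ {x} → Incident G f x → Incident G' zero (π x)
  inc-f i with inc-cases G {f} i
  ... | inj₁ refl = inc-src G' zero
  ... | inj₂ refl = inc-tgt G' zero

  inc-K : ∀ {i x} → Incident G (ιK i) x → Incident G' (suc i) (π x)
  inc-K {i} j with inc-cases G {ιK i} j
  ... | inj₁ refl = inc-src G' (suc i)
  ... | inj₂ refl = inc-tgt G' (suc i)

  InV-off : ∀ {Y x h} γ → h ≢ g → Lg Y γ h ≡ true → Incident G h x → InV G' Y (π x)
  InV-off {Y} {h = h} γ n p i with at h
  ... | atK k refl = suc k , trans (sym (Lg-K Y γ k)) p , inc-K i
  ... | atf refl = zero , trans (sym (Lg-f Y γ)) p , inc-f i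
  ... | atg refl = ⊥-elim (n refl)

  -- The lifted cycle uses `g` and leaves it at an end by another edge, which survives the
  -- contraction and becomes incident with `c`.
  InV-c : ∀ {Y} → Cyc G' Y → γ Y ≡ true → InV G' Y c
  InV-c {Y} y p = go (even-not-single {G = G} {lift Y} {g} (even-lift {Y} (Cyc.even y)) gY c≢d)
    where
    gY : lift Y g ≡ true
    gY = trans (Lg-g Y (γ Y)) p
    ends-g : ∀ {x} → InV G (lift Y ⊓ sing g) x → x ≡ c ⊎ x ≡ d
    ends-g (h , q , i) with sing-elim {e = g} {h} (∧-snd {lift Y h} q)
    ... | refl = inc-cases G i
    out : ∀ {x} → InV G (lift Y ⊖ sing g) x → InV G' Y (π x)
    out (h , q , i) = InV-off {Y} (γ Y) (λ r → t≢f (trans (cong (sing g) r) (sing-self g)) (⊖-snd {X = lift Y} {sing g} q)) (∧-fst q) i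
    go : ∃[ h ] (lift Y h ≡ true × h ≢ g) → InV G' Y c
    go (h , q , n) with cyc-cross G (lift-cyc y) (sing g) {g} {h} gY (sing-self g) q (sing-ne n)
    ... | x , _ , _ , i , j , _ with ends-g i
    ... | inj₁ refl = subst (InV G' Y) π-c (out j)
    ... | inj₂ refl = subst (InV G' Y) π-d (out j)

  lift-InV : ∀ {Y x} → Cyc G' Y → InV G (lift Y) x → InV G' Y (π x)
  lift-InV {Y} {x} y (h , p , i) with h ≟ g
  ... | no n = InV-off {Y} (γ Y) n p i
  ... | yes refl = subst (InV G' Y) (sym (to-c (inc-cases G i))) (InV-c y (trans (sym (Lg-g Y (γ Y))) p))
    where
    to-c : x ≡ c ⊎ x ≡ d → π x ≡ c
    to-c (inj₁ refl) = π-c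
    to-c (inj₂ refl) = π-d

  InV-lift : ∀ {Y y} → InV G' Y y → ∃[ x ] (InV G (lift Y) x × π x ≡ y)
  InV-lift {Y} (zero , p , i) with inc-cases G' {zero} i
  ... | inj₁ refl = src G f , (f , trans (Lg-f Y (γ Y)) p , inc-src G f) , refl
  ... | inj₂ refl = tgt G f , (f , trans (Lg-f Y (γ Y)) p , inc-tgt G f) , refl
  InV-lift {Y} (suc k , p , i) with inc-cases G' {suc k} i
  ... | inj₁ refl = src G (ιK k) , (ιK k , trans (Lg-K Y (γ Y) k) p , inc-src G (ιK k)) , refl
  ... | inj₂ refl = tgt G (ιK k) , (ιK k , trans (Lg-K Y (γ Y) k) p , inc-tgt G (ιK k)) , refl

  κ₀ : ESet (suc a) → Class
  κ₀ Y = κ Q (lift Y)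

  κ₀-cong : ∀ {Y Y'} → Y ≗ Y' → κ₀ Y ≡ κ₀ Y'
  κ₀-cong p = κ-cong Q (lift-cong p)

  module _ (T : Theta G') where
    open ThetaFacts G' T

    lift-theta : ¬ ExactlyTwoB (κ₀ c₁₂) (κ₀ c₁₃) (κ₀ c₂₃)
    lift-theta = alg-theta Q (lift-cyc cyc-c₁₂) (lift-cyc cyc-c₁₃) (lift-cyc cyc-c₂₃) sum≗ kinds
      where
      △-restr : restr (lift c₁₂ △ lift c₁₃) ≗ c₂₃
      △-restr e = trans (restr-△ e) (trans (cong₂ _xor_ (restr-lift c₁₂ e) (restr-lift c₁₃ e)) (sym (c₂₃≗ e)))
        where
        restr-△ : restr (lift c₁₂ △ lift c₁₃) ≗ restr (lift c₁₂) △ restr (lift c₁₃)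
        restr-△ zero = refl
        restr-△ (suc i) = refl
      sum≗ : lift c₂₃ ≗ lift c₁₂ △ lift c₁₃
      sum≗ e = trans (lift-cong (λ i → sym (△-restr i)) e)
        (lift-restr {lift c₁₂ △ lift c₁₃} (even-△ G {lift c₁₂} {lift c₁₃} (even-lift {c₁₂} (Cyc.even cyc-c₁₂)) (even-lift {c₁₃} (Cyc.even cyc-c₁₃))) e)
      ⊑θ : c₁₂ ⊔ c₁₃ ⊑ θ
      ⊑θ i p with ∨-elim {c₁₂ i} p
      ... | inj₁ q = case ∨-elim {w₁ i} q of λ { (inj₁ r) → ∨-inl r ; (inj₂ r) → ∨-inr {w₁ i} (∨-inl r) }
      ... | inj₂ q = case ∨-elim {w₁ i} q of λ { (inj₁ r) → ∨-inl r ; (inj₂ r) → ∨-inr {w₁ i} (∨-inr {w₂ i} r) }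
      kinds : ∀ Z → Even G Z → Z ⊑ lift c₁₂ ⊔ lift c₁₃ → NE Z → Z ≗ lift c₁₂ ⊎ Z ≗ lift c₁₃ ⊎ Z ≗ lift c₂₃
      kinds Z ev s ne = fin (theta-even (restr Z) (even-restr {Z} ev) (⊑-trans sub ⊑θ))
        where
        sub : restr Z ⊑ c₁₂ ⊔ c₁₃
        sub zero p = case ∨-elim {lift c₁₂ f} (s f p) of λ where
          (inj₁ q) → ∨-inl (trans (sym (restr-lift c₁₂ zero)) q)
          (inj₂ q) → ∨-inr {c₁₂ zero} (trans (sym (restr-lift c₁₃ zero)) q)
        sub (suc i) p = case ∨-elim {lift c₁₂ (ιK i)} (s (ιK i) p) of λ where
          (inj₁ q) → ∨-inl (trans (sym (restr-lift c₁₂ (suc i))) q)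
          (inj₂ q) → ∨-inr {c₁₂ (suc i)} (trans (sym (restr-lift c₁₃ (suc i))) q)
        via : ∀ {D} → restr Z ≗ D → Z ≗ lift D
        via p e = trans (sym (lift-restr {Z} ev e)) (lift-cong p e)
        fin : EvenKind (restr Z) → Z ≗ lift c₁₂ ⊎ Z ≗ lift c₁₃ ⊎ Z ≗ lift c₂₃
        fin (is-none n) = ⊥-elim (n (ne-restr {Z} ev ne))
        fin (is₁₂ p) = inj₁ (via p)
        fin (is₁₃ p) = inj₂ (inj₁ (via p))
        fin (is₂₃ p) = inj₂ (inj₂ (via p))

    theta-ok : ¬ ExactlyTwoB (κ₀ (lookup (Theta.cyc₁₂ T))) (κ₀ (lookup (Theta.cyc₁₃ T))) (κ₀ (lookup (Theta.cyc₂₃ T)))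
    theta-ok x = lift-theta (subst id (cong₂ (λ f z → f z) (cong₂ ExactlyTwoB (κ₀-cong lookup-c₁₂) (κ₀-cong lookup-c₁₃)) (κ₀-cong lookup-c₂₃)) x)

  Q' : QuasiBiased G'
  Q' = record
    { cls = λ X → κ₀ (lookup X)
    ; theta-cond = theta-ok
    ; LF-cond = λ C D cC cD k l → let yC = IsCycle→Cyc G' cC ; yD = IsCycle→Cyc G' cD
                                      (x , p , q) = LF-meet Q (lift-cyc yC) (lift-cyc yD) k l
                                  in π x , InV→vo G' (lift-InV yC p) , InV→vo G' (lift-InV yD q) }

  κ'≡ : ∀ Y → κ Q' Y ≡ κ₀ Y
  κ'≡ Y = κ₀-cong (lookup∘tabulate Y)

  κ-restr : ∀ {C} → Cyc G C → κ Q' (restr C) ≡ κ Q C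
  κ-restr {C} cy = trans (κ'≡ (restr C)) (κ-cong Q (lift-restr {C} (Cyc.even cy)))

  -- A subset of restr C lifts into C provided it does not acquire the edge g.
  restr-min : ∀ {C} → Cyc G C → (∀ Y → Y ⊑ restr C → Even G' Y → γ Y ≡ true → C g ≡ true) → Cyc G' (restr C)
  restr-min {C} cy h = record
    { even = even-restr {C} (Cyc.even cy) ; ne = ne-restr {C} (Cyc.even cy) (Cyc.ne cy)
    ; min = λ Y s ev n e p → trans (sym (restr-lift Y e)) (restr-mono (Cyc.min cy (lift Y) (sub Y s ev) (even-lift {Y} ev) (ne Y n)) e p) }
    where
    sub : ∀ Y → Y ⊑ restr C → Even G' Y → lift Y ⊑ C
    sub Y s ev e p with at e
    ... | atK i refl = s (suc i) (trans (sym (Lg-K Y (γ Y) i)) p)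
    ... | atf refl = s zero (trans (sym (Lg-f Y (γ Y))) p)
    ... | atg refl = h Y s ev (trans (sym (Lg-g Y (γ Y))) p)
    ne : ∀ Y → NE Y → NE (lift Y)
    ne Y (zero , p) = f , trans (Lg-f Y (γ Y)) p
    ne Y (suc i , p) = ιK i , trans (Lg-K Y (γ Y) i) p

  -- A subset of a cycle missing `d` has even parity at `d`, so its lift does not acquire `g`.
  restr-off : ∀ {C} → Cyc G C → C g ≡ false → ¬ InV G C d → Cyc G' (restr C)
  restr-off {C} cy cg n = restr-min cy λ Y s ev p → ⊥-elim (t≢f p (bd-const G (Lg Y false) (sing d) false
      (λ x i → sing-ne {e = d} {x} λ { refl → n (InV-mono G (sub Y s) i) })))
    where
    sub : ∀ Y → Y ⊑ restr C → Lg Y false ⊑ C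
    sub Y s e p with at e
    ... | atK i refl = s (suc i) (trans (sym (Lg-K Y false i)) p)
    ... | atf refl = s zero (trans (sym (Lg-f Y false)) p)
    ... | atg refl = ⊥-elim (t≢f p (Lg-g Y false))

  -- The cycle through `f` avoids both ends of `g`, which belong to its partner; so its restriction
  -- remains a cycle and contraction creates no new meeting.
  nonDeg' : ∀ {k} → Pair k → NonDeg Q' k
  nonDeg' P = record
    { C = restr Cf ; D = restr Cg ; cycC = yf ; cycD = yg
    ; κC = trans (κ-restr cycf) κf ; κD = trans (κ-restr cycg) κg ; apart = ap }
    where
    open Pair P
    g-at : ∀ {x} → Incident G g x → InV G Cg x
    g-at i = g , gg , i
    yf : Cyc G' (restr Cf)
    yf = restr-off cycf fg (λ i → apart (d , i , g-at (inc-tgt G g)))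
    yg : Cyc G' (restr Cg)
    yg = restr-min cycg (λ _ _ _ _ → gg)
    ap : ¬ Meet Q' (restr Cf) (restr Cg)
    ap (y , i , j) = go (InV-lift i) (InV-lift j)
      where
      go : ∃[ x ] (InV G (lift (restr Cf)) x × π x ≡ y) → ∃[ x ] (InV G (lift (restr Cg)) x × π x ≡ y) → ⊥
      go (x , p , r) (x' , p' , r') = sep (InV-mono G (≗→⊑ (lift-restr {Cf} (Cyc.even cycf))) p) (InV-mono G (≗→⊑ (lift-restr {Cg} (Cyc.even cycg))) p') (x ≟ d) (x' ≟ d)
        where
        sep : InV G Cf x → InV G Cg x' → Dec (x ≡ d) → Dec (x' ≡ d) → ⊥
        sep u u' (yes refl) _ = apart (d , u , g-at (inc-tgt G g))
        sep u u' (no n) (yes refl) = apart (c , subst (InV G Cf) (trans (sym (π-off n)) (trans r (trans (sym r') π-d))) u , g-at (inc-src G g))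
        sep u u' (no n) (no n') = apart (x , u , subst (InV G Cg) (trans (sym (π-off n')) (trans r' (trans (sym r) (π-off n)))) u')

  -- With `g` present every lifted cycle fits, whatever its `γ`, and connections through the
  -- contracted vertex run along `g`.
  up : ∀ {Y} → Dep Q' Y → Dep Q (Lg Y true)
  up {Y} = go
    where
    X : ESet m
    X = Lg Y true
    into : ∀ {Y₁} → Y₁ ⊑ Y → lift Y₁ ⊑ X
    into {Y₁} s e p with at e
    ... | atK i refl = trans (Lg-K Y true i) (s (suc i) (trans (sym (Lg-K Y₁ (γ Y₁) i)) p))
    ... | atf refl = trans (Lg-f Y true) (s zero (trans (sym (Lg-f Y₁ (γ Y₁))) p))
    ... | atg refl = Lg-g Y true
    toπ : ∀ x → Conn G X x (π x)
    toπ x with x ≟ d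
    ... | yes refl = conn-sym G (conn-edge G g (Lg-g Y true))
    ... | no _ = stop
    edge : ∀ e → X e ≡ true → Conn G X (π (src G e)) (π (tgt G e))
    edge e p = conn-trans G (conn-sym G (toπ (src G e))) (conn-trans G (conn-edge G e p) (toπ (tgt G e)))
    cn : ∀ {x y} → Conn G' Y x y → Conn G X x y
    cn = conn-map id λ where
      zero p → edge f (trans (Lg-f Y true) p)
      (suc i) p → edge (ιK i) (trans (Lg-K Y true i) p)
    go : Dep Q' Y → Dep Q X
    go (depB {Y₁} y s k) = depB (lift-cyc y) (into s) (trans (sym (κ'≡ Y₁)) k)
    go (depL {Y₁} {Y₂} y y' n s t k l) = depL (lift-cyc y) (lift-cyc y') (λ p → n (lift-inj p)) (into s) (into t) (trans (sym (κ'≡ Y₁)) k) (trans (sym (κ'≡ Y₂)) l)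
    go (depC {Y₁} {Y₂} y y' n s t i j cc) =
      let (x , p , r) = InV-lift {Y₁} i ; (x' , p' , r') = InV-lift {Y₂} j in
      depC (lift-cyc y) (lift-cyc y') (λ p → n (lift-inj p)) (into s) (into t) p p'
        (conn-trans G (subst (Conn G X x) r (toπ x)) (conn-trans G (cn cc) (conn-sym G (subst (Conn G X x') r' (toπ x')))))

  down : ∀ {Z} → Dep Q Z → Dep Q' (restr Z)
  down {Z} = go
    where
    -- when contraction splits C, both halves pass through the contracted vertex
    cyc-or : ∀ {C} → Cyc G C → C ⊑ Z → Cyc G' (restr C) ⊎ Dep Q' (restr Z)
    cyc-or {C} cy s with ne-restr {C} (Cyc.even cy) (Cyc.ne cy)
    ... | e , p with cyc-through G' {restr C} (even-restr {C} (Cyc.even cy)) {e} p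
    ... | Y₁ , y₁ , s₁ , _ with ⊑? (restr C) Y₁
    ... | yes t = inj₁ (cyc-resp G' (⊑-antisym s₁ t) y₁)
    ... | no n with ⋢ n
    ... | e₂ , p₂ , q₂ with cyc-through G' {restr C △ Y₁} (even-△ G' {restr C} {Y₁} (even-restr {C} (Cyc.even cy)) (Cyc.even y₁)) {e₂} (xor-tf p₂ q₂)
    ... | Y₂ , y₂ , s₂ , _ = inj₂ (depC y₁ y₂ Y₁≉Y₂ (⊑-trans s₁ (restr-mono s)) (⊑-trans s₂' (restr-mono s))
            (InV-c y₁ (has-g y₁ s₁ λ t → n t)) (InV-c y₂ (has-g y₂ s₂' λ t → disj (Cyc.ne y₁) (λ e r → t e (s₁ e r)))) stop)
      where
      s₂' : Y₂ ⊑ restr C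
      s₂' e r with xor-elim {restr C e} (s₂ e r)
      ... | inj₁ (x , _) = x
      ... | inj₂ (x , y) = ⊥-elim (t≢f (s₁ e y) x)
      disj : NE Y₁ → ¬ Y₁ ⊑ Y₂
      disj (e , r) t = t≢f (s₂ e (t e r)) (cong₂ _xor_ (s₁ e r) r)
      Y₁≉Y₂ : ¬ Y₁ ≗ Y₂
      Y₁≉Y₂ h = disj (Cyc.ne y₁) (≗→⊑ h)
      has-g : ∀ {Y} → Cyc G' Y → Y ⊑ restr C → ¬ restr C ⊑ Y → γ Y ≡ true
      has-g {Y} y t nt = ≢false λ r → nt (λ e q → trans (sym (restr-lift Y e)) (restr-mono (Cyc.min cy (lift Y) (sub r) (even-lift {Y} (Cyc.even y)) (Cyc.ne (lift-cyc y))) e q))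
        where
        sub : γ Y ≡ false → lift Y ⊑ C
        sub r e q with at e
        ... | atK i refl = t (suc i) (trans (sym (Lg-K Y (γ Y) i)) q)
        ... | atf refl = t zero (trans (sym (Lg-f Y (γ Y))) q)
        ... | atg refl = ⊥-elim (t≢f (trans (sym (Lg-g Y (γ Y))) q) r)
    ≉ : ∀ {C D} → Cyc G C → Cyc G D → ¬ C ≗ D → ¬ restr C ≗ restr D
    ≉ {C} {D} cC cD n h = n (λ e → trans (sym (lift-restr {C} (Cyc.even cC) e)) (trans (lift-cong h e) (lift-restr {D} (Cyc.even cD) e)))
    inV : ∀ {C x} → Cyc G C → Cyc G' (restr C) → InV G C x → InV G' (restr C) (π x)
    inV {C} cy y i = lift-InV y (InV-mono G (≗→⊑ (λ e → sym (lift-restr {C} (Cyc.even cy) e))) i)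
    cn : ∀ e → Z e ≡ true → Conn G' (restr Z) (π (src G e)) (π (tgt G e))
    cn e p with at e
    ... | atK i refl = conn-edge G' (suc i) p
    ... | atf refl = conn-edge G' zero p
    ... | atg refl = subst (Conn G' (restr Z) (π c)) (trans π-c (sym π-d)) stop
    go : Dep Q Z → Dep Q' (restr Z)
    go (depB cy s k) with cyc-or cy s
    ... | inj₂ dp = dp
    ... | inj₁ y = depB y (restr-mono s) (trans (κ-restr cy) k)
    go (depL cC cD n s t k l) with cyc-or cC s | cyc-or cD t
    ... | inj₂ dp | _ = dp
    ... | inj₁ _ | inj₂ dp = dp
    ... | inj₁ y | inj₁ y' = depL y y' (≉ cC cD n) (restr-mono s) (restr-mono t) (trans (κ-restr cC) k) (trans (κ-restr cD) l)
    go (depC cC cD n s t i j cc) with cyc-or cC s | cyc-or cD t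
    ... | inj₂ dp | _ = dp
    ... | inj₁ _ | inj₂ dp = dp
    ... | inj₁ y | inj₁ y' = depC y y' (≉ cC cD n) (restr-mono s) (restr-mono t) (inV cC y i) (inV cD y' j) (conn-map π cn cc)

  -- The triangle consists of the basepoint, `f` and `g`, so it takes part only if both edges are in
  -- `Z`. If just `f` is, it is dropped as a coloop before contracting.
  to : ∀ Z → Dep Q Z → Dep Q' (false ◁ (Z ∘ ιK)) ⊎ Cyclic triangle (false ◁ (Z ∘ ιR)) ⊎ (Dep Q' (true ◁ (Z ∘ ιK)) × Cyclic triangle (true ◁ (Z ∘ ιR)))
  to Z dp = go (bool-cases (Z f)) (bool-cases (Z g))
    where
    go : Z f ≡ true ⊎ Z f ≡ false → Z g ≡ true ⊎ Z g ≡ false → _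
    go (inj₂ p) _ = inj₁ (dep-mono Q' (λ { zero q → ⊥-elim (t≢f q p) ; (suc i) q → q }) (down dp))
    go (inj₁ p) (inj₂ q) = inj₁ (dep-mono Q' (λ { zero r → ⊥-elim (t≢f (sing-self f) (⊖-snd {X = Z} {sing f} r)) ; (suc i) r → ∧-fst r })
      (down (series Q f g f-only bal q dp)))
    go (inj₁ p) (inj₁ q) = inj₂ (inj₂ (dep-mono Q' (λ { zero _ → refl ; (suc i) r → r }) (down dp) ,
      (all , triangle-cyc , λ { zero _ → refl ; (suc zero) _ → p ; (suc (suc zero)) _ → q })))

  -- `g` is added to lift the dependence and removed again, being a coloop in the absence of `f`.
  fromK : ∀ Z → Dep Q' (false ◁ (Z ∘ ιK)) → Dep Q Z
  fromK Z dp = dep-mono Q sub (series Q g f g-only (λ C cy p q → bal C cy q p) (Lg-f Y true) (up dp))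
    where
    Y : ESet (suc a)
    Y = false ◁ (Z ∘ ιK)
    sub : Lg Y true ⊖ sing g ⊑ Z
    sub e p with at e
    ... | atK i refl = trans (sym (Lg-K Y true i)) (∧-fst p)
    ... | atf refl = ⊥-elim (t≢f (∧-fst p) (Lg-f Y true))
    ... | atg refl = ⊥-elim (t≢f (sing-self g) (⊖-snd {X = Lg Y true} {sing g} p))

  fromR : ∀ Z → Cyclic triangle (false ◁ (Z ∘ ιR)) → Dep Q Z
  fromR Z cy = case triangle-cyclic cy zero of λ ()

  from× : ∀ Z → Dep Q' (true ◁ (Z ∘ ιK)) → Cyclic triangle (true ◁ (Z ∘ ιR)) → Dep Q Z
  from× Z dp cy = dep-mono Q sub (up dp)
    where
    sub : Lg (true ◁ (Z ∘ ιK)) true ⊑ Z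
    sub e p with at e
    ... | atK i refl = trans (sym (Lg-K (true ◁ (Z ∘ ιK)) true i)) p
    ... | atf refl = triangle-cyclic cy (suc zero)
    ... | atg refl = triangle-cyclic cy (suc (suc zero))

  f-g-apart : ∀ {x} → Incident G f x → ¬ Incident G g x
  f-g-apart i j = apart (_ , (f , ff , i) , (g , gg , j))
    where open Pair PL

  no-loop₁ : ¬ Dep Q' (true ◁ none)
  no-loop₁ = bad
    where
    no-cyc : ∀ {Y} → Cyc G' Y → ¬ Y ⊑ true ◁ none
    no-cyc {Y} y s = t≢f (xsum-one f (∧-in Lf (cong₂ _xor_ (sing-self (src G f)) (sing-ne (noloop tc {f} {g} (f≢g ∘ sym) ∘ sym)))) others)
        (even-lift {Y} (Cyc.even y) (sing (src G f)))
      where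
      Yz : NE Y → Y zero ≡ true
      Yz (zero , p) = p
      Yz (suc i , p) = case s (suc i) p of λ ()
      Lf : lift Y f ≡ true
      Lf = trans (Lg-f Y (γ Y)) (Yz (Cyc.ne y))
      others : ∀ h → h ≢ f → lift Y h ∧ δ G (sing (src G f)) h ≡ false
      others h n with at h
      ... | atK i refl = ∧-f₁ (trans (Lg-K Y (γ Y) i) (≢true λ p → case s (suc i) p of λ ()))
      ... | atf refl = ⊥-elim (n refl)
      ... | atg refl = ∧-f₂ {lift Y g} (cong₂ _xor_ (sing-ne (λ p → f-g-apart (inc-src G f) (subst (Incident G g) p (inc-src G g))))
                                                     (sing-ne (λ p → f-g-apart (inc-src G f) (subst (Incident G g) p (inc-tgt G g)))))
    bad : ¬ Dep Q' (true ◁ none)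
    bad (depB y s _) = no-cyc y s
    bad (depL y _ _ s _ _ _) = no-cyc y s
    bad (depC y _ _ s _ _ _ _) = no-cyc y s

  no-loop₂ : ¬ Cyclic triangle (true ◁ none)
  no-loop₂ cy = case triangle-cyclic cy (suc zero) of λ ()

  iso : Iso (twoSum (qbCircuit Q') (IsCycle triangle)) (qbCircuit Q)
  iso = TwoSum.twoSum-iso E (Dep Q) (Dep Q') (Cyclic triangle) (dep-mono Q) (dep-mono Q') (cyclic-mono {G = triangle}) to fromK fromR from× no-loop₁ no-loop₂
    (qbCircuit Q) (qbCircuit Q') (IsCycle triangle) (qb⇔ Q) (qb⇔ Q') (cyc⇔ triangle)

-- Contraction preserves two-connectedness

module ContractConn {m : ℕ} {G : Graph m} (Q : QuasiBiased G) (tc : TwoConn G) (NL : NonDeg Q L) (NF : NonDeg Q F)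
            {R : ESet m} {a : ℕ} (E : Enum R a 2)
            (bal₀ : ∀ C → Cyc G C → C ∘ Enum.ιR E ⊑ none → κ Q C ≡ B) where

  open Enum E
  open Contract Q tc NL NF E bal₀

  module _ (X' : ESet (suc a)) (X'z : X' zero ≡ true) (i₀ : Fin a) (X'i : X' (suc i₀) ≡ false) where

    -- A side containing `f`, pulled back to `G` with `g` added or left out. Two-connectedness of
    -- `G` is applied to both versions.
    Xg X₀ Y : ESet m
    Xg = Lg X' true
    X₀ = Lg X' false
    Y = comp Xg

    Tip : Fin (nV G) → Set
    Tip x = x ≡ c ⊎ x ≡ d

    tip? : ∀ x → Dec (Tip x)
    tip? x = (x ≟ c) ⊎-dec (x ≟ d)

    π-tip : ∀ {x} → Tip x → π x ≡ c
    π-tip (inj₁ refl) = π-c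
    π-tip (inj₂ refl) = π-d

    Sh' : Fin (nV G) → Set
    Sh' y = InV G' X' y × InV G' (comp X') y

    same-off-g : ∀ {h} → h ≢ g → X₀ h ≡ Xg h
    same-off-g {h} n with at h
    ... | atK i refl = trans (Lg-K X' false i) (sym (Lg-K X' true i))
    ... | atf refl = trans (Lg-f X' false) (sym (Lg-f X' true))
    ... | atg refl = ⊥-elim (n refl)

    not-g : ∀ {h} → X₀ h ≡ true → h ≢ g
    not-g p refl = t≢f p (Lg-g X' false)

    InX : ∀ {x} → InV G X₀ x → InV G' X' (π x)
    InX (h , p , i) = InV-off {X'} false (not-g p) p i

    InY : ∀ {x} → InV G Y x → InV G' (comp X') (π x)
    InY (h , p , i) with at h
    ... | atK k refl = suc k , trans (cong not (sym (Lg-K X' true k))) p , inc-K i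
    ... | atf refl = ⊥-elim (t≢f p (cong not (trans (Lg-f X' true) X'z)))
    ... | atg refl = ⊥-elim (t≢f p (cong not (Lg-g X' true)))

    tip-g : ∀ {x} → Incident G g x → Tip x
    tip-g = inc-cases G

    Xg-cases : ∀ {x} → InV G Xg x → InV G X₀ x ⊎ Tip x
    Xg-cases (h , p , i) with h ≟ g
    ... | yes refl = inj₂ (tip-g i)
    ... | no n = inj₁ (h , trans (same-off-g n) p , i)

    X₀-comp : ∀ {x} → InV G (comp X₀) x → InV G Y x ⊎ Tip x
    X₀-comp (h , p , i) with h ≟ g
    ... | yes refl = inj₂ (tip-g i)
    ... | no n = inj₁ (h , trans (cong not (sym (same-off-g n))) p , i)

    -- The single shared vertex must be the contracted one, so `X₀` and `Y` meet at most in `c` and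
    -- `d`, and `Y` joins these two. With `g` this gives a cycle `D` outside `B`. The pair of the
    -- opposite class has a member through `f`; it avoids `c` and `d`, hence lies in `X₀` and cannot
    -- meet `D`.
    impossible : (∀ y y' → Sh' y → Sh' y' → y ≡ y') → ⊥
    impossible H = finish conn
      where
      T₁ : TwoShared G Xg
      T₁ = tc Xg {f} {ιK i₀} (trans (Lg-f X' true) X'z) (trans (Lg-K X' true i₀) X'i)
      T₂ : TwoShared G X₀
      T₂ = tc X₀ {f} {ιK i₀} (trans (Lg-f X' false) X'z) (trans (Lg-K X' false i₀) X'i)
      off-d : ∀ {x} → ¬ Tip x → π x ≡ x
      off-d n = π-off (λ p → n (inj₂ p))
      meet-tip : ∀ {p q} → p ≢ q → (¬ Tip p → InV G X₀ p × InV G Y p) → (¬ Tip q → InV G X₀ q × InV G Y q) → Tip p ⊎ Tip q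
      meet-tip {p} {q} n hp hq with tip? p | tip? q
      ... | yes t | _ = inj₁ t
      ... | no _ | yes t = inj₂ t
      -- Vertices other than `c` and `d` are not moved by the contraction, so two of them would be
      -- two shared vertices in `G'`.
      ... | no s | no t = ⊥-elim (n (trans (sym (off-d s)) (trans
              (H (π p) (π q) (InX (proj₁ (hp s)) , InY (proj₂ (hp s))) (InX (proj₁ (hq t)) , InY (proj₂ (hq t)))) (off-d t))))
      inl : ∀ {A B : Set} → A ⊎ B → ¬ B → A
      inl (inj₁ x) n = x
      inl (inj₂ y) n = ⊥-elim (n y)
      cY : InV G' (comp X') c
      cY with meet-tip p≢q (λ n → inl (Xg-cases pX) n , pY) (λ n → inl (Xg-cases qX) n , qY)
        where open TwoShared T₁
      ... | inj₁ t = subst (InV G' (comp X')) (π-tip t) (InY (TwoShared.pY T₁))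
      ... | inj₂ t = subst (InV G' (comp X')) (π-tip t) (InY (TwoShared.qY T₁))
      cX : InV G' X' c
      cX with meet-tip p≢q (λ n → pX , inl (X₀-comp pY) n) (λ n → qX , inl (X₀-comp qY) n)
        where open TwoShared T₂
      ... | inj₁ t = subst (InV G' X') (π-tip t) (InX (TwoShared.pX T₂))
      ... | inj₂ t = subst (InV G' X') (π-tip t) (InX (TwoShared.qX T₂))
      only : ∀ {x} → InV G X₀ x → InV G Y x → Tip x
      only i j = π-cases (H _ c (InX i , InY j) (cX , cY))
      only' : ∀ {x} → InV G Xg x → InV G Y x → Tip x
      only' i j with Xg-cases i
      ... | inj₁ k = only k j
      ... | inj₂ t = t
      Yc : InV G Y c
      Yc = go (only' pX pY) (only' qX qY)
        where
        open TwoShared T₁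
        go : Tip p → Tip q → InV G Y c
        go (inj₁ r) _ = subst (InV G Y) r pY
        go (inj₂ _) (inj₁ r) = subst (InV G Y) r qY
        go (inj₂ r) (inj₂ s) = ⊥-elim (p≢q (trans r (sym s)))
      cov : ∀ e → Y e ≡ true ⊎ Xg e ≡ true
      cov e with Xg e
      ... | true = inj₂ refl
      ... | false = inj₁ refl
      S : Span G Y
      S = span G Y
      module P = Pieces tc Y Xg cov (λ e p q → t≢f q (not-t p)) (g , Lg-g X' true) S
      conn : Conn G Y d c
      -- The component of `c` in `Y` has two attachments, and these can only be `c` and `d`.
      conn = conn-mono G (Span.T⊑X S) (Span.rep-conn S (go (tip pA pY) (tip qA qY)))
        where
        open P.Two (P.two Yc)
        tip : ∀ {x} → InV G (P.A (P.rep c)) x → InV G Xg x → Tip x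
        tip i j = only' j (InV-mono G P.A⊑X i)
        go : Tip p → Tip q → P.rep d ≡ P.rep c
        go (inj₂ r) _ = trans (cong P.rep (sym r)) (P.AV-rep pA)
        go (inj₁ _) (inj₂ r) = trans (cong P.rep (sym r)) (P.AV-rep qA)
        go (inj₁ r) (inj₁ s) = ⊥-elim (p≢q (trans r (sym s)))
      finish : Conn G Y d c → ⊥
      finish cn with close G {Y} g (cong not (Lg-g X' true)) (joins-self G g) cn
      ... | D , isD , sD , Dg = split (nonB (g-only (lookup D) cycD Dg Df))
        where
        cycD : Cyc G (lookup D)
        cycD = IsCycle→Cyc G isD
        Df : lookup D f ≡ false
        Df = ≢true λ p → case ∨-elim {Y f} (sD f p) of λ where
          (inj₁ q) → t≢f q (cong not (trans (Lg-f X' true) X'z))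
          (inj₂ q) → f≢g (sing-elim {e = g} {f} q)
        clash : ∀ {k} (P : Pair k) → Meet Q (lookup D) (Pair.Cf P) → ⊥
        clash P (x , (h , p , i) , j) = case ∨-elim {Y h} (sD h p) of λ where
            (inj₁ q) → no-tip (only (InV-mono G Cf⊑ j) (h , q , i)) j
            (inj₂ q) → no-tip (tip-g (subst (λ z → Incident G z x) (sing-elim {e = g} {h} q) i)) j
          where
          open Pair P
          no-tip : ∀ {z} → Tip z → ¬ InV G Cf z
          no-tip (inj₁ refl) k = apart (c , k , (g , gg , inc-src G g))
          no-tip (inj₂ refl) k = apart (d , k , (g , gg , inc-tgt G g))
          Cf-off : ∀ {e} → Cf e ≡ true → e ≢ g
          Cf-off q refl = t≢f q fg
          Cf⊑ : Cf ⊑ X₀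
          -- Otherwise the cycle would cross into `Y` at an end of `g`.
          Cf⊑ e q = ≢false λ r → let (z , _ , _ , u , v , _) = cyc-cross G cycf Xg {f} {e} ff (trans (Lg-f X' true) X'z) q (trans (sym (same-off-g (Cf-off q))) r) in
            no-tip (only (InV-mono G (λ k s → trans (same-off-g (Cf-off (∧-fst s))) (∧-snd {Cf k} s)) u) (InV-mono G (λ k s → ∧-snd {Cf k} s) v))
                   (InV-mono G (λ k s → ∧-fst s) u)
        split : κ Q (lookup D) ≡ L ⊎ κ Q (lookup D) ≡ F → ⊥
        split (inj₁ k) = clash PF (LF-meet Q cycD (Pair.cycf PF) k (Pair.κf PF))
        split (inj₂ k) = clash PL (meet-sym Q (LF-meet Q (Pair.cycf PL) cycD (Pair.κf PL) k))

    two-shared : TwoShared G' X'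
    two-shared with any? (λ y → any? (λ y' → ¬? (y ≟ y') ×-dec (InV? G' X' y ×-dec InV? G' (comp X') y) ×-dec (InV? G' X' y' ×-dec InV? G' (comp X') y')))
    ... | yes (y , y' , n , (p , q) , (r , s)) = shared₂ y y' n p q r s
    ... | no n = ⊥-elim (impossible λ y y' p q → case y ≟ y' of λ where
      (yes r) → r
      (no r) → ⊥-elim (n (y , y' , r , p , q)))

  twoConn' : TwoConn G'
  twoConn' X {e} {e'} p q = go (bool-cases (X zero))
    where
    from-true : ∀ X → X zero ≡ true → ∀ e → X e ≡ false → TwoShared G' X
    from-true X z zero r = ⊥-elim (t≢f z r)
    from-true X z (suc i) r = two-shared X z i r
    go : X zero ≡ true ⊎ X zero ≡ false → TwoShared G' X
    go (inj₁ z) = from-true X z e' q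
    go (inj₂ z) = flip (from-true (comp X) (not-f z) e (cong not p))
      where
      back : ∀ {x} → InV G' (comp (comp X)) x → InV G' X x
      back = InV-mono G' (λ h r → trans (sym (not-involutive (X h))) r)
      flip : TwoShared G' (comp X) → TwoShared G' X
      flip (shared₂ x y n a₁ a₂ b₁ b₂) = shared₂ x y n (back a₂) a₁ (back b₂) b₁

reduction₂ : ∀ {m} {G : Graph m} (Q : QuasiBiased G) → TwoConn G → NonDeg Q L → NonDeg Q F → BalancingPair Q → Reduction Q
reduction₂ {m} {G} Q tc NL NF O = let (a , b , E) = enum R in go a b E (trans (Enum.b≡ E) count-R)
  where
  open BalancingPair O
  R : ESet m
  R = sing f ⊔ sing g
  count-R : count R ≡ 2
  count-R = trans (count-insert (sing f) g (sing-ne (f≢g ∘ sym))) (cong suc (count-sing f))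
  go : ∀ a b → Enum R a b → b ≡ 2 → Reduction Q
  go a .2 E refl = record
      { Q' = X.Q' ; Γ = triangle ; NL' = NL' ; NF' = X.nonDeg' X.PF ; tc' = Y.twoConn'
      ; smaller = ≤-reflexive (trans (+-comm 2 a) a+b≡)
      ; ok = three-edges X.Q' Y.twoConn' NL' , ≤-refl ,
          (λ l → X.no-loop₁ (dep-mono X.Q' sing⊑ (MinDep.dep (circuit→minDep X.Q' l)))) ,
          no-coloop X.Q' Y.twoConn' NL' zero ,
          (λ l → X.no-loop₂ (_ , IsCycle→Cyc triangle l , sing⊑)) ,
          (λ col → col _ (Cyc→IsCycle′ triangle triangle-cyc) (lookup⇒[]= zero (tabulate all) refl))
      ; iso = X.iso }
    where
    open Enum E
    bal₀ : ∀ C → Cyc G C → C ∘ ιR ⊑ none → κ Q C ≡ B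
    bal₀ C c s = bal C c (off f (∨-inl (sing-self f))) (off g (∨-inr {sing f g} (sing-self g)))
      where
      off : ∀ h → R h ≡ true → C h ≡ false
      off h r with view h
      ... | inK i refl = ⊥-elim (t≢f r (K-out i))
      ... | inR j refl = ≢true λ p → case s j p of λ ()
    module X = Contract Q tc NL NF E bal₀
    module Y = ContractConn Q tc NL NF E bal₀
    NL' : NonDeg X.Q' L
    NL' = X.nonDeg' X.PL
    sing⊑ : ∀ {n} → lookup (⁅ zero {n} ⁆) ⊑ true ◁ none
    sing⊑ zero p = refl
    sing⊑ {n} (suc i) p = trans (sym (lookup-replicate i false)) p

-- Deciding reducibility, and the recursion

module _ {m : ℕ} {G : Graph m} (Q : QuasiBiased G) where

  BalancedPart? : Dec (BalancedPart Q)
  BalancedPart? = map′ (λ (R , v , w , e , f , n , k , p , q , s , c , b) → record { R = R ; v≢w = n ; e≢f = k ; eR = p ; fR = q ; shared = s ; conn = c ; bal = b })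
      (λ O → let open BalancedPart O in R , v , w , e , f , v≢w , e≢f , eR , fR , shared , conn , bal)
      (any-ESet? (λ R → ∃[ v ] ∃[ w ] ∃[ e ] ∃[ f ] P R v w e f) (λ h (v , w , e , f , r) → v , w , e , f , resp h r)
        (λ R → any? λ v → any? λ w → any? λ e → any? λ f → P? R v w e f))
    where
    P : ESet m → Fin (nV G) → Fin (nV G) → Fin m → Fin m → Set
    P R v w e f = v ≢ w × e ≢ f × R e ≡ true × R f ≡ true × (∀ x → InV G R x → InV G (comp R) x → x ≡ v ⊎ x ≡ w) × Conn G R v w × Bal Q R
    resp : ∀ {R R' v w e f} → R ≗ R' → P R v w e f → P R' v w e f
    resp h (n , k , p , q , s , c , b) = n , k , trans (sym (h _)) p , trans (sym (h _)) q ,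
      (λ x i j → s x (InV-mono G (λ e r → trans (h e) r) i) (InV-mono G (λ e r → trans (cong not (h e)) r) j)) ,
      conn-mono G (≗→⊑ h) c , λ C cy t → b C cy (λ e r → trans (h e) (t e r))
    Bal? : ∀ R → Dec (Bal Q R)
    Bal? R with bal? Q R
    ... | inj₁ b = yes b
    ... | inj₂ (C , c , s , k) = no λ b → k (b C c s)
    P? : ∀ R v w e f → Dec (P R v w e f)
    P? R v w e f = ¬? (v ≟ w) ×-dec ¬? (e ≟ f) ×-dec (R e Bool.≟ true) ×-dec (R f Bool.≟ true) ×-dec
      all? (λ x → InV? G R x →-dec InV? G (comp R) x →-dec ((x ≟ v) ⊎-dec (x ≟ w))) ×-dec Conn? G R v w ×-dec Bal? R

  BalancingPair? : Dec (BalancingPair Q)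
  BalancingPair? = map′ (λ (f , g , n , b) → record { f≢g = n ; bal = b }) (λ O → let open BalancingPair O in f , g , f≢g , bal)
    (any? λ f → any? λ g → ¬? (f ≟ g) ×-dec all-ESet? (λ C → Cyc G C → C f ≡ false → C g ≡ false → κ Q C ≡ B)
      (λ h b c p q → trans (κ-cong Q (λ e → sym (h e))) (b (cyc-resp G (λ e → sym (h e)) c) (trans (h f) p) (trans (h g) q)))
      (λ C → Cyc? G C →-dec (C f Bool.≟ false) →-dec (C g Bool.≟ false) →-dec (κ Q C ≟ᶜ B)))

Decomposed : ∀ {m} {G : Graph m} → QuasiBiased G → Set₁
Decomposed Q = Σ ℕ λ k → Σ (Graph k) λ H → Σ (QuasiBiased H) λ Q' →
  NonDegenerate Q' L × NonDegenerate Q' F × ThreeConnected (qbCircuit Q') × Built (qbCircuit Q') (qbCircuit Q) true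

iso-refl : ∀ {m} (M : CircFam m) → Iso M M
iso-refl M = mk↔ₛ′ id id (λ _ → refl) (λ _ → refl) ,
  λ Y → mk⇔ (subst M (sym (tabulate∘lookup Y))) (subst M (tabulate∘lookup Y))

sum-step : ∀ {m} {G : Graph m} {Q : QuasiBiased G} (R : Reduction Q) → Decomposed (Reduction.Q' R) → Decomposed Q
sum-step {Q = Q} R (k , H , Q″ , nl , nf , tc , built) = k , H , Q″ , nl , nf , tc ,
    sum (qbCircuit Q') (IsCycle Γ) (qbCircuit Q) built (graphic (IsCycle Γ) (Γ , λ X → mk⇔ id id)) ok refl iso
  where open Reduction R

-- Each reduction lowers the number of edges, bounded here by `n`. The induction carries
-- two-connectedness of the graph in place of connectedness of the matroid, since that is what the
-- reductions preserve directly.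
decompose : ∀ n {m} {G : Graph m} (Q : QuasiBiased G) → m < n → TwoConn G → NonDeg Q L → NonDeg Q F → Decomposed Q
decompose (suc n) Q (s≤s lt) tc NL NF = first (BalancedPart? Q)
  where
  via : Reduction Q → Decomposed Q
  via R = sum-step R (decompose n Q' (≤-trans smaller lt) tc' NL' NF')
    where open Reduction R
  second : ¬ BalancedPart Q → Dec (BalancingPair Q) → Decomposed Q
  second no₁ (yes O) = via (reduction₂ Q tc NL NF O)
  second no₁ (no no₂) = _ , _ , Q , nonDeg→ Q NL , nonDeg→ Q NF , three-connected Q tc NL NF no₁ no₂ , useN (qbCircuit Q) (iso-refl (qbCircuit Q))
  first : Dec (BalancedPart Q) → Decomposed Q
  first (yes O) = via (reduction₁ Q tc NL NF O)
  first (no no₁) = second no₁ (BalancingPair? Q)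

theorem7p3 : ∀ {m} (G : Graph m) (Q : QuasiBiased G) →
    ¬ Degenerate Q L → ¬ Degenerate Q F →
    Connected (qbCircuit Q) →
    Σ ℕ λ k → Σ (Graph k) λ H → Σ (QuasiBiased H) λ Q' →
    NonDegenerate Q' L × NonDegenerate Q' F ×
    ThreeConnected (qbCircuit Q') × Built (qbCircuit Q') (qbCircuit Q) true
theorem7p3 G Q nl nf con = decompose _ Q ≤-refl (CutVertex.connected→twoConn Q NL NF con) NL NF
  where
  NL : NonDeg Q L
  NL = ¬deg→ Q nl
  NF : NonDeg Q F
  NF = ¬deg→ Q nf
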